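{- Let $w\in\tilde S_n$ and write $\tilde F_w=\sum_{\lambda\in\mathrm{Par}^n}a_{w\lambda}\tilde F_\lambda$. (1) If $a_{w\lambda}\ne0$ then $\lambda(w)\preceq^*\lambda\preceq\mu(w)$. (2) $a_{w\mu(w)}=a_{w\lambda(w)}=1$.
   Context: Fix $n\ge3$; indices mod $n$. Realize the affine symmetric group $\tilde S_n$ as the group of bijections $w:\mathbb Z\to\mathbb Z$ with $w(i+n)=w(i)+n$ and $\sum_{i=1}^nw(i)=\sum_{i=1}^ni$, generated by $s_0,\dots,s_{n-1}$ where $s_i$ exchanges $i+kn$ and $i+1+kn$ for all $k$; $l$ is the Coxeter length. $\mathcal U_n$ is the $\mathbb C$-algebra generated by $u_0,\dots,u_{n-1}$ with $u_i^2=0$, $u_iu_{i+1}u_i=u_{i+1}u_iu_{i+1}$, $u_iu_j=u_ju_i$ for $|i-j|\ge2$. For $A\subsetneq\{0,\dots,n-1\}$, $u_A$ is the product of the $u_a$, $a\in A$, in any order where $u_{i+1}$ precedes $u_i$ whenever $i,i+1\in A$; $h_k(\mathbf u)=\sum_{|A|=k}u_A$ for $0\le k\le n-1$. $\mathcal U_n$ acts on $\mathbb C[\tilde S_n]$ by $u_i\cdot w=s_iw$ if $l(s_iw)>l(w)$, else $0$; $\langle w,v\rangle=\delta_{wv}$. $\tilde F_w(X)$ is the symmetric function whose coefficient of $x_1^{a_1}\cdots x_t^{a_t}$ (sequences with entries in $[0,n-1]$) is $\langle h_{a_t}(\mathbf u)\cdots h_{a_1}(\mathbf u)\cdot1,w\rangle$,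 other coefficients $0$. $\mathrm{Par}^n$ is the set of partitions with $\lambda_1\le n-1$. The code of $v$ is $c(v)=(c_1,\dots,c_n)$, $c_i=\#\{j>i:v(j)<v(i)\}$; $\mu(w)\in\mathrm{Par}^n$ is the conjugate of the partition obtained by sorting $c(w^{ -1})$ decreasingly. $w$ is Grassmannian if it is the minimal-length element of its coset $S_nw$, $S_n=\langle s_1,\dots,s_{n-1}\rangle$; $w\mapsto\mu(w)$ is a bijection from Grassmannian elements onto $\mathrm{Par}^n$, and $\tilde F_\mu:=\tilde F_w$ for the Grassmannian $w$ with $\mu(w)=\mu$ (affine Schur functions); these form a basis of the space spanned by the $m_\lambda$, $\lambda\in\mathrm{Par}^n$, which contains every $\tilde F_w$, so the $a_{w\lambda}$ are well defined. The automorphism $*$ of $\tilde S_n$ given by $s_i\mapsto s_{n-i}$ ($s_0\mapsto s_0$) maps Grassmannian elements to Grassmannian elements; define the involution $*$ on $\mathrm{Par}^n$ by $\mu(v)^*=\mu(v^*)$ for Grassmannian $v$. $\preceq$ is dominance order; $\lambda\preceq^*\mu$ means $\mu^*\preceq\lambda^*$. Finally $\lambda(w):=\mu(w^{ -1})^*$. -}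

module Defs where

open import Data.Nat as ℕ using (ℕ; zero; suc; NonZero; _∸_; _⊔_)
open import Data.Nat.Properties as ℕP using ()
open import Data.Integer as ℤ using (ℤ; +_)
open import Data.Integer.DivMod using (_%ℕ_; _/ℕ_)
open import Data.Integer.Properties as ℤP using ()
open import Data.Fin as Fin using (Fin; toℕ)
open import Data.Vec as Vec using (Vec; lookup; tabulate)
open import Data.Vec.Properties using (≡-dec)
import Data.List.Properties as ListP
open import Data.Nat.ListAction using (sum)
open import Data.List as List using (List; []; _∷_; map; filter; upTo; length; concatMap; foldl; foldr; _++_; take)
open import Data.List.Relation.Unary.All using (All)
open import Data.List.Membership.DecPropositional ℕP._≟_ using (_∈?_)
open import Data.Maybe as Maybe using (Maybe; just; nothing; _>>=_)
open import Data.Product using (Σ; _×_; _,_; proj₁; proj₂; ∃)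
open import Data.Bool using (Bool; true; false; if_then_else_)
open import Relation.Nullary using (¬_; Dec; yes; no)
open import Relation.Nullary.Decidable using (⌊_⌋; _×-dec_)
open import Relation.Binary.PropositionalEquality using (_≡_)

-- Conventions.
-- An element w of the affine symmetric group is represented by its
-- window (w(1),…,w(n)) : Vec ℤ n; position i : Fin n stands for the
-- integer toℕ i + 1.  The bijection ℤ → ℤ is recovered by
-- w(r + q n) = w(r) + q n.  Residues mod n are represented by ℕ < n,
-- so the generator s_i is indexed by i : ℕ with i < n.

Win : ℕ → Set
Win n = Vec ℤ n

pos : {n : ℕ} → Fin n → ℤ
pos i = + suc (toℕ i)

module _ (n : ℕ) .{{_ : NonZero n}} where

  -- the window is that of an element of the affine symmetric group:
  -- w(1),…,w(n) pairwise distinct mod n (so that i+kn ↦ w(i)+kn is a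
  -- bijection of ℤ commuting with +n), and ∑ w(i) = ∑ i.
  IsAffPerm : Win n → Set
  IsAffPerm w =
    ((i j : Fin n) → lookup w i %ℕ n ≡ lookup w j %ℕ n → i ≡ j) ×
    (Vec.foldr _ ℤ._+_ (+ 0) w ≡ Vec.foldr _ ℤ._+_ (+ 0) (tabulate (pos {n})))

  idW : Win n
  idW = tabulate pos

  sAt : ℕ → ℤ → ℤ
  sAt i k with (k %ℕ n) ℕP.≟ (i ℕ.% n) | (k %ℕ n) ℕP.≟ (suc i ℕ.% n)
  ... | yes _ | _     = k ℤ.+ + 1
  ... | no _  | yes _ = k ℤ.- + 1
  ... | no _  | no _  = k

  leftMul : ℕ → Win n → Win n
  leftMul i w = Vec.map (sAt i) w

  wordAct : List ℕ → Win n → Win n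
  wordAct word w = foldr leftMul w word

  wordElt : List ℕ → Win n
  wordElt word = wordAct word idW

  IsCoxeterLength : (Win n → ℕ) → Set
  IsCoxeterLength len = (w : Win n) → IsAffPerm w →
    (Σ (List ℕ) λ word → All (ℕ._< n) word × wordElt word ≡ w × length word ≡ len w) ×
    ((word : List ℕ) → All (ℕ._< n) word → wordElt word ≡ w → len w ℕ.≤ length word)

  σ : ℕ → ℕ
  σ i = (n ∸ i) ℕ.% n

  IsStarAut : (Win n → Win n) → Set
  IsStarAut star = (word : List ℕ) → All (ℕ._< n) word →
    star (wordElt word) ≡ wordElt (map σ word)

  -- Grassmannian: minimal length in its coset S_n w,
  -- S_n = ⟨s_1,…,s_{n-1}⟩ (all products of words in 1,…,n-1)
  Grassmannian : (Win n → ℕ) → Win n → Set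
  Grassmannian len w = (word : List ℕ) → All (λ i → 1 ℕ.≤ i × i ℕ.< n) word →
    len w ℕ.≤ len (wordAct word w)

  -- the inverse w⁻¹: w⁻¹(j) = r - q n where w(r) = j + q n
  invAt : Win n → ℤ → List (Fin n) → ℤ
  invAt w j [] = + 0   -- not reached for affine permutations
  invAt w j (r ∷ rs) with ((lookup w r ℤ.- j) %ℕ n) ℕP.≟ 0
  ... | yes _ = pos r ℤ.- ((lookup w r ℤ.- j) /ℕ n) ℤ.* + n
  ... | no _  = invAt w j rs

  inv : Win n → Win n
  inv w = tabulate λ j → invAt w (pos j) (List.allFin n)

  -- code c(v) = (c_1,…,c_n), c_i = #{ j ∈ ℤ : j > i, v(j) < v(i) }.
  -- Writing j = r + q n (r ∈ [1,n]), j > i forces q ≥ 0 and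
  -- v(r) + q n < v(i) forces q < |v(i) - v(r)|, so the finite
  -- enumeration below lists every such j exactly once.
  codeAt : Win n → Fin n → ℕ
  codeAt v i = sum (map countR (List.allFin n))
    where
    countR : Fin n → ℕ
    countR r = length (filter
      (λ q → (pos i ℤ.<? pos r ℤ.+ + q ℤ.* + n) ×-dec
             (lookup v r ℤ.+ + q ℤ.* + n ℤ.<? lookup v i))
      (upTo ℤ.∣ lookup v i ℤ.- lookup v r ∣))

  code : Win n → List ℕ
  code v = Vec.toList (tabulate (codeAt v))

insertDesc : ℕ → List ℕ → List ℕ
insertDesc x [] = x ∷ []
insertDesc x (y ∷ ys) with y ℕ.≤? x
... | yes _ = x ∷ y ∷ ys
... | no _  = y ∷ insertDesc x ys

sortDesc : List ℕ → List ℕ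
sortDesc = foldr insertDesc []

conj : List ℕ → List ℕ
conj l = map (λ k → length (filter (λ x → suc k ℕ.≤? x) l)) (upTo (foldr _⊔_ 0 l))

toPartition : List ℕ → List ℕ
toPartition l = filter (λ x → 1 ℕ.≤? x) (sortDesc l)

data Decreasing : List ℕ → Set where
  dnil  : Decreasing []
  done  : ∀ {x} → Decreasing (x ∷ [])
  dcons : ∀ {x y l} → y ℕ.≤ x → Decreasing (y ∷ l) → Decreasing (x ∷ y ∷ l)

Par : ℕ → List ℕ → Set
Par n l = Decreasing l × All (λ x → 1 ℕ.≤ x × x ℕ.≤ n ∸ 1) l

_⪯_ : List ℕ → List ℕ → Set
l ⪯ m = (sum l ≡ sum m) × ((k : ℕ) → sum (take k l) ℕ.≤ sum (take k m))

module _ (n : ℕ) .{{_ : NonZero n}} where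

  μ : Win n → List ℕ
  μ w = conj (toPartition (code n (inv n w)))

  -- affine Stanley symmetric functions.
  -- A subset A ⊊ ℤ/n is a list of residues; u_A is the product of u_a,
  -- a ∈ A, ordered cyclically decreasingly starting just below the
  -- least residue j ∉ A, i.e. u_{j-1} u_{j-2} ⋯ u_{j+1} (factors not in A
  -- omitted); then u_{i+1} precedes u_i whenever i, i+1 ∈ A.

  choose : ℕ → List ℕ → List (List ℕ)
  choose zero    xs       = [] ∷ []
  choose (suc k) []       = []
  choose (suc k) (x ∷ xs) = map (x ∷_) (choose k xs) ++ choose (suc k) xs

  leastMissing : List ℕ → List ℕ → ℕ
  leastMissing A []       = 0
  leastMissing A (x ∷ xs) with x ∈? A
  ... | yes _ = leastMissing A xs
  ... | no _  = x

  orderA : List ℕ → List ℕ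
  orderA A = filter (_∈? A)
    (map (λ d → (j ℕ.+ n ∸ suc d) ℕ.% n) (upTo (n ∸ 1)))
    where j = leastMissing A (upTo n)

  module _ (len : Win n → ℕ) where

    -- u_i · v = s_i v if l(s_i v) > l(v), else 0 (represented by nothing)
    uAct : ℕ → Win n → Maybe (Win n)
    uAct i v with len v ℕ.<? len (leftMul n i v)
    ... | yes _ = just (leftMul n i v)
    ... | no _  = nothing

    uAAct : List ℕ → Win n → Maybe (Win n)
    uAAct A v = foldr (λ a mv → mv >>= uAct a) (just v) (orderA A)

    -- elements of ℂ[S̃_n] with nonnegative integer coefficients, as
    -- lists of group elements with multiplicity
    hAct : ℕ → List (Win n) → List (Win n)
    hAct k vs = concatMap (λ v → concatMap (λ A → Maybe.maybe (_∷ []) [] (uAAct A v))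
                                            (choose k (upTo n))) vs

    -- ⟨h_{a_t}(u) ⋯ h_{a_1}(u) · 1 , w⟩ : the coefficient of
    -- x_1^{a_1} ⋯ x_t^{a_t} in F̃_w, for α = [a_1,…,a_t] with entries < n
    coefF : Win n → List ℕ → ℕ
    coefF w α = length (filter (λ v → ≡-dec ℤ._≟_ v w)
                               (foldl (λ vs a → hAct a vs) (idW n ∷ []) α))

    IsGrassSection : (List ℕ → Win n) → Set
    IsGrassSection G = (l : List ℕ) → Par n l →
      IsAffPerm n (G l) × Grassmannian n len (G l) × μ (G l) ≡ l

    -- L = [(λ, c), …] represents ∑ c · F̃_λ with F̃_λ = F̃_{G λ};
    -- Expansion w L : F̃_w = ∑ c F̃_λ (equality of all monomial coefficients)
    Expansion : (List ℕ → Win n) → Win n → List (List ℕ × ℤ) → Set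
    Expansion G w L = All (λ p → Par n (proj₁ p)) L ×
      ((α : List ℕ) → All (ℕ._< n) α →
        + coefF w α ≡ List.foldr ℤ._+_ (+ 0) (map (λ p → proj₂ p ℤ.* + coefF (G (proj₁ p)) α) L))

  coeffOf : List (List ℕ × ℤ) → List ℕ → ℤ
  coeffOf L l = List.foldr ℤ._+_ (+ 0)
    (map proj₂ (filter (λ p → ListP.≡-dec ℕP._≟_ (proj₁ p) l) L))

  module _ (star : Win n → Win n) (G : List ℕ → Win n) where

    -- the involution * on Par^n: μ(v)^* = μ(v^*) for Grassmannian v
    parStar : List ℕ → List ℕ
    parStar l = μ (star (G l))

    _⪯*_ : List ℕ → List ℕ → Set
    l ⪯* m = parStar m ⪯ parStar l

    lam : Win n → List ℕ
    lam w = parStar (μ (inv n w))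

{-# OPTIONS --safe #-}

-- An element w is studied through the bi-infinite sequence y = w⁻¹.  Multiplying by u_A carries, in
-- each cyclic run of A, the entry at the start of the run to the right past larger entries.  This
-- raises |A| distinct entries of the code of y by one and leaves the others unchanged, so the first k
-- factors of a decomposition have total size at most ∑ min(k, c_i), the sum of the first k parts of
-- μ(w).  Taking for the last factor the support of the code lowers every nonzero entry, so there is
-- exactly one decomposition of type μ(w).  Hence F̃_w is m_{μ(w)} plus lower terms in dominance order.
--
-- The h_k(u) commute: if w = d_A d_B is reduced then the code has entries ≤ 2, and A consists of all
-- entries 2 and, in each class of entries 1 inverted with the same position j, of the s entries
-- nearest to j for an arbitrary s ≤ r, r being the size of the class.  Replacing every s by r - s
-- exchanges the sizes of A and B.
--
-- Moving a letter m ∈ A ∪ B with m - 1 ∉ A ∪ B from one factor to the other proves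
-- ∑ (-1)^i h_i(u) e_{k-i}(u) = 0, so a linear relation between the F̃'s persists when the h's are
-- replaced by the e's.  The replacement turns F̃_w into F̃_{w⁻¹} and F̃_λ into F̃_{λ*}; the statements
-- about λ(w) are those about μ applied to w⁻¹.
module Submission where

open import Defs
open import Data.Nat as ℕ using (ℕ; zero; suc; NonZero; z≤n; s≤s; _+_; _*_; _≤_; _<_; _⊓_; _∸_; _⊔_)
open import Data.Nat.Properties as ℕP using (_≟_; _<?_; ≤-trans; ≤-reflexive; +-comm; +-identityʳ; <⇒≱; m≤n+m; ≤-pred; n<1+n; <⇒≤; m≤m+n; m+[n∸m]≡n; +-mono-≤; <-trans; +-suc; ≤-antisym; +-monoʳ-≤; ≤-<-trans; +-assoc; n≤1+n; ≤-refl; +-monoˡ-≤; suc-injective; +-cancelʳ-≡; +-cancelˡ-≤; m≤n⇒∃[o]m+o≡n; ≰⇒>; m≥n⇒m⊓n≡n; m≤n⇒m⊓n≡m; m<n⇒m<1+n; +-cancelʳ-≤; ≤∧≢⇒<; ≮⇒≥; n≤0⇒n≡0; ⊓-zeroʳ; m≤m⊔n; m≤n⊔m)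
import Data.Nat.DivMod as ℕD
open import Data.Nat.ListAction using (sum)
open import Data.Nat.Tactic.RingSolver using () renaming (solve-∀ to solveℕ-∀)
open import Data.Integer as ℤ using (ℤ; +_; -[1+_]) renaming (_+_ to _+ᶻ_; _-_ to _-ᶻ_; _*_ to _*ᶻ_; _<_ to _<ᶻ_; _≤_ to _≤ᶻ_; -_ to negᶻ)
import Data.Integer.Properties as ℤP
open import Data.Integer.DivMod using (_%ℕ_; _/ℕ_; n%ℕd<d; a≡a%ℕn+[a/ℕn]*n)
open import Data.Integer.Tactic.RingSolver using (solve-∀)
open import Data.Bool as Bool using (Bool; true; false; if_then_else_; _∨_)
import Data.Bool.Properties as BoolP
open import Data.Maybe as Maybe using (Maybe; just; nothing; _>>=_)
open import Data.Fin as Fin using (Fin; toℕ; fromℕ<)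
import Data.Fin.Properties as FinP
open import Data.Vec as Vec using (Vec; []; _∷_; lookup; tabulate; zipWith; _[_]≔_; replicate)
import Data.Vec.Properties as VecP
open import Data.List as List using (List; []; _∷_; _++_; reverse; length; filter; map; applyUpTo; upTo; concatMap; foldl; foldr; take; deduplicate)
import Data.List.Properties as ListP
open import Data.List.Membership.Propositional using (_∈_; _∉_; find; lose)
import Data.List.Membership.Propositional.Properties as MemP
open import Data.List.Membership.DecPropositional ℕP._≟_ using (_∈?_)
open import Data.List.Relation.Unary.All as All using (All; []; _∷_)
import Data.List.Relation.Unary.All.Properties as AllP
open import Data.List.Relation.Unary.Any as Any using (Any; here; there)
open import Data.List.Relation.Unary.AllPairs using ([]; _∷_)
open import Data.List.Relation.Unary.Unique.Propositional using (Unique)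
import Data.List.Relation.Unary.Unique.DecPropositional.Properties as UniqueDec
import Data.List.Relation.Unary.Unique.Propositional.Properties as UniqueP
open import Data.List.Relation.Binary.Permutation.Propositional as Perm using (_↭_)
import Data.List.Relation.Binary.Permutation.Propositional.Properties as PermP
open import Data.Product using (Σ; _×_; _,_; proj₁; proj₂; ∃)
import Data.Product.Properties as ProductP
open import Data.Sum using (_⊎_; inj₁; inj₂)
open import Data.Empty using (⊥; ⊥-elim)
open import Function using (_∘_; id)
open import Relation.Nullary using (¬_; yes; no; Dec; ¬?)
open import Relation.Nullary.Decidable using (⌊_⌋; _×-dec_)
open import Relation.Binary.Definitions using (tri<; tri≈; tri>)
open import Relation.Binary.PropositionalEquality hiding ([_])

-- The nilCoxeter algebra is never constructed. Products of h's and e's are tested against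
-- functionals on words that respect equality in the group and vanish on unreduced words. The
-- coefficients of F̃_w are values of such a functional, and a linear relation between the F̃'s is
-- one functional that kills all products of h's.
--
-- Length enters only as the sum of the code over a period. A factor u_A raises an entry of the code
-- by at most the indicator of A, so lengths add up exactly if it does so at every position. An
-- equality of lengths thus becomes a family of inequalities between entries of y.
--
-- Replacing h by e leads both from w to w⁻¹ and from λ to λ* for one reason: reversing a word and
-- negating its letters each turn a cyclically decreasing word into an increasing one. The star side
-- also needs that μ determines a Grassmannian element: its code increases weakly along the window,
-- and the code determines the element.
--
-- Dominance is only a partial order; inductions along it run on the sum of all partial sums of a
-- partition, which grows strictly with dominance.

-- Positions in ℤ and their shifts by natural numbers.

+ᶻ-cancelˡ : ∀ k {a b} → k +ᶻ a ≡ k +ᶻ b → a ≡ b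
+ᶻ-cancelˡ k {a} {b} e = trans (lem k a) (trans (cong (_-ᶻ k) e) (sym (lem k b)))
  where
  lem : ∀ k a → a ≡ (k +ᶻ a) -ᶻ k
  lem = solve-∀

up dn : ℤ → ℤ
up k = k +ᶻ + 1
dn k = k -ᶻ + 1

up-dn : ∀ k → up (dn k) ≡ k
up-dn = lem
  where
  lem : ∀ k → (k -ᶻ + 1) +ᶻ + 1 ≡ k
  lem = solve-∀

dn-up : ∀ k → dn (up k) ≡ k
dn-up = lem
  where
  lem : ∀ k → (k +ᶻ + 1) -ᶻ + 1 ≡ k
  lem = solve-∀

infixl 6 _⊕_
-- Iterates `up` instead of adding `+ t`, so that windows unfold in step with the recursion of the
-- sums over them.
_⊕_ : ℤ → ℕ → ℤ
k ⊕ zero = k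
k ⊕ suc t = up k ⊕ t

up-pos : ∀ k t → up k +ᶻ + t ≡ k +ᶻ + suc t
up-pos k t = lem k (+ t)
  where
  lem : ∀ k x → (k +ᶻ + 1) +ᶻ x ≡ k +ᶻ (+ 1 +ᶻ x)
  lem = solve-∀

⊕-+ : ∀ k t → k ⊕ t ≡ k +ᶻ + t
⊕-+ k zero = sym (ℤP.+-identityʳ k)
⊕-+ k (suc t) = trans (⊕-+ (up k) t) (up-pos k t)

⊕-up : ∀ k t → up (k ⊕ t) ≡ k ⊕ suc t
⊕-up k zero = refl
⊕-up k (suc t) = ⊕-up (up k) t

⊕-⊕ : ∀ k s t → k ⊕ s ⊕ t ≡ k ⊕ (s ℕ.+ t)
⊕-⊕ k zero t = refl
⊕-⊕ k (suc s) t = ⊕-⊕ (up k) s t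

k<k⊕ : ∀ k t → k <ᶻ k ⊕ suc t
k<k⊕ k t = subst (k <ᶻ_) (sym (⊕-+ k (suc t))) (ℤP.≤-<-trans (ℤP.≤-reflexive (sym (ℤP.+-identityʳ k))) (ℤP.+-monoʳ-< k (ℤ.+<+ (s≤s z≤n))))

k≤k⊕ : ∀ k t → k ≤ᶻ k ⊕ t
k≤k⊕ k zero = ℤP.≤-refl
k≤k⊕ k (suc t) = ℤP.<⇒≤ (k<k⊕ k t)

⊕-injective : ∀ k {s t} → k ⊕ s ≡ k ⊕ t → s ≡ t
⊕-injective k {s} {t} e = ℤP.+-injective (+ᶻ-cancelˡ k (trans (sym (⊕-+ k s)) (trans e (⊕-+ k t))))

⊖⊕ : ∀ k t → (k -ᶻ + t) ⊕ t ≡ k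
⊖⊕ k t = trans (⊕-+ _ t) (lem k (+ t))
  where
  lem : ∀ k t → (k -ᶻ t) +ᶻ t ≡ k
  lem = solve-∀

⊕⊖ : ∀ k t → (k ⊕ t) -ᶻ + t ≡ k
⊕⊖ k t = trans (cong (_-ᶻ + t) (⊕-+ k t)) (lem k (+ t))
  where
  lem : ∀ k t → (k +ᶻ t) -ᶻ t ≡ k
  lem = solve-∀

-- Residues modulo n and n-periodic functions on ℤ.

module Residues (n : ℕ) .{{nz : NonZero n}} where

  sh : ℤ → ℤ
  sh k = k +ᶻ + n

  res : ℤ → ℕ
  res k = k %ℕ n

  res<n : ∀ k → res k < n
  res<n k = n%ℕd<d k n

  up-sh : ∀ k → up (sh k) ≡ sh (up k)
  up-sh k = lem k (+ n)
    where
    lem : ∀ k m → (k +ᶻ m) +ᶻ + 1 ≡ (k +ᶻ + 1) +ᶻ m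
    lem = solve-∀

  ⊕-sh : ∀ k t → sh k ⊕ t ≡ sh (k ⊕ t)
  ⊕-sh k zero = refl
  ⊕-sh k (suc t) = trans (cong (_⊕ t) (up-sh k)) (⊕-sh (up k) t)

  ⊕n : ∀ k → k ⊕ n ≡ sh k
  ⊕n k = ⊕-+ k n

  private
    small-multiple : ∀ {r r'} q → r < n → r' < n → + r ≡ + r' +ᶻ q *ᶻ + n → r ≡ r'
    small-multiple {r} {r'} (+ zero) _ _ e = ℤP.+-injective (trans e (trans (cong (+ r' +ᶻ_) (ℤP.*-zeroˡ (+ n))) (ℤP.+-identityʳ (+ r'))))
    small-multiple {r} {r'} (+ suc m) r<n _ e =
      ⊥-elim (<⇒≱ r<n (subst (n ℕ.≤_) (sym (ℤP.+-injective (trans e (trans (cong (+ r' +ᶻ_) (sym (ℤP.pos-* (suc m) n))) (sym (ℤP.pos-+ r' _)))))) (≤-trans (m≤m+n n (m ℕ.* n)) (m≤n+m _ r'))))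
    small-multiple {r} {r'} -[1+ m ] _ r'<n e =
      ⊥-elim (<⇒≱ r'<n (subst (n ℕ.≤_) (ℤP.+-injective (trans (ℤP.pos-+ r _) (trans (cong (+ r +ᶻ_) (ℤP.pos-* (suc m) n)) (trans (cong (_+ᶻ (+ suc m *ᶻ + n)) e) (lem (+ r') (+ suc m) (+ n)))))) (≤-trans (m≤m+n n (m ℕ.* n)) (m≤n+m _ r))))
      where
      lem : ∀ r m k → (r +ᶻ (negᶻ m) *ᶻ k) +ᶻ m *ᶻ k ≡ r
      lem = solve-∀

  res-unique : ∀ {k r} q → r < n → k ≡ + r +ᶻ q *ᶻ + n → res k ≡ r
  res-unique {k} {r} q r<n e = small-multiple (q -ᶻ k /ℕ n) (res<n k) r<n
    (lem (+ res k) (k /ℕ n) (+ r) q (+ n) (trans (sym (a≡a%ℕn+[a/ℕn]*n k n)) e))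
    where
    lem2 : ∀ a b r q k → a +ᶻ b *ᶻ k ≡ r +ᶻ q *ᶻ k → (a +ᶻ b *ᶻ k) -ᶻ b *ᶻ k ≡ (r +ᶻ q *ᶻ k) -ᶻ b *ᶻ k
    lem2 a b r q k e = cong (_-ᶻ b *ᶻ k) e
    l1 : ∀ a b k → a ≡ (a +ᶻ b *ᶻ k) -ᶻ b *ᶻ k
    l1 = solve-∀
    l2 : ∀ r q b k → (r +ᶻ q *ᶻ k) -ᶻ b *ᶻ k ≡ r +ᶻ (q -ᶻ b) *ᶻ k
    l2 = solve-∀
    lem : ∀ a b r q k → a +ᶻ b *ᶻ k ≡ r +ᶻ q *ᶻ k → a ≡ r +ᶻ (q -ᶻ b) *ᶻ k
    lem a b r q k e = trans (l1 a b k) (trans (lem2 a b r q k e) (l2 r q b k))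

  res-small : ∀ {r} → r < n → res (+ r) ≡ r
  res-small {r} r<n = res-unique (+ 0) r<n (sym (trans (cong (+ r +ᶻ_) (ℤP.*-zeroˡ (+ n))) (ℤP.+-identityʳ (+ r))))

  res-mult : ∀ k q → res (k +ᶻ q *ᶻ + n) ≡ res k
  res-mult k q = res-unique (k /ℕ n +ᶻ q) (res<n k)
    (trans (cong (_+ᶻ q *ᶻ + n) (a≡a%ℕn+[a/ℕn]*n k n)) (lem (+ res k) (k /ℕ n) q (+ n)))
    where
    lem : ∀ a b q k → (a +ᶻ b *ᶻ k) +ᶻ q *ᶻ k ≡ a +ᶻ (b +ᶻ q) *ᶻ k
    lem = solve-∀

  res-sh : ∀ k → res (sh k) ≡ res k
  res-sh k = trans (cong (λ z → res (k +ᶻ z)) (sym (ℤP.*-identityˡ (+ n)))) (res-mult k (+ 1))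

  abstract
    res-diff : ∀ {k l} → res k ≡ res l → ∃ λ q → k ≡ l +ᶻ q *ᶻ + n
    res-diff {k} {l} e = k /ℕ n -ᶻ l /ℕ n , trans (a≡a%ℕn+[a/ℕn]*n k n)
      (trans (cong (λ z → + z +ᶻ k /ℕ n *ᶻ + n) e)
        (trans (lem (+ res l) (k /ℕ n) (l /ℕ n) (+ n)) (cong (_+ᶻ (k /ℕ n -ᶻ l /ℕ n) *ᶻ + n) (sym (a≡a%ℕn+[a/ℕn]*n l n)))))
      where
      lem : ∀ r a b k → r +ᶻ a *ᶻ k ≡ (r +ᶻ b *ᶻ k) +ᶻ (a -ᶻ b) *ᶻ k
      lem = solve-∀

  res-up : ∀ {k l} → res k ≡ res l → res (up k) ≡ res (up l)
  res-up {k} {l} e with res-diff {k} {l} e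
  ... | q , refl = trans (cong res (lem l (q *ᶻ + n))) (res-mult (up l) q)
    where
    lem : ∀ a b → (a +ᶻ b) +ᶻ + 1 ≡ (a +ᶻ + 1) +ᶻ b
    lem = solve-∀

  res-dn : ∀ {k l} → res (up k) ≡ res (up l) → res k ≡ res l
  res-dn {k} {l} e with res-diff {up k} {up l} e
  ... | q , e' = trans (cong res (trans (sym (dn-up k)) (trans (cong dn e') (lem l (q *ᶻ + n))))) (res-mult l q)
    where
    lem : ∀ a b → ((a +ᶻ + 1) +ᶻ b) -ᶻ + 1 ≡ a +ᶻ b
    lem = solve-∀

  abstract
    window-injective : ∀ k {t} → t < n → res (k ⊕ t) ≡ res k → t ≡ 0
    window-injective k {t} t<n e with res-diff {k ⊕ t} {k} e
    ... | q , e' = trans (sym (res-small t<n)) (res-unique q (≤-<-trans z≤n t<n) (trans lem (sym (ℤP.+-identityˡ _))))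
      where
      lem : + t ≡ q *ᶻ + n
      lem = +ᶻ-cancelˡ k (trans (sym (⊕-+ k t)) e')

  resF : ℤ → Fin n
  resF k = fromℕ< (res<n k)

  toℕ-resF : ∀ k → toℕ (resF k) ≡ res k
  toℕ-resF k = FinP.toℕ-fromℕ< (res<n k)

  resF-cong : ∀ k l → res k ≡ res l → resF k ≡ resF l
  resF-cong k l e = FinP.toℕ-injective (trans (toℕ-resF k) (trans e (sym (toℕ-resF l))))

  resF-toℕ : ∀ (i : Fin n) → resF (+ toℕ i) ≡ i
  resF-toℕ i = FinP.toℕ-injective (trans (toℕ-resF (+ toℕ i)) (res-small (FinP.toℕ<n i)))

  module _ {ℓ} {A : Set ℓ} (f : ℤ → A) (f-per : ∀ k → f (sh k) ≡ f k) where

    private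
      per-ℕ : ∀ k m → f (k +ᶻ + m *ᶻ + n) ≡ f k
      per-ℕ k zero = cong f (trans (cong (k +ᶻ_) (ℤP.*-zeroˡ (+ n))) (ℤP.+-identityʳ k))
      per-ℕ k (suc m) = trans (cong f (lem k (+ m) (+ n))) (trans (f-per _) (per-ℕ k m))
        where
        lem : ∀ k m x → k +ᶻ (+ 1 +ᶻ m) *ᶻ x ≡ (k +ᶻ m *ᶻ x) +ᶻ x
        lem = solve-∀

    per-mult : ∀ k q → f (k +ᶻ q *ᶻ + n) ≡ f k
    per-mult k (+ m) = per-ℕ k m
    per-mult k -[1+ m ] = trans (sym (per-ℕ _ (suc m))) (cong f (lem k (+ suc m) (+ n)))
      where
      lem : ∀ k m x → (k +ᶻ (negᶻ m) *ᶻ x) +ᶻ m *ᶻ x ≡ k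
      lem = solve-∀

    abstract
      per-res : ∀ k l → res k ≡ res l → f k ≡ f l
      per-res k l e with res-diff {k} {l} e
      ... | q , refl = per-mult l q

    per-+res : ∀ k → f k ≡ f (+ res k)
    per-+res k = per-res k (+ res k) (sym (res-small (res<n k)))

  mem : Vec Bool n → ℤ → Bool
  mem A k = lookup A (resF k)

  mem-sh : ∀ A k → mem A (sh k) ≡ mem A k
  mem-sh A k = cong (lookup A) (resF-cong (sh k) k (res-sh k))

  mk : (ℤ → Bool) → Vec Bool n
  mk a = Vec.tabulate (λ i → a (+ toℕ i))

  mem-mk : ∀ a → (∀ k → a (sh k) ≡ a k) → ∀ k → mem (mk a) k ≡ a k
  mem-mk a a-per k = trans (VecP.lookup∘tabulate _ (resF k)) (trans (cong (λ z → a (+ z)) (toℕ-resF k)) (sym (per-+res a a-per k)))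

  mem-ext : ∀ A B → (∀ k → mem A k ≡ mem B k) → A ≡ B
  mem-ext A B h = trans (sym (VecP.tabulate∘lookup A)) (trans (VecP.tabulate-cong same) (VecP.tabulate∘lookup B))
    where
    same : ∀ i → lookup A i ≡ lookup B i
    same i = trans (cong (lookup A) (sym (resF-toℕ i))) (trans (h (+ toℕ i)) (cong (lookup B) (resF-toℕ i)))

-- Indicators and sums over windows of ℤ.

bit : Bool → ℕ
bit true = 1
bit false = 0

[_] : ∀ {ℓ} {P : Set ℓ} → Dec P → ℕ
[ yes _ ] = 1
[ no _ ] = 0

[]-yes : ∀ {ℓ} {P : Set ℓ} (P? : Dec P) → P → [ P? ] ≡ 1
[]-yes (yes _) _ = refl
[]-yes (no ¬p) p = ⊥-elim (¬p p)

[]-no : ∀ {ℓ} {P : Set ℓ} (P? : Dec P) → ¬ P → [ P? ] ≡ 0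
[]-no (yes p) ¬p = ⊥-elim (¬p p)
[]-no (no _) _ = refl

[]-true : ∀ {ℓ} {P : Set ℓ} (P? : Dec P) → 1 ≤ [ P? ] → P
[]-true (yes p) _ = p

[]≤1 : ∀ {ℓ} {P : Set ℓ} (P? : Dec P) → [ P? ] ≤ 1
[]≤1 (yes _) = s≤s z≤n
[]≤1 (no _) = z≤n

[]-⇔ : ∀ {ℓ ℓ'} {P : Set ℓ} {Q : Set ℓ'} (P? : Dec P) (Q? : Dec Q) → (P → Q) → (Q → P) → [ P? ] ≡ [ Q? ]
[]-⇔ (yes p) Q? f g = sym ([]-yes Q? (f p))
[]-⇔ (no ¬p) Q? f g = sym ([]-no Q? (¬p ∘ g))

bit≤1 : ∀ b → bit b ≤ 1
bit≤1 true = s≤s z≤n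
bit≤1 false = z≤n

S : (ℤ → ℕ) → ℤ → ℕ → ℕ
S f p zero = 0
S f p (suc N) = f p + S f (up p) N

S-cong : ∀ {f g} → (∀ k → f k ≡ g k) → ∀ p N → S f p N ≡ S g p N
S-cong h p zero = refl
S-cong h p (suc N) = cong₂ _+_ (h p) (S-cong h (up p) N)

S-cong< : ∀ {f g} p N → (∀ t → t < N → f (p ⊕ t) ≡ g (p ⊕ t)) → S f p N ≡ S g p N
S-cong< p zero h = refl
S-cong< p (suc N) h = cong₂ _+_ (h 0 (s≤s z≤n)) (S-cong< (up p) N (λ t t<N → h (suc t) (s≤s t<N)))

S-distrib-+ : ∀ f g p N → S (λ k → f k + g k) p N ≡ S f p N + S g p N
S-distrib-+ f g p zero = refl
S-distrib-+ f g p (suc N) = trans (cong ((f p + g p) ℕ.+_) (S-distrib-+ f g (up p) N)) (lem (f p) (g p) _ _)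
  where
  lem : ∀ a b c d → a + b + (c + d) ≡ a + c + (b + d)
  lem = solveℕ-∀

S-++ : ∀ f p M N → S f p (M + N) ≡ S f p M + S f (p ⊕ M) N
S-++ f p zero N = refl
S-++ f p (suc M) N = trans (cong (f p ℕ.+_) (S-++ f (up p) M N)) (sym (+-assoc (f p) _ _))

S-snoc : ∀ f p N → S f p (suc N) ≡ S f p N + f (p ⊕ N)
S-snoc f p N = trans (cong (S f p) (sym (+-comm N 1))) (trans (S-++ f p N 1) (cong (S f p N ℕ.+_) (+-identityʳ _)))

S-∘up : ∀ f p N → S (f ∘ up) p N ≡ S f (up p) N
S-∘up f p zero = refl
S-∘up f p (suc N) = cong (f (up p) ℕ.+_) (S-∘up f (up p) N)

S-mono : ∀ {f g} → (∀ k → f k ≤ g k) → ∀ p N → S f p N ≤ S g p N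
S-mono h p zero = z≤n
S-mono h p (suc N) = +-mono-≤ (h p) (S-mono h (up p) N)

-- Used to pass from an equality of lengths, which concerns sums, to information at each single
-- position.
S-tight : ∀ {f g} → (∀ k → f k ≤ g k) → ∀ p N → S g p N ≤ S f p N → ∀ t → t < N → g (p ⊕ t) ≤ f (p ⊕ t)
S-tight {f} {g} h p (suc N) le zero _ = +-cancelʳ-≤ (S g (up p) N) (g p) (f p)
  (≤-trans le (+-monoʳ-≤ (f p) (S-mono h (up p) N)))
S-tight {f} {g} h p (suc N) le (suc t) (s≤s t<N) = S-tight h (up p) N (+-cancelˡ-≤ (f p) _ _ (≤-trans (+-monoˡ-≤ _ (h p)) le)) t t<N

S-zero : ∀ f p N → (∀ t → t < N → f (p ⊕ t) ≡ 0) → S f p N ≡ 0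
S-zero f p zero h = refl
S-zero f p (suc N) h = cong₂ _+_ (h 0 (s≤s z≤n)) (S-zero f (up p) N (λ t t<N → h (suc t) (s≤s t<N)))

S-term : ∀ f p N t → t < N → f (p ⊕ t) ≤ S f p N
S-term f p (suc N) zero _ = m≤m+n _ _
S-term f p (suc N) (suc t) (s≤s t<N) = ≤-trans (S-term f (up p) N t t<N) (m≤n+m _ _)

S-term₂ : ∀ f p N t u → t < u → u < N → f (p ⊕ t) + f (p ⊕ u) ≤ S f p N
S-term₂ f p (suc N) zero (suc u) _ (s≤s u<N) = +-monoʳ-≤ (f p) (S-term f (up p) N u u<N)
S-term₂ f p (suc N) (suc t) (suc u) (s≤s t<u) (s≤s u<N) = ≤-trans (S-term₂ f (up p) N t u t<u u<N) (m≤n+m _ _)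

S-exists : ∀ f p N → 1 ≤ S f p N → ∃ λ t → t < N × 1 ≤ f (p ⊕ t) × (∀ u → u < t → f (p ⊕ u) ≡ 0)
S-exists f p (suc N) le with f p in eq
... | suc _ = 0 , s≤s z≤n , subst (1 ≤_) (sym eq) (s≤s z≤n) , λ _ ()
... | zero with S-exists f (up p) N le
... | t , t<N , pos , first = suc t , s≤s t<N , pos , λ { zero _ → eq ; (suc u) (s≤s u<t) → first u u<t }

-- Affine sequences and their codes.

module Codes (n : ℕ) .{{nz : NonZero n}} where

  open Residues n

  S-per : ∀ f → (∀ k → f (sh k) ≡ f k) → ∀ p q → S f p n ≡ S f q n
  S-per f f-per p q = trans (all p) (sym (all q))
    where
    step : ∀ p → S f (up p) n ≡ S f p n
    step p = ℕP.+-cancelˡ-≡ (f p) _ _ (trans (S-snoc f p n) (trans (cong (S f p n ℕ.+_) (trans (cong f (⊕n p)) (f-per p))) (+-comm _ (f p))))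
    many : ∀ p t → S f (p ⊕ t) n ≡ S f p n
    many p zero = refl
    many p (suc t) = trans (many (up p) t) (step p)
    all : ∀ p → S f p n ≡ S f (+ 0) n
    all (+ m) = trans (cong (λ z → S f z n) (sym (trans (⊕-+ (+ 0) m) (ℤP.+-identityˡ (+ m))))) (many (+ 0) m)
    all -[1+ m ] = trans (sym (many -[1+ m ] (suc m))) (cong (λ z → S f z n) (⊖⊕ (+ 0) (suc m)))

  β : (ℤ → ℤ) → ℤ → ℤ → ℕ
  β x k m = [ x m ℤ.<? x k ]

  -- Positions at distance `N` or more are never inverted, which makes the code a finite sum. The
  -- bound is a parameter, so that two sequences can be compared at a common one.
  record Aff (N : ℕ) (x : ℤ → ℤ) : Set where
    field
      equi : ∀ k → x (sh k) ≡ sh (x k)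
      inj  : ∀ {k l} → x k ≡ x l → k ≡ l
      bnd  : ∀ k t → N ≤ t → x k <ᶻ x (k ⊕ t)

  Aff-mono : ∀ {M N x} → M ≤ N → Aff M x → Aff N x
  Aff-mono M≤N X = record { equi = equi ; inj = inj ; bnd = λ k t N≤t → bnd k t (≤-trans M≤N N≤t) }
    where open Aff X

  code' : ℕ → (ℤ → ℤ) → ℤ → ℕ
  code' N x k = S (β x k) (up k) N

  code'-≗ : ∀ N {x y} → (∀ k → x k ≡ y k) → ∀ k → code' N x k ≡ code' N y k
  code'-≗ N h k = S-cong (λ m → cong₂ (λ a b → [ a ℤ.<? b ]) (h m) (h k)) (up k) N

  sh-mono-< : ∀ {k l} → k <ᶻ l → sh k <ᶻ sh l
  sh-mono-< = ℤP.+-monoˡ-< (+ n)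

  sh-cancel-< : ∀ {k l} → sh k <ᶻ sh l → k <ᶻ l
  sh-cancel-< {k} {l} lt = subst₂ _<ᶻ_ (lem k (+ n)) (lem l (+ n)) (ℤP.+-monoˡ-< (negᶻ (+ n)) lt)
    where
    lem : ∀ k m → (k +ᶻ m) +ᶻ negᶻ m ≡ k
    lem = solve-∀

  module _ {N x} (X : Aff N x) where
    open Aff X

    -- No position beyond the bound is inverted, so the longer window only adds zeros.
    code-ext : ∀ M → N ≤ M → ∀ k → code' M x k ≡ code' N x k
    code-ext M N≤M k with m≤n⇒∃[o]m+o≡n N≤M
    ... | o , refl = trans (S-++ (β x k) (up k) N o) (trans (cong (code' N x k ℕ.+_) (S-zero _ _ o (λ t _ →
            []-no (_ ℤ.<? _) (λ lt → ℤP.<-asym lt (subst (λ z → x k <ᶻ x z) (sym (⊕-⊕ (up k) N t)) (bnd k (suc (N + t)) (ℕP.m≤n⇒m≤1+n (m≤m+n N t)))))))) (+-identityʳ _))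

    β-sh : ∀ k m → β x (sh k) (sh m) ≡ β x k m
    β-sh k m = []-⇔ (_ ℤ.<? _) (_ ℤ.<? _)
      (λ lt → sh-cancel-< (subst₂ _<ᶻ_ (equi m) (equi k) lt))
      (λ lt → subst₂ _<ᶻ_ (sym (equi m)) (sym (equi k)) (sh-mono-< lt))

    code-sh : ∀ k → code' N x (sh k) ≡ code' N x k
    code-sh k = trans (cong (λ p → S (β x (sh k)) p N) (up-sh k)) (go (up k) N)
      where
      go : ∀ p M → S (β x (sh k)) (sh p) M ≡ S (β x k) p M
      go p zero = refl
      go p (suc M) = cong₂ _+_ (β-sh k p) (trans (cong (λ z → S (β x (sh k)) z M) (up-sh p)) (go (up p) M))

    inverted⇒< : ∀ k t → x (k ⊕ t) <ᶻ x k → t < N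
    inverted⇒< k t lt = ≰⇒> (λ le → ℤP.<-asym lt (bnd k t le))

    code-≥1 : ∀ k t → x (k ⊕ suc t) <ᶻ x k → 1 ≤ code' N x k
    code-≥1 k t lt = subst (_≤ code' N x k) ([]-yes (_ ℤ.<? _) lt)
      (S-term (β x k) (up k) N t (<-trans (n<1+n t) (inverted⇒< k (suc t) lt)))

    code-≥2 : ∀ k t u → t < u → x (k ⊕ suc t) <ᶻ x k → x (k ⊕ suc u) <ᶻ x k → 2 ≤ code' N x k
    code-≥2 k t u t<u lt lu = subst (_≤ code' N x k) (cong₂ _+_ ([]-yes (_ ℤ.<? _) lt) ([]-yes (_ ℤ.<? _) lu))
      (S-term₂ (β x k) (up k) N t u t<u (<-trans (n<1+n u) (inverted⇒< k (suc u) lu)))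

    abstract
      code-first : ∀ k → 1 ≤ code' N x k → ∃ λ t → x (k ⊕ suc t) <ᶻ x k × (∀ u → u < t → x k <ᶻ x (k ⊕ suc u))
      code-first k le with S-exists (β x k) (up k) N le
      ... | t , t<N , pos , first = t , []-true (_ ℤ.<? _) pos , λ u u<t → later u (first u u<t)
        where
        later : ∀ u → β x k (k ⊕ suc u) ≡ 0 → x k <ᶻ x (k ⊕ suc u)
        later u e with ℤP.<-cmp (x k) (x (k ⊕ suc u))
        ... | tri< lt _ _ = lt
        ... | tri≈ _ eq _ = ⊥-elim (ℤP.<-irrefl (inj eq) (k<k⊕ k u))
        ... | tri> _ _ gt = ⊥-elim (absurd (trans (sym ([]-yes (_ ℤ.<? _) gt)) e))
          where
          absurd : 1 ≡ 0 → ⊥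
          absurd ()

    abstract
      code-zero : ∀ k → code' N x k ≡ 0 → ∀ t → x k <ᶻ x (k ⊕ suc t)
      code-zero k e t with x k ℤ.<? x (k ⊕ suc t)
      ... | yes lt = lt
      ... | no ≮ with ℤP.<-cmp (x k) (x (k ⊕ suc t))
      ... | tri< lt _ _ = lt
      ... | tri≈ _ eq _ = ⊥-elim (ℤP.<-irrefl (inj eq) (k<k⊕ k t))
      ... | tri> _ _ gt = ⊥-elim (<⇒≱ (code-≥1 k t gt) (≤-reflexive e))

    size : ℕ
    size = S (code' N x) (+ 0) n

    partial : ℕ → ℕ
    partial j = S (λ k → j ⊓ code' N x k) (+ 0) n

true≢false : true ≢ false
true≢false ()

-- Carrying entries along the runs of a set, and its effect on the code.

module Moves (n : ℕ) .{{nz : NonZero n}} where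

  open Residues n
  open Codes n

  -- The permutation of positions belonging to u_A, described without a word: `d` lowers `k + 1` to
  -- `k` for `k` in A and sends the start of a run to its end; `e` is its inverse. `run k` is the
  -- number of consecutive members of A from `k` on.
  record Move (a : ℤ → Bool) (d e : ℤ → ℤ) : Set where
    field
      a-sh : ∀ k → a (sh k) ≡ a k
      e-sh : ∀ k → e (sh k) ≡ sh (e k)
      e∘d : ∀ k → e (d k) ≡ k
      d∘e : ∀ k → d (e k) ≡ k
      run : ℤ → ℕ
      run-in : ∀ k → a k ≡ true → run k ≡ suc (run (up k))
      run-out : ∀ k → a k ≡ false → run k ≡ 0
      d-in : ∀ k → a k ≡ true → d (up k) ≡ k
      d-out : ∀ k → a k ≡ false → d (up k) ≡ up k ⊕ run (up k)

    -- the first position ≥ k outside A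
    ν : ℤ → ℤ
    ν k = k ⊕ run k

    -- where the entry carried into position k starts
    κ : ℤ → ℤ
    κ k = e (ν k)

    ν-in : ∀ k → a k ≡ true → ν k ≡ ν (up k)
    ν-in k ak rewrite run-in k ak = refl

    ν-out : ∀ k → a k ≡ false → ν k ≡ k
    ν-out k ak rewrite run-out k ak = refl

    e-in : ∀ k → a k ≡ true → e k ≡ up k
    e-in k ak = trans (cong e (sym (d-in k ak))) (e∘d (up k))

    e-out : ∀ k → a k ≡ false → e k ≡ κ k
    e-out k ak = cong e (sym (ν-out k ak))

    κ-in : ∀ k → a k ≡ true → κ (up k) ≡ κ k
    κ-in k ak = cong e (sym (ν-in k ak))

    κ-out : ∀ k → a k ≡ false → κ (up k) ≡ up k
    κ-out k ak = trans (cong e (sym (d-out k ak))) (e∘d (up k))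

    abstract
      segment : ∀ r k → run k ≡ r → ∀ t → t < r → a (k ⊕ t) ≡ true × ν (k ⊕ t) ≡ ν k
      segment (suc r) k eq t t<r with a k in ak
      ... | false = ⊥-elim (ℕP.1+n≢0 (trans (sym eq) (run-out k ak)))
      ... | true with t | t<r
      ... | zero | _ = ak , refl
      ... | suc t' | s≤s t'<r with segment r (up k) (suc-injective (trans (sym (run-in k ak)) eq)) t' t'<r
      ... | in-A , same = in-A , trans same (sym (ν-in k ak))

    ν∉ : ∀ k → a (ν k) ≡ false
    ν∉ k = go (run k) k refl
      where
      go : ∀ r k → run k ≡ r → a (ν k) ≡ false
      go r k eq with a k in ak
      go r k eq | false = trans (cong a (ν-out k ak)) ak
      go zero k eq | true = ⊥-elim (ℕP.1+n≢0 (trans (sym (run-in k ak)) eq))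
      go (suc r) k eq | true = trans (cong a (ν-in k ak)) (go r (up k) (suc-injective (trans (sym (run-in k ak)) eq)))

    private
      step : ∀ f m → f (e m) + f (κ (up m)) ≡ f (up m) + f (κ m)
      step f m with a m in am
      ... | true = cong₂ _+_ (cong f (e-in m am)) (cong f (κ-in m am))
      ... | false = trans (cong₂ _+_ (cong f (e-out m am)) (cong f (κ-out m am))) (+-comm (f (κ m)) _)

    -- As multisets {e m, κ (m+1)} = {m+1, κ m}, so the sum telescopes.
    telescope : ∀ f p N → S (f ∘ e) p N + f (κ (p ⊕ N)) ≡ S f (up p) N + f (κ p)
    telescope f p zero = refl
    telescope f p (suc N) = trans (+-assoc (f (e p)) _ _) (trans (cong (f (e p) ℕ.+_) (telescope f (up p) N))
      (trans (lem (f (e p)) (S f (up (up p)) N) (f (κ (up p)))) (trans (cong (S f (up (up p)) N ℕ.+_) (step f p)) (lem2 (f (up p)) (f (κ p)) _))))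
      where
      lem : ∀ a b c → a + (b + c) ≡ b + (a + c)
      lem = solveℕ-∀
      lem2 : ∀ a b c → c + (a + b) ≡ (a + c) + b
      lem2 = solveℕ-∀

    run-sh : ∀ k → run (sh k) ≡ run k
    run-sh k = go (run k) k refl
      where
      go : ∀ r k → run k ≡ r → run (sh k) ≡ r
      go r k eq with a k in ak
      go r k eq | false = trans (run-out (sh k) (trans (a-sh k) ak)) (trans (sym (run-out k ak)) eq)
      go zero k eq | true = ⊥-elim (ℕP.1+n≢0 (trans (sym (run-in k ak)) eq))
      go (suc r) k eq | true = trans (run-in (sh k) (trans (a-sh k) ak)) (cong suc (trans (cong run (up-sh k))
        (go r (up k) (suc-injective (trans (sym (run-in k ak)) eq)))))

    ν-sh : ∀ k → ν (sh k) ≡ sh (ν k)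
    ν-sh k = trans (cong (sh k ⊕_) (run-sh k)) (⊕-sh k (run k))

    κ-sh : ∀ k → κ (sh k) ≡ sh (κ k)
    κ-sh k = trans (cong e (ν-sh k)) (e-sh (ν k))

    -- Over a full period the two boundary terms of `telescope` agree by periodicity, so no
    -- bijection of residues has to be exhibited.
    S-∘e : ∀ f → (∀ k → f (sh k) ≡ f k) → ∀ p → S (f ∘ e) p n ≡ S f p n
    S-∘e f f-per p = +-cancelʳ-≡ (f (κ p)) _ _
      (trans (cong (S (f ∘ e) p n ℕ.+_) (sym (trans (cong (f ∘ κ) (⊕n p)) (trans (cong f (κ-sh p)) (f-per (κ p))))))
        (trans (telescope f p n) (cong (ℕ._+ f (κ p)) (S-per f f-per (up p) p))))

    -- The predecessor of `e k` is not in A: otherwise `d` would send `e k` to that predecessor, yet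
    -- `d (e k)` is `k`, which is outside A. Hence `d` carries `e k` to the end of its run.
    start-run : ∀ k → a k ≡ false → k ≡ ν (e k)
    start-run k ak with a (dn (e k)) in ad
    ... | true = ⊥-elim (true≢false (trans (sym ad) (trans (cong a (trans (sym (d-in _ ad)) (trans (cong d (up-dn (e k))) (d∘e k)))) ak)))
    ... | false = trans (sym (d∘e k)) (trans (cong d (sym (up-dn (e k)))) (trans (d-out _ ad) (cong ν (up-dn (e k)))))

  -- Carrying turned x = y ∘ d into y and passed only larger entries.
  Valid : ∀ {a d e} → Move a d e → (ℤ → ℤ) → Set
  Valid {a} M y = ∀ k → a k ≡ true → y (Move.ν M k) <ᶻ y k

  module _ {a d e} (M : Move a d e) {N x y} (X : Aff N x) (Y : Aff N y) (y≗ : ∀ k → y k ≡ x (e k)) where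
    open Move M
    private
      module X = Aff X
      module Y = Aff Y

      far : ∀ k → [ x (κ (up k ⊕ N)) ℤ.<? x (e k) ] ≡ 0
      far k = []-no (_ ℤ.<? _) (λ lt → ℤP.<-asym (subst₂ _<ᶻ_ (trans (sym (y≗ _)) (cong y (⊕-⊕ (up k) N _))) (sym (y≗ k)) lt)
        (Y.bnd k (suc (N + run (up k ⊕ N))) (ℕP.m≤n⇒m≤1+n (m≤m+n N _))))

      -- This is `telescope` for the indicator of the entries smaller than the one at `k`; by `far`
      -- its right boundary term is zero.
      code-tele : ∀ k → code' N y k ≡ S (λ m → [ x m ℤ.<? x (e k) ]) (up (up k)) N + [ x (κ (up k)) ℤ.<? x (e k) ]
      code-tele k = trans (S-cong (λ m → cong₂ (λ u v → [ u ℤ.<? v ]) (y≗ m) (y≗ k)) (up k) N)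
        (trans (sym (+-identityʳ _)) (trans (cong (S ((λ m → [ x m ℤ.<? x (e k) ]) ∘ e) (up k) N ℕ.+_) (sym (far k))) (telescope (λ m → [ x m ℤ.<? x (e k) ]) (up k) N)))

    code-in : ∀ k → a k ≡ true → code' N y k ≡ code' N x (e k) + [ y (ν k) ℤ.<? y k ]
    code-in k ak = trans (code-tele k) (cong₂ _+_ (cong (λ z → S (λ m → [ x m ℤ.<? x (e k) ]) (up z) N) (sym (e-in k ak)))
      (cong₂ (λ u v → [ u ℤ.<? v ]) (trans (cong x (κ-in k ak)) (sym (y≗ (ν k)))) (sym (y≗ k))))

    passed : ℤ → ℕ
    passed k = S (β x (e k)) (up (e k)) (run (e k))

    -- For a carried entry the inversions of `x` split into those with the entries of the run,
    -- counted by `passed`, and those behind the run, which survive in `y`.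
    code-out : ∀ k → a k ≡ false → code' N x (e k) ≡ passed k + code' N y k
    code-out k ak = trans (sym (code-ext X (run p + suc N) (≤-trans (n≤1+n N) (m≤n+m _ (run p))) p))
      (trans (S-++ f (up p) (run p) (suc N)) (cong (passed k ℕ.+_) (trans (cong (λ z → S f z (suc N)) (trans (sym (⊕-up p (run p))) (cong up (sym (start-run k ak)))))
        (sym (trans (code-tele k) (trans (cong (S f (up (up k)) N ℕ.+_) (cong f (κ-out k ak))) (+-comm _ (f (up k)))))))))
      where
      p = e k
      f = β x p

    code-≤ : ∀ k → code' N y k ≤ code' N x (e k) + bit (a k)
    code-≤ k with a k in ak
    ... | true = ≤-trans (≤-reflexive (code-in k ak)) (+-monoʳ-≤ _ ([]≤1 (_ ℤ.<? _)))
    ... | false = ≤-trans (m≤n+m _ (passed k)) (≤-reflexive (trans (sym (code-out k ak)) (sym (+-identityʳ _))))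

    code-valid : Valid M y → ∀ k → code' N y k ≡ code' N x (e k) + bit (a k)
    code-valid V k with a k in ak
    ... | true = trans (code-in k ak) (cong (code' N x (e k) ℕ.+_) ([]-yes (_ ℤ.<? _) (V k ak)))
    ... | false = sym (trans (+-identityʳ _) (trans (code-out k ak) (cong (ℕ._+ code' N y k) (S-zero _ _ (run (e k)) none))))
      where
      none : ∀ t → t < run (e k) → β x (e k) (up (e k) ⊕ t) ≡ 0
      none t t<r with segment (run (e k)) (e k) refl t t<r
      ... | in-A , same = []-no (_ ℤ.<? _) (λ lt → ℤP.<-asym lt
            (subst₂ _<ᶻ_ (trans (cong y (trans same (sym (start-run k ak)))) (y≗ k))
              (trans (y≗ _) (cong x (trans (e-in _ in-A) (⊕-up (e k) t)))) (V (e k ⊕ t) in-A)))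

    card : ℕ
    card = S (bit ∘ a) (+ 0) n

    private
      sum-eq : ∀ p → S (λ k → code' N x (e k) + bit (a k)) p n ≡ size X + card
      sum-eq p = trans (S-distrib-+ (code' N x ∘ e) (bit ∘ a) p n) (cong₂ _+_
        (trans (S-∘e (code' N x) (code-sh X) p) (S-per (code' N x) (code-sh X) p (+ 0)))
        (S-per (bit ∘ a) (λ k → cong bit (a-sh k)) p (+ 0)))

    size-≤ : size Y ≤ size X + card
    size-≤ = ≤-trans (S-mono code-≤ (+ 0) n) (≤-reflexive (sum-eq (+ 0)))

    size-valid : Valid M y → size Y ≡ size X + card
    size-valid V = trans (S-cong (code-valid V) (+ 0) n) (sum-eq (+ 0))

    -- If the sizes add up, `code-≤` is an equality everywhere, and at `k` in A equality says that
    -- the carried entry is smaller than `y k`. The window is placed at `k`, so that `k` itself is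
    -- its term 0.
    size-tight : size X + card ≤ size Y → Valid M y
    size-tight le k ak = []-true (_ ℤ.<? _) (+-cancelˡ-≤ (code' N x (e k)) 1 _
      (≤-trans (≤-reflexive (cong (λ b → code' N x (e k) + bit b) (sym ak)))
        (≤-trans (S-tight code-≤ k n le' 0 (ℕ.>-nonZero⁻¹ n)) (≤-reflexive (code-in k ak)))))
      where
      le' : S (λ k → code' N x (e k) + bit (a k)) k n ≤ S (code' N y) k n
      le' = ≤-trans (≤-reflexive (sum-eq k)) (≤-trans le (≤-reflexive (S-per (code' N y) (code-sh Y) (+ 0) k)))

    partial-mono : Valid M y → ∀ j → partial X j ≤ partial Y j
    partial-mono V j = ≤-trans (≤-reflexive (sym (S-∘e (λ k → j ⊓ code' N x k) (λ k → cong (j ⊓_) (code-sh X k)) (+ 0))))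
      (S-mono (λ k → ℕP.⊓-monoʳ-≤ j (≤-trans (m≤m+n _ (bit (a k))) (≤-reflexive (sym (code-valid V k))))) (+ 0) n)

    -- A raised entry gains one below the higher cap whatever its value: `suc j ⊓ suc c` is
    -- `suc (j ⊓ c)`.
    partial-step : Valid M y → ∀ j → partial X j + card ≤ partial Y (suc j)
    partial-step V j = ≤-trans (≤-reflexive (trans
        (cong (ℕ._+ card) (sym (S-∘e (λ k → j ⊓ code' N x k) (λ k → cong (j ⊓_) (code-sh X k)) (+ 0))))
        (sym (S-distrib-+ (λ k → j ⊓ code' N x (e k)) (bit ∘ a) (+ 0) n))))
      (S-mono (λ k → ≤-trans (both (code' N x (e k)) (a k)) (≤-reflexive (cong (suc j ⊓_) (sym (code-valid V k))))) (+ 0) n)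
      where
      both : ∀ c b → j ⊓ c + bit b ≤ suc j ⊓ (c + bit b)
      both c true = ≤-reflexive (trans (+-comm (j ⊓ c) 1) (cong (suc j ⊓_) (+-comm 1 c)))
      both c false = ≤-trans (≤-reflexive (+-identityʳ _))
        (≤-trans (ℕP.⊓-monoˡ-≤ c (n≤1+n j)) (≤-reflexive (cong (suc j ⊓_) (sym (+-identityʳ c)))))

  abstract
    -- Induction on the length of the run from `k` on. A position inverted with `k` is either the
    -- end of the run, or inside it, where induction finds a still smaller entry at the end, or
    -- behind the end; in the last case the end has code 0 and so carries a smaller entry than
    -- everything behind it.
    support-valid : ∀ {a d e} (M : Move a d e) {N y} (Y : Aff N y) →
      (∀ k → a k ≡ true → 1 ≤ code' N y k) → (∀ k → a k ≡ false → code' N y k ≡ 0) → Valid M y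
    support-valid {a} M {N} {y} Y pos-code zero-code k ak = go (suc (run k)) k (n<1+n _) ak
      where
      open Move M
      go : ∀ r k → run k < r → a k ≡ true → y (ν k) <ᶻ y k
      go (suc r) k (s≤s lt) ak with code-first Y k (pos-code k ak)
      ... | t , inverted , _ with ℕP.<-cmp (suc t) (run k)
      ... | tri≈ _ e _ = subst (λ z → y (k ⊕ z) <ᶻ y k) e inverted
      ... | tri< t<r _ _ with segment (run k) k refl (suc t) t<r
      ... | in-A , same = ℤP.<-trans (subst (λ z → y z <ᶻ y (k ⊕ suc t)) same (go r (k ⊕ suc t) smaller in-A)) inverted
        where
        smaller : run (k ⊕ suc t) < r
        smaller = ≤-trans (≤-trans (s≤s (m≤n+m _ t)) (≤-reflexive (⊕-injective k (trans (sym (⊕-⊕ k (suc t) _)) same)))) lt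
      go (suc r) k (s≤s lt) ak | t , inverted , _ | tri> _ _ r<t with m≤n⇒∃[o]m+o≡n r<t
      ... | o , e = ℤP.<-trans (subst (λ z → y (ν k) <ᶻ y z) (trans (⊕-⊕ k (run k) (suc o)) (cong (k ⊕_) (trans (+-suc (run k) o) e)))
              (code-zero Y (ν k) (zero-code (ν k) (ν∉ k)) o)) inverted

-- Subsets as Boolean vectors.

cnt : ∀ {m} → Vec Bool m → ℕ
cnt [] = 0
cnt (b ∷ A) = bit b + cnt A

cnt-S : ∀ {m} (A : Vec Bool m) f p → (∀ i → f (p ⊕ toℕ i) ≡ bit (lookup A i)) → S f p m ≡ cnt A
cnt-S [] f p h = refl
cnt-S (b ∷ A) f p h = cong₂ _+_ (h Fin.zero) (cnt-S A f (up p) (λ i → h (Fin.suc i)))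

cnt<⇒missing : ∀ {m} (A : Vec Bool m) → cnt A < m → ∃ λ i → lookup A i ≡ false
cnt<⇒missing (false ∷ A) _ = Fin.zero , refl
cnt<⇒missing (true ∷ A) (s≤s lt) with cnt<⇒missing A lt
... | i , e = Fin.suc i , e

missing⇒cnt< : ∀ {m} (A : Vec Bool m) i → lookup A i ≡ false → cnt A < m
missing⇒cnt< (false ∷ A) Fin.zero _ = s≤s (cnt≤ A)
  where
  cnt≤ : ∀ {m} (A : Vec Bool m) → cnt A ≤ m
  cnt≤ [] = z≤n
  cnt≤ (b ∷ A) = +-mono-≤ (bit≤1 b) (cnt≤ A)
missing⇒cnt< (b ∷ A) (Fin.suc i) e = ℕP.+-mono-≤-< (bit≤1 b) (missing⇒cnt< A i e)

sel : ∀ {m} → Vec Bool m → (ℕ → ℕ) → List ℕ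
sel [] f = []
sel (true ∷ A) f = f 0 ∷ sel A (f ∘ suc)
sel (false ∷ A) f = sel A (f ∘ suc)

∈-sel⁺ : ∀ {m} (A : Vec Bool m) f i → lookup A i ≡ true → f (toℕ i) ∈ sel A f
∈-sel⁺ (true ∷ A) f Fin.zero e = here refl
∈-sel⁺ (true ∷ A) f (Fin.suc i) e = there (∈-sel⁺ A (f ∘ suc) i e)
∈-sel⁺ (false ∷ A) f (Fin.suc i) e = ∈-sel⁺ A (f ∘ suc) i e

∈-sel⁻ : ∀ {m} (A : Vec Bool m) f {x} → x ∈ sel A f → ∃ λ i → f (toℕ i) ≡ x × lookup A i ≡ true
∈-sel⁻ (true ∷ A) f (here refl) = Fin.zero , refl , refl
∈-sel⁻ (true ∷ A) f (there x∈) with ∈-sel⁻ A (f ∘ suc) x∈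
... | i , e , t = Fin.suc i , e , t
∈-sel⁻ (false ∷ A) f x∈ with ∈-sel⁻ A (f ∘ suc) x∈
... | i , e , t = Fin.suc i , e , t

∈?-sel : ∀ {m} (A : Vec Bool m) i → ⌊ toℕ i ∈? sel A id ⌋ ≡ lookup A i
∈?-sel A i with toℕ i ∈? sel A id
... | yes x∈ with ∈-sel⁻ A id x∈
... | j , e , t = trans (sym t) (cong (lookup A) (FinP.toℕ-injective e))
∈?-sel A i | no x∉ with lookup A i in eq
... | true = ⊥-elim (x∉ (∈-sel⁺ A id i eq))
... | false = refl

-- Words in the generators and the cyclically decreasing word of a set.

module Words (n : ℕ) .{{nz : NonZero n}} (3≤n : 3 ≤ n) where

  open Residues n
  open Codes n
  open Moves n

  1<n : 1 < n
  1<n = ≤-trans (s≤s (s≤s z≤n)) 3≤n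

  res-up≢ : ∀ k → res (up k) ≢ res k
  res-up≢ k e with window-injective k {1} 1<n e
  ... | ()

  res-suc : ∀ i → suc i ℕ.% n ≡ res (up (+ i))
  res-suc i = cong res (cong +_ (+-comm 1 i))

  sAt-in : ∀ i k → res k ≡ i ℕ.% n → sAt n i k ≡ up k
  sAt-in i k e with (k %ℕ n) ≟ (i ℕ.% n) | (k %ℕ n) ≟ (suc i ℕ.% n)
  ... | yes _ | _ = refl
  ... | no ¬e | _ = ⊥-elim (¬e e)

  sAt-after : ∀ i k → res k ≡ i ℕ.% n → sAt n i (up k) ≡ k
  sAt-after i k e with (up k %ℕ n) ≟ (i ℕ.% n) | (up k %ℕ n) ≟ (suc i ℕ.% n)
  ... | yes e' | _ = ⊥-elim (res-up≢ k (trans e' (sym e)))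
  ... | no _ | yes _ = dn-up k
  ... | no _ | no ¬e = ⊥-elim (¬e (trans (res-up {k} {+ i} e) (sym (res-suc i))))

  sAt-else : ∀ i k → res (up k) ≢ i ℕ.% n → res k ≢ i ℕ.% n → sAt n i (up k) ≡ up k
  sAt-else i k ¬a ¬b with (up k %ℕ n) ≟ (i ℕ.% n) | (up k %ℕ n) ≟ (suc i ℕ.% n)
  ... | yes e | _ = ⊥-elim (¬a e)
  ... | no _ | yes e = ⊥-elim (¬b (res-dn {k} {+ i} (trans e (res-suc i))))
  ... | no _ | no _ = refl

  at : ℕ → ℤ → Bool
  at i k = ⌊ res k ≟ i ℕ.% n ⌋

  at-true : ∀ i k → at i k ≡ true → res k ≡ i ℕ.% n
  at-true i k e with res k ≟ i ℕ.% n
  ... | yes p = p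

  at-false : ∀ i k → at i k ≡ false → res k ≢ i ℕ.% n
  at-false i k e with res k ≟ i ℕ.% n
  ... | no ¬p = ¬p

  sAt-step : ∀ i k → (at i k ≡ true → sAt n i (up k) ≡ k) × (at i k ≡ false → sAt n i (up k) ≡ up k ⊕ bit (at i (up k)))
  sAt-step i k = (λ e → sAt-after i k (at-true i k e)) , outside
    where
    outside : at i k ≡ false → sAt n i (up k) ≡ up k ⊕ bit (at i (up k))
    outside e with at i (up k) in eq
    ... | true = sAt-in i (up k) (at-true i (up k) eq)
    ... | false = sAt-else i k (at-false i (up k) eq) (at-false i k e)

  private
    at-up : ∀ i k → at i k ≡ true → at i (up k) ≡ false
    at-up i k e with at i (up k) in eq
    ... | false = refl
    ... | true = ⊥-elim (res-up≢ k (trans (at-true i (up k) eq) (sym (at-true i k e))))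

    sAt-cases : ∀ i k → (sAt n i (up k) ≡ up (up k) × res (up k) ≡ i ℕ.% n) ⊎ (sAt n i (up k) ≡ k × res k ≡ i ℕ.% n) ⊎ (sAt n i (up k) ≡ up k × res (up k) ≢ i ℕ.% n × res k ≢ i ℕ.% n)
    sAt-cases i k = go (res (up k) ≟ i ℕ.% n) (res k ≟ i ℕ.% n)
      where
      go : Dec (res (up k) ≡ i ℕ.% n) → Dec (res k ≡ i ℕ.% n) → _
      go (yes e) _ = inj₁ (sAt-in i (up k) e , e)
      go (no ¬e) (yes e') = inj₂ (inj₁ (sAt-after i k e' , e'))
      go (no ¬e) (no ¬e') = inj₂ (inj₂ (sAt-else i k ¬e ¬e' , ¬e , ¬e'))

    via-up : ∀ {ℓ} (P : ℤ → Set ℓ) → (∀ k → P (up k)) → ∀ k → P k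
    via-up P h k = subst P (up-dn k) (h (dn k))

  sAt-involutive : ∀ i k → sAt n i (sAt n i k) ≡ k
  sAt-involutive i = via-up _ go
    where
    go : ∀ k → sAt n i (sAt n i (up k)) ≡ up k
    go k with sAt-cases i k
    ... | inj₁ (e , r) = trans (cong (sAt n i) e) (sAt-after i (up k) r)
    ... | inj₂ (inj₁ (e , r)) = trans (cong (sAt n i) e) (sAt-in i k r)
    ... | inj₂ (inj₂ (e , _)) = trans (cong (sAt n i) e) e

  sAt-sh : ∀ i k → sAt n i (sh k) ≡ sh (sAt n i k)
  sAt-sh i = via-up _ go
    where
    go : ∀ k → sAt n i (sh (up k)) ≡ sh (sAt n i (up k))
    go k with sAt-cases i k
    ... | inj₁ (e , r) = trans (sAt-in i (sh (up k)) (trans (res-sh (up k)) r)) (trans (up-sh (up k)) (cong sh (sym e)))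
    ... | inj₂ (inj₁ (e , r)) = trans (trans (cong (sAt n i) (sym (up-sh k))) (sAt-after i (sh k) (trans (res-sh k) r))) (cong sh (sym e))
    ... | inj₂ (inj₂ (e , ¬a , ¬b)) = trans (trans (cong (sAt n i) (sym (up-sh k))) (trans (sAt-else i (sh k) (λ q → ¬a (trans (sym (trans (cong res (up-sh k)) (res-sh (up k)))) q)) (λ q → ¬b (trans (sym (res-sh k)) q))) (up-sh k))) (cong sh (sym e))

  sAt-≤ : ∀ i k → dn k ≤ᶻ sAt n i k × sAt n i k ≤ᶻ up k
  sAt-≤ i = via-up _ go
    where
    dn≤ : ∀ k → dn k ≤ᶻ k
    dn≤ k = subst (dn k ≤ᶻ_) (up-dn k) (k≤k⊕ (dn k) 1)
    go : ∀ k → dn (up k) ≤ᶻ sAt n i (up k) × sAt n i (up k) ≤ᶻ up (up k)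
    go k with sAt-cases i k
    ... | inj₁ (e , _) rewrite e = ℤP.≤-trans (dn≤ (up k)) (k≤k⊕ (up k) 1) , ℤP.≤-refl
    ... | inj₂ (inj₁ (e , _)) rewrite e = ℤP.≤-reflexive (dn-up k) , k≤k⊕ k 2
    ... | inj₂ (inj₂ (e , _)) rewrite e = dn≤ (up k) , k≤k⊕ (up k) 1

  abstract
    -- A generator is the carrying along a single residue class; runs have length at most 1 because
    -- neighbouring residues differ.
    letter : ∀ i → Move (at i) (sAt n i) (sAt n i)
    letter i = record
      { a-sh = λ k → cong (λ r → ⌊ r ≟ i ℕ.% n ⌋) (res-sh k)
      ; e-sh = sAt-sh i
      ; e∘d = sAt-involutive i
      ; d∘e = sAt-involutive i
      ; run = λ k → bit (at i k)
      ; run-in = λ k e → trans (cong bit e) (cong (suc ∘ bit) (sym (at-up i k e)))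
      ; run-out = λ k e → cong bit e
      ; d-in = λ k → proj₁ (sAt-step i k)
      ; d-out = λ k → proj₂ (sAt-step i k)
      }

  -- Letters act in reading order, so this is the inverse of the element of the word, and a letter
  -- put in front permutes positions.
  app : List ℕ → ℤ → ℤ
  app [] k = k
  app (i ∷ W) k = app W (sAt n i k)

  app-++ : ∀ V W k → app (V ++ W) k ≡ app W (app V k)
  app-++ [] W k = refl
  app-++ (i ∷ V) W k = app-++ V W (sAt n i k)

  app-reverse : ∀ W k → app (reverse W) (app W k) ≡ k
  app-reverse [] k = refl
  app-reverse (i ∷ W) k = trans (cong (λ V → app V (app W (sAt n i k))) (ListP.unfold-reverse i W))
    (trans (app-++ (reverse W) (i ∷ []) _) (trans (cong (sAt n i) (app-reverse W (sAt n i k))) (sAt-involutive i k)))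

  app-reverse' : ∀ W k → app W (app (reverse W) k) ≡ k
  app-reverse' W k = trans (cong (λ V → app V (app (reverse W) k)) (sym (ListP.reverse-involutive W))) (app-reverse (reverse W) k)

  app-sh : ∀ W k → app W (sh k) ≡ sh (app W k)
  app-sh [] k = refl
  app-sh (i ∷ W) k = trans (cong (app W) (sAt-sh i k)) (app-sh W (sAt n i k))

  app-injective : ∀ W {k l} → app W k ≡ app W l → k ≡ l
  app-injective W {k} {l} e = trans (sym (app-reverse W k)) (trans (cong (app (reverse W)) e) (app-reverse W l))

  abstract
    app-mult : ∀ W k q → app W (k +ᶻ q *ᶻ + n) ≡ app W k +ᶻ q *ᶻ + n
    app-mult W k q = trans (lem₁ (app W (k +ᶻ q *ᶻ + n)) (k +ᶻ q *ᶻ + n))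
      (trans (cong (_+ᶻ (k +ᶻ q *ᶻ + n)) (per-mult (λ k → app W k -ᶻ k) (λ k → trans (cong (_-ᶻ sh k) (app-sh W k)) (lem₂ (app W k) k (+ n))) k q))
        (lem₃ (app W k) k (q *ᶻ + n)))
      where
      lem₁ : ∀ a b → a ≡ (a -ᶻ b) +ᶻ b
      lem₁ = solve-∀
      lem₂ : ∀ a b m → (a +ᶻ m) -ᶻ (b +ᶻ m) ≡ a -ᶻ b
      lem₂ = solve-∀
      lem₃ : ∀ a b m → (a -ᶻ b) +ᶻ (b +ᶻ m) ≡ a +ᶻ m
      lem₃ = solve-∀

  app-bounds : ∀ W k → k -ᶻ + length W ≤ᶻ app W k × app W k ≤ᶻ k +ᶻ + length W
  app-bounds [] k = ℤP.≤-reflexive (ℤP.+-identityʳ k) , ℤP.≤-reflexive (sym (ℤP.+-identityʳ k))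
  app-bounds (i ∷ W) k with app-bounds W (sAt n i k) | sAt-≤ i k
  ... | lo , hi | lo' , hi' =
    ℤP.≤-trans (ℤP.≤-trans (ℤP.≤-reflexive (l₁ k (+ length W))) (ℤP.+-monoˡ-≤ (negᶻ (+ length W)) lo')) lo ,
    ℤP.≤-trans hi (ℤP.≤-trans (ℤP.+-monoˡ-≤ (+ length W) hi') (ℤP.≤-reflexive (l₂ k (+ length W))))
    where
    l₁ : ∀ k w → k -ᶻ (+ 1 +ᶻ w) ≡ (k -ᶻ + 1) -ᶻ w
    l₁ = solve-∀
    l₂ : ∀ k w → (k +ᶻ + 1) +ᶻ w ≡ k +ᶻ (+ 1 +ᶻ w)
    l₂ = solve-∀

  -- Each letter displaces a number by at most 1, so positions further apart than twice the length
  -- keep their order.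
  bound : List ℕ → ℕ
  bound W = suc (length W + length W)

  abstract
    affine : ∀ W → Aff (bound W) (app W)
    affine W = record { equi = app-sh W ; inj = app-injective W ; bnd = far }
      where
      far : ∀ k t → bound W ≤ t → app W k <ᶻ app W (k ⊕ t)
      far k t le = ℤP.≤-<-trans (proj₂ (app-bounds W k)) (ℤP.<-≤-trans
        (subst₂ _<ᶻ_ (lem₁ k (+ length W)) (cong (_-ᶻ + length W) (sym (⊕-+ k t))) mid)
        (proj₁ (app-bounds W (k ⊕ t))))
        where
        mid : (k +ᶻ + (length W + length W)) -ᶻ + length W <ᶻ (k +ᶻ + t) -ᶻ + length W
        mid = ℤP.+-monoˡ-< (negᶻ (+ length W)) (ℤP.+-monoʳ-< k (ℤ.+<+ le))
        lem₁ : ∀ k w → (k +ᶻ (w +ᶻ w)) -ᶻ w ≡ k +ᶻ w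
        lem₁ = solve-∀

  affine≤ : ∀ W N → bound W ≤ N → Aff N (app W)
  affine≤ W N le = Aff-mono le (affine W)

  al : (ℤ → Bool) → ℤ → ℕ → List ℕ
  al a q zero = []
  al a q (suc d) = if a q then res q ∷ al a (up q) d else al a (up q) d

  al-cong : ∀ {a b} q d → (∀ t → t < d → a (q ⊕ t) ≡ b (q ⊕ t)) → al a q d ≡ al b q d
  al-cong q zero h = refl
  al-cong {a} {b} q (suc d) h rewrite h 0 (s≤s z≤n) | al-cong {a} {b} (up q) d (λ t lt → h (suc t) (s≤s lt)) = refl

  al-snoc : ∀ a q d → al a q (suc d) ≡ al a q d ++ (if a (q ⊕ d) then res (q ⊕ d) ∷ [] else [])
  al-snoc a q zero = refl
  al-snoc a q (suc d) with a q
  ... | true = cong (res q ∷_) (al-snoc a (up q) d)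
  ... | false = al-snoc a (up q) d

  length-al : ∀ a q d → length (al a q d) ≡ S (bit ∘ a) q d
  length-al a q zero = refl
  length-al a q (suc d) with a q
  ... | true = cong suc (length-al a (up q) d)
  ... | false = length-al a (up q) d

  -- Run length with fuel; by `runF-stable` the fuel is irrelevant once a position outside the set
  -- is within reach.
  runF : (ℤ → Bool) → ℕ → ℤ → ℕ
  runF a zero k = 0
  runF a (suc d) k = if a k then suc (runF a d (up k)) else 0

  runF-stable : ∀ a k m M → m ≤ M → a (k ⊕ m) ≡ false → runF a M k ≡ runF a m k
  runF-stable a k zero zero _ e = refl
  runF-stable a k zero (suc M) _ e rewrite e = refl
  runF-stable a k (suc m) (suc M) (s≤s le) e with a k
  ... | true = cong suc (runF-stable a (up k) m M le e)
  ... | false = refl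

  private
    res-≢ : ∀ k t → suc t < n → res (k ⊕ suc t) ≢ res k
    res-≢ k t lt e with window-injective k lt e
    ... | ()

    res-res : ∀ k → res k ℕ.% n ≡ res k
    res-res k = res-small (res<n k)

    al-untouched : ∀ a q d k → (∀ u → u < d → res (q ⊕ u) ≢ res (up k)) → (∀ u → u < d → res (q ⊕ u) ≢ res k) → app (al a q d) (up k) ≡ up k
    al-untouched a q zero k h₁ h₂ = refl
    al-untouched a q (suc d) k h₁ h₂ with a q
    ... | true = trans (cong (app (al a (up q) d)) (sAt-else (res q) k (λ e → h₁ 0 (s≤s z≤n) (sym (trans e (res-res q)))) (λ e → h₂ 0 (s≤s z≤n) (sym (trans e (res-res q))))))
                   (al-untouched a (up q) d k (λ u lt → h₁ (suc u) (s≤s lt)) (λ u lt → h₂ (suc u) (s≤s lt)))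
    ... | false = al-untouched a (up q) d k (λ u lt → h₁ (suc u) (s≤s lt)) (λ u lt → h₂ (suc u) (s≤s lt))

    al-below : ∀ a q d → suc d < n → app (al a (up q) d) q ≡ q
    al-below a q d lt = subst (λ k → app (al a (up q) d) k ≡ k) (up-dn q) (al-untouched a (up q) d (dn q)
      (λ u u<d e → res-≢ q u (<-trans (s≤s u<d) lt) (trans e (cong res (up-dn q))))
      (λ u u<d e → res-≢ (dn q) (suc u) (≤-<-trans (s≤s u<d) lt) (trans (cong (λ z → res (up z ⊕ u)) (up-dn q)) e)))

  -- The letter at `q` moves `q` to `q + 1`, the next letter moves it on, and so forth until a
  -- letter is missing; the letters after the gap no longer touch the position reached.
  al-first : ∀ a q d → d < n → app (al a q d) q ≡ q ⊕ runF a d q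
  al-first a q zero lt = refl
  al-first a q (suc d) lt with a q
  ... | true = trans (cong (app (al a (up q) d)) (sAt-in (res q) q (sym (res-res q)))) (al-first a (up q) d (<-trans (n<1+n d) lt))
  ... | false = al-below a q d lt

  -- The letters before `q ⊕ t` fix `q ⊕ suc t`. Then either the letter at `q ⊕ t` lowers it by one,
  -- out of reach of the remaining letters, or that letter is absent and the position is carried to
  -- the right as in `al-first`.
  al-later : ∀ a q d → d < n → ∀ t m → t + suc m ≡ d →
    (a (q ⊕ t) ≡ true → app (al a q d) (q ⊕ suc t) ≡ q ⊕ t) ×
    (a (q ⊕ t) ≡ false → app (al a q d) (q ⊕ suc t) ≡ q ⊕ suc t ⊕ runF a m (q ⊕ suc t))
  al-later a q (suc d) lt zero m e with a q in aq | suc-injective e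
  ... | true | refl = (λ _ → trans (cong (app (al a (up q) d)) (sAt-after (res q) q (sym (res-res q)))) (al-below a q d lt)) , λ ()
  ... | false | refl = (λ ()) , λ _ → al-first a (up q) d (<-trans (n<1+n d) lt)
  al-later a q (suc d) lt (suc t) m e with al-later a (up q) d (<-trans (n<1+n d) lt) t m (suc-injective e) | a q
  ... | ih | false = ih
  ... | ih₁ , ih₂ | true = (λ at → trans (cong (app (al a (up q) d)) skip) (ih₁ at)) , λ at → trans (cong (app (al a (up q) d)) skip) (ih₂ at)
    where
    t<n : suc (suc t) < n
    t<n = ≤-<-trans (≤-trans (≤-trans (s≤s (≤-reflexive (+-comm 1 t))) (s≤s (+-monoʳ-≤ t (s≤s z≤n)))) (≤-reflexive e)) lt
    skip : sAt n (res q) (q ⊕ suc (suc t)) ≡ q ⊕ suc (suc t)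
    skip = subst (λ z → sAt n (res q) z ≡ z) (⊕-up (up q) t) (sAt-else (res q) (up q ⊕ t)
      (λ e → res-≢ q (suc t) t<n (trans (cong res (sym (⊕-up (up q) t))) (trans e (res-res q))))
      (λ e → res-≢ q t (<-trans (n<1+n _) t<n) (trans e (res-res q))))

  abstract
    reach : ∀ k l → ∃ λ t → t < n × ∃ λ q → l ≡ (k ⊕ t) +ᶻ q *ᶻ + n
    reach k l = res (l -ᶻ k) , res<n (l -ᶻ k) , (l -ᶻ k) /ℕ n ,
      trans (lem k l) (trans (cong (k +ᶻ_) (a≡a%ℕn+[a/ℕn]*n (l -ᶻ k) n))
        (trans (sym (ℤP.+-assoc k _ _)) (cong (_+ᶻ (l -ᶻ k) /ℕ n *ᶻ + n) (sym (⊕-+ k (res (l -ᶻ k)))))))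
      where
      lem : ∀ k l → l ≡ k +ᶻ (l -ᶻ k)
      lem = solve-∀

  -- The increasing word of a set, cut at a missing position j, undoes the carrying.
  module Cut (a : ℤ → Bool) (a-sh : ∀ k → a (sh k) ≡ a k) (j : ℤ) (aj : a j ≡ false) where

    I : List ℕ
    I = al a (up j) (n ∸ 1)

    private
      suc-n∸1 : suc (n ∸ 1) ≡ n
      suc-n∸1 = m+[n∸m]≡n (<⇒≤ 1<n)

      n∸1<n : n ∸ 1 < n
      n∸1<n = ≤-reflexive suc-n∸1

      run : ℤ → ℕ
      run = runF a n

      missing-after : ∀ k → ∃ λ t → t < n × a (k ⊕ t) ≡ false
      missing-after k with reach k j
      ... | t , t<n , q , e = t , t<n , trans (sym (per-mult a a-sh (k ⊕ t) q)) (trans (cong a (sym e)) aj)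

      run-stable' : ∀ k → a k ≡ true → runF a (n ∸ 1) (up k) ≡ run (up k)
      run-stable' k ak with missing-after k
      ... | zero , _ , e = ⊥-elim (true≢false (trans (sym ak) e))
      ... | suc t , t<n , e = trans (runF-stable a (up k) t (n ∸ 1) (≤-trans (n≤1+n t) (≤-pred (≤-trans t<n (≤-reflexive (sym suc-n∸1))))) e)
              (sym (runF-stable a (up k) t n (<⇒≤ (<-trans (n<1+n t) t<n)) e))

      run-unfold : ∀ k → run k ≡ (if a k then suc (runF a (n ∸ 1) (up k)) else 0)
      run-unfold k = cong (λ m → runF a m k) (sym suc-n∸1)

      run-in : ∀ k → a k ≡ true → run k ≡ suc (run (up k))
      run-in k ak = trans (run-unfold k) (trans (cong (λ b → if b then suc (runF a (n ∸ 1) (up k)) else 0) ak) (cong suc (run-stable' k ak)))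

      run-out : ∀ k → a k ≡ false → run k ≡ 0
      run-out k ak = trans (run-unfold k) (cong (λ b → if b then suc (runF a (n ∸ 1) (up k)) else 0) ak)

      a-end : ∀ t m → t + m ≡ n ∸ 1 → a (up j ⊕ t ⊕ m) ≡ false
      a-end t m e = trans (cong a (trans (⊕-⊕ (up j) t m) (trans (cong (j ⊕_) (trans (cong suc e) suc-n∸1)) (⊕n j)))) (trans (a-sh j) aj)

      run-tail : ∀ t m → t + m ≡ n ∸ 1 → runF a m (up j ⊕ t) ≡ run (up j ⊕ t)
      run-tail t m e = sym (runF-stable a (up j ⊕ t) m n (≤-trans (m≤n+m m t) (≤-trans (≤-reflexive e) (<⇒≤ n∸1<n))) (a-end t m e))

      window : ∀ t → t < n → (a (j ⊕ t) ≡ true → app I (up (j ⊕ t)) ≡ j ⊕ t) × (a (j ⊕ t) ≡ false → app I (up (j ⊕ t)) ≡ up (j ⊕ t) ⊕ run (up (j ⊕ t)))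
      window zero _ = (λ e → ⊥-elim (true≢false (trans (sym e) aj))) , λ _ → trans (al-first a (up j) (n ∸ 1) n∸1<n) (cong (up j ⊕_) (run-tail 0 (n ∸ 1) refl))
      window (suc t) t<n with m≤n⇒∃[o]m+o≡n (≤-pred (≤-trans t<n (≤-reflexive (sym suc-n∸1))))
      ... | m , e with al-later a (up j) (n ∸ 1) n∸1<n t m (trans (+-suc t m) e)
      ... | h₁ , h₂ = (λ at → trans (cong (app I) (⊕-up (up j) t)) (h₁ at)) ,
            λ at → trans (cong (app I) (⊕-up (up j) t)) (trans (h₂ at) (trans (cong (up j ⊕ suc t ⊕_) (run-tail (suc t) m e)) (cong (λ z → z ⊕ run z) (sym (⊕-up (up j) t)))))

      run-mult : ∀ k q → run (k +ᶻ q *ᶻ + n) ≡ run k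
      run-mult = per-mult run (λ k → runF-sh n k)
        where
        runF-sh : ∀ m k → runF a m (sh k) ≡ runF a m k
        runF-sh zero k = refl
        runF-sh (suc m) k rewrite a-sh k | up-sh k | runF-sh m (up k) = refl

      up-mult : ∀ k x → up (k +ᶻ x) ≡ up k +ᶻ x
      up-mult = lem
        where
        lem : ∀ k x → (k +ᶻ x) +ᶻ + 1 ≡ (k +ᶻ + 1) +ᶻ x
        lem = solve-∀

      d-in : ∀ k → a k ≡ true → app I (up k) ≡ k
      d-in k ak with reach j k
      ... | t , t<n , q , refl = trans (cong (app I) (up-mult (j ⊕ t) _)) (trans (app-mult I (up (j ⊕ t)) q)
            (cong (_+ᶻ q *ᶻ + n) (proj₁ (window t t<n) (trans (sym (per-mult a a-sh (j ⊕ t) q)) ak))))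

      d-out : ∀ k → a k ≡ false → app I (up k) ≡ up k ⊕ run (up k)
      d-out k ak with reach j k
      ... | t , t<n , q , refl = trans (cong (app I) (up-mult (j ⊕ t) _)) (trans (app-mult I (up (j ⊕ t)) q)
            (trans (cong (_+ᶻ q *ᶻ + n) (proj₂ (window t t<n) (trans (sym (per-mult a a-sh (j ⊕ t) q)) ak)))
              (trans (cong (_+ᶻ q *ᶻ + n) (⊕-+ (up (j ⊕ t)) _)) (trans (lem (up (j ⊕ t)) (+ run (up (j ⊕ t))) (q *ᶻ + n))
                (trans (sym (⊕-+ _ (run (up (j ⊕ t))))) (cong₂ _⊕_ (sym (up-mult (j ⊕ t) _)) (trans (sym (run-mult (up (j ⊕ t)) q)) (cong run (sym (up-mult (j ⊕ t) _))))))))))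
        where
        lem : ∀ a r m → (a +ᶻ r) +ᶻ m ≡ (a +ᶻ m) +ᶻ r
        lem = solve-∀

    move : Move a (app I) (app (reverse I))
    move = record
      { a-sh = a-sh ; e-sh = app-sh (reverse I) ; e∘d = app-reverse I ; d∘e = app-reverse' I
      ; run = run ; run-in = run-in ; run-out = run-out ; d-in = d-in ; d-out = d-out }

    length-I : length I ≡ S (bit ∘ a) (+ 0) n
    length-I = trans (length-al a (up j) (n ∸ 1)) (trans (cong (ℕ._+ S (bit ∘ a) (up j) (n ∸ 1)) (sym (cong bit aj)))
      (trans (cong (S (bit ∘ a) j) suc-n∸1) (S-per (bit ∘ a) (λ k → cong bit (a-sh k)) j (+ 0))))

  abstract
    -- The set forces the run lengths, these force `d`, and `e` is the inverse of `d`. In particular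
    -- the element u_A is independent of the position at which its word is cut.
    Move-unique : ∀ {a d e d' e'} → Move a d e → Move a d' e' → (∀ k → d k ≡ d' k) × (∀ k → e k ≡ e' k)
    Move-unique {a} {d} {e} {d'} {e'} M M' = d≡ , λ k → trans (sym (M'.e∘d (e k))) (cong e' (trans (sym (d≡ (e k))) (M.d∘e k)))
      where
      module M = Move M
      module M' = Move M'
      run≡ : ∀ r k → M.run k ≡ r → M'.run k ≡ r
      run≡ r k eq with a k in ak
      run≡ r k eq | false = trans (M'.run-out k ak) (trans (sym (M.run-out k ak)) eq)
      run≡ zero k eq | true = ⊥-elim (ℕP.1+n≢0 (trans (sym (M.run-in k ak)) eq))
      run≡ (suc r) k eq | true = trans (M'.run-in k ak) (cong suc (run≡ r (up k) (suc-injective (trans (sym (M.run-in k ak)) eq))))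
      d≡' : ∀ k → d (up k) ≡ d' (up k)
      d≡' k with a k in ak
      ... | true = trans (M.d-in k ak) (sym (M'.d-in k ak))
      ... | false = trans (M.d-out k ak) (trans (cong (up k ⊕_) (sym (run≡ _ (up k) refl))) (sym (M'.d-out k ak)))
      d≡ : ∀ k → d k ≡ d' k
      d≡ k = subst (λ z → d z ≡ d' z) (up-dn k) (d≡' (dn k))

  abstract
    D : Vec Bool n → List ℕ
    D A = orderA n (sel A id)

    D-def : ∀ A → D A ≡ orderA n (sel A id)
    D-def A = refl

  private
    -- The list in `orderA` descends through the window while `al` ascends; the hypothesis matches
    -- the letter number `u` from the top with the letter number `v` from the bottom.
    filter-al : ∀ As q d g → (∀ u v → u + suc v ≡ d → g u ≡ res (q ⊕ v)) →
      filter (_∈? As) (applyUpTo g d) ≡ reverse (al (λ k → ⌊ res k ∈? As ⌋) q d)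
    filter-al As q zero g h = refl
    filter-al As q (suc d) g h = trans (split (res (q ⊕ d) ∈? As) (h 0 d refl))
      (trans (cong (opt ++_) (filter-al As q d (g ∘ suc) (λ u v e → h (suc u) v (cong suc e))))
        (trans (cong (_++ reverse (al a q d)) (sym opt-rev)) (trans (sym (ListP.reverse-++ (al a q d) opt)) (cong reverse (sym (al-snoc a q d))))))
      where
      a = λ k → ⌊ res k ∈? As ⌋
      opt = if a (q ⊕ d) then res (q ⊕ d) ∷ [] else []
      opt-rev : reverse opt ≡ opt
      opt-rev with a (q ⊕ d)
      ... | true = refl
      ... | false = refl
      split : ∀ (D? : Dec (res (q ⊕ d) ∈ As)) → g 0 ≡ res (q ⊕ d) →
        filter (_∈? As) (g 0 ∷ applyUpTo (g ∘ suc) d) ≡ (if ⌊ D? ⌋ then res (q ⊕ d) ∷ [] else []) ++ filter (_∈? As) (applyUpTo (g ∘ suc) d)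
      split (yes p) e rewrite e = ListP.filter-accept (_∈? As) p
      split (no ¬p) e rewrite e = ListP.filter-reject (_∈? As) ¬p

    leastMissing-∉ : ∀ A xs {x} → x ∈ xs → x ∉ A → leastMissing n A xs ∉ A
    leastMissing-∉ A (y ∷ xs) x∈ x∉ with y ∈? A
    leastMissing-∉ A (y ∷ xs) x∈ x∉ | no y∉ = y∉
    leastMissing-∉ A (y ∷ xs) (here refl) x∉ | yes y∈ = ⊥-elim (x∉ y∈)
    leastMissing-∉ A (y ∷ xs) (there x∈) x∉ | yes y∈ = leastMissing-∉ A xs x∈ x∉

    leastMissing-∈ : ∀ A xs {x} → x ∈ xs → x ∉ A → leastMissing n A xs ∈ xs
    leastMissing-∈ A (y ∷ xs) x∈ x∉ with y ∈? A
    leastMissing-∈ A (y ∷ xs) x∈ x∉ | no y∉ = here refl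
    leastMissing-∈ A (y ∷ xs) (here refl) x∉ | yes y∈ = ⊥-elim (x∉ y∈)
    leastMissing-∈ A (y ∷ xs) (there x∈) x∉ | yes y∈ = there (leastMissing-∈ A xs x∈ x∉)

  cut : Vec Bool n → ℤ
  cut A = + leastMissing n (sel A id) (upTo n)

  cnt-mem : ∀ A → S (bit ∘ mem A) (+ 0) n ≡ cnt A
  cnt-mem A = cnt-S A (bit ∘ mem A) (+ 0) (λ i → cong (λ z → bit (lookup A z)) (trans (cong resF (trans (⊕-+ (+ 0) (toℕ i)) (ℤP.+-identityˡ (+ toℕ i)))) (resF-toℕ i)))

  missing⇒cnt : ∀ A k → mem A k ≡ false → cnt A < n
  missing⇒cnt A k e = missing⇒cnt< A (resF k) e

  module _ (A : Vec Bool n) (proper : cnt A < n) where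

    private
      sel-lookup : ∀ k → ⌊ res k ∈? sel A id ⌋ ≡ mem A k
      sel-lookup k = trans (cong (λ r → ⌊ r ∈? sel A id ⌋) (sym (toℕ-resF k))) (∈?-sel A (resF k))

      i∉ : ∃ λ i → lookup A i ≡ false
      i∉ = cnt<⇒missing A proper

      toℕ∉ : toℕ (proj₁ i∉) ∉ sel A id
      toℕ∉ x∈ with toℕ (proj₁ i∉) ∈? sel A id | ∈?-sel A (proj₁ i∉)
      ... | yes _ | e = true≢false (trans e (proj₂ i∉))
      ... | no x∉ | _ = x∉ x∈

      toℕ∈ : toℕ (proj₁ i∉) ∈ upTo n
      toℕ∈ = MemP.∈-upTo⁺ (FinP.toℕ<n (proj₁ i∉))

    cut< : leastMissing n (sel A id) (upTo n) < n
    cut< = MemP.∈-upTo⁻ (leastMissing-∈ (sel A id) (upTo n) toℕ∈ toℕ∉)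

    cut-missing : mem A (cut A) ≡ false
    cut-missing = trans (sym (sel-lookup (cut A))) (trans (cong (λ r → ⌊ r ∈? sel A id ⌋) (res-small cut<)) (not-in _ (leastMissing-∉ (sel A id) (upTo n) toℕ∈ toℕ∉)))
      where
      not-in : ∀ r → r ∉ sel A id → ⌊ r ∈? sel A id ⌋ ≡ false
      not-in r r∉ with r ∈? sel A id
      ... | yes r∈ = ⊥-elim (r∉ r∈)
      ... | no _ = refl

    D≡ : D A ≡ reverse (al (mem A) (up (cut A)) (n ∸ 1))
    D≡ = trans (D-def A) (trans (cong (filter (_∈? sel A id)) (ListP.map-upTo _ (n ∸ 1)))
      (trans (filter-al (sel A id) (up (cut A)) (n ∸ 1) _ letters)
        (cong reverse (al-cong (up (cut A)) (n ∸ 1) (λ t _ → sel-lookup (up (cut A) ⊕ t))))))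
      where
      j = leastMissing n (sel A id) (upTo n)
      letters : ∀ u v → u + suc v ≡ n ∸ 1 → (j + n ∸ suc u) ℕ.% n ≡ res (up (cut A) ⊕ v)
      letters u v e = cong res (trans (cong +_ (trans (cong (λ m → j + m ∸ suc u) n≡) (trans (ℕP.+-∸-assoc j (m≤m+n (suc u) (suc v))) (cong (j ℕ.+_) (ℕP.m+n∸m≡n (suc u) (suc v))))))
        (sym (⊕-+ (cut A) (suc v))))
        where
        n≡ : n ≡ suc u + suc v
        n≡ = trans (sym (m+[n∸m]≡n (<⇒≤ 1<n))) (cong suc (sym e))

    module CutA = Cut (mem A) (mem-sh A) (cut A) cut-missing

    reverse-D : reverse (D A) ≡ CutA.I
    reverse-D = trans (cong reverse D≡) (ListP.reverse-involutive _)

    abstract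
      moveA : Move (mem A) (app (reverse (D A))) (app (D A))
      moveA = subst₂ (λ V W → Move (mem A) (app V) (app W)) (sym reverse-D) (sym D≡) CutA.move

    length-D : length (D A) ≡ cnt A
    length-D = trans (sym (ListP.length-reverse (D A))) (trans (cong length reverse-D) (trans CutA.length-I (cnt-mem A)))

-- Counting and ranks in initial segments of ℕ.

nonzero : ℕ → Bool
nonzero zero = false
nonzero (suc _) = true

Sn : (ℕ → ℕ) → ℕ → ℕ
Sn f zero = 0
Sn f (suc N) = Sn f N + f N

Sn-cong : ∀ {f g} N → (∀ t → t < N → f t ≡ g t) → Sn f N ≡ Sn g N
Sn-cong zero h = refl
Sn-cong (suc N) h = cong₂ _+_ (Sn-cong N (λ t lt → h t (m<n⇒m<1+n lt))) (h N (n<1+n N))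

Sn-head : ∀ f N → Sn f (suc N) ≡ f 0 + Sn (f ∘ suc) N
Sn-head f zero = sym (+-identityʳ (f 0))
Sn-head f (suc N) = trans (cong (ℕ._+ f (suc N)) (Sn-head f N)) (+-assoc (f 0) _ _)

Sn-zero : ∀ {f} N → (∀ t → t < N → f t ≡ 0) → Sn f N ≡ 0
Sn-zero zero h = refl
Sn-zero (suc N) h = cong₂ _+_ (Sn-zero N (λ t lt → h t (m<n⇒m<1+n lt))) (h N (n<1+n N))

Sn-mono : ∀ {f g} N → (∀ t → t < N → f t ≤ g t) → Sn f N ≤ Sn g N
Sn-mono zero h = z≤n
Sn-mono (suc N) h = +-mono-≤ (Sn-mono N (λ t lt → h t (m<n⇒m<1+n lt))) (h N (n<1+n N))

Sn-≤ : ∀ f {M N} → M ≤ N → Sn f M ≤ Sn f N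
Sn-≤ f {M} {N} le with m≤n⇒∃[o]m+o≡n le
... | o , refl = go o
  where
  go : ∀ o → Sn f M ≤ Sn f (M + o)
  go zero = ≤-reflexive (cong (Sn f) (sym (+-identityʳ M)))
  go (suc o) = ≤-trans (go o) (≤-trans (m≤m+n _ (f (M + o))) (≤-reflexive (cong (Sn f) (sym (+-suc M o)))))

Sn-S-swap : ∀ (F : ℤ → ℕ → ℕ) p M N → S (λ k → Sn (F k) N) p M ≡ Sn (λ t → S (λ k → F k t) p M) N
Sn-S-swap F p M zero = S-zero _ p M (λ _ _ → refl)
Sn-S-swap F p M (suc N) = trans (S-distrib-+ (λ k → Sn (F k) N) (λ k → F k N) p M) (cong (ℕ._+ S (λ k → F k N) p M) (Sn-S-swap F p M N))

S≡Sn : ∀ f p N → S f p N ≡ Sn (λ t → f (p ⊕ t)) N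
S≡Sn f p zero = refl
S≡Sn f p (suc N) = trans (cong (f p ℕ.+_) (S≡Sn f (up p) N)) (sym (Sn-head (λ t → f (p ⊕ t)) N))

Sn-pick : ∀ f (X : ℕ → ℕ) N t → t < N → f t ≡ 1 → Sn f N ≤ 1 → Sn (λ u → f u * X u) N ≡ X t
Sn-pick f X (suc N) t lt ft le with t ≟ N
... | yes refl = cong₂ _+_ (Sn-zero N (λ u u<N → cong (_* X u) (n≤0⇒n≡0 (≤-trans (term u N u<N) (none N le ft)))))
                   (trans (cong (_* X N) ft) (ℕP.*-identityˡ (X N)))
  where
  term : ∀ u N → u < N → f u ≤ Sn f N
  term u N u<N = ≤-trans (m≤n+m (f u) (Sn f u)) (Sn-≤ f {suc u} {N} u<N)
  none : ∀ N → Sn f N + f N ≤ 1 → f N ≡ 1 → Sn f N ≤ 0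
  none N le e = +-cancelʳ-≤ 1 (Sn f N) 0 (subst (λ z → Sn f N + z ≤ 1) e le)
... | no t≢N = trans (cong₂ _+_ (Sn-pick f X N t t<N ft (≤-trans (m≤m+n _ (f N)) le)) (cong (_* X N) fN≡0)) (+-identityʳ (X t))
  where
  t<N = ≤∧≢⇒< (≤-pred lt) t≢N
  fN≡0 : f N ≡ 0
  fN≡0 = n≤0⇒n≡0 (+-cancelˡ-≤ 1 (f N) 0 (≤-trans (+-monoˡ-≤ (f N) (≤-trans (≤-reflexive (sym ft)) (≤-trans (m≤n+m (f t) (Sn f t)) (Sn-≤ f {suc t} {N} t<N)))) le))

-- With `f` marking a subset of ℕ, `Sn f t` is the rank of `t` in it, so the test selects the
-- members of rank below `R ∸ s`.
Sn-threshold : ∀ f s R N → (∀ t → f t ≤ 1) → Sn (λ t → f t * [ Sn f t + s <? R ]) N ≡ (R ∸ s) ⊓ Sn f N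
Sn-threshold f s R zero f≤1 = sym (⊓-zeroʳ (R ∸ s))
Sn-threshold f s R (suc N) f≤1 with f N | f≤1 N
... | zero | _ = trans (+-identityʳ _) (trans (Sn-threshold f s R N f≤1) (cong ((R ∸ s) ⊓_) (sym (+-identityʳ _))))
... | suc (suc _) | s≤s ()
... | suc zero | _ with Sn f N + s <? R
... | yes lt = trans (cong (ℕ._+ 1) (trans (Sn-threshold f s R N f≤1) (m≥n⇒m⊓n≡n (≤-trans (n≤1+n _) below)))) (sym (m≥n⇒m⊓n≡n (≤-trans (≤-reflexive (+-comm _ 1)) below)))
  where
  below : suc (Sn f N) ≤ R ∸ s
  below = ℕP.m+n≤o⇒m≤o∸n (suc (Sn f N)) lt
... | no ≮ = trans (+-identityʳ _) (trans (Sn-threshold f s R N f≤1) (trans (m≤n⇒m⊓n≡m above) (sym (m≤n⇒m⊓n≡m (≤-trans above (m≤m+n _ 1))))))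
  where
  above : R ∸ s ≤ Sn f N
  above = ℕP.m≤n+o⇒m∸n≤o R s (subst (R ≤_) (+-comm (Sn f N) s) (≮⇒≥ ≮))

-- By the closure hypothesis the members satisfying `g` form an initial segment of the marked set,
-- so membership amounts to having a rank below the size of the segment.
Sn-initial : ∀ f (g : ℕ → Bool) N → (∀ t → f t ≤ 1) →
  (∀ t u → u < t → f t ≡ 1 → g t ≡ true → f u ≡ 1 → g u ≡ true) → ∀ t → t < N → f t ≡ 1 →
  (g t ≡ true → Sn f t < Sn (λ u → f u * bit (g u)) N) × (g t ≡ false → Sn (λ u → f u * bit (g u)) N ≤ Sn f t)
Sn-initial f g N f≤1 closed t t<N ft = in' , out'
  where
  fg = λ u → f u * bit (g u)
  cases : ∀ u → f u ≡ 0 ⊎ f u ≡ 1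
  cases u with f u | f≤1 u
  ... | zero | _ = inj₁ refl
  ... | suc zero | _ = inj₂ refl
  ... | suc (suc _) | s≤s ()
  in' : g t ≡ true → Sn f t < Sn fg N
  in' gt = ≤-trans (≤-reflexive (trans (+-comm 1 (Sn f t)) (cong₂ _+_ (Sn-cong t same) (sym (trans (cong₂ _*_ ft (cong bit gt)) refl))))) (Sn-≤ fg {suc t} {N} t<N)
    where
    same : ∀ u → u < t → f u ≡ fg u
    same u u<t with cases u
    ... | inj₁ e = trans e (sym (cong (_* bit (g u)) e))
    ... | inj₂ e = sym (trans (cong (λ b → f u * bit b) (closed t u u<t ft gt e)) (ℕP.*-identityʳ (f u)))
  out' : g t ≡ false → Sn fg N ≤ Sn f t
  out' gt = go N
    where
    fg≤f : ∀ u → fg u ≤ f u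
    fg≤f u = ≤-trans (ℕP.*-monoʳ-≤ (f u) (bit≤1 (g u))) (≤-reflexive (ℕP.*-identityʳ (f u)))
    go : ∀ M → Sn fg M ≤ Sn f t
    go zero = z≤n
    go (suc M) with M <? t
    ... | yes M<t = ≤-trans (Sn-mono (suc M) (λ u _ → fg≤f u)) (Sn-≤ f {suc M} {t} M<t)
    ... | no M≮t = ≤-trans (≤-reflexive (trans (cong (Sn fg M ℕ.+_) none) (+-identityʳ _))) (go M)
      where
      none : fg M ≡ 0
      none with cases M
      ... | inj₁ e = cong (_* bit (g M)) e
      ... | inj₂ e with g M in gM
      ... | false = ℕP.*-zeroʳ (f M)
      ... | true with M ≟ t
      ... | yes refl = ⊥-elim (true≢false (trans (sym gM) gt))
      ... | no M≢t = ⊥-elim (true≢false (trans (sym (closed M t (≤∧≢⇒< (≮⇒≥ M≮t) (M≢t ∘ sym)) e gM ft)) gt))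

-- Admissible sets for codes with entries at most 2, and the mirror involution.

module Mirrors (n : ℕ) .{{nz : NonZero n}} where

  open Residues n
  open Codes n
  open Moves n

  run-unique : ∀ {a d e} (M : Move a d e) s k → (∀ u → u < s → a (k ⊕ u) ≡ true) → a (k ⊕ s) ≡ false → Move.run M k ≡ s
  run-unique M zero k _ e = Move.run-out M k e
  run-unique M (suc s) k h e = trans (Move.run-in M k (h 0 (s≤s z≤n))) (cong suc (run-unique M s (up k) (λ u lt → h (suc u) (s≤s lt)) e))

  module _ {N y} (Y : Aff N y) where
    open Aff Y
    private
      c = code' N y

    -- Whatever is inverted with the later, smaller entry is inverted with `k` as well, and that
    -- entry itself counts once more.
    code-drop : ∀ k t → y (k ⊕ suc t) <ᶻ y k → suc (c (k ⊕ suc t)) ≤ c k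
    code-drop k t lt = subst (suc (c (k ⊕ suc t)) ≤_) (code-ext Y (suc t + N) (m≤n+m N (suc t)) k)
      (subst (suc (c (k ⊕ suc t)) ≤_) (sym (S-++ (β y k) (up k) (suc t) N))
        (+-mono-≤ (subst (_≤ S (β y k) (up k) (suc t)) ([]-yes (_ ℤ.<? _) lt) (S-term (β y k) (up k) (suc t) t (n<1+n t)))
          (subst (λ p → c (k ⊕ suc t) ≤ S (β y k) p N) (⊕-up k (suc t)) (S-mono smaller (up (k ⊕ suc t)) N))))
      where
      smaller : ∀ m → β y (k ⊕ suc t) m ≤ β y k m
      smaller m with y m ℤ.<? y (k ⊕ suc t)
      ... | no _ = z≤n
      ... | yes lt' = ≤-reflexive (sym ([]-yes (_ ℤ.<? _) (ℤP.<-trans lt' lt)))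

    -- Everything inverted with `k` lies behind `k ⊕ suc t`, whose entry is larger and so is
    -- inverted with it too.
    code-grow : ∀ k t → (∀ u → u ≤ t → y k <ᶻ y (k ⊕ suc u)) → c k ≤ c (k ⊕ suc t)
    code-grow k t h = subst (_≤ c (k ⊕ suc t)) (code-ext Y (suc t + N) (m≤n+m N (suc t)) k)
      (subst (_≤ c (k ⊕ suc t)) (sym (S-++ (β y k) (up k) (suc t) N))
        (≤-trans (≤-reflexive (cong (ℕ._+ S (β y k) (up k ⊕ suc t) N) (S-zero (β y k) (up k) (suc t) (λ u lt → []-no (_ ℤ.<? _) (λ lt' → ℤP.<-asym lt' (h u (≤-pred lt)))))))
          (subst (λ p → S (β y k) p N ≤ c (k ⊕ suc t)) (⊕-up k (suc t)) (S-mono larger (up (k ⊕ suc t)) N))))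
      where
      larger : ∀ m → β y k m ≤ β y (k ⊕ suc t) m
      larger m with y m ℤ.<? y k
      ... | no _ = z≤n
      ... | yes lt = ≤-reflexive (sym ([]-yes (_ ℤ.<? _) (ℤP.<-trans lt (h t ≤-refl))))

  -- For codes with entries ≤ 2 these are exactly the sets along which carrying can be
  -- undone leaving a code with entries ≤ 1: all entries 2, no entries 0, and in each class
  -- of entries 1 with the same inverted position j the ones nearest to j.
  record Admissible (N : ℕ) (y : ℤ → ℤ) (a : ℤ → Bool) : Set where
    field
      twos  : ∀ k → code' N y k ≡ 2 → a k ≡ true
      zeros : ∀ k → code' N y k ≡ 0 → a k ≡ false
      ones  : ∀ k t u → a k ≡ true → code' N y k ≡ 1 → y (k ⊕ suc t) <ᶻ y k → u < t → a (k ⊕ suc u) ≡ true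

  module _ {N y} (Y : Aff N y) (c≤2 : ∀ k → code' N y k ≤ 2) where
    open Aff Y
    private
      c = code' N y

    inverted-unique : ∀ k t u → c k ≡ 1 → y (k ⊕ suc t) <ᶻ y k → y (k ⊕ suc u) <ᶻ y k → t ≡ u
    inverted-unique k t u ck lt lu with ℕP.<-cmp t u
    ... | tri≈ _ e _ = e
    ... | tri< t<u _ _ = ⊥-elim (<⇒≱ (code-≥2 Y k t u t<u lt lu) (≤-reflexive ck))
    ... | tri> _ _ u<t = ⊥-elim (<⇒≱ (code-≥2 Y k u t u<t lu lt) (≤-reflexive ck))

    -- A member of code 1 is inverted with the end of its run by validity, and with nothing else;
    -- all positions before that end belong to the run.
    valid⇒admissible : ∀ {a d e} (M : Move a d e) → Valid M y → (∀ k → c k ≡ 2 → a k ≡ true) → (∀ k → c k ≡ 0 → a k ≡ false) → Admissible N y a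
    valid⇒admissible {a} M V twos zeros = record { twos = twos ; zeros = zeros ; ones = ones' }
      where
      open Move M
      ones' : ∀ k t u → a k ≡ true → c k ≡ 1 → y (k ⊕ suc t) <ᶻ y k → u < t → a (k ⊕ suc u) ≡ true
      ones' k t u ak ck lt u<t = proj₁ (segment (run k) k refl (suc u) (≤-trans (s≤s u<t) (≤-reflexive (trans (cong suc t≡) (sym (run-in k ak))))))
        where
        t≡ : t ≡ run (up k)
        t≡ = inverted-unique k t (run (up k)) ck lt (subst (λ r → y (k ⊕ r) <ᶻ y k) (run-in k ak) (V k ak))

    -- Suppose the end of the run carries a larger entry than `k`, and let `j` be the first position
    -- inverted with `k`. If `j` is inside the run, it has code 1 and its own inverted position has
    -- code 0, hence ends the run with an entry below `y k`. If `j` is behind the run, `code-grow`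
    -- bounds the code of `k` by that of the end, which is at most 1 as the end is outside the set;
    -- then `ones` puts the end into the set.
    admissible⇒valid : ∀ {a d e} (M : Move a d e) → Admissible N y a → Valid M y
    admissible⇒valid {a} M adm k ak with ℤP.<-cmp (y (Move.ν M k)) (y k)
    ... | tri< lt _ _ = lt
    ... | tri≈ _ e _ = ⊥-elim (true≢false (trans (sym ak) (trans (cong a (sym (inj e))) (Move.ν∉ M k))))
    ... | tri> _ _ gt = ⊥-elim (impossible (code-first Y k positive))
      where
      open Move M
      open Admissible adm
      r = run (up k)
      run≡ = run-in k ak
      gt' : y k <ᶻ y (k ⊕ suc r)
      gt' = subst (λ z → y k <ᶻ y (k ⊕ z)) run≡ gt
      out : a (k ⊕ suc r) ≡ false
      out = subst (λ z → a (k ⊕ z) ≡ false) run≡ (ν∉ k)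
      nonzero-code : ∀ k → a k ≡ true → 1 ≤ c k
      nonzero-code k ak = ℕP.n≢0⇒n>0 (λ e → true≢false (trans (sym ak) (zeros k e)))
      positive : 1 ≤ c k
      positive = nonzero-code k ak
      one : ∀ {m} → 1 ≤ m → m ≤ 1 → m ≡ 1
      one le le' = ≤-antisym le' le
      impossible : (∃ λ t → y (k ⊕ suc t) <ᶻ y k × (∀ u → u < t → y k <ᶻ y (k ⊕ suc u))) → ⊥
      impossible (t , inverted , first) with ℕP.<-cmp t r
      ... | tri≈ _ e _ = ℤP.<-asym gt' (subst (λ z → y (k ⊕ suc z) <ᶻ y k) e inverted)
      ... | tri< t<r _ _ = inside (segment (run k) k refl (suc t) (≤-trans (s≤s t<r) (≤-reflexive (sym run≡))))
        where
        j = k ⊕ suc t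
        inside : a j ≡ true × ν j ≡ ν k → ⊥
        inside (aj , same) = second (code-first Y j (nonzero-code j aj))
          where
          cj : c j ≡ 1
          cj = one (nonzero-code j aj) (≤-pred (≤-trans (code-drop Y k t inverted) (c≤2 k)))
          second : (∃ λ t' → y (j ⊕ suc t') <ᶻ y j × (∀ u → u < t' → y j <ᶻ y (j ⊕ suc u))) → ⊥
          second (t' , inv' , _) = ℤP.<-asym gt (subst (λ z → y z <ᶻ y k) (trans (cong (j ⊕_) (sym (run-unique M (suc t') j all-in j₂∉))) same) (ℤP.<-trans inv' inverted))
            where
            j₂∉ : a (j ⊕ suc t') ≡ false
            j₂∉ = zeros _ (n≤0⇒n≡0 (≤-pred (≤-trans (code-drop Y j t' inv') (≤-reflexive cj))))
            all-in : ∀ u → u < suc t' → a (j ⊕ u) ≡ true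
            all-in zero _ = aj
            all-in (suc u) (s≤s u<t') = ones j t' u aj cj inv' u<t'
      ... | tri> _ _ r<t = true≢false (trans (sym (ones k t r ak ck inverted r<t)) out)
        where
        m = k ⊕ suc r
        m≤1 : c m ≤ 1
        m≤1 with c m in cm | c≤2 m
        ... | zero | _ = z≤n
        ... | suc zero | _ = s≤s z≤n
        ... | suc (suc zero) | _ = ⊥-elim (true≢false (trans (sym (twos m cm)) out))
        ... | suc (suc (suc _)) | s≤s (s≤s ())
        ck : c k ≡ 1
        ck = one positive (≤-trans (code-grow Y k r (λ u u≤r → first u (≤-<-trans u≤r r<t))) m≤1)

  one? : ℕ → (ℤ → ℤ) → ℤ → ℕ
  one? N y k = [ code' N y k ≟ 1 ]

  -- K j t says that j - (1+t) has code 1 and that j is its inverted position.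
  K : ℕ → (ℤ → ℤ) → ℤ → ℕ → ℕ
  K N y j t = one? N y (j -ᶻ + suc t) * [ y j ℤ.<? y (j -ᶻ + suc t) ]

  chosen : ℕ → (ℤ → ℤ) → (ℤ → Bool) → ℤ → ℕ
  chosen N y a j = Sn (λ t → K N y j t * bit (a (j -ᶻ + suc t))) N

  -- In the class of `j`, `Sn (K N y j) t` counts the members nearer than distance `suc t`, `chosen`
  -- is s and the full sum is r. The test is rank < r - s, written without subtraction.
  Q : ℕ → (ℤ → ℤ) → (ℤ → Bool) → ℤ → ℕ → ℕ
  Q N y a j t = [ Sn (K N y j) t + chosen N y a j <? Sn (K N y j) N ]

  pick : ℕ → ℕ → Bool
  pick zero q = false
  pick (suc zero) q = nonzero q
  pick (suc (suc _)) q = true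

  -- In each class of entries 1, replace the s elements nearest to j by the r - s nearest ones.
  mirror : ℕ → (ℤ → ℤ) → (ℤ → Bool) → ℤ → Bool
  mirror N y a k = pick (code' N y k) (Sn (λ t → β y k (k ⊕ suc t) * Q N y a (k ⊕ suc t) t) N)

  module _ (N : ℕ) {y y' : ℤ → ℤ} {a a' : ℤ → Bool} (h : ∀ k → y k ≡ y' k) (ha : ∀ k → a k ≡ a' k) where
    private
      K-cong : ∀ j t → K N y j t ≡ K N y' j t
      K-cong j t = cong₂ _*_ (cong (λ z → [ z ≟ 1 ]) (code'-≗ N {y} {y'} h (j -ᶻ + suc t))) (cong₂ (λ u v → [ u ℤ.<? v ]) (h j) (h (j -ᶻ + suc t)))

    mirror-cong : ∀ k → mirror N y a k ≡ mirror N y' a' k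
    mirror-cong k = cong₂ pick (code'-≗ N h k) (Sn-cong N (λ t _ → cong₂ _*_ (cong₂ (λ u v → [ u ℤ.<? v ]) (h _) (h k))
      (cong₂ (λ u v → [ u <? v ]) (cong₂ _+_ (Sn-cong t (λ u _ → K-cong (k ⊕ suc t) u)) (Sn-cong N (λ u _ → cong₂ _*_ (K-cong (k ⊕ suc t) u) (cong bit (ha _)))))
        (Sn-cong N (λ u _ → K-cong (k ⊕ suc t) u)))))

  module _ {N y} (Y : Aff N y) (c≤2 : ∀ k → code' N y k ≤ 2) where
    open Aff Y
    private
      c = code' N y
      k⊖ : ℤ → ℕ → ℤ
      k⊖ j t = j -ᶻ + suc t

      K≤1 : ∀ j t → K N y j t ≤ 1
      K≤1 j t = ℕP.*-mono-≤ ([]≤1 (c (k⊖ j t) ≟ 1)) ([]≤1 (y j ℤ.<? y (k⊖ j t)))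

      K-true : ∀ j t → K N y j t ≡ 1 → c (k⊖ j t) ≡ 1 × y (k⊖ j t ⊕ suc t) <ᶻ y (k⊖ j t)
      K-true j t e with c (k⊖ j t) ≟ 1 | y j ℤ.<? y (k⊖ j t)
      ... | yes p | yes q = p , subst (λ z → y z <ᶻ y (k⊖ j t)) (sym (⊖⊕ j (suc t))) q

      K-⊕ : ∀ k t → K N y (k ⊕ suc t) t ≡ one? N y k * β y k (k ⊕ suc t)
      K-⊕ k t = cong (λ z → one? N y z * [ y (k ⊕ suc t) ℤ.<? y z ]) (⊕⊖ k (suc t))

      K-at : ∀ k t → c k ≡ 1 → y (k ⊕ suc t) <ᶻ y k → K N y (k ⊕ suc t) t ≡ 1
      K-at k t ck lt = trans (K-⊕ k t) (cong₂ _*_ ([]-yes (c k ≟ 1) ck) ([]-yes (_ ℤ.<? _) lt))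

      code-Sn : ∀ k → c k ≡ Sn (λ t → β y k (k ⊕ suc t)) N
      code-Sn k = S≡Sn (β y k) (up k) N

      Sn-inverted : ∀ X k t → c k ≡ 1 → y (k ⊕ suc t) <ᶻ y k → Sn (λ u → β y k (k ⊕ suc u) * X u) N ≡ X t
      Sn-inverted X k t ck lt = Sn-pick (λ u → β y k (k ⊕ suc u)) X N t (<-trans (n<1+n t) (inverted⇒< Y k (suc t) lt))
        ([]-yes (_ ℤ.<? _) lt) (≤-reflexive (trans (sym (code-Sn k)) ck))

      nonzero-[] : ∀ {P : Set} (P? : Dec P) → bit (nonzero [ P? ]) ≡ [ P? ]
      nonzero-[] (yes _) = refl
      nonzero-[] (no _) = refl

    -- An entry 1 has exactly one inverted position, so one term of the sum in `mirror` survives.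
    mirror-one : ∀ a k t → c k ≡ 1 → y (k ⊕ suc t) <ᶻ y k → mirror N y a k ≡ nonzero (Q N y a (k ⊕ suc t) t)
    mirror-one a k t ck lt = trans (cong (λ z → pick z (Sn (λ t → β y k (k ⊕ suc t) * Q N y a (k ⊕ suc t) t) N)) ck)
      (cong nonzero (Sn-inverted (λ u → Q N y a (k ⊕ suc u) u) k t ck lt))

    mirror-two : ∀ a k → c k ≡ 2 → mirror N y a k ≡ true
    mirror-two a k ck = cong (λ z → pick z (Sn (λ t → β y k (k ⊕ suc t) * Q N y a (k ⊕ suc t) t) N)) ck

    mirror-zero : ∀ a k → c k ≡ 0 → mirror N y a k ≡ false
    mirror-zero a k ck = cong (λ z → pick z (Sn (λ t → β y k (k ⊕ suc t) * Q N y a (k ⊕ suc t) t) N)) ck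

    -- Only `ones` has content. A position `i` between `k` and its inverted position j carries a
    -- larger entry than `k`, hence is inverted with j. If its code is 1, it is in the class of `k`
    -- with no larger rank and passes the same test; if its code is 2, it is always taken.
    mirror-admissible : ∀ a → Admissible N y (mirror N y a)
    mirror-admissible a = record { twos = mirror-two a ; zeros = mirror-zero a ; ones = ones' }
      where
      ones' : ∀ k t u → mirror N y a k ≡ true → c k ≡ 1 → y (k ⊕ suc t) <ᶻ y k → u < t → mirror N y a (k ⊕ suc u) ≡ true
      ones' k t u mk ck lt u<t with m≤n⇒∃[o]m+o≡n u<t
      ... | v , uv = conclude (c i) refl (c≤2 i)
        where
        i = k ⊕ suc u
        to-j : i ⊕ suc v ≡ k ⊕ suc t
        to-j = trans (⊕-⊕ k (suc u) (suc v)) (cong (λ z → k ⊕ suc z) (trans (+-suc u v) uv))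
        above : y k <ᶻ y i
        above with y i ℤ.<? y k
        ... | yes lt' = ⊥-elim (ℕP.<⇒≢ u<t (inverted-unique Y c≤2 k u t ck lt' lt))
        ... | no ≮ with ℤP.<-cmp (y k) (y i)
        ... | tri< l _ _ = l
        ... | tri≈ _ e _ = ⊥-elim (ℤP.<-irrefl (inj e) (k<k⊕ k u))
        ... | tri> _ _ g = ⊥-elim (≮ g)
        inv-i : y (i ⊕ suc v) <ᶻ y i
        inv-i = ℤP.<-trans (subst (λ z → y z <ᶻ y k) (sym to-j) lt) above
        Q-at-t : 1 ≤ Q N y a (k ⊕ suc t) t
        Q-at-t with Q N y a (k ⊕ suc t) t | trans (sym (mirror-one a k t ck lt)) mk
        ... | suc _ | _ = s≤s z≤n
        v≤t : v ≤ t
        v≤t = ≤-trans (m≤n+m v (suc u)) (≤-reflexive uv)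
        Q-at-v : Q N y a (k ⊕ suc t) v ≡ 1
        Q-at-v = []-yes (_ <? _) (≤-<-trans (+-monoˡ-≤ _ (Sn-≤ (K N y (k ⊕ suc t)) v≤t)) ([]-true (_ <? _) Q-at-t))
        conclude : ∀ m → c i ≡ m → m ≤ 2 → mirror N y a i ≡ true
        conclude zero e _ = ⊥-elim (<⇒≱ (code-≥1 Y i v inv-i) (≤-reflexive e))
        conclude (suc zero) e _ = trans (mirror-one a i v e inv-i) (cong nonzero (trans (cong (λ z → Q N y a z v) to-j) Q-at-v))
        conclude (suc (suc zero)) e _ = mirror-two a i e
        conclude (suc (suc (suc _))) e (s≤s (s≤s ()))

    chosen-mirror : ∀ a j → chosen N y (mirror N y a) j ≡ Sn (K N y j) N ∸ chosen N y a j
    chosen-mirror a j = trans (Sn-cong N same) (trans (Sn-threshold (K N y j) (chosen N y a j) (Sn (K N y j) N) N (K≤1 j)) (m≤n⇒m⊓n≡m (ℕP.m∸n≤m _ (chosen N y a j))))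
      where
      same : ∀ t → t < N → K N y j t * bit (mirror N y a (k⊖ j t)) ≡ K N y j t * Q N y a j t
      same t _ = by (K N y j t) refl (K≤1 j t)
        where
        by : ∀ m → K N y j t ≡ m → m ≤ 1 → m * bit (mirror N y a (k⊖ j t)) ≡ m * Q N y a j t
        by zero _ _ = refl
        by (suc zero) e _ = cong (ℕ._+ 0) (trans (cong bit (trans (mirror-one a (k⊖ j t) t (proj₁ (K-true j t e)) (proj₂ (K-true j t e))) (cong (λ z → nonzero (Q N y a z t)) (⊖⊕ j (suc t)))))
          (nonzero-[] (Sn (K N y j) t + chosen N y a j <? Sn (K N y j) N)))
        by (suc (suc _)) _ (s≤s ())

    chosen≤ : ∀ a j → chosen N y a j ≤ Sn (K N y j) N
    chosen≤ a j = Sn-mono N (λ t _ → ≤-trans (ℕP.*-monoʳ-≤ (K N y j t) (bit≤1 (a (k⊖ j t)))) (≤-reflexive (ℕP.*-identityʳ _)))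

    -- In an admissible set the chosen members of a class are those of rank below s, and mirroring
    -- twice selects the ranks below r - (r - s).
    mirror-involutive : ∀ a → Admissible N y a → ∀ k → mirror N y (mirror N y a) k ≡ a k
    mirror-involutive a adm k = by (c k) refl (c≤2 k)
      where
      open Admissible adm
      by : ∀ m → c k ≡ m → m ≤ 2 → mirror N y (mirror N y a) k ≡ a k
      by zero e _ = trans (mirror-zero (mirror N y a) k e) (sym (zeros k e))
      by (suc (suc zero)) e _ = trans (mirror-two (mirror N y a) k e) (sym (twos k e))
      by (suc (suc (suc _))) e (s≤s (s≤s ()))
      by (suc zero) e _ = at-inverted (code-first Y k (≤-reflexive (sym e)))
        where
        at-inverted : (∃ λ t → y (k ⊕ suc t) <ᶻ y k × (∀ u → u < t → y k <ᶻ y (k ⊕ suc u))) → mirror N y (mirror N y a) k ≡ a k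
        at-inverted (t , lt , _) = trans (mirror-one (mirror N y a) k t e lt) (decide (a k) refl)
          where
          j = k ⊕ suc t
          r = Sn (K N y j) N
          s = chosen N y a j
          g = λ u → a (k⊖ j u)
          closed : ∀ t u → u < t → K N y j t ≡ 1 → g t ≡ true → K N y j u ≡ 1 → g u ≡ true
          closed t u u<t Kt gt _ with m≤n⇒∃[o]m+o≡n u<t
          ... | v , uv = subst (λ z → a z ≡ true) there' (ones (k⊖ j t) t v gt (proj₁ (K-true j t Kt)) (proj₂ (K-true j t Kt)) (≤-trans (s≤s (m≤n+m v u)) (≤-reflexive uv)))
            where
            there' : k⊖ j t ⊕ suc v ≡ k⊖ j u
            there' = trans (sym (⊕⊖ (k⊖ j t ⊕ suc v) (suc u))) (cong (_-ᶻ + suc u) (trans (⊕-⊕ (k⊖ j t) (suc v) (suc u))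
              (trans (cong (λ z → k⊖ j t ⊕ suc z) (trans (+-comm v (suc u)) uv)) (⊖⊕ j (suc t)))))
          t<N = <-trans (n<1+n t) (inverted⇒< Y k (suc t) lt)
          rank = Sn-initial (K N y j) g N (K≤1 j) closed t t<N (K-at k t e lt)
          gt≡ : g t ≡ a k
          gt≡ = cong a (⊕⊖ k (suc t))
          decide : ∀ b → a k ≡ b → nonzero (Q N y (mirror N y a) j t) ≡ b
          decide true ak = cong nonzero ([]-yes (_ <? _) (subst (λ z → Sn (K N y j) t + z < r) (sym (chosen-mirror a j))
            (ℕP.<-≤-trans (ℕP.+-monoˡ-< (r ∸ s) (proj₁ rank (trans gt≡ ak))) (≤-reflexive (m+[n∸m]≡n (chosen≤ a j))))))
          decide false ak = cong nonzero ([]-no (_ <? _) (λ lt' → <⇒≱ lt' (subst (λ z → r ≤ Sn (K N y j) t + z) (sym (chosen-mirror a j))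
            (≤-trans (≤-reflexive (sym (m+[n∸m]≡n (chosen≤ a j)))) (+-monoˡ-≤ (r ∸ s) (proj₂ rank (trans gt≡ ak)))))))

    private
      sh-⊖ : ∀ j t → k⊖ (sh j) t ≡ sh (k⊖ j t)
      sh-⊖ j t = lem j (+ n) (+ suc t)
        where
        lem : ∀ j n t → (j +ᶻ n) -ᶻ t ≡ (j -ᶻ t) +ᶻ n
        lem = solve-∀

      one-sh : ∀ k → one? N y (sh k) ≡ one? N y k
      one-sh k = cong (λ z → [ z ≟ 1 ]) (code-sh Y k)

      K-sh : ∀ j t → K N y (sh j) t ≡ K N y j t
      K-sh j t = trans (cong (λ z → one? N y z * β y z (sh j)) (sh-⊖ j t)) (cong₂ _*_ (one-sh (k⊖ j t)) (β-sh Y (k⊖ j t) j))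

      -- Counts the pairs of a position of code 1 and its inverted position, once by the former and
      -- once by the latter. For a fixed distance the two sums differ by a shift of the period.
      regroup : ∀ (X : ℤ → ℕ → ℕ) → (∀ j t → X (sh j) t ≡ X j t) →
        S (λ k → one? N y k * Sn (λ t → β y k (k ⊕ suc t) * X (k ⊕ suc t) t) N) (+ 0) n ≡ S (λ j → Sn (λ t → K N y j t * X j t) N) (+ 0) n
      regroup X X-sh = trans (S-cong (λ k → Sn-scale (one? N y k) N (λ t → K-term k t)) (+ 0) n)
        (trans (Sn-S-swap (λ k t → F t (k ⊕ suc t)) (+ 0) n N) (trans (Sn-cong N (λ t _ → shifted t)) (sym (Sn-S-swap (λ j t → F t j) (+ 0) n N))))
        where
        F : ℕ → ℤ → ℕ
        F t j = K N y j t * X j t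
        K-term : ∀ k t → one? N y k * (β y k (k ⊕ suc t) * X (k ⊕ suc t) t) ≡ F t (k ⊕ suc t)
        K-term k t = trans (sym (ℕP.*-assoc (one? N y k) _ _)) (cong (_* X (k ⊕ suc t) t) (sym (K-⊕ k t)))
        Sn-scale : ∀ m N {f g : ℕ → ℕ} → (∀ t → m * f t ≡ g t) → m * Sn f N ≡ Sn g N
        Sn-scale m zero h = ℕP.*-zeroʳ m
        Sn-scale m (suc N) {f} h = trans (ℕP.*-distribˡ-+ m (Sn f N) (f N)) (cong₂ _+_ (Sn-scale m N h) (h N))
        S-shift : ∀ f s p M → S (λ k → f (k ⊕ s)) p M ≡ S f (p ⊕ s) M
        S-shift f s p zero = refl
        S-shift f s p (suc M) = cong (f (p ⊕ s) ℕ.+_) (trans (S-shift f s (up p) M) (cong (λ z → S f z M) (sym (⊕-up p s))))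
        shifted : ∀ t → S (λ k → F t (k ⊕ suc t)) (+ 0) n ≡ S (F t) (+ 0) n
        shifted t = trans (S-shift (F t) (suc t) (+ 0) n) (S-per (F t) (λ j → cong₂ _*_ (K-sh j t) (X-sh j t)) _ (+ 0))

    module _ (a : ℤ → Bool) (a-sh : ∀ k → a (sh k) ≡ a k) where
      private
        chosen-sh : ∀ j → chosen N y a (sh j) ≡ chosen N y a j
        chosen-sh j = Sn-cong N (λ t _ → cong₂ _*_ (K-sh j t) (cong bit (trans (cong a (sh-⊖ j t)) (a-sh (k⊖ j t)))))

        Q-sh : ∀ j t → Q N y a (sh j) t ≡ Q N y a j t
        Q-sh j t = cong₂ (λ u v → [ u <? v ]) (cong₂ _+_ (Sn-cong t (λ u _ → K-sh j u)) (chosen-sh j)) (Sn-cong N (λ u _ → K-sh j u))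

      mirror-sh : ∀ k → mirror N y a (sh k) ≡ mirror N y a k
      mirror-sh k = cong₂ pick (code-sh Y k) (Sn-cong N (λ t _ → trans (cong (λ z → β y (sh k) z * Q N y a z t) (⊕-sh k (suc t))) (cong₂ _*_ (β-sh Y k (k ⊕ suc t)) (Q-sh (k ⊕ suc t) t))))

      private
        two? : ℤ → ℕ
        two? k = [ c k ≟ 2 ]

        weight : ∀ b m → m ≤ 2 → (m ≡ 2 → b ≡ true) → (m ≡ 0 → b ≡ false) → bit b ≡ [ m ≟ 2 ] + [ m ≟ 1 ] * (m * bit b)
        weight b zero _ _ z = cong bit (z refl)
        weight b (suc zero) _ _ _ = sym (trans (+-identityʳ _) (+-identityʳ _))
        weight b (suc (suc zero)) _ t _ = cong bit (t refl)
        weight b (suc (suc (suc _))) (s≤s (s≤s ())) _ _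

        code-weight : ∀ m → m ≤ 2 → m ≡ [ m ≟ 2 ] + [ m ≟ 2 ] + [ m ≟ 1 ] * (m * 1)
        code-weight zero _ = refl
        code-weight (suc zero) _ = refl
        code-weight (suc (suc zero)) _ = refl
        code-weight (suc (suc (suc _))) (s≤s (s≤s ()))

        Sn-const : ∀ f x M → Sn (λ t → f t * x) M ≡ Sn f M * x
        Sn-const f x zero = refl
        Sn-const f x (suc M) = trans (cong (ℕ._+ f M * x) (Sn-const f x M)) (sym (ℕP.*-distribʳ-+ x (Sn f M) (f M)))

        count-by : ∀ b → (∀ k → b (sh k) ≡ b k) → S (λ k → one? N y k * (c k * bit (b k))) (+ 0) n ≡ S (chosen N y b) (+ 0) n
        count-by b b-sh = trans (S-cong (λ k → cong (one? N y k *_) (trans (cong (_* bit (b k)) (code-Sn k))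
            (trans (sym (Sn-const (λ t → β y k (k ⊕ suc t)) (bit (b k)) N)) (Sn-cong N (λ t _ → cong (λ z → β y k (k ⊕ suc t) * bit (b z)) (sym (⊕⊖ k (suc t)))))))) (+ 0) n)
          (regroup (λ j t → bit (b (k⊖ j t))) (λ j t → cong bit (trans (cong b (sh-⊖ j t)) (b-sh (k⊖ j t)))))

      -- An admissible set has as many elements per period as there are entries 2 plus the numbers
      -- chosen from the classes. The numbers s and r - s add up to r, and the code sums to twice
      -- the number of entries 2 plus the class sizes.
      mirror-count : Admissible N y a → S (bit ∘ a) (+ 0) n + S (bit ∘ mirror N y a) (+ 0) n ≡ S c (+ 0) n
      mirror-count adm = trans (cong₂ _+_ (split a a-sh adm) (split (mirror N y a) mirror-sh (mirror-admissible a)))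
        (trans (lem (S two? (+ 0) n) (S (chosen N y a) (+ 0) n) (S (chosen N y (mirror N y a)) (+ 0) n))
          (trans (cong (S two? (+ 0) n + S two? (+ 0) n ℕ.+_) total) (sym c-split)))
        where
        lem : ∀ t x z → (t + x) + (t + z) ≡ (t + t) + (x + z)
        lem = solveℕ-∀
        split : ∀ b → (∀ k → b (sh k) ≡ b k) → Admissible N y b → S (bit ∘ b) (+ 0) n ≡ S two? (+ 0) n + S (chosen N y b) (+ 0) n
        split b b-sh adm = trans (S-cong (λ k → weight (b k) (c k) (c≤2 k) (Admissible.twos adm k) (Admissible.zeros adm k)) (+ 0) n)
          (trans (S-distrib-+ two? (λ k → one? N y k * (c k * bit (b k))) (+ 0) n) (cong (S two? (+ 0) n ℕ.+_) (count-by b b-sh)))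
        total : S (chosen N y a) (+ 0) n + S (chosen N y (mirror N y a)) (+ 0) n ≡ S (λ j → Sn (K N y j) N) (+ 0) n
        total = trans (sym (S-distrib-+ (chosen N y a) (chosen N y (mirror N y a)) (+ 0) n))
          (S-cong (λ j → trans (cong (chosen N y a j ℕ.+_) (chosen-mirror a j)) (m+[n∸m]≡n (chosen≤ a j))) (+ 0) n)
        c-split : S c (+ 0) n ≡ (S two? (+ 0) n + S two? (+ 0) n) + S (λ j → Sn (K N y j) N) (+ 0) n
        c-split = trans (S-cong (λ k → code-weight (c k) (c≤2 k)) (+ 0) n)
          (trans (S-distrib-+ (λ k → two? k + two? k) (λ k → one? N y k * (c k * 1)) (+ 0) n)
            (cong₂ _+_ (S-distrib-+ two? two? (+ 0) n) (trans (count-by (λ _ → true) (λ _ → refl)) (S-cong (λ j → Sn-cong N (λ t _ → ℕP.*-identityʳ _)) (+ 0) n))))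

-- Integer-valued sums over windows.

SZ : (ℤ → ℤ) → ℤ → ℕ → ℤ
SZ f p zero = + 0
SZ f p (suc N) = f p +ᶻ SZ f (up p) N

SZ-cong< : ∀ {f g} p N → (∀ t → t < N → f (p ⊕ t) ≡ g (p ⊕ t)) → SZ f p N ≡ SZ g p N
SZ-cong< p zero h = refl
SZ-cong< p (suc N) h = cong₂ _+ᶻ_ (h 0 (s≤s z≤n)) (SZ-cong< (up p) N (λ t t<N → h (suc t) (s≤s t<N)))

SZ-snoc : ∀ f p N → SZ f p (suc N) ≡ SZ f p N +ᶻ f (p ⊕ N)
SZ-snoc f p zero = ℤP.+-comm (f p) (+ 0)
SZ-snoc f p (suc N) = trans (cong (f p +ᶻ_) (SZ-snoc f (up p) N)) (sym (ℤP.+-assoc (f p) _ _))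

SZ-sub : ∀ f g p N → SZ (λ k → f k -ᶻ g k) p N ≡ SZ f p N -ᶻ SZ g p N
SZ-sub f g p zero = refl
SZ-sub f g p (suc N) = trans (cong (f p -ᶻ g p +ᶻ_) (SZ-sub f g (up p) N)) (lem (f p) (g p) _ _)
  where
  lem : ∀ a b c d → (a -ᶻ b) +ᶻ (c -ᶻ d) ≡ (a +ᶻ c) -ᶻ (b +ᶻ d)
  lem = solve-∀

SZ-const : ∀ c p N → SZ (λ _ → c) p N ≡ + N *ᶻ c
SZ-const c p zero = sym (ℤP.*-zeroˡ c)
SZ-const c p (suc N) = trans (cong (c +ᶻ_) (SZ-const c (up p) N)) (lem c (+ N))
  where
  lem : ∀ c m → c +ᶻ m *ᶻ c ≡ (+ 1 +ᶻ m) *ᶻ c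
  lem = solve-∀

-- Words as group elements; the size of the code is the Coxeter length.

module Group (n : ℕ) .{{nz : NonZero n}} (3≤n : 3 ≤ n) where

  open Residues n
  open Codes n
  open Moves n
  open Words n 3≤n

  infix 4 _≈_
  _≈_ : List ℕ → List ℕ → Set
  V ≈ W = ∀ k → app V k ≡ app W k

  ++-≈ : ∀ {V V' W W'} → V ≈ V' → W ≈ W' → V ++ W ≈ V' ++ W'
  ++-≈ {V} {V'} {W} {W'} h h' k = trans (app-++ V W k) (trans (h' (app V k)) (trans (cong (app W') (h k)) (sym (app-++ V' W' k))))

  reverse-≈ : ∀ {V W} → V ≈ W → reverse V ≈ reverse W
  reverse-≈ {V} {W} h k = app-injective V (trans (app-reverse' V k) (trans (sym (app-reverse' W k)) (sym (h _))))

  ≈-sym : ∀ {V W} → V ≈ W → W ≈ V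
  ≈-sym h k = sym (h k)

  ≈-trans : ∀ {U V W} → U ≈ V → V ≈ W → U ≈ W
  ≈-trans h h' k = trans (h k) (h' k)

  ≡⇒≈ : ∀ {V W} → V ≡ W → V ≈ W
  ≡⇒≈ refl k = refl

  cancel-reverse : ∀ V W → reverse V ++ (V ++ W) ≈ W
  cancel-reverse V W k = trans (app-++ (reverse V) (V ++ W) k) (trans (app-++ V W _) (cong (app W) (app-reverse' V k)))

  cancel-reverse' : ∀ V W → V ++ (reverse V ++ W) ≈ W
  cancel-reverse' V W k = trans (app-++ V (reverse V ++ W) k) (trans (app-++ (reverse V) W _) (cong (app W) (app-reverse V k)))

  act : List ℕ → ℤ → ℤ
  act W = app (reverse W)

  act-∷ : ∀ i W k → act (i ∷ W) k ≡ sAt n i (act W k)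
  act-∷ i W k = trans (cong (λ V → app V k) (ListP.unfold-reverse i W)) (app-++ (reverse W) (i ∷ []) k)

  lookup-wordElt : ∀ W i → lookup (wordElt n W) i ≡ act W (pos i)
  lookup-wordElt [] i = VecP.lookup∘tabulate pos i
  lookup-wordElt (j ∷ W) i = trans (VecP.lookup-map i (sAt n j) (wordElt n W)) (trans (cong (sAt n j) (lookup-wordElt W i)) (sym (act-∷ j W (pos i))))

  pos-⊕ : ∀ {m} (i : Fin m) → pos i ≡ + 1 ⊕ toℕ i
  pos-⊕ i = sym (⊕-+ (+ 1) (toℕ i))

  reach-pos : ∀ k → ∃ λ (i : Fin n) → ∃ λ q → k ≡ pos i +ᶻ q *ᶻ + n
  reach-pos k with reach (+ 1) k
  ... | t , t<n , q , e = fromℕ< t<n , q , trans e (cong (_+ᶻ q *ᶻ + n) (trans (cong (+ 1 ⊕_) (sym (FinP.toℕ-fromℕ< t<n))) (sym (pos-⊕ (fromℕ< t<n)))))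

  wordElt⇒≈ : ∀ V W → wordElt n V ≡ wordElt n W → V ≈ W
  wordElt⇒≈ V W e k = trans (cong (app V) (trans (sym (app-reverse W k)) (sym (same (app W k))))) (app-reverse' V (app W k))
    where
    same : ∀ k → act V k ≡ act W k
    same k with reach-pos k
    ... | i , q , refl = trans (app-mult (reverse V) (pos i) q) (trans (cong (_+ᶻ q *ᶻ + n)
            (trans (sym (lookup-wordElt V i)) (trans (cong (λ w → lookup w i) e) (lookup-wordElt W i)))) (sym (app-mult (reverse W) (pos i) q)))

  lookup-ext : ∀ {A : Set} {m} (u v : Vec A m) → (∀ i → lookup u i ≡ lookup v i) → u ≡ v
  lookup-ext u v h = trans (sym (VecP.tabulate∘lookup u)) (trans (VecP.tabulate-cong h) (VecP.tabulate∘lookup v))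

  ≈⇒wordElt : ∀ V W → V ≈ W → wordElt n V ≡ wordElt n W
  ≈⇒wordElt V W h = lookup-ext _ _ (λ i → trans (lookup-wordElt V i) (trans (reverse-≈ {V} {W} h (pos i)) (sym (lookup-wordElt W i))))

  wordAct-++ : ∀ V W → wordAct n V (wordElt n W) ≡ wordElt n (V ++ W)
  wordAct-++ [] W = refl
  wordAct-++ (i ∷ V) W = cong (leftMul n i) (wordAct-++ V W)

  private
    SZ-per : ∀ f → (∀ k → f (sh k) ≡ f k) → ∀ p t → SZ f (p ⊕ t) n ≡ SZ f p n
    SZ-per f f-per p zero = refl
    SZ-per f f-per p (suc t) = trans (SZ-per f f-per (up p) t) (+ᶻ-cancelˡ (f p) (trans (SZ-snoc f p n) (trans (cong (SZ f p n +ᶻ_) (trans (cong f (⊕n p)) (f-per p))) (ℤP.+-comm _ (f p)))))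

    SZ-per' : ∀ f → (∀ k → f (sh k) ≡ f k) → ∀ p q → SZ f p n ≡ SZ f q n
    SZ-per' f f-per p q = trans (all p) (sym (all q))
      where
      all : ∀ p → SZ f p n ≡ SZ f (+ 0) n
      all (+ m) = trans (cong (λ z → SZ f z n) (sym (trans (⊕-+ (+ 0) m) (ℤP.+-identityˡ (+ m))))) (SZ-per f f-per (+ 0) m)
      all -[1+ m ] = trans (sym (SZ-per f f-per -[1+ m ] (suc m))) (cong (λ z → SZ f z n) (⊖⊕ (+ 0) (suc m)))

  displacement : List ℕ → ℤ → ℤ
  displacement W k = app W k -ᶻ k

  displacement-sh : ∀ W k → displacement W (sh k) ≡ displacement W k
  displacement-sh W k = trans (cong (_-ᶻ sh k) (app-sh W k)) (lem (app W k) k (+ n))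
    where
    lem : ∀ a b m → (a +ᶻ m) -ᶻ (b +ᶻ m) ≡ a -ᶻ b
    lem = solve-∀

  -- Summed over the window starting at i, s_i only exchanges the first two entries.
  SZ-displacement : ∀ W p → SZ (displacement W) p n ≡ + 0
  SZ-displacement [] p = trans (SZ-cong< p n (λ t _ → lem (p ⊕ t))) (trans (SZ-const (+ 0) p n) (ℤP.*-zeroʳ (+ n)))
    where
    lem : ∀ k → k -ᶻ k ≡ + 0
    lem = solve-∀
  SZ-displacement (i ∷ W) p = trans (SZ-per' _ (displacement-sh (i ∷ W)) p (+ i)) (trans (swap n refl) (SZ-displacement W (+ i)))
    where
    f = app W
    swap : ∀ m → m ≡ n → SZ (displacement (i ∷ W)) (+ i) m ≡ SZ (displacement W) (+ i) m
    swap zero e = refl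
    swap (suc zero) e = ⊥-elim (<⇒≱ 1<n (≤-reflexive (sym e)))
    swap (suc (suc m)) e = trans (sym (ℤP.+-assoc (displacement (i ∷ W) (+ i)) _ _)) (trans (cong₂ _+ᶻ_
        (trans (cong₂ (λ u v → (f u -ᶻ + i) +ᶻ (f v -ᶻ up (+ i))) (sAt-in i (+ i) refl) (sAt-after i (+ i) refl)) (lem (f (+ i)) (f (up (+ i))) (+ i) (up (+ i))))
        (SZ-cong< (up (up (+ i))) m (λ t t<m → cong (λ z → f z -ᶻ (up (up (+ i)) ⊕ t)) (fixed t (subst (suc (suc t) <_) e (s≤s (s≤s t<m))) ))))
      (ℤP.+-assoc (displacement W (+ i)) _ _))
      where
      lem : ∀ a b k l → (b -ᶻ k) +ᶻ (a -ᶻ l) ≡ (a -ᶻ k) +ᶻ (b -ᶻ l)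
      lem = solve-∀
      no-return : ∀ t → suc t < n → res (+ i ⊕ suc t) ≢ i ℕ.% n
      no-return t lt e with window-injective (+ i) lt e
      ... | ()
      fixed : ∀ t → suc (suc t) < n → sAt n i (+ i ⊕ suc (suc t)) ≡ + i ⊕ suc (suc t)
      fixed t lt = subst (λ z → sAt n i z ≡ z) (⊕-up (+ i) (suc t)) (sAt-else i (+ i ⊕ suc t)
        (λ e → no-return (suc t) lt (trans (cong res (sym (⊕-up (+ i) (suc t)))) e)) (no-return t (<-trans (n<1+n _) lt)))

  wordElt-affine : ∀ W → IsAffPerm n (wordElt n W)
  wordElt-affine W = distinct , sums
    where
    distinct : ∀ i j → lookup (wordElt n W) i %ℕ n ≡ lookup (wordElt n W) j %ℕ n → i ≡ j
    distinct i j e with res-diff {act W (pos i)} {act W (pos j)} (trans (cong res (sym (lookup-wordElt W i))) (trans e (cong res (lookup-wordElt W j))))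
    ... | q , e' = FinP.toℕ-injective (small (toℕ i) (toℕ j) (FinP.toℕ<n i) (FinP.toℕ<n j)
            (trans (cong res (app-injective (reverse W) (trans e' (sym (app-mult (reverse W) (pos j) q))))) (res-mult (pos j) q)))
      where
      small : ∀ a b → a < n → b < n → res (+ suc a) ≡ res (+ suc b) → a ≡ b
      small a b a<n b<n e = trans (sym (res-small a<n)) (trans (res-dn {+ a} {+ b} (trans (cong (res ∘ +_) (+-comm a 1)) (trans e (cong (res ∘ +_) (+-comm 1 b))))) (res-small b<n))
    fold-SZ : ∀ {m} (v : Vec ℤ m) f p → (∀ i → lookup v i ≡ f (p ⊕ toℕ i)) → Vec.foldr _ _+ᶻ_ (+ 0) v ≡ SZ f p m
    fold-SZ [] f p h = refl
    fold-SZ (x ∷ v) f p h = cong₂ _+ᶻ_ (h Fin.zero) (fold-SZ v f (up p) (λ i → h (Fin.suc i)))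
    sums : Vec.foldr _ _+ᶻ_ (+ 0) (wordElt n W) ≡ Vec.foldr _ _+ᶻ_ (+ 0) (tabulate (pos {n}))
    sums = trans (fold-SZ (wordElt n W) (act W) (+ 1) (λ i → trans (lookup-wordElt W i) (cong (act W) (pos-⊕ i))))
      (trans (lem _ _ (trans (sym (SZ-sub (act W) id (+ 1) n)) (SZ-displacement (reverse W) (+ 1))))
        (sym (fold-SZ (tabulate (pos {n})) id (+ 1) (λ i → trans (VecP.lookup∘tabulate (pos {n}) i) (pos-⊕ i)))))
      where
      lem : ∀ a b → a -ᶻ b ≡ + 0 → a ≡ b
      lem a b = ℤP.i-j≡0⇒i≡j a b

  -- The number `app W j` is congruent to a position of the window, so the search in `invAt`
  -- succeeds and its default value is never returned; any position it stops at yields the preimage.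
  inv-wordElt : ∀ W → inv n (wordElt n W) ≡ wordElt n (reverse W)
  inv-wordElt W = lookup-ext _ _ (λ i → trans (VecP.lookup∘tabulate _ i) (trans (correct (pos i) (List.allFin n) (found (pos i)))
      (trans (cong (λ V → app V (pos i)) (sym (ListP.reverse-involutive W))) (sym (lookup-wordElt (reverse W) i)))))
    where
    w = wordElt n W
    found : ∀ j → ∃ λ r → r ∈ List.allFin n × (lookup w r -ᶻ j) %ℕ n ≡ 0
    found j with reach-pos (app W j)
    ... | r , q , e = r , MemP.∈-allFin r , trans (cong res (trans (cong (_-ᶻ j) (trans (lookup-wordElt W r) (trans (sym shift) (cong (_-ᶻ q *ᶻ + n) (app-reverse W j))))) (lem j (q *ᶻ + n))))
            (trans (cong res (sym (trans (ℤP.+-identityˡ _) (sym (ℤP.neg-distribˡ-* q (+ n)))))) (trans (res-mult (+ 0) (negᶻ q)) (res-small (<-trans (s≤s z≤n) 1<n))))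
      where
      lem : ∀ j x → (j -ᶻ x) -ᶻ j ≡ negᶻ x
      lem = solve-∀
      lem' : ∀ a x → (a +ᶻ x) -ᶻ x ≡ a
      lem' = solve-∀
      shift : app (reverse W) (app W j) -ᶻ q *ᶻ + n ≡ act W (pos r)
      shift = trans (cong (λ k → app (reverse W) k -ᶻ q *ᶻ + n) e) (trans (cong (_-ᶻ q *ᶻ + n) (app-mult (reverse W) (pos r) q)) (lem' _ (q *ᶻ + n)))
    correct : ∀ j rs → (∃ λ r → r ∈ rs × (lookup w r -ᶻ j) %ℕ n ≡ 0) → invAt n w j rs ≡ app W j
    correct j (r ∷ rs) (r' , r'∈ , e) with ((lookup w r -ᶻ j) %ℕ n) ≟ 0
    ... | yes z = sym (trans (cong (app W) (trans (sym at-j) (sym (app-mult' (pos r) q)))) (app-reverse' W _))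
      where
      q = (lookup w r -ᶻ j) /ℕ n
      lem : ∀ a j x → a -ᶻ j ≡ + 0 +ᶻ x → a -ᶻ x ≡ j
      lem a j x e = trans (cong (a -ᶻ_) (trans (sym (ℤP.+-identityˡ x)) (sym e))) (l a j)
        where
        l : ∀ a j → a -ᶻ (a -ᶻ j) ≡ j
        l = solve-∀
      at-j : act W (pos r) -ᶻ q *ᶻ + n ≡ j
      at-j = trans (cong (_-ᶻ q *ᶻ + n) (sym (lookup-wordElt W r))) (lem (lookup w r) j (q *ᶻ + n)
        (trans (a≡a%ℕn+[a/ℕn]*n (lookup w r -ᶻ j) n) (cong (λ z → + z +ᶻ q *ᶻ + n) z)))
      app-mult' : ∀ k q → act W (k -ᶻ q *ᶻ + n) ≡ act W k -ᶻ q *ᶻ + n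
      app-mult' k q = trans (cong (λ z → act W (k +ᶻ z)) (ℤP.neg-distribˡ-* q (+ n))) (trans (app-mult (reverse W) k (negᶻ q)) (cong (act W k +ᶻ_) (sym (ℤP.neg-distribˡ-* q (+ n)))))
    correct j (r ∷ rs) (r' , here refl , e) | no ¬z = ⊥-elim (¬z e)
    correct j (r ∷ rs) (r' , there r'∈ , e) | no ¬z = correct j rs (r' , r'∈ , e)

  -- As `app W` is the inverse of the element w of `W`, this is c(w⁻¹), the code from which μ(w) is
  -- formed.
  cd : List ℕ → ℤ → ℕ
  cd W = code' (bound W) (app W)

  cd-N : ∀ W N → bound W ≤ N → ∀ k → code' N (app W) k ≡ cd W k
  cd-N W N le k = code-ext (affine W) N le k

  cd-sh : ∀ W k → cd W (sh k) ≡ cd W k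
  cd-sh W = code-sh (affine W)

  cd-≈ : ∀ V W → V ≈ W → ∀ k → cd V k ≡ cd W k
  cd-≈ V W h k = trans (sym (cd-N V N (m≤m⊔n (bound V) (bound W)) k)) (trans (code'-≗ N h k) (cd-N W N (m≤n⊔m (bound V) (bound W)) k))
    where N = bound V ⊔ bound W

  siz : List ℕ → ℕ
  siz W = S (cd W) (+ 0) n

  par : ℕ → List ℕ → ℕ
  par j W = S (λ k → j ⊓ cd W k) (+ 0) n

  siz-≈ : ∀ V W → V ≈ W → siz V ≡ siz W
  siz-≈ V W h = S-cong (cd-≈ V W h) (+ 0) n

  par-≈ : ∀ j V W → V ≈ W → par j V ≡ par j W
  par-≈ j V W h = S-cong (λ k → cong (j ⊓_) (cd-≈ V W h k)) (+ 0) n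

  -- The two words come with different bounds; the results on moves are applied at the maximum and
  -- translated back by `cd-N`.
  module Step {a d e} (M : Move a d e) (W W' : List ℕ) (h : ∀ k → app W' k ≡ app W (e k)) where
    private
      N = bound W ⊔ bound W'
      X = affine≤ W N (m≤m⊔n (bound W) (bound W'))
      Y = affine≤ W' N (m≤n⊔m (bound W) (bound W'))
      cX : ∀ k → code' N (app W) k ≡ cd W k
      cX = cd-N W N (m≤m⊔n (bound W) (bound W'))
      cY : ∀ k → code' N (app W') k ≡ cd W' k
      cY = cd-N W' N (m≤n⊔m (bound W) (bound W'))
      sX = S-cong cX (+ 0) n
      sY = S-cong cY (+ 0) n
      pX = λ j → S-cong (λ k → cong (j ⊓_) (cX k)) (+ 0) n
      pY = λ j → S-cong (λ k → cong (j ⊓_) (cY k)) (+ 0) n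

    cardM : ℕ
    cardM = S (bit ∘ a) (+ 0) n

    cd-valid : Valid M (app W') → ∀ k → cd W' k ≡ cd W (e k) + bit (a k)
    cd-valid V k = trans (sym (cY k)) (trans (code-valid M X Y h V k) (cong (ℕ._+ bit (a k)) (cX (e k))))

    siz-≤ : siz W' ≤ siz W + cardM
    siz-≤ = subst₂ _≤_ sY (cong (ℕ._+ cardM) sX) (size-≤ M X Y h)

    siz-valid : Valid M (app W') → siz W' ≡ siz W + cardM
    siz-valid V = trans (sym sY) (trans (size-valid M X Y h V) (cong (ℕ._+ cardM) sX))

    siz-tight : siz W + cardM ≤ siz W' → Valid M (app W')
    siz-tight le = size-tight M X Y h (subst₂ _≤_ (cong (ℕ._+ cardM) (sym sX)) (sym sY) le)

    par-mono : Valid M (app W') → ∀ j → par j W ≤ par j W'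
    par-mono V j = subst₂ _≤_ (pX j) (pY j) (partial-mono M X Y h V j)

    par-step : Valid M (app W') → ∀ j → par j W + cardM ≤ par (suc j) W'
    par-step V j = subst₂ _≤_ (cong (ℕ._+ cardM) (pX j)) (pY (suc j)) (partial-step M X Y h V j)

  letter-card : ∀ i → S (bit ∘ at i) (+ 0) n ≡ 1
  letter-card i = trans (S-per (bit ∘ at i) (λ k → cong (bit) (Move.a-sh (letter i) k)) (+ 0) (+ i)) (go n refl)
    where
    go : ∀ m → m ≡ n → S (bit ∘ at i) (+ i) m ≡ 1
    go zero e = ⊥-elim (<⇒≱ 1<n (subst (_≤ 1) e z≤n))
    go (suc m) e = cong₂ _+_ here' (S-zero _ _ m (λ t t<m → there' t (subst (suc t <_) e (s≤s t<m))))
      where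
      here' : bit (at i (+ i)) ≡ 1
      here' with at i (+ i) in eq
      ... | true = refl
      ... | false = ⊥-elim (at-false i (+ i) eq refl)
      there' : ∀ t → suc t < n → bit (at i (+ i ⊕ suc t)) ≡ 0
      there' t lt with at i (+ i ⊕ suc t) in eq
      ... | false = refl
      ... | true with window-injective (+ i) lt (at-true i (+ i ⊕ suc t) eq)
      ... | ()

  siz-∷ : ∀ i W → siz (i ∷ W) ≤ suc (siz W)
  siz-∷ i W = ≤-trans (Step.siz-≤ (letter i) W (i ∷ W) (λ k → refl)) (≤-reflexive (trans (cong (siz W ℕ.+_) (letter-card i)) (+-comm (siz W) 1)))

  siz-[] : siz [] ≡ 0
  siz-[] = S-zero (cd []) (+ 0) n (λ t _ → S-zero (β id (+ 0 ⊕ t)) (up (+ 0 ⊕ t)) 1 (λ u _ → []-no (_ ℤ.<? _) (λ lt → ℤP.<-asym lt (k<k⊕ (+ 0 ⊕ t) u))))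

  siz≤length : ∀ W → siz W ≤ length W
  siz≤length [] = ≤-reflexive siz-[]
  siz≤length (i ∷ W) = ≤-trans (siz-∷ i W) (s≤s (siz≤length W))

  -- Removes d_A on the left as a group element, whether or not lengths add up.
  back : Vec Bool n → List ℕ → List ℕ
  back A W = reverse (D A) ++ W

  app-back : ∀ A W k → app W k ≡ app (back A W) (app (D A) k)
  app-back A W k = sym (trans (app-++ (reverse (D A)) W _) (cong (app W) (app-reverse (D A) k)))

  back-≈ : ∀ A {V W} → V ≈ W → back A V ≈ back A W
  back-≈ A {V} {W} h = ++-≈ {reverse (D A)} {reverse (D A)} {V} {W} (λ _ → refl) h

  mk-cong : ∀ {a b} → (∀ k → a k ≡ b k) → mk a ≡ mk b
  mk-cong h = VecP.tabulate-cong (λ i → h (+ toℕ i))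

  abstract
    supp : List ℕ → Vec Bool n
    supp W = mk (λ k → nonzero (cd W k))

    mem-supp : ∀ W k → mem (supp W) k ≡ nonzero (cd W k)
    mem-supp W = mem-mk _ (λ k → cong nonzero (cd-sh W k))

    supp-cong : ∀ V W → (∀ k → cd V k ≡ cd W k) → supp V ≡ supp W
    supp-cong V W h = mk-cong (λ k → cong nonzero (h k))

  -- If no entry of the code vanished, every position would have a smaller entry behind it;
  -- iterating leads arbitrarily far to the right without ever rising, against the bound of the
  -- sequence.
  exists-zero : ∀ W → ∃ λ k → cd W k ≡ 0
  exists-zero W with FinP.any? (λ (i : Fin n) → cd W (+ toℕ i) ≟ 0)
  ... | yes (i , e) = + toℕ i , e
  ... | no none = ⊥-elim (ℤP.<-irrefl refl (ℤP.<-≤-trans (Aff.bnd (affine W) (+ 0) _ (proj₁ (proj₂ far))) (proj₂ (proj₂ far))))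
    where
    pos-code : ∀ k → 1 ≤ cd W k
    pos-code k = ℕP.n≢0⇒n>0 (λ e → none (resF k , trans (cong (λ r → cd W (+ r)) (toℕ-resF k)) (trans (sym (per-+res (cd W) (cd-sh W) k)) e)))
    descend : ∀ m → ∃ λ t → m ≤ t × app W (+ 0 ⊕ t) ≤ᶻ app W (+ 0)
    descend zero = 0 , z≤n , ℤP.≤-refl
    descend (suc m) with descend m
    ... | t , m≤t , le with code-first (affine W) (+ 0 ⊕ t) (pos-code (+ 0 ⊕ t))
    ... | u , lt , _ = t + suc u , ≤-trans (s≤s m≤t) (≤-trans (≤-reflexive (+-comm 1 t)) (+-monoʳ-≤ t (s≤s z≤n))) ,
          ℤP.≤-trans (ℤP.<⇒≤ (subst (λ z → app W z <ᶻ app W (+ 0 ⊕ t)) (⊕-⊕ (+ 0) t (suc u)) lt)) le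
    far = descend (bound W)

  supp-proper : ∀ W → cnt (supp W) < n
  supp-proper W with exists-zero W
  ... | k , e = missing⇒cnt (supp W) k (trans (mem-supp W k) (cong nonzero e))

  supp-valid : ∀ W → Valid (moveA (supp W) (supp-proper W)) (app W)
  supp-valid W = support-valid (moveA (supp W) (supp-proper W)) (affine W)
    (λ k e → pos-code (cd W k) (trans (sym (mem-supp W k)) e)) (λ k e → zero-code (cd W k) (trans (sym (mem-supp W k)) e))
    where
    pos-code : ∀ c → nonzero c ≡ true → 1 ≤ c
    pos-code (suc c) _ = s≤s z≤n
    zero-code : ∀ c → nonzero c ≡ false → c ≡ 0
    zero-code zero _ = refl

  module _ (W : List ℕ) where
    private
      A₀ = supp W
      module St = Step (moveA A₀ (supp-proper W)) (back A₀ W) W (app-back A₀ W)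

    siz-back-supp : siz W ≡ siz (back A₀ W) + cnt A₀
    siz-back-supp = trans (St.siz-valid (supp-valid W)) (cong (siz (back A₀ W) ℕ.+_) (cnt-mem A₀))

    cd-back-supp : ∀ k → cd W k ≡ cd (back A₀ W) (app (D A₀) k) + bit (nonzero (cd W k))
    cd-back-supp k = trans (St.cd-valid (supp-valid W) k) (cong (λ b → cd (back A₀ W) (app (D A₀) k) + bit b) (mem-supp W k))

    cnt-supp-zero : cnt A₀ ≡ 0 → ∀ k → cd W k ≡ 0
    cnt-supp-zero e k with cd W k in eq
    ... | zero = refl
    ... | suc _ = ⊥-elim (<⇒≱ (≤-trans (≤-reflexive (cong bit (sym (trans (mem-supp W k) (cong nonzero eq)))))
          (S-term (bit ∘ mem A₀) k n 0 (ℕ.>-nonZero⁻¹ n))) (≤-reflexive (trans (S-per (bit ∘ mem A₀) (λ k → cong bit (mem-sh A₀ k)) k (+ 0)) (trans (cnt-mem A₀) e))))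

  siz-zero : ∀ W → siz W ≡ 0 → ∀ k → cd W k ≡ 0
  siz-zero W e k = n≤0⇒n≡0 (≤-trans (S-term (cd W) k n 0 (ℕ.>-nonZero⁻¹ n)) (≤-reflexive (trans (S-per (cd W) (cd-sh W) k (+ 0)) e)))

  -- The sequence is strictly increasing and grows by n in n steps, so each step is 1 and the
  -- displacement is constant. By `SZ-displacement` the constant is 0.
  zero-code⇒id : ∀ W → (∀ k → cd W k ≡ 0) → W ≈ []
  zero-code⇒id W zeros k = ℤP.i-j≡0⇒i≡j _ _ (trans (const k) const-zero)
    where
    y = app W
    inc : ∀ k t → y k +ᶻ + t ≤ᶻ y (k ⊕ t)
    inc k zero = ℤP.≤-reflexive (ℤP.+-identityʳ (y k))
    inc k (suc t) = ℤP.≤-trans (ℤP.≤-trans (ℤP.≤-reflexive (sym (up-pos (y k) t)))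
      (ℤP.+-monoˡ-≤ (+ t) (ℤP.≤-trans (ℤP.≤-reflexive (ℤP.+-comm (y k) (+ 1))) (ℤP.i<j⇒suc[i]≤j (code-zero (affine W) k (zeros k) 0))))) (inc (up k) t)
    step : ∀ k → y (up k) ≡ up (y k)
    step k = ℤP.≤-antisym (upper n refl) (inc k 1)
      where
      upper : ∀ m → m ≡ n → y (up k) ≤ᶻ up (y k)
      upper zero e = ⊥-elim (<⇒≱ 1<n (subst (_≤ 1) e z≤n))
      upper (suc m) e = subst₂ _≤ᶻ_ (lem (y (up k)) (+ m)) (trans (cong (_-ᶻ + m) (trans (cong y (trans (cong (k ⊕_) e) (⊕n k))) (trans (app-sh W k) (cong (λ z → y k +ᶻ + z) (sym e))))) (lem' (y k) (+ m)))
        (ℤP.+-monoˡ-≤ (negᶻ (+ m)) (inc (up k) m))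
        where
        lem : ∀ a m → (a +ᶻ m) -ᶻ m ≡ a
        lem = solve-∀
        lem' : ∀ a m → (a +ᶻ (+ 1 +ᶻ m)) -ᶻ m ≡ a +ᶻ + 1
        lem' = solve-∀
    disp-up : ∀ k → displacement W (up k) ≡ displacement W k
    disp-up k = trans (cong (_-ᶻ up k) (step k)) (lem (y k) k)
      where
      lem : ∀ a b → (a +ᶻ + 1) -ᶻ (b +ᶻ + 1) ≡ a -ᶻ b
      lem = solve-∀
    disp-⊕ : ∀ k t → displacement W (k ⊕ t) ≡ displacement W k
    disp-⊕ k zero = refl
    disp-⊕ k (suc t) = trans (disp-⊕ (up k) t) (disp-up k)
    const : ∀ k → displacement W k ≡ displacement W (+ 0)
    const (+ m) = trans (cong (displacement W) (sym (trans (⊕-+ (+ 0) m) (ℤP.+-identityˡ (+ m))))) (disp-⊕ (+ 0) m)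
    const -[1+ m ] = trans (sym (disp-⊕ -[1+ m ] (suc m))) (cong (displacement W) (⊖⊕ (+ 0) (suc m)))
    const-zero : displacement W (+ 0) ≡ + 0
    const-zero with ℤP.i*j≡0⇒i≡0∨j≡0 (+ n) (trans (sym (trans (SZ-cong< (+ 0) n (λ t _ → const (+ 0 ⊕ t))) (SZ-const (displacement W (+ 0)) (+ 0) n))) (SZ-displacement W (+ 0)))
    ... | inj₂ z = z
    ... | inj₁ z = ⊥-elim (<⇒≱ 1<n (≤-trans (≤-reflexive (ℤP.+-injective z)) z≤n))

  rebuild : ∀ A W → D A ++ back A W ≈ W
  rebuild A W = cancel-reverse' (D A) W

  siz-back-≤ : ∀ W m c → cnt (supp W) ≡ suc c → siz W ≤ suc m → siz (back (supp W) W) ≤ m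
  siz-back-≤ W m c ec le = ≤-pred (≤-trans (≤-trans (≤-reflexive (+-comm 1 _)) (+-monoʳ-≤ _ (s≤s z≤n)))
    (≤-trans (≤-reflexive (trans (cong (siz (back (supp W) W) ℕ.+_) (sym ec)) (sym (siz-back-supp W)))) le))

  siz≢0 : ∀ W c → cnt (supp W) ≡ suc c → ¬ siz W ≤ 0
  siz≢0 W c ec le = <⇒≱ (≤-trans (≤-trans (s≤s z≤n) (m≤n+m (suc c) (siz (back (supp W) W))))
    (≤-reflexive (trans (cong (siz (back (supp W) W) ℕ.+_) (sym ec)) (sym (siz-back-supp W))))) le

  -- Removing the support of the code lowers the size by exactly the number of letters written down,
  -- until the code is zero and the identity remains.
  reduce : ∀ m W → siz W ≤ m → ∃ λ V → V ≈ W × length V ≡ siz W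
  reduce m W le = go m le (cnt (supp W)) refl
    where
    go : ∀ m → siz W ≤ m → ∀ c → cnt (supp W) ≡ c → ∃ λ V → V ≈ W × length V ≡ siz W
    go m le zero ec = [] , ≈-sym {W} {[]} (zero-code⇒id W (cnt-supp-zero W ec)) , sym (S-zero _ _ n (λ t _ → cnt-supp-zero W ec (+ 0 ⊕ t)))
    go zero le (suc c) ec = ⊥-elim (siz≢0 W c ec le)
    go (suc m) le (suc c) ec = extend (reduce m (back (supp W) W) (siz-back-≤ W m c ec le))
      where
      extend : (∃ λ V → V ≈ back (supp W) W × length V ≡ siz (back (supp W) W)) → ∃ λ V → V ≈ W × length V ≡ siz W
      extend (V , V≈ , eV) = D (supp W) ++ V , (λ k → trans (++-≈ {D (supp W)} {D (supp W)} {V} {back (supp W) W} (λ _ → refl) V≈ k) (rebuild (supp W) W k)) ,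
        trans (ListP.length-++ (D (supp W))) (trans (cong₂ _+_ (length-D (supp W) (supp-proper W)) eV) (trans (+-comm _ (siz (back (supp W) W))) (sym (siz-back-supp W))))

  -- Equal codes have equal supports, hence the same factor is removed, and by `cd-back-supp` the
  -- remainders again have equal codes.
  code-injective : ∀ m V W → siz V ≤ m → (∀ k → cd V k ≡ cd W k) → V ≈ W
  code-injective m V W le same = go m le (cnt (supp V)) refl
    where
    A = supp V
    rhs : Vec Bool n → ℤ → ℕ → ℕ
    rhs B k c = cd (back B W) (app (D B) k) + bit (nonzero c)
    step : ∀ k → cd (back A V) (app (D A) k) + bit (nonzero (cd V k)) ≡ rhs A k (cd V k)
    step k = trans (sym (cd-back-supp V k)) (trans (same k) (trans (cd-back-supp W k) (cong₂ (λ B c → rhs B k c) (sym (supp-cong V W same)) (sym (same k)))))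
    same' : ∀ k → cd (back A V) (app (D A) k) ≡ cd (back A W) (app (D A) k)
    same' k = +-cancelʳ-≡ (bit (nonzero (cd V k))) (cd (back A V) (app (D A) k)) (cd (back A W) (app (D A) k)) (step k)
    all-same : ∀ k → cd (back A V) k ≡ cd (back A W) k
    all-same k = subst (λ z → cd (back A V) z ≡ cd (back A W) z) (app-reverse' (D A) k) (same' (app (reverse (D A)) k))
    go : ∀ m → siz V ≤ m → ∀ c → cnt (supp V) ≡ c → V ≈ W
    go m le zero ec k = trans (zero-code⇒id V zV k) (sym (zero-code⇒id W (λ k → trans (sym (same k)) (zV k)) k))
      where zV = cnt-supp-zero V ec
    go zero le (suc c) ec k = ⊥-elim (siz≢0 V c ec le)
    go (suc m) le (suc c) ec k = trans (app-back A V k) (trans (code-injective m (back A V) (back A W) (siz-back-≤ V m c ec le)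
      all-same (app (D A) k)) (sym (app-back A W k)))

  private
    -- Minimality in `IsCoxeterLength` ranges over words with letters below n; taking letters modulo
    -- n brings any word into that range.
    app-mod : ∀ W k → app (map (ℕ._% n) W) k ≡ app W k
    app-mod [] k = refl
    app-mod (i ∷ W) k = trans (app-mod W _) (cong (app W) (sAt-mod k))
      where
      sAt-mod : ∀ k → sAt n (i ℕ.% n) k ≡ sAt n i k
      sAt-mod k = proj₂ (Move-unique (letter (i ℕ.% n)) M') k
        where
        at≡ : ∀ k → at i k ≡ at (i ℕ.% n) k
        at≡ k = cong (λ r → ⌊ res k ≟ r ⌋) (sym (ℕD.m%n%n≡m%n i n))
        module L = Move (letter i)
        M' : Move (at (i ℕ.% n)) (sAt n i) (sAt n i)
        M' = record
          { a-sh = λ k → trans (sym (at≡ (sh k))) (trans (L.a-sh k) (at≡ k)) ; e-sh = L.e-sh ; e∘d = L.e∘d ; d∘e = L.d∘e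
          ; run = L.run ; run-in = λ k e → L.run-in k (trans (at≡ k) e) ; run-out = λ k e → L.run-out k (trans (at≡ k) e)
          ; d-in = λ k e → L.d-in k (trans (at≡ k) e) ; d-out = λ k e → L.d-out k (trans (at≡ k) e) }

    all-mod : ∀ W → All (_< n) (map (ℕ._% n) W)
    all-mod [] = []
    all-mod (i ∷ W) = ℕD.m%n<n i n ∷ all-mod W

  module Length (len : Win n → ℕ) (isLen : IsCoxeterLength n len) where

    L : List ℕ → ℕ
    L W = len (wordElt n W)

    -- A word as short as the size exists by `reduce`, and no word is shorter because a letter
    -- raises the size by at most 1.
    L≡siz : ∀ W → L W ≡ siz W
    L≡siz W = ≤-antisym L≤ ≤L
      where
      short : (∃ λ V → V ≈ W × length V ≡ siz W) → L W ≤ siz W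
      short (V , V≈W , e) = ≤-trans (proj₂ (isLen (wordElt n W) (wordElt-affine W)) (map (ℕ._% n) V) (all-mod V)
        (≈⇒wordElt (map (ℕ._% n) V) W (λ k → trans (app-mod V k) (V≈W k)))) (≤-reflexive (trans (ListP.length-map (ℕ._% n) V) e))
      L≤ : L W ≤ siz W
      L≤ = short (reduce (siz W) W ≤-refl)
      long : (∃ λ V → All (_< n) V × wordElt n V ≡ wordElt n W × length V ≡ L W) → siz W ≤ L W
      long (V , _ , V≡ , e) = ≤-trans (≤-reflexive (sym (siz-≈ V W (wordElt⇒≈ V W V≡)))) (≤-trans (siz≤length V) (≤-reflexive e))
      ≤L : siz W ≤ L W
      ≤L = long (proj₁ (isLen (wordElt n W) (wordElt-affine W)))

    word-of : ∀ w → IsAffPerm n w → ∃ λ W → All (_< n) W × wordElt n W ≡ w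
    word-of w aff with proj₁ (isLen w aff)
    ... | W , all , e , _ = W , all , e

-- The involution on pairs of factors that exchanges their sizes.

module Pairs (n : ℕ) .{{nz : NonZero n}} (3≤n : 3 ≤ n) where

  open Residues n
  open Codes n
  open Moves n
  open Words n 3≤n
  open Group n 3≤n
  open Mirrors n

  siz-++ˡ : ∀ V W → siz (V ++ W) ≤ length V + siz W
  siz-++ˡ [] W = ≤-refl
  siz-++ˡ (i ∷ V) W = ≤-trans (siz-∷ i (V ++ W)) (s≤s (siz-++ˡ V W))

  -- Letters on the right do not act as moves of positions; replacing `V` by a word of length
  -- `siz V` leaves only `siz≤length` to use.
  siz-++ʳ : ∀ V W → siz (V ++ W) ≤ siz V + length W
  siz-++ʳ V W = go (reduce (siz V) V ≤-refl)
    where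
    go : (∃ λ U → U ≈ V × length U ≡ siz V) → siz (V ++ W) ≤ siz V + length W
    go (U , U≈V , e) = ≤-trans (≤-reflexive (sym (siz-≈ (U ++ W) (V ++ W) (++-≈ {U} {V} {W} {W} U≈V (λ _ → refl)))))
      (≤-trans (siz≤length (U ++ W)) (≤-reflexive (trans (ListP.length-++ U) (cong (ℕ._+ length W) e))))

  abstract
    -- One bound for all products of two factors, whose words have at most 2n letters. The mirror
    -- has to be formed at the same bound for a pair and for its image.
    N₀ : ℕ
    N₀ = suc ((n + n) + (n + n))

    bound≤N₀ : ∀ W → length W ≤ n + n → bound W ≤ N₀
    bound≤N₀ W le = s≤s (+-mono-≤ le le)

  Good : Vec Bool n → Vec Bool n → Set
  Good A B = (cnt A < n × cnt B < n) × siz (D A ++ D B) ≡ cnt A + cnt B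

  Good? : ∀ A B → Dec (Good A B)
  Good? A B = ((cnt A <? n) ×-dec (cnt B <? n)) ×-dec (siz (D A ++ D B) ≟ cnt A + cnt B)

  cd-[] : ∀ k → cd [] k ≡ 0
  cd-[] = siz-zero [] siz-[]

  cd-D : ∀ B → cnt B < n → siz (D B) ≡ cnt B → ∀ k → cd (D B) k ≡ bit (mem B k)
  cd-D B pB e k = trans (St.cd-valid (St.siz-tight (≤-reflexive (trans (cong₂ _+_ siz-[] (cnt-mem B)) (sym e)))) k) (cong (ℕ._+ bit (mem B k)) (cd-[] _))
    where module St = Step (moveA B pB) [] (D B) (λ _ → refl)

  -- With entries at most 1 the size equals the number of nonzero entries, so removing the support
  -- leaves size 0, which is the identity.
  supp-D : ∀ V → (∀ k → cd V k ≤ 1) → (∀ k → bit (mem (supp V) k) ≡ cd V k) × cnt (supp V) ≡ siz V × D (supp V) ≈ V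
  supp-D V c≤1 = bits , total , ≈V
    where
    bit-nonzero : ∀ m → m ≤ 1 → bit (nonzero m) ≡ m
    bit-nonzero zero _ = refl
    bit-nonzero (suc zero) _ = refl
    bit-nonzero (suc (suc _)) (s≤s ())
    bits : ∀ k → bit (mem (supp V) k) ≡ cd V k
    bits k = trans (cong bit (mem-supp V k)) (bit-nonzero _ (c≤1 k))
    total : cnt (supp V) ≡ siz V
    total = trans (sym (cnt-mem (supp V))) (S-cong bits (+ 0) n)
    rest : siz (back (supp V) V) ≡ 0
    rest = +-cancelʳ-≡ (cnt (supp V)) (siz (back (supp V) V)) 0 (trans (sym (siz-back-supp V)) (sym total))
    ≈V : D (supp V) ≈ V
    ≈V k = trans (sym (zero-code⇒id (back (supp V) V) (siz-zero (back (supp V) V) rest) (app (D (supp V)) k))) (sym (app-back (supp V) V k))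

  abstract
    swapA : Vec Bool n → Vec Bool n → Vec Bool n
    swapA A B = mk (mirror N₀ (app (D A ++ D B)) (mem A))

    swapA-def : ∀ A B → swapA A B ≡ mk (mirror N₀ (app (D A ++ D B)) (mem A))
    swapA-def A B = refl

    swapB : Vec Bool n → Vec Bool n → Vec Bool n
    swapB A B = supp (back (swapA A B) (D A ++ D B))

    swapB-def : ∀ A B → swapB A B ≡ supp (back (swapA A B) (D A ++ D B))
    swapB-def A B = refl

  Admissible-cong : ∀ {N y a a'} → (∀ k → a' k ≡ a k) → Admissible N y a → Admissible N y a'
  Admissible-cong h adm = record
    { twos = λ k e → trans (h k) (twos k e) ; zeros = λ k e → trans (h k) (zeros k e)
    ; ones = λ k t u ak ck lt u<t → trans (h _) (ones k t u (trans (sym (h k)) ak) ck lt u<t) }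
    where open Admissible adm

  module _ (A B : Vec Bool n) (good : Good A B) where
    private
      pA = proj₁ (proj₁ good)
      pB = proj₂ (proj₁ good)
      W = D A ++ D B
      y = app W

      lengthW : length W ≡ cnt A + cnt B
      lengthW = trans (ListP.length-++ (D A)) (cong₂ _+_ (length-D A pA) (length-D B pB))

      bW : bound W ≤ N₀
      bW = bound≤N₀ W (≤-trans (≤-reflexive lengthW) (+-mono-≤ (<⇒≤ pA) (<⇒≤ pB)))

      Y : Aff N₀ y
      Y = affine≤ W N₀ bW

      cW : ∀ k → code' N₀ y k ≡ cd W k
      cW = cd-N W N₀ bW

      module StA = Step (moveA A pA) (D B) W (app-++ (D A) (D B))

      validA : Valid (moveA A pA) y
      validA = StA.siz-tight (≤-trans (+-mono-≤ (≤-trans (siz≤length (D B)) (≤-reflexive (length-D B pB))) (≤-reflexive (cnt-mem A)))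
        (≤-reflexive (trans (+-comm (cnt B) (cnt A)) (sym (proj₂ good)))))

    siz-DB : siz (D B) ≡ cnt B
    siz-DB = +-cancelʳ-≡ (cnt A) _ _ (trans (cong (siz (D B) ℕ.+_) (sym (cnt-mem A))) (trans (sym (StA.siz-valid validA)) (trans (proj₂ good) (+-comm (cnt A) (cnt B)))))

    private
      bits : ∀ k → code' N₀ y k ≡ bit (mem B (app (D A) k)) + bit (mem A k)
      bits k = trans (cW k) (trans (StA.cd-valid validA k) (cong (ℕ._+ bit (mem A k)) (cd-D B pB siz-DB (app (D A) k))))

      c≤2 : ∀ k → code' N₀ y k ≤ 2
      c≤2 k = ≤-trans (≤-reflexive (bits k)) (+-mono-≤ (bit≤1 (mem B (app (D A) k))) (bit≤1 (mem A k)))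

      two-bits : ∀ b a → bit b + bit a ≡ 2 → a ≡ true
      two-bits true true _ = refl
      two-bits true false ()
      two-bits false true ()
      two-bits false false ()

      no-bits : ∀ b a → bit b + bit a ≡ 0 → a ≡ false
      no-bits _ false _ = refl
      no-bits true true ()
      no-bits false true ()

      admA : Admissible N₀ y (mem A)
      admA = valid⇒admissible Y c≤2 (moveA A pA) validA
        (λ k e → two-bits (mem B (app (D A) k)) (mem A k) (trans (sym (bits k)) e)) (λ k e → no-bits (mem B (app (D A) k)) (mem A k) (trans (sym (bits k)) e))

      A' = swapA A B
      B' = swapB A B
      V = back A' W

    mirror-back : ∀ k → mirror N₀ y (mirror N₀ y (mem A)) k ≡ mem A k
    mirror-back = mirror-involutive Y c≤2 (mem A) admA

    mem-swapA : ∀ k → mem (swapA A B) k ≡ mirror N₀ (app (D A ++ D B)) (mem A) k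
    mem-swapA k = trans (cong (λ X → mem X k) (swapA-def A B)) (mem-mk (mirror N₀ y (mem A)) (mirror-sh Y c≤2 (mem A) (mem-sh A)) k)

    private
      admA' : Admissible N₀ y (mem A')
      admA' = Admissible-cong mem-swapA (mirror-admissible Y c≤2 (mem A))

    properA' : cnt A' < n
    properA' = go (exists-zero W)
      where
      go : (∃ λ k → cd W k ≡ 0) → cnt A' < n
      go (k , e) = missing⇒cnt A' k (Admissible.zeros admA' k (trans (cW k) e))

    private
      validA' : Valid (moveA A' properA') y
      validA' = admissible⇒valid Y c≤2 (moveA A' properA') admA'

      module StA' = Step (moveA A' properA') V W (app-back A' W)

    -- By `mirror-count` the sizes of A and its mirror add up to the size of the product, which is
    -- |A| + |B|.
    cnt-swapA : cnt A' ≡ cnt B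
    cnt-swapA = ℕP.+-cancelˡ-≡ (cnt A) _ _ (trans (cong₂ _+_ (sym (cnt-mem A)) (trans (sym (cnt-mem A')) (S-cong (λ k → cong bit (mem-swapA k)) (+ 0) n)))
      (trans (mirror-count Y c≤2 (mem A) (mem-sh A) admA) (trans (S-cong cW (+ 0) n) (proj₂ good))))

    private
      -- The entries 2 all belong to the mirrored set, and removing that factor lowers them.
      V≤1 : ∀ k → cd V k ≤ 1
      V≤1 k = subst (λ z → cd V z ≤ 1) (app-reverse' (D A') k) (at-e (app (reverse (D A')) k))
        where
        low : ∀ m b v → m ≡ v + bit b → m ≤ 2 → (m ≡ 2 → b ≡ true) → v ≤ 1
        low m true v e le _ = +-cancelʳ-≤ 1 v 1 (≤-trans (≤-reflexive (sym e)) le)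
        low m false zero e le _ = z≤n
        low m false (suc zero) e le _ = s≤s z≤n
        low .(suc (suc v) + 0) false (suc (suc v)) refl (s≤s (s≤s le)) h = ⊥-elim (true≢false (sym (h (cong (suc ∘ suc) (n≤0⇒n≡0 le)))))
        at-e : ∀ k → cd V (app (D A') k) ≤ 1
        at-e k = low (cd W k) (mem A' k) _ (StA'.cd-valid validA' k) (subst (_≤ 2) (cW k) (c≤2 k)) (λ e → Admissible.twos admA' k (trans (cW k) e))

      sizV : siz V ≡ cnt A
      sizV = +-cancelʳ-≡ (cnt B) _ _ (trans (cong (siz V ℕ.+_) (trans (sym cnt-swapA) (sym (cnt-mem A')))) (trans (sym (StA'.siz-valid validA')) (proj₂ good)))

    cnt-swapB : cnt B' ≡ cnt A
    cnt-swapB = trans (cong cnt (swapB-def A B)) (trans (proj₁ (proj₂ (supp-D V V≤1))) sizV)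

    swap-≈ : D A' ++ D B' ≈ D A ++ D B
    swap-≈ = ≈-trans {D A' ++ D B'} {D A' ++ V} {W} (++-≈ {D A'} {D A'} {D B'} {V} (λ _ → refl) (≈-trans {D B'} {D (supp V)} {V} (≡⇒≈ (cong D (swapB-def A B))) (proj₂ (proj₂ (supp-D V V≤1))))) (rebuild A' W)

    swap-good : Good A' B'
    swap-good = (properA' , subst (_< n) (sym cnt-swapB) pA) ,
      trans (siz-≈ (D A' ++ D B') W swap-≈) (trans (proj₂ good) (trans (+-comm (cnt A) (cnt B)) (sym (cong₂ _+_ cnt-swapA cnt-swapB))))

  -- The swapped pair has the same product, so the second mirror is taken in the same sequence, up
  -- to pointwise equality.
  swapA-involutive : ∀ A B → Good A B → swapA (swapA A B) (swapB A B) ≡ A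
  swapA-involutive A B good = mem-ext _ _ (λ k → trans (mem-swapA (swapA A B) (swapB A B) (swap-good A B good) k)
    (trans (mirror-cong N₀ {app (D (swapA A B) ++ D (swapB A B))} {app (D A ++ D B)} {mem (swapA A B)} {mirror N₀ (app (D A ++ D B)) (mem A)} (swap-≈ A B good) (mem-swapA A B good) k) (mirror-back A B good k)))

  swapB-involutive : ∀ A B → Good A B → swapB (swapA A B) (swapB A B) ≡ B
  swapB-involutive A B good = trans (swapB-def A' B') (mem-ext _ _ (λ k → trans (mem-supp U k)
    (trans (cong nonzero (trans (cd-≈ U (D B) ≈DB k) (cd-D B (proj₂ (proj₁ good)) (siz-DB A B good) k))) (nonzero-bit (mem B k)))))
    where
    A' = swapA A B
    B' = swapB A B
    U = back (swapA A' B') (D A' ++ D B')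
    nonzero-bit : ∀ b → nonzero (bit b) ≡ b
    nonzero-bit true = refl
    nonzero-bit false = refl
    ≈DB : U ≈ D B
    ≈DB k = trans (cong (λ X → app (back X (D A' ++ D B')) k) (swapA-involutive A B good))
      (trans (back-≈ A {D A' ++ D B'} {D A ++ D B} (swap-≈ A B good) k) (cancel-reverse (D A) (D B) k))

  -- Pairs with improper sets or an unreduced product are fixed, which gives an involution of all
  -- pairs; in the sums it is applied to, their terms are zero.
  swapPair : Vec Bool n × Vec Bool n → Vec Bool n × Vec Bool n
  swapPair (A , B) = by (Good? A B)
    where
    by : Dec (Good A B) → Vec Bool n × Vec Bool n
    by (yes _) = swapA A B , swapB A B
    by (no _) = A , B

  swapPair-good : ∀ A B → Good A B → swapPair (A , B) ≡ (swapA A B , swapB A B)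
  swapPair-good A B g with Good? A B
  ... | yes _ = refl
  ... | no ¬g = ⊥-elim (¬g g)

  swapPair-bad : ∀ A B → ¬ Good A B → swapPair (A , B) ≡ (A , B)
  swapPair-bad A B ¬g with Good? A B
  ... | yes g = ⊥-elim (¬g g)
  ... | no _ = refl

  swapPair-involutive : ∀ p → swapPair (swapPair p) ≡ p
  swapPair-involutive (A , B) = by (Good? A B)
    where
    by : Dec (Good A B) → swapPair (swapPair (A , B)) ≡ (A , B)
    by (yes g) = trans (cong swapPair (swapPair-good A B g)) (trans (swapPair-good _ _ (swap-good A B g)) (cong₂ _,_ (swapA-involutive A B g) (swapB-involutive A B g)))
    by (no ¬g) = trans (cong swapPair (swapPair-bad A B ¬g)) (swapPair-bad A B ¬g)

-- Signed sums over subsets, delta sums and involutions.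

guard : ∀ {ℓ} {P : Set ℓ} → Dec P → ℤ → ℤ
guard (yes _) x = x
guard (no _) x = + 0

guard-yes : ∀ {ℓ} {P : Set ℓ} (d : Dec P) x → P → guard d x ≡ x
guard-yes (yes _) x p = refl
guard-yes (no ¬p) x p = ⊥-elim (¬p p)

guard-no : ∀ {ℓ} {P : Set ℓ} (d : Dec P) x → ¬ P → guard d x ≡ + 0
guard-no (yes p) x ¬p = ⊥-elim (¬p p)
guard-no (no _) x ¬p = refl

guard-cong : ∀ {ℓ} {P : Set ℓ} (d : Dec P) {x y} → (P → x ≡ y) → guard d x ≡ guard d y
guard-cong (yes p) h = h p
guard-cong (no _) h = refl

guard-⇔ : ∀ {ℓ ℓ'} {P : Set ℓ} {Q : Set ℓ'} (d : Dec P) (d' : Dec Q) x → (P → Q) → (Q → P) → guard d x ≡ guard d' x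
guard-⇔ (yes p) d' x f g = sym (guard-yes d' x (f p))
guard-⇔ (no ¬p) d' x f g = sym (guard-no d' x (¬p ∘ g))

guard-+ : ∀ {ℓ} {P : Set ℓ} (d : Dec P) x y → guard d (x +ᶻ y) ≡ guard d x +ᶻ guard d y
guard-+ (yes _) x y = refl
guard-+ (no _) x y = refl

guard-*ˡ : ∀ {ℓ} {P : Set ℓ} (d : Dec P) c x → guard d (c *ᶻ x) ≡ c *ᶻ guard d x
guard-*ˡ (yes _) c x = refl
guard-*ˡ (no _) c x = sym (ℤP.*-zeroʳ c)

guard-swap : ∀ {ℓ ℓ'} {P : Set ℓ} {Q : Set ℓ'} (d : Dec P) (d' : Dec Q) x → guard d (guard d' x) ≡ guard d' (guard d x)
guard-swap (yes _) d' x = refl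
guard-swap (no _) (yes _) x = refl
guard-swap (no _) (no _) x = refl

guard-0 : ∀ {ℓ} {P : Set ℓ} (d : Dec P) {x} → x ≡ + 0 → guard d x ≡ + 0
guard-0 (yes _) e = e
guard-0 (no _) e = refl

sumB : ∀ {m} → (Vec Bool m → ℤ) → ℤ
sumB {zero} F = F []
sumB {suc m} F = sumB (λ A → F (true ∷ A)) +ᶻ sumB (λ A → F (false ∷ A))

sumB-cong : ∀ {m} {F G : Vec Bool m → ℤ} → (∀ A → F A ≡ G A) → sumB F ≡ sumB G
sumB-cong {zero} h = h []
sumB-cong {suc m} h = cong₂ _+ᶻ_ (sumB-cong (λ A → h (true ∷ A))) (sumB-cong (λ A → h (false ∷ A)))

sumB-0 : ∀ {m} {F : Vec Bool m → ℤ} → (∀ A → F A ≡ + 0) → sumB F ≡ + 0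
sumB-0 {zero} h = h []
sumB-0 {suc m} h = cong₂ _+ᶻ_ (sumB-0 (λ A → h (true ∷ A))) (sumB-0 (λ A → h (false ∷ A)))

sumB-+ : ∀ {m} (F G : Vec Bool m → ℤ) → sumB (λ A → F A +ᶻ G A) ≡ sumB F +ᶻ sumB G
sumB-+ {zero} F G = refl
sumB-+ {suc m} F G = trans (cong₂ _+ᶻ_ (sumB-+ (λ A → F (true ∷ A)) (λ A → G (true ∷ A))) (sumB-+ (λ A → F (false ∷ A)) (λ A → G (false ∷ A))))
  (lem (sumB (λ A → F (true ∷ A))) (sumB (λ A → G (true ∷ A))) (sumB (λ A → F (false ∷ A))) (sumB (λ A → G (false ∷ A))))
  where
  lem : ∀ a b c d → (a +ᶻ b) +ᶻ (c +ᶻ d) ≡ (a +ᶻ c) +ᶻ (b +ᶻ d)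
  lem = solve-∀

sumB-*ˡ : ∀ {m} c (F : Vec Bool m → ℤ) → sumB (λ A → c *ᶻ F A) ≡ c *ᶻ sumB F
sumB-*ˡ {zero} c F = refl
sumB-*ˡ {suc m} c F = trans (cong₂ _+ᶻ_ (sumB-*ˡ c (λ A → F (true ∷ A))) (sumB-*ˡ c (λ A → F (false ∷ A)))) (sym (ℤP.*-distribˡ-+ c _ _))

sumB-guard : ∀ {m ℓ} {P : Set ℓ} (d : Dec P) (F : Vec Bool m → ℤ) → sumB (λ A → guard d (F A)) ≡ guard d (sumB F)
sumB-guard (yes _) F = refl
sumB-guard {m} (no _) F = sumB-0 {m} (λ _ → refl)

sumB-swap : ∀ {m l} (F : Vec Bool m → Vec Bool l → ℤ) → sumB (λ A → sumB (F A)) ≡ sumB (λ B → sumB (λ A → F A B))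
sumB-swap {zero} F = refl
sumB-swap {suc m} {l} F = trans (cong₂ _+ᶻ_ (sumB-swap (λ A → F (true ∷ A))) (sumB-swap (λ A → F (false ∷ A)))) (sym (sumB-+ {l} _ _))

sumB-delta : ∀ {m} (A₀ : Vec Bool m) (d : ∀ A → Dec (A ≡ A₀)) (F : Vec Bool m → ℤ) → sumB (λ A → guard (d A) (F A)) ≡ F A₀
sumB-delta [] d F = guard-yes (d []) (F []) refl
sumB-delta (true ∷ A₀) d F = trans (cong₂ _+ᶻ_
  (trans (sumB-cong (λ A → guard-⇔ (d (true ∷ A)) (VecP.≡-dec Bool._≟_ A A₀) (F (true ∷ A)) VecP.∷-injectiveʳ (cong (true ∷_)))) (sumB-delta A₀ (λ A → VecP.≡-dec Bool._≟_ A A₀) (λ A → F (true ∷ A))))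
  (sumB-0 (λ A → guard-no (d (false ∷ A)) _ (λ ())))) (ℤP.+-identityʳ _)
sumB-delta (false ∷ A₀) d F = trans (cong₂ _+ᶻ_
  (sumB-0 (λ A → guard-no (d (true ∷ A)) _ (λ ())))
  (trans (sumB-cong (λ A → guard-⇔ (d (false ∷ A)) (VecP.≡-dec Bool._≟_ A A₀) (F (false ∷ A)) VecP.∷-injectiveʳ (cong (false ∷_)))) (sumB-delta A₀ (λ A → VecP.≡-dec Bool._≟_ A A₀) (λ A → F (false ∷ A))))) (ℤP.+-identityˡ _)

sumB-empty : ∀ {m} (F : Vec Bool m → ℤ) → sumB (λ A → guard (cnt A ≟ 0) (F A)) ≡ F (replicate m false)
sumB-empty {zero} F = refl
sumB-empty {suc m} F = trans (cong₂ _+ᶻ_ (sumB-0 {m} (λ A → refl)) (sumB-empty (λ A → F (false ∷ A)))) (ℤP.+-identityˡ _)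

cnt-empty : ∀ m → cnt (replicate m false) ≡ 0
cnt-empty zero = refl
cnt-empty (suc m) = cnt-empty m

record Summable (X : Set) : Set₁ where
  field
    ∑ : (X → ℤ) → ℤ
    ∑-cong : ∀ {F G} → (∀ x → F x ≡ G x) → ∑ F ≡ ∑ G
    ∑-swap : ∀ (F : X → X → ℤ) → ∑ (λ x → ∑ (F x)) ≡ ∑ (λ y → ∑ (λ x → F x y))
    _≟ₓ_ : ∀ (x y : X) → Dec (x ≡ y)
    ∑-delta : ∀ x₀ (F : X → ℤ) → ∑ (λ x → guard (x ≟ₓ x₀) (F x)) ≡ F x₀

  -- Each `F (τ x)` is written as a delta sum over `y` and the sums are exchanged; for an involution
  -- the delta at `y ≡ τ x` is one at `x ≡ τ y`.
  ∑-involution : ∀ τ → (∀ x → τ (τ x) ≡ x) → ∀ F → ∑ (F ∘ τ) ≡ ∑ F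
  ∑-involution τ ττ F = trans (∑-cong (λ x → sym (∑-delta (τ x) F)))
    (trans (∑-swap (λ x y → guard (y ≟ₓ τ x) (F y)))
      (∑-cong (λ y → trans (∑-cong (λ x → guard-⇔ (y ≟ₓ τ x) (x ≟ₓ τ y) (F y) (λ e → trans (sym (ττ x)) (cong τ (sym e))) (λ e → trans (sym (ττ y)) (cong τ (sym e)))))
        (∑-delta (τ y) (λ _ → F y)))))

subsets : ∀ m → Summable (Vec Bool m)
subsets m = record { ∑ = sumB ; ∑-cong = sumB-cong ; ∑-swap = sumB-swap ; _≟ₓ_ = VecP.≡-dec Bool._≟_ ; ∑-delta = λ A₀ → sumB-delta A₀ (λ A → VecP.≡-dec Bool._≟_ A A₀) }

subsetPairs : ∀ m → Summable (Vec Bool m × Vec Bool m)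
subsetPairs m = record
  { ∑ = λ F → sumB (λ A → sumB (λ B → F (A , B)))
  ; ∑-cong = λ h → sumB-cong {m} (λ A → sumB-cong {m} (λ B → h (A , B)))
  ; ∑-swap = λ F → trans (sumB-cong {m} (λ A → sumB-swap {m} {m} (λ B C → sumB (λ D → F (A , B) (C , D)))))
      (trans (sumB-swap {m} {m} _) (sumB-cong {m} (λ C → trans (sumB-cong {m} (λ A → sumB-swap {m} {m} (λ B D → F (A , B) (C , D)))) (sumB-swap {m} {m} _))))
  ; _≟ₓ_ = ProductP.≡-dec (VecP.≡-dec Bool._≟_) (VecP.≡-dec Bool._≟_)
  ; ∑-delta = delta }
  where
  _≟ᵛ_ : (A B : Vec Bool m) → Dec (A ≡ B)
  _≟ᵛ_ = VecP.≡-dec Bool._≟_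
  delta : ∀ p₀ (F : Vec Bool m × Vec Bool m → ℤ) → sumB (λ A → sumB (λ B → guard (ProductP.≡-dec _≟ᵛ_ _≟ᵛ_ (A , B) p₀) (F (A , B)))) ≡ F p₀
  delta (A₀ , B₀) F = trans (sumB-cong {m} (λ A → trans (sumB-cong {m} (λ B → split A B)) (trans (sumB-guard {m} (A ≟ᵛ A₀) _) (cong (guard (A ≟ᵛ A₀)) (sumB-delta {m} B₀ (λ B → B ≟ᵛ B₀) (λ B → F (A , B)))))))
    (sumB-delta {m} A₀ (λ A → A ≟ᵛ A₀) (λ A → F (A , B₀)))
    where
    split : ∀ A B → guard (ProductP.≡-dec _≟ᵛ_ _≟ᵛ_ (A , B) (A₀ , B₀)) (F (A , B)) ≡ guard (A ≟ᵛ A₀) (guard (B ≟ᵛ B₀) (F (A , B)))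
    split A B = by (ProductP.≡-dec _≟ᵛ_ _≟ᵛ_ (A , B) (A₀ , B₀)) (A ≟ᵛ A₀) (B ≟ᵛ B₀)
      where
      by : ∀ (d : Dec ((A , B) ≡ (A₀ , B₀))) (d₁ : Dec (A ≡ A₀)) (d₂ : Dec (B ≡ B₀)) → guard d (F (A , B)) ≡ guard d₁ (guard d₂ (F (A , B)))
      by d (yes a) (yes b) = guard-yes d _ (cong₂ _,_ a b)
      by d (yes _) (no ¬b) = guard-no d _ (¬b ∘ cong proj₂)
      by d (no ¬a) _ = guard-no d _ (¬a ∘ cong proj₁)

sumN : (ℕ → ℤ) → ℕ → ℤ
sumN f zero = + 0
sumN f (suc N) = sumN f N +ᶻ f N

sumN-0 : ∀ f N → (∀ i → i < N → f i ≡ + 0) → sumN f N ≡ + 0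
sumN-0 f zero h = refl
sumN-0 f (suc N) h = cong₂ _+ᶻ_ (sumN-0 f N (λ i lt → h i (m<n⇒m<1+n lt))) (h N (n<1+n N))

sumN-cong : ∀ {f g} N → (∀ i → f i ≡ g i) → sumN f N ≡ sumN g N
sumN-cong zero h = refl
sumN-cong (suc N) h = cong₂ _+ᶻ_ (sumN-cong N h) (h N)

sumN-head : ∀ f N → sumN f (suc N) ≡ f 0 +ᶻ sumN (f ∘ suc) N
sumN-head f zero = trans (ℤP.+-identityˡ (f 0)) (sym (ℤP.+-identityʳ (f 0)))
sumN-head f (suc N) = trans (cong (_+ᶻ f (suc N)) (sumN-head f N)) (ℤP.+-assoc (f 0) _ _)

sumN-delta : ∀ a (g : ℕ → ℤ) N → a < N → sumN (λ i → guard (a ≟ i) (g i)) N ≡ g a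
sumN-delta a g (suc N) lt with a ≟ N
... | yes refl = trans (cong (_+ᶻ g N) (sumN-0 _ N (λ i i<N → guard-no (N ≟ i) _ (λ e → ℕP.<⇒≢ i<N (sym e))))) (ℤP.+-identityˡ _)
... | no a≢N = trans (ℤP.+-identityʳ _) (sumN-delta a g N (≤∧≢⇒< (≤-pred lt) a≢N))

sumN-none : ∀ a (g : ℕ → ℤ) N → N ≤ a → sumN (λ i → guard (a ≟ i) (g i)) N ≡ + 0
sumN-none a g N le = sumN-0 _ N (λ i i<N → guard-no (a ≟ i) _ (λ e → ℕP.<⇒≢ (ℕP.<-≤-trans i<N le) (sym e)))

sumB-sumN : ∀ {m} (F : ℕ → Vec Bool m → ℤ) N → sumB (λ A → sumN (λ i → F i A) N) ≡ sumN (λ i → sumB (F i)) N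
sumB-sumN {m} F zero = sumB-0 {m} (λ _ → refl)
sumB-sumN {m} F (suc N) = trans (sumB-+ {m} _ (F N)) (cong (_+ᶻ sumB (F N)) (sumB-sumN F N))

sgn : ℕ → ℤ
sgn zero = + 1
sgn (suc m) = negᶻ (sgn m)

-- dec stands for the factors h_k(u), inc for their cyclically increasing analogues e_k(u).
data Kind : Set where
  dec inc : Kind

∨-false : ∀ a b → a ∨ b ≡ false → a ≡ false × b ≡ false
∨-false false false _ = refl , refl

cnt-update : ∀ {m} (A : Vec Bool m) i b → cnt (A [ i ]≔ b) + bit (lookup A i) ≡ cnt A + bit b
cnt-update (x ∷ A) Fin.zero b = lem (bit b) (cnt A) (bit x)
  where
  lem : ∀ b a x → b + a + x ≡ x + a + b
  lem = solveℕ-∀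
cnt-update (x ∷ A) (Fin.suc i) b = trans (+-assoc (bit x) _ _) (trans (cong (bit x ℕ.+_) (cnt-update A i b)) (sym (+-assoc (bit x) _ _)))

-- Functionals on the nilCoxeter algebra: commuting h's and the relation between h's and e's.

module Functionals (n : ℕ) .{{nz : NonZero n}} (3≤n : 3 ≤ n) where

  open Residues n
  open Codes n
  open Moves n
  open Words n 3≤n
  open Group n 3≤n
  open Mirrors n
  open Pairs n 3≤n

  -- Linear functionals on the nilCoxeter algebra, given by their values on words.
  record Nil (ψ : List ℕ → ℤ) : Set where
    field
      respects : ∀ V W → V ≈ W → length V ≡ length W → ψ V ≡ ψ W
      vanish : ∀ V → siz V ≢ length V → ψ V ≡ + 0

  -- If `V` is not reduced, neither is the product with `P` and `Q`, since lengths are subadditive.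
  -- This allows outer factors to be absorbed into the functional.
  Nil-++ : ∀ {ψ} → Nil ψ → ∀ P Q → Nil (λ W → ψ (P ++ (W ++ Q)))
  Nil-++ {ψ} N P Q = record { respects = resp' ; vanish = vanish' }
    where
    open Nil N
    resp' : ∀ V W → V ≈ W → length V ≡ length W → ψ (P ++ (V ++ Q)) ≡ ψ (P ++ (W ++ Q))
    resp' V W V≈W e = respects (P ++ (V ++ Q)) (P ++ (W ++ Q)) (++-≈ {P} {P} {V ++ Q} {W ++ Q} (λ _ → refl) (++-≈ {V} {W} {Q} {Q} V≈W (λ _ → refl)))
      (trans (ListP.length-++ P) (trans (cong (length P ℕ.+_) (trans (ListP.length-++ V) (trans (cong (ℕ._+ length Q) e) (sym (ListP.length-++ W))))) (sym (ListP.length-++ P))))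
    vanish' : ∀ V → siz V ≢ length V → ψ (P ++ (V ++ Q)) ≡ + 0
    vanish' V ne = vanish (P ++ (V ++ Q)) (λ eq → ne (≤-antisym (siz≤length V) (+-cancelʳ-≤ (length Q) _ _ (+-cancelˡ-≤ (length P) _ _
      (≤-trans (≤-reflexive (trans (cong (length P ℕ.+_) (sym (ListP.length-++ V))) (trans (sym (ListP.length-++ P)) (sym eq))))
        (≤-trans (siz-++ˡ P (V ++ Q)) (+-monoʳ-≤ (length P) (siz-++ʳ V Q))))))))

  Nil-++ʳ : ∀ {ψ} → Nil ψ → ∀ Q → Nil (λ W → ψ (W ++ Q))
  Nil-++ʳ N Q = Nil-++ N [] Q

  Nil-++ˡ : ∀ {ψ} → Nil ψ → ∀ P → Nil (λ W → ψ (P ++ W))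
  Nil-++ˡ {ψ} N P = record
    { respects = λ V W V≈W e → trans (cong (λ z → ψ (P ++ z)) (sym (ListP.++-identityʳ V))) (trans (Nil.respects N' V W V≈W e) (cong (λ z → ψ (P ++ z)) (ListP.++-identityʳ W)))
    ; vanish = λ V ne → trans (cong (λ z → ψ (P ++ z)) (sym (ListP.++-identityʳ V))) (Nil.vanish N' V ne) }
    where N' = Nil-++ N P []

  wd : Kind → Vec Bool n → List ℕ
  wd dec A = D A
  wd inc A = reverse (D A)

  length-wd : ∀ o A → cnt A < n → length (wd o A) ≡ cnt A
  length-wd dec A p = length-D A p
  length-wd inc A p = trans (ListP.length-reverse (D A)) (length-D A p)

  Op : Set
  Op = Kind × ℕ

  -- T [(o₁,a₁),…,(o_t,a_t)] ψ is the value of ψ on (o_t)_{a_t} ⋯ (o₁)_{a₁}.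
  T : List Op → (List ℕ → ℤ) → ℤ
  T [] ψ = ψ []
  T ((o , a) ∷ α) ψ = sumB (λ A → guard (cnt A ≟ a) (T α (λ W → ψ (W ++ wd o A))))

  T-cong : ∀ α {ψ ψ'} → (∀ W → ψ W ≡ ψ' W) → T α ψ ≡ T α ψ'
  T-cong [] h = h []
  T-cong ((o , a) ∷ α) h = sumB-cong {n} (λ A → cong (guard (cnt A ≟ a)) (T-cong α (λ W → h (W ++ wd o A))))

  T-0 : ∀ α {ψ} → (∀ W → ψ W ≡ + 0) → T α ψ ≡ + 0
  T-0 [] h = h []
  T-0 ((o , a) ∷ α) h = sumB-0 {n} (λ A → guard-0 (cnt A ≟ a) (T-0 α (λ W → h (W ++ wd o A))))

  T-+ : ∀ α ψ ψ' → T α (λ W → ψ W +ᶻ ψ' W) ≡ T α ψ +ᶻ T α ψ'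
  T-+ [] ψ ψ' = refl
  T-+ ((o , a) ∷ α) ψ ψ' = trans (sumB-cong {n} (λ A → trans (cong (guard (cnt A ≟ a)) (T-+ α _ _)) (guard-+ (cnt A ≟ a) _ _))) (sumB-+ {n} _ _)

  T-*ˡ : ∀ α c ψ → T α (λ W → c *ᶻ ψ W) ≡ c *ᶻ T α ψ
  T-*ˡ [] c ψ = refl
  T-*ˡ ((o , a) ∷ α) c ψ = trans (sumB-cong {n} (λ A → trans (cong (guard (cnt A ≟ a)) (T-*ˡ α c _)) (guard-*ˡ (cnt A ≟ a) c _))) (sumB-*ˡ {n} c _)

  T-guard : ∀ α {ℓ} {P : Set ℓ} (d : Dec P) ψ → T α (λ W → guard d (ψ W)) ≡ guard d (T α ψ)
  T-guard α (yes _) ψ = refl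
  T-guard α (no _) ψ = T-0 α (λ _ → refl)

  T-sumB : ∀ α {m} (F : Vec Bool m → List ℕ → ℤ) → T α (λ W → sumB (λ A → F A W)) ≡ sumB (λ A → T α (F A))
  T-sumB α {zero} F = refl
  T-sumB α {suc m} F = trans (T-+ α _ _) (cong₂ _+ᶻ_ (T-sumB α (λ A → F (true ∷ A))) (T-sumB α (λ A → F (false ∷ A))))

  T-sumN : ∀ α (F : ℕ → List ℕ → ℤ) N → T α (λ W → sumN (λ i → F i W) N) ≡ sumN (λ i → T α (F i)) N
  T-sumN α F zero = T-0 α (λ _ → refl)
  T-sumN α F (suc N) = trans (T-+ α _ _) (cong (_+ᶻ T α (F N)) (T-sumN α F N))

  T-snoc : ∀ α o a ψ → T (α ++ (o , a) ∷ []) ψ ≡ sumB (λ A → guard (cnt A ≟ a) (T α (λ W → ψ (wd o A ++ W))))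
  T-snoc [] o a ψ = sumB-cong {n} (λ A → cong (λ z → guard (cnt A ≟ a) (ψ z)) (sym (ListP.++-identityʳ (wd o A))))
  T-snoc ((o' , a') ∷ α) o a ψ = trans (sumB-cong {n} (λ A → trans (cong (guard (cnt A ≟ a')) (T-snoc α o a (λ W → ψ (W ++ wd o' A)))) (sym (sumB-guard {n} (cnt A ≟ a') _))))
    (trans (sumB-swap {n} {n} _) (sumB-cong {n} (λ B → trans (sumB-cong {n} (λ A → trans (guard-swap (cnt A ≟ a') (cnt B ≟ a) _)
      (cong (λ z → guard (cnt B ≟ a) (guard (cnt A ≟ a') z)) (T-cong α (λ W → cong ψ (ListP.++-assoc (wd o B) W (wd o' A))))))) (sumB-guard {n} (cnt B ≟ a) _))))

  D-empty : D (replicate n false) ≡ []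
  D-empty = empty (D (replicate n false)) (trans (length-D (replicate n false) (subst (_< n) (sym (cnt-empty n)) (<-trans (s≤s z≤n) 1<n))) (cnt-empty n))
    where
    empty : ∀ (l : List ℕ) → length l ≡ 0 → l ≡ []
    empty [] _ = refl

  wd-empty : ∀ o → wd o (replicate n false) ≡ []
  wd-empty dec = D-empty
  wd-empty inc = cong reverse D-empty

  T-drop-0 : ∀ o α ψ → T ((o , 0) ∷ α) ψ ≡ T α ψ
  T-drop-0 o α ψ = trans (sumB-empty {n} (λ A → T α (λ W → ψ (W ++ wd o A)))) (T-cong α (λ W → cong ψ (trans (cong (W ++_) (wd-empty o)) (ListP.++-identityʳ W))))

  pairSum : ℕ → ℕ → (Vec Bool n → Vec Bool n → ℤ) → ℤ
  pairSum a b X = sumB (λ A → guard (cnt A ≟ a) (sumB (λ B → guard (cnt B ≟ b) (X A B))))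

  T-pair : ∀ o a o' b α ψ → T ((o , a) ∷ (o' , b) ∷ α) ψ ≡ T α (λ W → pairSum a b (λ A B → ψ (W ++ (wd o' B ++ wd o A))))
  T-pair o a o' b α ψ = sym (trans (T-sumB α {n} _) (sumB-cong {n} (λ A → trans (T-guard α (cnt A ≟ a) _) (cong (guard (cnt A ≟ a))
    (trans (T-sumB α {n} _) (sumB-cong {n} (λ B → trans (T-guard α (cnt B ≟ b) _) (cong (guard (cnt B ≟ b)) (T-cong α (λ W → cong ψ (sym (ListP.++-assoc W (wd o' B) (wd o A)))))))))))))

  -- Reindexing by `swapPair`: a good pair keeps its product while the sizes are exchanged, and
  -- every other pair contributes zero on both sides.
  pairSum-comm : ∀ a b → a < n → b < n → ∀ {ψ} → Nil ψ → pairSum a b (λ A B → ψ (D B ++ D A)) ≡ pairSum b a (λ A B → ψ (D B ++ D A))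
  pairSum-comm a b a<n b<n {ψ} N = trans (flatten a b) (trans (∑-cong (λ p → sym (same p)))
    (trans (∑-involution swapPair swapPair-involutive (F b a)) (sym (flatten b a))))
    where
    open Nil N
    open Summable (subsetPairs n)
    F : ℕ → ℕ → Vec Bool n × Vec Bool n → ℤ
    F a b (B , A) = guard (cnt A ≟ a) (guard (cnt B ≟ b) (ψ (D B ++ D A)))
    flatten : ∀ a b → pairSum a b (λ A B → ψ (D B ++ D A)) ≡ ∑ (F a b)
    flatten a b = trans (sumB-cong {n} (λ A → sym (sumB-guard {n} (cnt A ≟ a) (λ B → guard (cnt B ≟ b) (ψ (D B ++ D A)))))) (sumB-swap {n} {n} (λ A B → F a b (B , A)))
    same : ∀ p → F b a (swapPair p) ≡ F a b p
    same (B , A) = by (Good? B A)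
      where
      by : Dec (Good B A) → F b a (swapPair (B , A)) ≡ F a b (B , A)
      by (yes g) = trans (cong (F b a) (swapPair-good B A g)) (trans (cong₂ (λ x y → guard (x ≟ b) (guard (y ≟ a) (ψ (D B' ++ D A')))) (cnt-swapB B A g) (cnt-swapA B A g))
        (trans (guard-swap (cnt B ≟ b) (cnt A ≟ a) _) (cong (λ z → guard (cnt A ≟ a) (guard (cnt B ≟ b) z)) (respects (D B' ++ D A') (D B ++ D A) (swap-≈ B A g) lengths))))
        where
        B' = swapA B A
        A' = swapB B A
        len2 : ∀ X Y → Good X Y → length (D X ++ D Y) ≡ cnt X + cnt Y
        len2 X Y g = trans (ListP.length-++ (D X)) (cong₂ _+_ (length-D X (proj₁ (proj₁ g))) (length-D Y (proj₂ (proj₁ g))))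
        lengths : length (D B' ++ D A') ≡ length (D B ++ D A)
        lengths = trans (len2 B' A' (swap-good B A g)) (trans (cong₂ _+_ (cnt-swapA B A g) (cnt-swapB B A g)) (trans (+-comm (cnt A) (cnt B)) (sym (len2 B A g))))
      by (no ¬g) = trans (cong (F b a) (swapPair-bad B A ¬g)) (trans (zero-at b a b<n a<n) (sym (zero-at a b a<n b<n)))
        where
        zero-at : ∀ a b → a < n → b < n → F a b (B , A) ≡ + 0
        zero-at a b a<n b<n = trans (guard-cong (cnt A ≟ a) (λ eA → trans (guard-cong (cnt B ≟ b) (λ eB → vanish (D B ++ D A) (λ es → ¬g
          ((subst (_< n) (sym eB) b<n , subst (_< n) (sym eA) a<n) , trans es (trans (ListP.length-++ (D B)) (cong₂ _+_ (length-D B (subst (_< n) (sym eB) b<n)) (length-D A (subst (_< n) (sym eA) a<n))))))))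
          (guard-0 (cnt B ≟ b) refl))) (guard-0 (cnt A ≟ a) refl)

  H : List ℕ → List Op
  H = map (dec ,_)

  -- This is the symmetry of the functions F̃. For a transposition inside a product the factors on
  -- either side are absorbed into the functional.
  T-perm : ∀ {α β} → α ↭ β → All (_< n) α → ∀ {ψ} → Nil ψ → T (H α) ψ ≡ T (H β) ψ
  T-perm Perm.refl _ N = refl
  T-perm (Perm.prep a p) (_ ∷ all) N = sumB-cong {n} (λ A → cong (guard (cnt A ≟ a)) (T-perm p all (Nil-++ʳ N (D A))))
  T-perm (Perm.swap {xs} {ys} a b p) (a<n ∷ b<n ∷ all) {ψ} N =
    trans (T-pair dec a dec b (H xs) ψ) (trans (T-cong (H xs) (λ W → pairSum-comm a b a<n b<n (Nil-++ˡ N W)))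
      (trans (sym (T-pair dec b dec a (H xs) ψ)) (sumB-cong {n} (λ A → cong (guard (cnt A ≟ b)) (sumB-cong {n} (λ B → cong (guard (cnt B ≟ a)) (T-perm p all (Nil-++ʳ (Nil-++ʳ N (D A)) (D B)))))))))
  T-perm (Perm.trans p q) all N = trans (T-perm p all N) (T-perm q (PermP.All-resp-↭ p all) N)

  union : Vec Bool n → Vec Bool n → Vec Bool n
  union A B = zipWith _∨_ A B

  lookup-union : ∀ A B i → lookup (union A B) i ≡ lookup A i ∨ lookup B i
  lookup-union A B i = VecP.lookup-zipWith _∨_ i A B

  cnt-union : ∀ {m} (A B : Vec Bool m) → cnt (zipWith _∨_ A B) ≤ cnt A + cnt B
  cnt-union [] [] = z≤n
  cnt-union (a ∷ A) (b ∷ B) = ≤-trans (+-mono-≤ (or a b) (cnt-union A B)) (≤-reflexive (lem (bit a) (bit b) (cnt A) (cnt B)))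
    where
    or : ∀ a b → bit (a ∨ b) ≤ bit a + bit b
    or true b = s≤s z≤n
    or false b = ≤-refl
    lem : ∀ a b c d → a + b + (c + d) ≡ a + c + (b + d)
    lem = solveℕ-∀

  cnt-all : ∀ {m} (A : Vec Bool m) → (∀ i → lookup A i ≡ true) → cnt A ≡ m
  cnt-all [] _ = refl
  cnt-all (a ∷ A) h = cong₂ _+_ (cong bit (h Fin.zero)) (cnt-all A (λ i → h (Fin.suc i)))

  cnt-none : ∀ {m} (A : Vec Bool m) → (∀ i → lookup A i ≡ false) → cnt A ≡ 0
  cnt-none [] _ = refl
  cnt-none (a ∷ A) h = cong₂ _+_ (cong bit (h Fin.zero)) (cnt-none A (λ i → h (Fin.suc i)))

  Start : Vec Bool n → Fin n → Set
  Start U i = lookup U i ≡ true × mem U (dn (+ toℕ i)) ≡ false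

  start? : ∀ U → Dec (∃ (Start U))
  start? U = FinP.any? (λ i → (lookup U i Bool.≟ true) ×-dec (mem U (dn (+ toℕ i)) Bool.≟ false))

  -- Without a start, membership passes from each residue to the preceding one and so around the
  -- whole circle.
  no-start : ∀ U → ¬ ∃ (Start U) → (∀ i → lookup U i ≡ true) ⊎ (∀ i → lookup U i ≡ false)
  no-start U ¬s = by (FinP.any? (λ i → lookup U i Bool.≟ true))
    where
    mem-toℕ : ∀ i → mem U (+ toℕ i) ≡ lookup U i
    mem-toℕ i = cong (lookup U) (resF-toℕ i)
    down : ∀ k → mem U k ≡ true → mem U (dn k) ≡ true
    down k e = BoolP.¬-not (λ e' → ¬s (resF k , e , trans (per-res (mem U) (mem-sh U) (dn (+ toℕ (resF k))) (dn k)
        (res-dn {dn (+ toℕ (resF k))} {dn k} (trans (cong res (up-dn (+ toℕ (resF k)))) (trans (trans (cong (res ∘ +_) (toℕ-resF k)) (res-small (res<n k))) (cong res (sym (up-dn k))))))) e'))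
    downs : ∀ t k → mem U (k ⊕ t) ≡ true → mem U k ≡ true
    downs zero k e = e
    downs (suc t) k e = downs t k (trans (cong (mem U) (sym (trans (cong dn (sym (⊕-up k t))) (dn-up (k ⊕ t))))) (down (k ⊕ suc t) e))
    by : Dec (∃ λ i → lookup U i ≡ true) → _
    by (no none) = inj₂ (λ i → BoolP.¬-not (λ e → none (i , e)))
    by (yes (i , e)) = inj₁ (λ j → all j (reach (+ toℕ j) (+ toℕ i)))
      where
      all : ∀ j → (∃ λ t → t < n × ∃ λ q → + toℕ i ≡ (+ toℕ j ⊕ t) +ᶻ q *ᶻ + n) → lookup U j ≡ true
      all j (t , _ , q , eq) = trans (sym (mem-toℕ j)) (downs t (+ toℕ j) (trans (sym (per-mult (mem U) (mem-sh U) (+ toℕ j ⊕ t) q)) (trans (cong (mem U) (sym eq)) (trans (mem-toℕ i) e))))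

  exchange : Fin n → Vec Bool n × Vec Bool n → Vec Bool n × Vec Bool n
  exchange i (A , B) = A [ i ]≔ lookup B i , B [ i ]≔ lookup A i

  -- The letter is chosen from the union of the two sets alone. Exchanging it preserves the union,
  -- so the same letter is chosen again; the last component of `toggle-yes` records this.
  toggle : Vec Bool n × Vec Bool n → Vec Bool n × Vec Bool n
  toggle (A , B) = by (start? (union A B))
    where
    by : Dec (∃ (Start (union A B))) → Vec Bool n × Vec Bool n
    by (yes (i , _)) = exchange i (A , B)
    by (no _) = A , B

  toggle-yes : ∀ A B → ∃ (Start (union A B)) → ∃ λ i → Start (union A B) i × toggle (A , B) ≡ exchange i (A , B) × (∀ A' B' → union A' B' ≡ union A B → toggle (A' , B') ≡ exchange i (A' , B'))
  toggle-yes A B s = by (start? (union A B)) refl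
    where
    fn : ∀ A' B' → Dec (∃ (Start (union A' B'))) → Vec Bool n × Vec Bool n
    fn A' B' (yes (i , _)) = exchange i (A' , B')
    fn A' B' (no _) = A' , B'
    toggle-fn : ∀ A' B' → toggle (A' , B') ≡ fn A' B' (start? (union A' B'))
    toggle-fn A' B' with start? (union A' B')
    ... | yes _ = refl
    ... | no _ = refl
    move : ∀ A' B' (U : Vec Bool n) → union A' B' ≡ U → ∀ i p → start? U ≡ yes (i , p) → fn A' B' (start? (union A' B')) ≡ exchange i (A' , B')
    move A' B' .(union A' B') refl i p eq = cong (fn A' B') eq
    by : ∀ d → start? (union A B) ≡ d → ∃ λ i → Start (union A B) i × toggle (A , B) ≡ exchange i (A , B) × (∀ A' B' → union A' B' ≡ union A B → toggle (A' , B') ≡ exchange i (A' , B'))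
    by (no ¬s) _ = ⊥-elim (¬s s)
    by (yes (i , p)) eq = i , p , trans (toggle-fn A B) (cong (fn A B) eq) , λ A' B' eU → trans (toggle-fn A' B') (move A' B' (union A B) eU i p eq)

  toggle-no : ∀ A B → ¬ ∃ (Start (union A B)) → toggle (A , B) ≡ (A , B)
  toggle-no A B ¬s with start? (union A B)
  ... | yes s = ⊥-elim (¬s s)
  ... | no _ = refl

  private
    lookup-update : ∀ (A : Vec Bool n) i b j → (j ≡ i × lookup (A [ i ]≔ b) j ≡ b) ⊎ (j ≢ i × lookup (A [ i ]≔ b) j ≡ lookup A j)
    lookup-update A i b j with j Fin.≟ i
    ... | yes refl = inj₁ (refl , VecP.lookup∘update i A b)
    ... | no j≢i = inj₂ (j≢i , VecP.lookup∘update′ j≢i A b)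

  union-exchange : ∀ i A B → union (A [ i ]≔ lookup B i) (B [ i ]≔ lookup A i) ≡ union A B
  union-exchange i A B = lookup-ext _ _ (λ j → trans (lookup-union (A [ i ]≔ lookup B i) (B [ i ]≔ lookup A i) j) (trans (at-j j) (sym (lookup-union A B j))))
    where
    at-j : ∀ j → lookup (A [ i ]≔ lookup B i) j ∨ lookup (B [ i ]≔ lookup A i) j ≡ lookup A j ∨ lookup B j
    at-j j with lookup-update A i (lookup B i) j | lookup-update B i (lookup A i) j
    ... | inj₁ (refl , e) | inj₁ (_ , e') = trans (cong₂ _∨_ e e') (BoolP.∨-comm (lookup B i) (lookup A i))
    ... | inj₂ (_ , e) | inj₂ (_ , e') = cong₂ _∨_ e e'
    ... | inj₁ (q , _) | inj₂ (ne , _) = ⊥-elim (ne q)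
    ... | inj₂ (ne , _) | inj₁ (q , _) = ⊥-elim (ne q)

  exchange-involutive : ∀ i p → exchange i (exchange i p) ≡ p
  exchange-involutive i (A , B) = cong₂ _,_ (back' A (lookup B i) (lookup (B [ i ]≔ lookup A i) i) (VecP.lookup∘update i B (lookup A i))) (back' B (lookup A i) (lookup (A [ i ]≔ lookup B i) i) (VecP.lookup∘update i A (lookup B i)))
    where
    back' : ∀ (X : Vec Bool n) b c → c ≡ lookup X i → (X [ i ]≔ b) [ i ]≔ c ≡ X
    back' X b c eq = trans (VecP.[]≔-idempotent X i) (trans (cong (X [ i ]≔_) eq) (VecP.[]≔-lookup X i))

  toggle-involutive : ∀ p → toggle (toggle p) ≡ p
  toggle-involutive (A , B) = by (start? (union A B))
    where
    by : Dec (∃ (Start (union A B))) → toggle (toggle (A , B)) ≡ (A , B)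
    by (no ¬s) = trans (cong toggle (toggle-no A B ¬s)) (toggle-no A B ¬s)
    by (yes s) = go (toggle-yes A B s)
      where
      go : (∃ λ i → Start (union A B) i × toggle (A , B) ≡ exchange i (A , B) × (∀ A' B' → union A' B' ≡ union A B → toggle (A' , B') ≡ exchange i (A' , B'))) → toggle (toggle (A , B)) ≡ (A , B)
      go (i , _ , e , other) = trans (cong toggle e) (trans (other _ _ (union-exchange i A B)) (exchange-involutive i (A , B)))

  opt : ℕ → Bool → List ℕ
  opt i true = i ∷ []
  opt i false = []

  reverse-opt : ∀ i b → reverse (opt i b) ≡ opt i b
  reverse-opt i true = refl
  reverse-opt i false = refl

  -- With a cut just below i, the letter i is the last one of the decreasing word.
  module LastLetter (i : Fin n) where
    private
      p = dn (+ toℕ i)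
      q = + toℕ i

      n≡ : n ≡ suc (suc (n ∸ 2))
      n≡ = sym (m+[n∸m]≡n 1<n)

    rest : Vec Bool n → List ℕ
    rest A = al (mem A) (up q) (n ∸ 2)

    D-last : ∀ A → mem A p ≡ false → D A ≈ reverse (rest A) ++ opt (res q) (lookup A i)
    D-last A missing = ≈-trans {D A} {reverse C.I} {reverse (rest A) ++ opt (res q) (lookup A i)} (proj₂ (Move-unique (moveA A (missing⇒cnt A p missing)) C.move)) (≡⇒≈ (trans (cong reverse I≡) (trans (ListP.reverse-++ (opt (res q) (lookup A i)) (rest A)) (cong (reverse (rest A) ++_) (reverse-opt (res q) (lookup A i))))))
      where
      module C = Cut (mem A) (mem-sh A) p missing
      unfold : ∀ b xs → (if b then res q ∷ xs else xs) ≡ opt (res q) b ++ xs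
      unfold true xs = refl
      unfold false xs = refl
      I≡ : C.I ≡ opt (res q) (lookup A i) ++ rest A
      I≡ = trans (cong₂ (al (mem A)) (up-dn q) (cong (_∸ 1) n≡)) (trans (unfold (mem A q) (rest A)) (cong (λ j → opt (res q) (lookup A j) ++ rest A) (resF-toℕ i)))

    rest-update : ∀ A b → rest (A [ i ]≔ b) ≡ rest A
    rest-update A b = al-cong (up q) (n ∸ 2) (λ t lt → other (up q ⊕ t) (λ eq → absurd (window-injective q {suc t} (<-trans (s≤s lt) (≤-reflexive (sym n≡))) (trans (sym (toℕ-resF (up q ⊕ t))) (trans (cong toℕ eq) (sym (res-small (FinP.toℕ<n i))))))))
      where
      absurd : ∀ {t} → suc t ≡ 0 → ⊥
      absurd ()
      other : ∀ k → resF k ≢ i → mem (A [ i ]≔ b) k ≡ mem A k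
      other k ne = VecP.lookup∘update′ ne A b

    mem-p-update : ∀ A b → mem (A [ i ]≔ b) p ≡ mem A p
    mem-p-update A b = VecP.lookup∘update′ (λ eq → res-up≢ p (trans (cong res (up-dn q)) (trans (res-small (FinP.toℕ<n i)) (trans (cong toℕ (sym eq)) (toℕ-resF p))))) A b

    -- The letter `i` comes last in d_A and first in the reversal of d_B, so its occurrences meet in
    -- the middle of the product.
    DI-≈ : ∀ A B → mem A p ≡ false → mem B p ≡ false →
      D A ++ reverse (D B) ≈ reverse (rest A) ++ ((opt (res q) (lookup A i) ++ opt (res q) (lookup B i)) ++ rest B)
    DI-≈ A B pA pB = ≈-trans {D A ++ reverse (D B)} {(reverse (rest A) ++ opt (res q) (lookup A i)) ++ (opt (res q) (lookup B i) ++ rest B)} {reverse (rest A) ++ ((opt (res q) (lookup A i) ++ opt (res q) (lookup B i)) ++ rest B)}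
      (++-≈ {D A} {reverse (rest A) ++ opt (res q) (lookup A i)} {reverse (D B)} {opt (res q) (lookup B i) ++ rest B} (D-last A pA)
        (≈-trans {reverse (D B)} {reverse (reverse (rest B) ++ opt (res q) (lookup B i))} {opt (res q) (lookup B i) ++ rest B} (reverse-≈ {D B} {reverse (rest B) ++ opt (res q) (lookup B i)} (D-last B pB))
          (≡⇒≈ (trans (ListP.reverse-++ (reverse (rest B)) (opt (res q) (lookup B i))) (cong₂ _++_ (reverse-opt (res q) (lookup B i)) (ListP.reverse-involutive (rest B)))))))
      (≡⇒≈ (trans (ListP.++-assoc (reverse (rest A)) _ _) (cong (reverse (rest A) ++_) (sym (ListP.++-assoc (opt (res q) (lookup A i)) _ _)))))

  module Relation {ψ : List ℕ → ℤ} (N : Nil ψ) (k : ℕ) (1≤k : 1 ≤ k) (k<n : k < n) where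
    open Nil N
    open Summable (subsetPairs n)

    F : Vec Bool n × Vec Bool n → ℤ
    F (A , B) = guard (cnt A + cnt B ≟ k) (sgn (cnt A) *ᶻ ψ (D A ++ reverse (D B)))

    private
      length-DI : ∀ A B → cnt A + cnt B ≡ k → length (D A ++ reverse (D B)) ≡ k
      length-DI A B eq = trans (ListP.length-++ (D A)) (trans (cong₂ _+_ (length-wd dec A pA) (length-wd inc B pB)) eq)
        where
        pA = ≤-<-trans (m≤m+n (cnt A) (cnt B)) (subst (_< n) (sym eq) k<n)
        pB = ≤-<-trans (m≤n+m (cnt B) (cnt A)) (subst (_< n) (sym eq) k<n)

      module _ (A B : Vec Bool n) (i : Fin n) (start : Start (union A B) i) where
        private
          open LastLetter i
          A' = A [ i ]≔ lookup B i
          B' = B [ i ]≔ lookup A i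
          p = dn (+ toℕ i)
          pAB : mem A p ≡ false × mem B p ≡ false
          pAB = ∨-false (mem A p) (mem B p) (trans (sym (lookup-union A B (resF p))) (proj₂ start))

        sum-cnt : cnt A' + cnt B' ≡ cnt A + cnt B
        sum-cnt = +-cancelʳ-≡ (bit (lookup A i) + bit (lookup B i)) _ _ (trans (lem (cnt A') (cnt B') (bit (lookup A i)) (bit (lookup B i)))
          (trans (cong₂ _+_ (cnt-update A i (lookup B i)) (cnt-update B i (lookup A i))) (lem' (cnt A) (cnt B) (bit (lookup A i)) (bit (lookup B i)))))
          where
          lem : ∀ a b x y → a + b + (x + y) ≡ (a + x) + (b + y)
          lem = solveℕ-∀
          lem' : ∀ a b x y → (a + y) + (b + x) ≡ a + b + (x + y)
          lem' = solveℕ-∀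

        -- If exactly one of the sets contains `i`, the product stays the same and |A| changes by
        -- one. If both contain it, the product contains the square of a generator and both terms
        -- vanish.
        exchange-sign : F (exchange i (A , B)) ≡ negᶻ (F (A , B))
        exchange-sign = trans (trans (guard-⇔ (cnt A' + cnt B' ≟ k) (cnt A + cnt B ≟ k) _ (trans (sym sum-cnt)) (trans sum-cnt))
            (guard-cong (cnt A + cnt B ≟ k) (λ eq → main eq (lookup A i) (lookup B i) refl refl))) (guard-neg (cnt A + cnt B ≟ k) _)
          where
          guard-neg : ∀ {P : Set} (d : Dec P) x → guard d (negᶻ x) ≡ negᶻ (guard d x)
          guard-neg (yes _) x = refl
          guard-neg (no _) x = refl
          words : List ℕ → List ℕ
          words m = reverse (rest A) ++ (m ++ rest B)
          W = D A ++ reverse (D B)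
          W' = D A' ++ reverse (D B')
          q = + toℕ i
          W≈ : W ≈ words (opt (res q) (lookup A i) ++ opt (res q) (lookup B i))
          W≈ = DI-≈ A B (proj₁ pAB) (proj₂ pAB)
          W'≈ : W' ≈ words (opt (res q) (lookup B i) ++ opt (res q) (lookup A i))
          W'≈ = ≈-trans {W'} {reverse (rest A') ++ ((opt (res q) (lookup A' i) ++ opt (res q) (lookup B' i)) ++ rest B')} {words (opt (res q) (lookup B i) ++ opt (res q) (lookup A i))}
            (DI-≈ A' B' (trans (mem-p-update A (lookup B i)) (proj₁ pAB)) (trans (mem-p-update B (lookup A i)) (proj₂ pAB)))
            (≡⇒≈ (cong₂ _++_ (cong reverse (rest-update A (lookup B i))) (cong₂ _++_ (cong₂ (λ x y → opt (res q) x ++ opt (res q) y) (VecP.lookup∘update i A (lookup B i)) (VecP.lookup∘update i B (lookup A i))) (rest-update B (lookup A i)))))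
          one-letter : cnt A + cnt B ≡ k → opt (res q) (lookup B i) ++ opt (res q) (lookup A i) ≡ opt (res q) (lookup A i) ++ opt (res q) (lookup B i) → ψ W' ≡ ψ W
          one-letter eq same = respects W' W (≈-trans {W'} {words (opt (res q) (lookup B i) ++ opt (res q) (lookup A i))} {W} W'≈ (≈-trans {words (opt (res q) (lookup B i) ++ opt (res q) (lookup A i))} {words (opt (res q) (lookup A i) ++ opt (res q) (lookup B i))} {W} (≡⇒≈ (cong words same)) (≈-sym {W} {words (opt (res q) (lookup A i) ++ opt (res q) (lookup B i))} W≈)))
            (trans (length-DI A' B' (trans sum-cnt eq)) (sym (length-DI A B eq)))
          neg-* : ∀ s x → negᶻ s *ᶻ x ≡ negᶻ (s *ᶻ x)
          neg-* s x = sym (ℤP.neg-distribˡ-* s x)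
          main : cnt A + cnt B ≡ k → ∀ a b → lookup A i ≡ a → lookup B i ≡ b → sgn (cnt A') *ᶻ ψ W' ≡ negᶻ (sgn (cnt A) *ᶻ ψ W)
          main eq true false ea eb = trans (cong₂ _*ᶻ_ (sym (trans (cong negᶻ (cong sgn suc-cnt)) (ℤP.neg-involutive _))) (one-letter eq (trans (cong₂ (λ x y → opt (res q) y ++ opt (res q) x) ea eb) (sym (cong₂ (λ x y → opt (res q) x ++ opt (res q) y) ea eb))))) (neg-* (sgn (cnt A)) (ψ W))
            where
            suc-cnt : cnt A ≡ suc (cnt A')
            suc-cnt = trans (sym (+-identityʳ _)) (trans (cong (λ z → cnt A + bit z) (sym eb)) (trans (sym (cnt-update A i (lookup B i))) (trans (cong (λ z → cnt A' + bit z) ea) (+-comm (cnt A') 1))))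
          main eq false true ea eb = trans (cong₂ _*ᶻ_ (cong sgn suc-cnt) (one-letter eq (trans (cong₂ (λ x y → opt (res q) y ++ opt (res q) x) ea eb) (sym (cong₂ (λ x y → opt (res q) x ++ opt (res q) y) ea eb))))) (neg-* (sgn (cnt A)) (ψ W))
            where
            suc-cnt : cnt A' ≡ suc (cnt A)
            suc-cnt = trans (sym (+-identityʳ _)) (trans (cong (λ z → cnt A' + bit z) (sym ea)) (trans (cnt-update A i (lookup B i)) (trans (cong (λ z → cnt A + bit z) eb) (+-comm (cnt A) 1))))
          main eq false false ea eb = ⊥-elim (true≢false (trans (sym (proj₁ start)) (trans (lookup-union A B i) (cong₂ _∨_ ea eb))))
          main eq true true ea eb = trans (zero* (sgn (cnt A')) (ψ W') (vanish W' (not-reduced W' (trans (length-DI A' B' (trans sum-cnt eq)) (sym (length-DI A B eq))) (≈-trans {W'} {words (opt (res q) (lookup B i) ++ opt (res q) (lookup A i))} {words (res q ∷ res q ∷ [])} W'≈ (≡⇒≈ (cong₂ (λ x y → words (opt (res q) y ++ opt (res q) x)) ea eb))))))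
            (cong negᶻ (sym (zero* (sgn (cnt A)) (ψ W) (vanish W (not-reduced W refl (≈-trans {W} {words (opt (res q) (lookup A i) ++ opt (res q) (lookup B i))} {words (res q ∷ res q ∷ [])} W≈ (≡⇒≈ (cong₂ (λ x y → words (opt (res q) x ++ opt (res q) y)) ea eb))))))))
            where
            zero* : ∀ s x → x ≡ + 0 → s *ᶻ x ≡ + 0
            zero* s x z = trans (cong (s *ᶻ_) z) (ℤP.*-zeroʳ s)
            square : words (res q ∷ res q ∷ []) ≈ words []
            square = ++-≈ {reverse (rest A)} {reverse (rest A)} {res q ∷ res q ∷ rest B} {rest B} (λ _ → refl) (λ z → cong (app (rest B)) (sAt-involutive (res q) z))
            length-words : length W ≡ suc (suc (length (words [])))
            length-words = trans (ListP.length-++ (D A)) (trans (cong₂ _+_ lenD (trans (ListP.length-reverse (D B)) lenD')) (trans (lem (length (rest A)) (length (rest B))) (cong (suc ∘ suc) (sym (trans (ListP.length-++ (reverse (rest A))) (cong (ℕ._+ length (rest B)) (ListP.length-reverse (rest A))))))))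
              where
              lem : ∀ a b → suc a + suc b ≡ suc (suc (a + b))
              lem = solveℕ-∀
              lenX : ∀ X → lookup X i ≡ true → mem X p ≡ false → length (D X) ≡ suc (length (rest X))
              lenX X ex pX = trans (length-D X (missing⇒cnt X p pX)) (trans (sym (trans C.length-I (cnt-mem X))) (cong length I≡))
                where
                module C = Cut (mem X) (mem-sh X) p pX
                n≡ : n ≡ suc (suc (n ∸ 2))
                n≡ = sym (m+[n∸m]≡n 1<n)
                I≡ : C.I ≡ res q ∷ rest X
                I≡ = trans (cong₂ (al (mem X)) (up-dn q) (cong (_∸ 1) n≡)) (cong (λ b → if b then res q ∷ rest X else rest X) (trans (cong (lookup X) (resF-toℕ i)) ex))
              lenD = lenX A ea (proj₁ pAB)
              lenD' = lenX B eb (proj₂ pAB)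
            not-reduced : ∀ V → length V ≡ length W → V ≈ words (res q ∷ res q ∷ []) → siz V ≢ length V
            not-reduced V lenV V≈ es = <⇒≱ (≤-trans (n<1+n _) (≤-trans (n≤1+n _) (≤-reflexive (trans (sym length-words) (trans (sym lenV) (sym es))))))
              (≤-trans (≤-reflexive (siz-≈ V (words []) (≈-trans {V} {words (res q ∷ res q ∷ [])} {words []} V≈ square))) (siz≤length (words [])))

      F-toggle : ∀ P → F (toggle P) ≡ negᶻ (F P)
      F-toggle (A , B) = by (start? (union A B))
        where
        by : Dec (∃ (Start (union A B))) → F (toggle (A , B)) ≡ negᶻ (F (A , B))
        by (yes s) = go (toggle-yes A B s)
          where
          go : (∃ λ i → Start (union A B) i × toggle (A , B) ≡ exchange i (A , B) × (∀ A' B' → union A' B' ≡ union A B → toggle (A' , B') ≡ exchange i (A' , B'))) → F (toggle (A , B)) ≡ negᶻ (F (A , B))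
          go (i , start , eq , _) = trans (cong F eq) (exchange-sign A B i start)
        by (no ¬s) = trans (cong F (toggle-no A B ¬s)) (trans F≡0 (cong negᶻ (sym F≡0)))
          where
          -- Here 1 ≤ k < n enters: sets of total size `k` have a union that is neither empty nor
          -- everything, so a start exists.
          impossible : cnt A + cnt B ≡ k → (∀ i → lookup (union A B) i ≡ true) ⊎ (∀ i → lookup (union A B) i ≡ false) → ⊥
          impossible eq (inj₁ all) = <⇒≱ k<n (≤-trans (≤-reflexive (sym (cnt-all (union A B) all))) (≤-trans (cnt-union A B) (≤-reflexive eq)))
          impossible eq (inj₂ none) = <⇒≱ 1≤k (≤-reflexive (trans (sym eq) (cong₂ _+_ (cnt-none A (λ i → proj₁ (both i))) (cnt-none B (λ i → proj₂ (both i))))))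
            where
            both : ∀ i → lookup A i ≡ false × lookup B i ≡ false
            both i = ∨-false (lookup A i) (lookup B i) (trans (sym (lookup-union A B i)) (none i))
          F≡0 : F (A , B) ≡ + 0
          F≡0 = guard-no (cnt A + cnt B ≟ k) _ (λ eq → impossible eq (no-start (union A B) ¬s))

    sum-zero : ∑ F ≡ + 0
    sum-zero = self-neg (∑ F) (trans (sym (∑-involution toggle toggle-involutive F)) (trans (∑-cong F-toggle) neg-sum))
      where
      self-neg : ∀ x → x ≡ negᶻ x → x ≡ + 0
      self-neg (+ zero) _ = refl
      neg-sum : ∑ (λ P → negᶻ (F P)) ≡ negᶻ (∑ F)
      neg-sum = trans (∑-cong (λ P → sym (ℤP.-1*i≡-i (F P)))) (trans (sumB-cong {n} (λ A → sumB-*ˡ {n} (negᶻ (+ 1)) (λ B → F (A , B)))) (trans (sumB-*ˡ {n} (negᶻ (+ 1)) (λ A → sumB {n} (λ B → F (A , B)))) (ℤP.-1*i≡-i _)))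

-- Sums over lists and the enumeration of subsets by `choose`.

sumL : ∀ {X : Set} → (X → ℤ) → List X → ℤ
sumL f [] = + 0
sumL f (x ∷ xs) = f x +ᶻ sumL f xs

sumL-++ : ∀ {X : Set} (f : X → ℤ) xs ys → sumL f (xs ++ ys) ≡ sumL f xs +ᶻ sumL f ys
sumL-++ f [] ys = sym (ℤP.+-identityˡ _)
sumL-++ f (x ∷ xs) ys = trans (cong (f x +ᶻ_) (sumL-++ f xs ys)) (sym (ℤP.+-assoc (f x) _ _))

sumL-cong : ∀ {X : Set} {f g : X → ℤ} xs → All (λ x → f x ≡ g x) xs → sumL f xs ≡ sumL g xs
sumL-cong [] [] = refl
sumL-cong (x ∷ xs) (e ∷ es) = cong₂ _+ᶻ_ e (sumL-cong xs es)

sumL-concatMap : ∀ {X Y : Set} (f : Y → ℤ) (g : X → List Y) xs → sumL f (concatMap g xs) ≡ sumL (λ x → sumL f (g x)) xs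
sumL-concatMap f g [] = refl
sumL-concatMap f g (x ∷ xs) = trans (sumL-++ f (g x) (concatMap g xs)) (cong (sumL f (g x) +ᶻ_) (sumL-concatMap f g xs))

sumL-map : ∀ {X Y : Set} (f : Y → ℤ) (g : X → Y) xs → sumL f (map g xs) ≡ sumL (f ∘ g) xs
sumL-map f g [] = refl
sumL-map f g (x ∷ xs) = cong (f (g x) +ᶻ_) (sumL-map f g xs)

length-filter : ∀ {X : Set} {P : X → Set} (P? : ∀ x → Dec (P x)) xs → + length (filter P? xs) ≡ sumL (λ x → guard (P? x) (+ 1)) xs
length-filter P? [] = refl
length-filter P? (x ∷ xs) with P? x
... | yes p = cong (+ 1 +ᶻ_) (length-filter P? xs)
... | no ¬p = trans (length-filter P? xs) (sym (ℤP.+-identityˡ _))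

sel-empty : ∀ m (f : ℕ → ℕ) → sel (replicate m false) f ≡ []
sel-empty zero f = refl
sel-empty (suc m) f = sel-empty m (f ∘ suc)

module _ (n : ℕ) .{{nz : NonZero n}} where

  sumL-choose : ∀ m k (f : ℕ → ℕ) G → sumL G (choose n k (applyUpTo f m)) ≡ sumB {m} (λ A → guard (cnt A ≟ k) (G (sel A f)))
  sumL-choose m zero f G = trans (trans (cong (sumL G) (choose-zero (applyUpTo f m))) (ℤP.+-identityʳ (G []))) (sym (trans (sumB-empty {m} (λ A → G (sel A f))) (cong G (sel-empty m f))))
    where
    choose-zero : ∀ xs → choose n zero xs ≡ [] ∷ []
    choose-zero [] = refl
    choose-zero (x ∷ xs) = refl
  sumL-choose zero (suc k) f G = refl
  sumL-choose (suc m) (suc k) f G = trans (sumL-++ G (map (f 0 ∷_) (choose n k (applyUpTo (f ∘ suc) m))) _)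
    (cong₂ _+ᶻ_ (trans (sumL-map G (f 0 ∷_) (choose n k (applyUpTo (f ∘ suc) m))) (trans (sumL-choose m k (f ∘ suc) (λ As → G (f 0 ∷ As)))
        (sumB-cong {m} (λ A → guard-⇔ (cnt A ≟ k) (suc (cnt A) ≟ suc k) _ (cong suc) suc-injective))))
      (sumL-choose m (suc k) (f ∘ suc) G))

-- From h's to e's: vanishing, reversal of words and the star automorphism.

module Transfer (n : ℕ) .{{nz : NonZero n}} (3≤n : 3 ≤ n) where

  open Residues n
  open Codes n
  open Moves n
  open Words n 3≤n
  open Group n 3≤n
  open Mirrors n
  open Pairs n 3≤n
  open Functionals n 3≤n

  private
    sumN-sumB : ∀ (F : ℕ → Vec Bool n → ℤ) N → sumN (λ i → sumB {n} (F i)) N ≡ sumB {n} (λ A → sumN (λ i → F i A) N)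
    sumN-sumB F N = sym (sumB-sumN {n} F N)

    collapse : ∀ a b k x → sumN (λ i → sgn i *ᶻ guard (a ≟ k ∸ i) (guard (b ≟ i) x)) (suc k) ≡ guard (b + a ≟ k) (sgn b *ᶻ x)
    collapse a b k x = trans (sumN-cong (suc k) (λ i → trans (cong (sgn i *ᶻ_) (guard-swap (a ≟ k ∸ i) (b ≟ i) x)) (sym (guard-*ˡ (b ≟ i) (sgn i) _)))) (by (b <? suc k))
      where
      g : ℕ → ℤ
      g i = sgn i *ᶻ guard (a ≟ k ∸ i) x
      by : Dec (b < suc k) → sumN (λ i → guard (b ≟ i) (g i)) (suc k) ≡ guard (b + a ≟ k) (sgn b *ᶻ x)
      by (yes b<) = trans (sumN-delta b g (suc k) b<) (trans (sym (guard-*ˡ (a ≟ k ∸ b) (sgn b) x)) (guard-⇔ (a ≟ k ∸ b) (b + a ≟ k) _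
        (λ e → trans (cong (b ℕ.+_) e) (m+[n∸m]≡n (≤-pred b<))) (λ e → trans (sym (ℕP.m+n∸m≡n b a)) (cong (_∸ b) e))))
      by (no b≮) = trans (sumN-none b g (suc k) (≮⇒≥ b≮)) (sym (guard-no (b + a ≟ k) _ (λ e → b≮ (s≤s (≤-trans (m≤m+n b a) (≤-reflexive e))))))

  T-relation : ∀ {ψ} → Nil ψ → ∀ k → 1 ≤ k → k < n → ∀ post → sumN (λ i → sgn i *ᶻ T ((inc , k ∸ i) ∷ (dec , i) ∷ post) ψ) (suc k) ≡ + 0
  T-relation {ψ} N k 1≤k k<n post = trans (sumN-cong (suc k) (λ i → trans (cong (sgn i *ᶻ_) (T-pair inc (k ∸ i) dec i post ψ)) (sym (T-*ˡ post (sgn i) _))))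
    (trans (sym (T-sumN post (λ i W → sgn i *ᶻ pairSum (k ∸ i) i (X W)) (suc k))) (T-0 post (λ W → trans (pairs W) (Relation.sum-zero (Nil-++ˡ N W) k 1≤k k<n))))
    where
    X : List ℕ → Vec Bool n → Vec Bool n → ℤ
    X W A B = ψ (W ++ (D B ++ reverse (D A)))
    spread : ∀ W i → sgn i *ᶻ pairSum (k ∸ i) i (X W) ≡ sumB {n} (λ A → sumB {n} (λ B → sgn i *ᶻ guard (cnt A ≟ k ∸ i) (guard (cnt B ≟ i) (X W A B))))
    spread W i = trans (sym (sumB-*ˡ {n} (sgn i) _)) (sumB-cong {n} (λ A → trans (cong (sgn i *ᶻ_) (sym (sumB-guard {n} (cnt A ≟ k ∸ i) _))) (sym (sumB-*ˡ {n} (sgn i) _))))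
    pairs : ∀ W → sumN (λ i → sgn i *ᶻ pairSum (k ∸ i) i (X W)) (suc k) ≡ Summable.∑ (subsetPairs n) (Relation.F (Nil-++ˡ N W) k 1≤k k<n)
    pairs W = trans (sumN-cong (suc k) (spread W)) (trans (sumN-sumB _ (suc k)) (trans (sumB-cong {n} (λ A → trans (sumN-sumB _ (suc k)) (sumB-cong {n} (λ B → collapse (cnt A) (cnt B) k (X W A B))))) (sumB-swap {n} {n} _)))

  -- revmap [β₁,…,β_t] x applies e_{β_t}(u), …, e_{β₁}(u) in this order and then x.
  revmap : List ℕ → List Op → List Op
  revmap [] x = x
  revmap (k ∷ rs) x = revmap rs ((inc , k) ∷ x)

  revmap-linear : ∀ (xs : ℕ → List Op) (c : ℕ → ℤ) M → (∀ {ψ} → Nil ψ → sumN (λ i → c i *ᶻ T (xs i) ψ) M ≡ + 0) →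
    ∀ rs {ψ} → Nil ψ → sumN (λ i → c i *ᶻ T (revmap rs (xs i)) ψ) M ≡ + 0
  revmap-linear xs c M hyp [] N = hyp N
  revmap-linear xs c M hyp (k ∷ rs) N = revmap-linear (λ i → (inc , k) ∷ xs i) c M hyp' rs N
    where
    sumN-guard : ∀ {P : Set} (d : Dec P) (f : ℕ → ℤ) M → sumN (λ i → guard d (f i)) M ≡ guard d (sumN f M)
    sumN-guard d f zero = sym (guard-0 d refl)
    sumN-guard d f (suc M) = trans (cong (_+ᶻ guard d (f M)) (sumN-guard d f M)) (sym (guard-+ d _ _))
    hyp' : ∀ {ψ} → Nil ψ → sumN (λ i → c i *ᶻ T ((inc , k) ∷ xs i) ψ) M ≡ + 0
    hyp' {ψ} N = trans (sumN-cong M (λ i → trans (sym (sumB-*ˡ {n} (c i) _)) (sumB-cong {n} (λ A → sym (guard-*ˡ (cnt A ≟ k) (c i) _)))))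
      (trans (sumN-sumB _ M) (sumB-0 {n} (λ A → trans (sumN-guard (cnt A ≟ k) _ M) (guard-0 (cnt A ≟ k) (hyp (Nil-++ʳ N (reverse (D A))))))))

  revmap-cong : ∀ {x x'} → (∀ ψ → T x ψ ≡ T x' ψ) → ∀ rs ψ → T (revmap rs x) ψ ≡ T (revmap rs x') ψ
  revmap-cong hyp [] ψ = hyp ψ
  revmap-cong {x} {x'} hyp (k ∷ rs) ψ = revmap-cong {(inc , k) ∷ x} {(inc , k) ∷ x'} (λ ψ → sumB-cong {n} (λ A → cong (guard (cnt A ≟ k)) (hyp _))) rs ψ

  -- e_k(u) = ∑_{i ≥ 1} ± h_i(u) e_{k-i}(u), so a functional killing all products of h's kills all products of e's.
  vanish-inc : ∀ {ψ} → Nil ψ → (∀ γ → All (_< n) γ → T (H γ) ψ ≡ + 0) → ∀ rs → All (_< n) rs → ∀ γ → All (_< n) γ → T (revmap rs (H γ)) ψ ≡ + 0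
  vanish-inc N hyp [] _ γ allγ = hyp γ allγ
  vanish-inc {ψ} N hyp (k ∷ rs) (k<n ∷ all) γ allγ = go (suc k) k (n<1+n k) k<n γ allγ
    where
    go : ∀ m k → k < m → k < n → ∀ γ → All (_< n) γ → T (revmap rs ((inc , k) ∷ H γ)) ψ ≡ + 0
    go (suc m) zero _ _ γ allγ = trans (revmap-cong {(inc , 0) ∷ H γ} {H γ} (T-drop-0 inc (H γ)) rs ψ) (vanish-inc N hyp rs all γ allγ)
    -- The term i = 0 of the relation is the product in question. In the others the e has a smaller
    -- index, and h_i joins the h's directly beside it, so no h has to be moved past an e.
    go (suc m) (suc k) (s≤s k<m) k<n γ allγ = trans (sym first) (trans (sym (ℤP.+-identityʳ _)) (trans (cong (f 0 +ᶻ_) (sym others)) (trans (sym (sumN-head f (suc k)))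
        (revmap-linear (λ i → (inc , suc k ∸ i) ∷ (dec , i) ∷ H γ) sgn (suc (suc k)) (λ N' → T-relation N' (suc k) (s≤s z≤n) k<n (H γ)) rs N))))
      where
      f : ℕ → ℤ
      f i = sgn i *ᶻ T (revmap rs ((inc , suc k ∸ i) ∷ (dec , i) ∷ H γ)) ψ
      first : f 0 ≡ T (revmap rs ((inc , suc k) ∷ H γ)) ψ
      first = trans (ℤP.*-identityˡ _) (revmap-cong {(inc , suc k) ∷ (dec , 0) ∷ H γ} {(inc , suc k) ∷ H γ} (λ ψ → sumB-cong {n} (λ A → cong (guard (cnt A ≟ suc k)) (T-drop-0 dec (H γ) _))) rs ψ)
      others : sumN (f ∘ suc) (suc k) ≡ + 0
      others = sumN-0 (f ∘ suc) (suc k) (λ i i<k → trans (cong (sgn (suc i) *ᶻ_) (go m (k ∸ i) (≤-<-trans (ℕP.m∸n≤m k i) k<m) (≤-<-trans (≤-trans (ℕP.m∸n≤m k i) (n≤1+n k)) k<n) (suc i ∷ γ) (≤-<-trans i<k k<n ∷ allγ))) (ℤP.*-zeroʳ (sgn (suc i))))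

  T-reverse' : ∀ α x ψ → T (revmap α x) ψ ≡ T (H α) (λ W → T x (λ U → ψ (U ++ reverse W)))
  T-reverse' [] x ψ = T-cong x (λ U → cong ψ (sym (ListP.++-identityʳ U)))
  T-reverse' (a ∷ α) x ψ = trans (T-reverse' α ((inc , a) ∷ x) ψ) (trans (T-sumB (H α) {n} (λ A W → guard (cnt A ≟ a) (T x (λ U → ψ ((U ++ reverse (D A)) ++ reverse W)))))
    (sumB-cong {n} (λ A → trans (T-guard (H α) (cnt A ≟ a) _) (cong (guard (cnt A ≟ a)) (T-cong (H α) (λ W → T-cong x (λ U → cong ψ
      (trans (ListP.++-assoc U (reverse (D A)) (reverse W)) (cong (U ++_) (sym (ListP.reverse-++ W (D A))))))))))))

  -- Reversing a product of decreasing words makes every factor increasing and inverts the order of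
  -- the factors.
  T-reverse : ∀ α ψ → T (H α) (ψ ∘ reverse) ≡ T (revmap α []) ψ
  T-reverse α ψ = sym (T-reverse' α [] ψ)

  private
    -- The star automorphism is conjugation by this reflection: it maps the pair i, i + 1 to 1 - i,
    -- -i, which is exchanged by the generator with index -i, that is n - i.
    ρ : ℤ → ℤ
    ρ k = + 1 -ᶻ k

    ρρ : ∀ k → ρ (ρ k) ≡ k
    ρρ k = lem k
      where
      lem : ∀ k → + 1 -ᶻ (+ 1 -ᶻ k) ≡ k
      lem = solve-∀

    σ-res : ∀ i → i < n → ∀ m → (res m ≡ σ n i ℕ.% n → res (negᶻ m) ≡ i ℕ.% n) × (res (negᶻ m) ≡ i ℕ.% n → res m ≡ σ n i ℕ.% n)
    σ-res i i<n m = to , from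
      where
      n-i : + (n ∸ i) ≡ + n -ᶻ + i
      n-i = trans (sym (ℤP.⊖-≥ (<⇒≤ i<n))) (sym (ℤP.m-n≡m⊖n n i))
      σ≡ : σ n i ℕ.% n ≡ res (+ (n ∸ i))
      σ≡ = ℕD.m%n%n≡m%n (n ∸ i) n
      to : res m ≡ σ n i ℕ.% n → res (negᶻ m) ≡ i ℕ.% n
      to e = go (res-diff {m} {+ (n ∸ i)} (trans e σ≡))
        where
        lem : ∀ n i q → negᶻ ((n -ᶻ i) +ᶻ q *ᶻ n) ≡ i +ᶻ (negᶻ (+ 1 +ᶻ q)) *ᶻ n
        lem = solve-∀
        go : (∃ λ q → m ≡ + (n ∸ i) +ᶻ q *ᶻ + n) → res (negᶻ m) ≡ i ℕ.% n
        go (q , eq) = trans (cong res (trans (cong negᶻ (trans eq (cong (_+ᶻ q *ᶻ + n) n-i))) (lem (+ n) (+ i) q))) (res-mult (+ i) (negᶻ (+ 1 +ᶻ q)))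
      from : res (negᶻ m) ≡ i ℕ.% n → res m ≡ σ n i ℕ.% n
      from e = go (res-diff {negᶻ m} {+ i} e)
        where
        lem : ∀ n i q → negᶻ (i +ᶻ q *ᶻ n) ≡ (n -ᶻ i) +ᶻ (negᶻ (+ 1 +ᶻ q)) *ᶻ n
        lem = solve-∀
        go : (∃ λ q → negᶻ m ≡ + i +ᶻ q *ᶻ + n) → res m ≡ σ n i ℕ.% n
        go (q , eq) = trans (cong res (trans (sym (ℤP.neg-involutive m)) (trans (cong negᶻ eq) (trans (lem (+ n) (+ i) q) (cong (_+ᶻ negᶻ (+ 1 +ᶻ q) *ᶻ + n) (sym n-i))))))
          (trans (res-mult (+ (n ∸ i)) (negᶻ (+ 1 +ᶻ q))) (sym σ≡))

    sAt-σ : ∀ i → i < n → ∀ k → sAt n (σ n i) k ≡ ρ (sAt n i (ρ k))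
    sAt-σ i i<n k = subst (λ z → sAt n (σ n i) z ≡ ρ (sAt n i (ρ z))) (up-dn k) (at-up' (dn k))
      where
      ρ-up : ∀ m → ρ (up m) ≡ negᶻ m
      ρ-up m = lem m
        where
        lem : ∀ m → + 1 -ᶻ (m +ᶻ + 1) ≡ negᶻ m
        lem = solve-∀
      neg-up : ∀ m → up (negᶻ (up m)) ≡ negᶻ m
      neg-up m = lem m
        where
        lem : ∀ m → negᶻ (m +ᶻ + 1) +ᶻ + 1 ≡ negᶻ m
        lem = solve-∀
      ρ-up-neg : ∀ m → ρ (up (negᶻ m)) ≡ m
      ρ-up-neg m = lem m
        where
        lem : ∀ m → + 1 -ᶻ (negᶻ m +ᶻ + 1) ≡ m
        lem = solve-∀
      ρ-neg : ∀ m → ρ (negᶻ m) ≡ up m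
      ρ-neg m = lem m
        where
        lem : ∀ m → + 1 -ᶻ negᶻ m ≡ m +ᶻ + 1
        lem = solve-∀
      at-up' : ∀ m → sAt n (σ n i) (up m) ≡ ρ (sAt n i (ρ (up m)))
      at-up' m = by (res (up m) ≟ σ n i ℕ.% n) (res m ≟ σ n i ℕ.% n)
        where
        by : Dec (res (up m) ≡ σ n i ℕ.% n) → Dec (res m ≡ σ n i ℕ.% n) → _
        by (yes p) _ = trans (sAt-in (σ n i) (up m) p) (sym (trans (cong (λ z → ρ (sAt n i z)) (trans (ρ-up m) (sym (neg-up m)))) (trans (cong ρ (sAt-after i (negᶻ (up m)) (proj₁ (σ-res i i<n (up m)) p))) (ρ-neg (up m)))))
        by (no _) (yes p) = trans (sAt-after (σ n i) m p) (sym (trans (cong (λ z → ρ (sAt n i z)) (ρ-up m)) (trans (cong ρ (sAt-in i (negᶻ m) (proj₁ (σ-res i i<n m) p))) (ρ-up-neg m))))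
        by (no ¬p) (no ¬q) = trans (sAt-else (σ n i) m ¬p ¬q) (sym (trans (cong (λ z → ρ (sAt n i z)) (trans (ρ-up m) (sym (neg-up m))))
          (trans (cong ρ (sAt-else i (negᶻ (up m)) (λ e → ¬q (proj₂ (σ-res i i<n m) (trans (cong res (sym (neg-up m))) e))) (λ e → ¬p (proj₂ (σ-res i i<n (up m)) e)))) (trans (cong ρ (neg-up m)) (ρ-neg m)))))

    app-σ : ∀ W → All (_< n) W → ∀ k → app (map (σ n) W) k ≡ ρ (app W (ρ k))
    app-σ [] [] k = sym (ρρ k)
    app-σ (i ∷ W) (i<n ∷ all) k = trans (app-σ W all _) (cong (λ z → ρ (app W z)) (trans (cong ρ (sAt-σ i i<n k)) (ρρ _)))

  σ-≈ : ∀ V W → All (_< n) V → All (_< n) W → V ≈ W → map (σ n) V ≈ map (σ n) W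
  σ-≈ V W allV allW h k = trans (app-σ V allV k) (trans (cong ρ (h (ρ k))) (sym (app-σ W allW k)))

  σ< : ∀ i → σ n i < n
  σ< i = ℕD.m%n<n (n ∸ i) n

  map-σ< : ∀ W → All (_< n) (map (σ n) W)
  map-σ< [] = []
  map-σ< (i ∷ W) = σ< i ∷ map-σ< W

  σσ : ∀ W → All (_< n) W → map (σ n) (map (σ n) W) ≡ W
  σσ [] [] = refl
  σσ (i ∷ W) (i<n ∷ all) = cong₂ _∷_ (letter' i i<n) (σσ W all)
    where
    letter' : ∀ i → i < n → σ n (σ n i) ≡ i
    letter' zero _ = trans (cong (λ z → (n ∸ z) ℕ.% n) (ℕD.n%n≡0 n)) (ℕD.n%n≡0 n)
    letter' (suc i) i<n = trans (cong (λ z → (n ∸ z) ℕ.% n) (ℕD.m<n⇒m%n≡m (ℕP.∸-monoʳ-< (s≤s z≤n) (<⇒≤ i<n)))) (trans (cong (ℕ._% n) (ℕP.m∸[m∸n]≡n (<⇒≤ i<n))) (ℕD.m<n⇒m%n≡m i<n))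

  al< : ∀ a q d → All (_< n) (al a q d)
  al< a q zero = []
  al< a q (suc d) with a q
  ... | true = res<n q ∷ al< a (up q) d
  ... | false = al< a (up q) d

  D< : ∀ A → cnt A < n → All (_< n) (D A)
  D< A p = subst (All (_< n)) (sym (D≡ A p)) (PermP.All-resp-↭ (Perm.↭-sym (PermP.↭-reverse (al (mem A) (up (cut A)) (n ∸ 1)))) (al< (mem A) (up (cut A)) (n ∸ 1)))

  reflect : Vec Bool n → Vec Bool n
  reflect A = mk (λ k → mem A (negᶻ k))

  private
    neg-sh : ∀ A k → mem A (negᶻ (sh k)) ≡ mem A (negᶻ k)
    neg-sh A k = trans (sym (mem-sh A (negᶻ (sh k)))) (cong (mem A) (lem k (+ n)))
      where
      lem : ∀ k m → negᶻ (k +ᶻ m) +ᶻ m ≡ negᶻ k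
      lem = solve-∀

  mem-reflect : ∀ A k → mem (reflect A) k ≡ mem A (negᶻ k)
  mem-reflect A = mem-mk _ (neg-sh A)

  reflect-involutive : ∀ A → reflect (reflect A) ≡ A
  reflect-involutive A = mem-ext _ _ (λ k → trans (mem-reflect (reflect A) k) (trans (mem-reflect A (negᶻ k)) (cong (mem A) (ℤP.neg-involutive k))))

  private
    map-σ-al : ∀ a q d → map (σ n) (reverse (al a q d)) ≡ al (λ k → a (negᶻ k)) (ρ (q ⊕ d)) d
    map-σ-al a q zero = refl
    map-σ-al a q (suc d) = trans (cong (map (σ n) ∘ reverse) (unfold (a q))) (trans (cong (map (σ n)) (ListP.reverse-++ (opt (res q) (a q)) (al a (up q) d)))
      (trans (ListP.map-++ (σ n) (reverse (al a (up q) d)) (reverse (opt (res q) (a q)))) (trans (cong₂ _++_ (map-σ-al a (up q) d) (last (a q) refl)) (sym (al-snoc a' p d)))))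
      where
      a' = λ k → a (negᶻ k)
      p = ρ (up q ⊕ d)
      unfold : ∀ b → (if b then res q ∷ al a (up q) d else al a (up q) d) ≡ opt (res q) b ++ al a (up q) d
      unfold true = refl
      unfold false = refl
      pd : p ⊕ d ≡ negᶻ q
      pd = trans (⊕-+ p d) (trans (cong (λ z → (+ 1 -ᶻ z) +ᶻ + d) (⊕-+ (up q) d)) (lem q (+ d)))
        where
        lem : ∀ q d → (+ 1 -ᶻ ((q +ᶻ + 1) +ᶻ d)) +ᶻ d ≡ negᶻ q
        lem = solve-∀
      a'pd : a' (p ⊕ d) ≡ a q
      a'pd = trans (cong a' pd) (cong a (ℤP.neg-involutive q))
      σ-letter : σ n (res q) ≡ res (p ⊕ d)
      σ-letter = trans (sym (ℕD.m%n%n≡m%n (n ∸ res q) n)) (trans (sym (proj₂ (σ-res (res q) (res<n q) (negᶻ q)) (trans (cong res (ℤP.neg-involutive q)) (sym (res-small (res<n q)))))) (cong res (sym pd)))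
      last : ∀ b → a q ≡ b → map (σ n) (reverse (opt (res q) b)) ≡ (if a' (p ⊕ d) then res (p ⊕ d) ∷ [] else [])
      last true e = trans (cong (_∷ []) σ-letter) (cong (λ b → if b then res (p ⊕ d) ∷ [] else []) (sym (trans a'pd e)))
      last false e = cong (λ b → if b then res (p ⊕ d) ∷ [] else []) (sym (trans a'pd e))

  -- Negating the letters gives an increasing word of -A, cut at minus the original cut; by
  -- `Move-unique` another cut of the same set yields the same element.
  D-σ : ∀ A → cnt A < n → (map (σ n) (D A) ≈ reverse (D (reflect A))) × cnt (reflect A) ≡ cnt A
  D-σ A p = same , cards
    where
    j = cut A
    q = up j
    a' = mem (reflect A)
    j' = dn (ρ (q ⊕ (n ∸ 1)))
    end : q ⊕ (n ∸ 1) ≡ sh j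
    end = trans (cong (j ⊕_) (m+[n∸m]≡n (<⇒≤ 1<n))) (⊕n j)
    missing : a' j' ≡ false
    missing = trans (mem-reflect A j') (trans (cong (mem A) (trans (cong (λ z → negᶻ (dn (ρ z))) end) (lem (sh j)))) (trans (mem-sh A j) (cut-missing A p)))
      where
      lem : ∀ z → negᶻ ((+ 1 -ᶻ z) -ᶻ + 1) ≡ z
      lem = solve-∀
    module C = Cut a' (mem-sh (reflect A)) j' missing
    word : map (σ n) (D A) ≡ C.I
    word = trans (cong (map (σ n)) (D≡ A p)) (trans (map-σ-al (mem A) q (n ∸ 1))
      (trans (cong (λ z → al (λ k → mem A (negᶻ k)) z (n ∸ 1)) (sym (up-dn _))) (al-cong (up j') (n ∸ 1) (λ t _ → sym (mem-reflect A (up j' ⊕ t))))))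
    proper' : cnt (reflect A) < n
    proper' = missing⇒cnt (reflect A) j' missing
    same : map (σ n) (D A) ≈ reverse (D (reflect A))
    same k = trans (cong (λ V → app V k) word) (sym (proj₁ (Move-unique (moveA (reflect A) proper') C.move) k))
    cards : cnt (reflect A) ≡ cnt A
    cards = trans (sym (trans C.length-I (cnt-mem (reflect A)))) (trans (cong length (sym word)) (trans (ListP.length-map (σ n) (D A)) (length-D A p)))

  T-star : ∀ α → All (_< n) α → ∀ {ψ} → Nil ψ → T (H α) (ψ ∘ map (σ n)) ≡ T (map (inc ,_) α) ψ
  T-star [] [] N = refl
  T-star (a ∷ α) (a<n ∷ all) {ψ} N = trans (sumB-cong {n} term) (Summable.∑-involution (subsets n) reflect reflect-involutive Φ)
    where
    Φ : Vec Bool n → ℤ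
    Φ A = guard (cnt A ≟ a) (T (map (inc ,_) α) (λ W → ψ (W ++ reverse (D A))))
    cnt-reflect : ∀ A → cnt A ≡ a → cnt (reflect A) ≡ a
    cnt-reflect A e = trans (proj₂ (D-σ A (subst (_< n) (sym e) a<n))) e
    term : ∀ A → guard (cnt A ≟ a) (T (H α) (λ W → ψ (map (σ n) (W ++ D A)))) ≡ Φ (reflect A)
    term A = trans (guard-cong (cnt A ≟ a) (λ e → inner (subst (_< n) (sym e) a<n)))
      (guard-⇔ (cnt A ≟ a) (cnt (reflect A) ≟ a) _ (cnt-reflect A) (λ e → trans (cong cnt (sym (reflect-involutive A))) (cnt-reflect (reflect A) e)))
      where
      inner : cnt A < n → T (H α) (λ W → ψ (map (σ n) (W ++ D A))) ≡ T (map (inc ,_) α) (λ W → ψ (W ++ reverse (D (reflect A))))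
      inner p = trans (T-cong (H α) (λ W → trans (cong ψ (ListP.map-++ (σ n) W (D A))) (Nil.respects (Nil-++ˡ N (map (σ n) W)) (map (σ n) (D A)) (reverse (D (reflect A))) (proj₁ (D-σ A p))
          (trans (ListP.length-map (σ n) (D A)) (trans (length-D A p) (trans (sym (proj₂ (D-σ A p))) (sym (length-wd inc (reflect A) (subst (_< n) (sym (proj₂ (D-σ A p))) p)))))))))
        (T-star α all (Nil-++ʳ N (reverse (D (reflect A)))))

  map-inc : ∀ α x → revmap (reverse α) x ≡ map (inc ,_) α ++ x
  map-inc α x = trans (go (reverse α) x) (cong (λ β → map (inc ,_) β ++ x) (ListP.reverse-involutive α))
    where
    go : ∀ β x → revmap β x ≡ map (inc ,_) (reverse β) ++ x
    go [] x = refl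
    go (b ∷ β) x = trans (go β ((inc , b) ∷ x)) (sym (trans (cong (λ z → map (inc ,_) z ++ x) (ListP.unfold-reverse b β)) (trans (cong (_++ x) (ListP.map-++ (inc ,_) (reverse β) (b ∷ []))) (ListP.++-assoc (map (inc ,_) (reverse β)) _ x))))

-- The coefficients of F̃_w as values of functionals.

module Coefficients (n : ℕ) .{{nz : NonZero n}} (3≤n : 3 ≤ n) (len : Win n → ℕ) (isLen : IsCoxeterLength n len) where

  open Residues n
  open Codes n
  open Moves n
  open Words n 3≤n
  open Group n 3≤n
  open Length len isLen
  open Mirrors n
  open Pairs n 3≤n
  open Functionals n 3≤n
  open Transfer n 3≤n

  _≟ʷ_ : (v w : Win n) → Dec (v ≡ w)
  _≟ʷ_ = VecP.≡-dec ℤ._≟_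

  -- The dual basis functional of `w`: 1 on its reduced words and 0 on all other words.
  φ : Win n → List ℕ → ℤ
  φ w V = guard ((wordElt n V ≟ʷ w) ×-dec (len w ≟ length V)) (+ 1)

  φ-Nil : ∀ w → Nil (φ w)
  φ-Nil w = record { respects = same ; vanish = zero' }
    where
    same : ∀ V W → V ≈ W → length V ≡ length W → φ w V ≡ φ w W
    same V W V≈W e = guard-⇔ ((wordElt n V ≟ʷ w) ×-dec (len w ≟ length V)) ((wordElt n W ≟ʷ w) ×-dec (len w ≟ length W)) (+ 1)
      (λ p → trans (sym eq) (proj₁ p) , trans (proj₂ p) e) (λ p → trans eq (proj₁ p) , trans (proj₂ p) (sym e))
      where eq = ≈⇒wordElt V W V≈W
    zero' : ∀ V → siz V ≢ length V → φ w V ≡ + 0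
    zero' V ne = guard-no ((wordElt n V ≟ʷ w) ×-dec (len w ≟ length V)) (+ 1) (λ p → ne (trans (sym (L≡siz V)) (trans (cong len (proj₁ p)) (proj₂ p))))

  L-++ : ∀ V W → L (V ++ W) ≤ length V + L W
  L-++ V W = ≤-trans (≤-reflexive (L≡siz (V ++ W))) (≤-trans (siz-++ˡ V W) (+-monoʳ-≤ (length V) (≤-reflexive (sym (L≡siz W)))))

  steps : List ℕ → Win n → Maybe (Win n)
  steps W v = foldr (λ a mv → mv >>= uAct n len a) (just v) W

  private
    uAct-just : ∀ i v → len v < len (leftMul n i v) → uAct n len i v ≡ just (leftMul n i v)
    uAct-just i v lt with len v <? len (leftMul n i v)
    ... | yes _ = refl
    ... | no ≮ = ⊥-elim (≮ lt)

    uAct-nothing : ∀ i v → ¬ (len v < len (leftMul n i v)) → uAct n len i v ≡ nothing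
    uAct-nothing i v ≮ with len v <? len (leftMul n i v)
    ... | yes lt = ⊥-elim (≮ lt)
    ... | no _ = refl

  -- A letter changes the length by at most +1, so the final length is maximal exactly if every
  -- single letter raised it.
  steps-spec : ∀ W U → (L (W ++ U) ≡ length W + L U → steps W (wordElt n U) ≡ just (wordElt n (W ++ U))) ×
                       (L (W ++ U) ≢ length W + L U → steps W (wordElt n U) ≡ nothing)
  steps-spec [] U = (λ _ → refl) , λ ne → ⊥-elim (ne refl)
  steps-spec (i ∷ W) U = good , bad
    where
    ih = steps-spec W U
    bind : ∀ {m m'} → m ≡ m' → (m >>= uAct n len i) ≡ (m' >>= uAct n len i)
    bind refl = refl
    drop : L (i ∷ W ++ U) ≡ suc (length W + L U) → L (W ++ U) ≡ length W + L U
    drop e = ≤-antisym (L-++ W U) (≤-pred (≤-trans (≤-reflexive (sym e)) (L-++ (i ∷ []) (W ++ U))))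
    good : L (i ∷ W ++ U) ≡ suc (length W + L U) → steps (i ∷ W) (wordElt n U) ≡ just (wordElt n (i ∷ W ++ U))
    good e = trans (bind (proj₁ ih (drop e))) (uAct-just i _ (≤-reflexive (trans (cong suc (drop e)) (sym e))))
    bad : L (i ∷ W ++ U) ≢ suc (length W + L U) → steps (i ∷ W) (wordElt n U) ≡ nothing
    bad ne = by (L (W ++ U) ≟ length W + L U)
      where
      by : Dec (L (W ++ U) ≡ length W + L U) → steps (i ∷ W) (wordElt n U) ≡ nothing
      by (no ne') = bind (proj₂ ih ne')
      by (yes e) = trans (bind (proj₁ ih e)) (uAct-nothing i _ (λ lt → ne (≤-antisym (L-++ (i ∷ W) U) (≤-trans (≤-reflexive (cong suc (sym e))) lt))))

  -- The version of `φ` relative to a starting element `v`, needed because the factors act on `v`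
  -- one after the other.
  φ' : Win n → Win n → List ℕ → ℤ
  φ' w v W = guard ((wordAct n W v ≟ʷ w) ×-dec (len w ≟ length W + len v)) (+ 1)

  IsWord : Win n → Set
  IsWord v = ∃ λ U → v ≡ wordElt n U

  private
    maybeZ : (Win n → ℤ) → Maybe (Win n) → ℤ
    maybeZ g = Maybe.maybe g (+ 0)

    sum-maybe : ∀ (g : Win n → ℤ) m → sumL g (Maybe.maybe (_∷ []) [] m) ≡ maybeZ g m
    sum-maybe g (just v) = ℤP.+-identityʳ (g v)
    sum-maybe g nothing = refl

    step-value : ∀ w α v A → cnt A < n → IsWord v → maybeZ (λ v' → T (H α) (φ' w v')) (steps (D A) v) ≡ T (H α) (λ W → φ' w v (W ++ D A))
    step-value w α .(wordElt n U) A p (U , refl) = by (L (D A ++ U) ≟ length (D A) + L U)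
      where
      v = wordElt n U
      by : Dec (L (D A ++ U) ≡ length (D A) + L U) → maybeZ (λ v' → T (H α) (φ' w v')) (steps (D A) v) ≡ T (H α) (λ W → φ' w v (W ++ D A))
      by (yes e) = trans (cong (maybeZ (λ v' → T (H α) (φ' w v'))) (proj₁ (steps-spec (D A) U) e)) (T-cong (H α) (λ W → guard-⇔ _ _ (+ 1)
          (λ q → trans (element W) (proj₁ q) , trans (proj₂ q) (lens W)) (λ q → trans (sym (element W)) (proj₁ q) , trans (proj₂ q) (sym (lens W)))))
        where
        element : ∀ W → wordAct n (W ++ D A) v ≡ wordAct n W (wordElt n (D A ++ U))
        element W = trans (wordAct-++ (W ++ D A) U) (trans (cong (wordElt n) (ListP.++-assoc W (D A) U)) (sym (wordAct-++ W (D A ++ U))))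
        lens : ∀ W → length W + L (D A ++ U) ≡ length (W ++ D A) + L U
        lens W = trans (cong (length W ℕ.+_) e) (trans (sym (+-assoc (length W) _ _)) (cong (ℕ._+ L U) (sym (ListP.length-++ W))))
      by (no ne) = trans (cong (maybeZ (λ v' → T (H α) (φ' w v'))) (proj₂ (steps-spec (D A) U) ne)) (sym (T-0 (H α) (λ W → guard-no _ (+ 1) (impossible W))))
        where
        impossible : ∀ W → ¬ (wordAct n (W ++ D A) v ≡ w × len w ≡ length (W ++ D A) + L U)
        impossible W (q , r) = ne (≤-antisym (L-++ (D A) U) (+-cancelˡ-≤ (length W) _ _
          (≤-trans (≤-reflexive (trans (sym (+-assoc (length W) _ _)) (trans (cong (ℕ._+ L U) (sym (ListP.length-++ W)))
             (trans (sym r) (trans (cong len (sym q)) (cong len (trans (wordAct-++ (W ++ D A) U) (cong (wordElt n) (ListP.++-assoc W (D A) U)))))))))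
            (L-++ W (D A ++ U)))))

  hAct-words : ∀ a vs → All IsWord vs → All IsWord (hAct n len a vs)
  hAct-words a vs all = AllP.concat⁺ (AllP.map⁺ (All.map (λ {v} isW → AllP.concat⁺ (AllP.map⁺ (All.universal (λ A → one v A isW) (choose n a (upTo n))))) all))
    where
    run : ∀ W {v} → IsWord v → ∀ {v'} → steps W v ≡ just v' → IsWord v'
    run [] isW refl = isW
    run (i ∷ W) {v} isW {v'} e with steps W v in eq
    ... | just u with len u <? len (leftMul n i u)
    run (i ∷ W) isW refl | just u | yes _ = i ∷ proj₁ (run W isW eq) , cong (leftMul n i) (proj₂ (run W isW eq))
    one : ∀ v A → IsWord v → All IsWord (Maybe.maybe (_∷ []) [] (uAAct n len A v))
    one v A isW with uAAct n len A v in eq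
    ... | nothing = []
    ... | just v' = run (orderA n A) isW eq ∷ []

  count-T : ∀ w α → All (_< n) α → ∀ vs → All IsWord vs →
    + length (filter (λ v → v ≟ʷ w) (foldl (λ vs a → hAct n len a vs) vs α)) ≡ sumL (λ v → T (H α) (φ' w v)) vs
  count-T w [] [] vs all = trans (length-filter (λ v → v ≟ʷ w) vs) (sumL-cong vs (All.universal (λ v → guard-⇔ (v ≟ʷ w) ((v ≟ʷ w) ×-dec (len w ≟ len v)) (+ 1) (λ e → e , cong len (sym e)) proj₁) vs))
  count-T w (a ∷ α) (a<n ∷ <n) vs all = trans (count-T w α <n (hAct n len a vs) (hAct-words a vs all))
    (trans (sumL-concatMap g _ vs) (sumL-cong vs (All.map (λ {v} isW → one v isW) all)))
    where
    g = λ v → T (H α) (φ' w v)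
    one : ∀ v → IsWord v → sumL g (concatMap (λ A → Maybe.maybe (_∷ []) [] (uAAct n len A v)) (choose n a (upTo n))) ≡ T (H (a ∷ α)) (φ' w v)
    one v isW = trans (sumL-concatMap g (λ A → Maybe.maybe (_∷ []) [] (uAAct n len A v)) (choose n a (upTo n)))
      (trans (sumL-choose n n a id (λ A → sumL g (Maybe.maybe (_∷ []) [] (uAAct n len A v))))
        (sumB-cong {n} (λ A → guard-cong (cnt A ≟ a) (λ e → trans (sum-maybe g (uAAct n len (sel A id) v))
          (trans (cong (λ W → maybeZ g (steps W v)) (sym (D-def A))) (step-value w α v A (subst (_< n) (sym e) a<n) isW))))))

  coefF-T : ∀ w α → All (_< n) α → + coefF n len w α ≡ T (H α) (φ w)
  coefF-T w α <n = trans (count-T w α <n (idW n ∷ []) (([] , refl) ∷ [])) (trans (ℤP.+-identityʳ _)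
    (T-cong (H α) (λ W → guard-⇔ _ _ (+ 1) (λ p → proj₁ p , trans (proj₂ p) (L0 W)) (λ p → proj₁ p , trans (proj₂ p) (sym (L0 W))))))
    where
    L0 : ∀ W → length W + len (idW n) ≡ length W
    L0 W = trans (cong (length W ℕ.+_) (trans (L≡siz []) siz-[])) (+-identityʳ _)

-- Partial sums of conjugate partitions.

cap : ℕ → List ℕ → ℕ
cap k l = sum (map (k ⊓_) l)

count≥ : ℕ → List ℕ → ℕ
count≥ j l = length (filter (λ x → suc j ℕ.≤? x) l)

count≥-∷ : ∀ j x l → count≥ j (x ∷ l) ≡ [ suc j ℕ.≤? x ] + count≥ j l
count≥-∷ j x l = by (suc j ℕ.≤? x)
  where
  by : ∀ (d : Dec (suc j ≤ x)) → count≥ j (x ∷ l) ≡ [ d ] + count≥ j l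
  by (yes p) = cong length (ListP.filter-accept (λ x → suc j ℕ.≤? x) p)
  by (no ¬p) = cong length (ListP.filter-reject (λ x → suc j ℕ.≤? x) ¬p)

⊓-suc : ∀ j x → suc j ⊓ x ≡ [ suc j ℕ.≤? x ] + j ⊓ x
⊓-suc j x = by (suc j ℕ.≤? x)
  where
  by : ∀ (d : Dec (suc j ≤ x)) → suc j ⊓ x ≡ [ d ] + j ⊓ x
  by (yes le) = trans (m≤n⇒m⊓n≡m le) (cong suc (sym (m≤n⇒m⊓n≡m (<⇒≤ le))))
  by (no ≰) = trans (m≥n⇒m⊓n≡n (≤-trans (≤-pred (≰⇒> ≰)) (n≤1+n j))) (sym (m≥n⇒m⊓n≡n (≤-pred (≰⇒> ≰))))

cap-suc : ∀ j l → cap (suc j) l ≡ count≥ j l + cap j l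
cap-suc j [] = refl
cap-suc j (x ∷ l) = trans (cong₂ _+_ (⊓-suc j x) (cap-suc j l)) (trans (lem [ suc j ℕ.≤? x ] (j ⊓ x) (count≥ j l) (cap j l)) (cong (ℕ._+ cap j (x ∷ l)) (sym (count≥-∷ j x l))))
  where
  lem : ∀ d a b c → (d + a) + (b + c) ≡ (d + b) + (a + c)
  lem = solveℕ-∀

cap-0 : ∀ l → cap 0 l ≡ 0
cap-0 [] = refl
cap-0 (x ∷ l) = cap-0 l

cap-≥max : ∀ k l m → foldr _⊔_ 0 l ≤ m → cap (k ⊓ m) l ≡ cap k l
cap-≥max k [] m le = refl
cap-≥max k (x ∷ l) m le = cong₂ _+_ (trans (ℕP.⊓-assoc k m x) (cong (k ⊓_) (m≥n⇒m⊓n≡n (≤-trans (m≤m⊔n x _) le)))) (cap-≥max k l m (≤-trans (m≤n⊔m x _) le))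

-- The part number `j` of the conjugate, counted from 0, is the increment from `cap j` to
-- `cap (suc j)`, so the sum telescopes. Caps beyond the maximum change nothing.
sum-take-conj : ∀ k l → sum (take k (conj l)) ≡ cap k l
sum-take-conj k l = trans (cong (sum ∘ take k) (ListP.map-upTo (λ j → count≥ j l) (foldr _⊔_ 0 l)))
  (trans (trans (sym (trans (cong (sum (take k (applyUpTo (λ j → count≥ j l) m)) ℕ.+_) (cap-0 l)) (+-identityʳ _))) (go k m 0 (λ j → count≥ j l) (λ j → refl))) (cap-≥max k l m ≤-refl))
  where
  m = foldr _⊔_ 0 l
  go : ∀ k m s (f : ℕ → ℕ) → (∀ j → f j ≡ count≥ (s + j) l) → sum (take k (applyUpTo f m)) + cap s l ≡ cap (s + k ⊓ m) l
  go zero m s f h = cong (λ z → cap z l) (sym (+-identityʳ s))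
  go (suc k) zero s f h = cong (λ z → cap z l) (sym (+-identityʳ s))
  go (suc k) (suc m) s f h = trans (lem (f 0) _ (cap s l)) (trans (cong (sum (take k (applyUpTo (f ∘ suc) m)) ℕ.+_) (trans (cong (ℕ._+ cap s l) (trans (h 0) (cong (λ z → count≥ z l) (+-identityʳ s)))) (sym (cap-suc s l))))
    (trans (go k m (suc s) (f ∘ suc) (λ j → trans (h (suc j)) (cong (λ z → count≥ z l) (+-suc s j)))) (cong (λ z → cap z l) (sym (+-suc s (k ⊓ m))))))
    where
    lem : ∀ a b c → a + b + c ≡ b + (a + c)
    lem = solveℕ-∀

cap-insertDesc : ∀ k x l → cap k (insertDesc x l) ≡ k ⊓ x + cap k l
cap-insertDesc k x [] = refl
cap-insertDesc k x (y ∷ l) with y ℕ.≤? x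
... | yes _ = refl
... | no _ = trans (cong (k ⊓ y ℕ.+_) (cap-insertDesc k x l)) (lem (k ⊓ y) (k ⊓ x) (cap k l))
  where
  lem : ∀ a b c → a + (b + c) ≡ b + (a + c)
  lem = solveℕ-∀

cap-sortDesc : ∀ k l → cap k (sortDesc l) ≡ cap k l
cap-sortDesc k [] = refl
cap-sortDesc k (x ∷ l) = trans (cap-insertDesc k x (sortDesc l)) (cong (k ⊓ x ℕ.+_) (cap-sortDesc k l))

cap-filter : ∀ k l → cap k (filter (λ x → 1 ℕ.≤? x) l) ≡ cap k l
cap-filter k [] = refl
cap-filter k (zero ∷ l) = trans (cap-filter k l) (cong (ℕ._+ cap k l) (sym (⊓-zeroʳ k)))
cap-filter k (suc x ∷ l) = cong (k ⊓ suc x ℕ.+_) (cap-filter k l)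

cap-toPartition : ∀ k l → cap k (toPartition l) ≡ cap k l
cap-toPartition k l = trans (cap-filter k (sortDesc l)) (cap-sortDesc k l)

count≥-antitone : ∀ j l → count≥ (suc j) l ≤ count≥ j l
count≥-antitone j [] = z≤n
count≥-antitone j (x ∷ l) = subst₂ _≤_ (sym (count≥-∷ (suc j) x l)) (sym (count≥-∷ j x l)) (+-mono-≤ (by (suc (suc j) ℕ.≤? x)) (count≥-antitone j l))
  where
  by : ∀ (d : Dec (suc (suc j) ≤ x)) → [ d ] ≤ [ suc j ℕ.≤? x ]
  by (yes p) = ≤-reflexive (sym ([]-yes (suc j ℕ.≤? x) (<⇒≤ p)))
  by (no _) = z≤n

count≥-pos : ∀ j l → j < foldr _⊔_ 0 l → 1 ≤ count≥ j l
count≥-pos j (x ∷ l) lt = subst (1 ≤_) (sym (count≥-∷ j x l)) (by (suc j ℕ.≤? x))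
  where
  by : ∀ (d : Dec (suc j ≤ x)) → 1 ≤ [ d ] + count≥ j l
  by (yes _) = s≤s z≤n
  by (no ≰) = count≥-pos j l (≰⇒> (λ le → <⇒≱ lt (ℕP.⊔-lub (≤-pred (≰⇒> ≰)) le)))

conj-Par : ∀ n l → cap 1 l ≤ n ∸ 1 → Par n (conj l)
conj-Par n l le = subst (Par n) (sym (ListP.map-upTo (λ j → count≥ j l) (foldr _⊔_ 0 l)))
  (decreasing (λ j → count≥ j l) (λ j → count≥-antitone j l) (foldr _⊔_ 0 l) , AllP.applyUpTo⁺₁ (λ j → count≥ j l) (foldr _⊔_ 0 l) (λ {j} lt → count≥-pos j l lt , ≤-trans (first j) (≤-trans (≤-reflexive count0) le)))
  where
  decreasing : ∀ f → (∀ j → f (suc j) ≤ f j) → ∀ m → Decreasing (applyUpTo f m)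
  decreasing f h zero = dnil
  decreasing f h (suc zero) = done
  decreasing f h (suc (suc m)) = dcons (h 0) (decreasing (f ∘ suc) (λ j → h (suc j)) (suc m))
  first : ∀ j → count≥ j l ≤ count≥ 0 l
  first zero = ≤-refl
  first (suc j) = ≤-trans (count≥-antitone j l) (first j)
  count0 : count≥ 0 l ≡ cap 1 l
  count0 = sym (trans (cap-suc 0 l) (trans (cong (count≥ 0 l ℕ.+_) (cap-0 l)) (+-identityʳ _)))

-- Positivity of the parts excludes trailing zeros, which partial sums cannot detect.
partial-sums-injective : ∀ l m → All (1 ≤_) l → All (1 ≤_) m → (∀ k → sum (take k l) ≡ sum (take k m)) → l ≡ m
partial-sums-injective [] [] _ _ h = refl
partial-sums-injective [] (y ∷ m) _ (y≥1 ∷ _) h = ⊥-elim (<⇒≱ y≥1 (≤-trans (m≤m+n y 0) (≤-reflexive (sym (h 1)))))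
partial-sums-injective (x ∷ l) [] (x≥1 ∷ _) _ h = ⊥-elim (<⇒≱ x≥1 (≤-trans (m≤m+n x 0) (≤-reflexive (h 1))))
partial-sums-injective (x ∷ l) (y ∷ m) (_ ∷ pl) (_ ∷ pm) h = cong₂ _∷_ x≡y (partial-sums-injective l m pl pm (λ k → ℕP.+-cancelˡ-≡ x _ _ (trans (h (suc k)) (cong (ℕ._+ sum (take k m)) (sym x≡y)))))
  where
  x≡y : x ≡ y
  x≡y = trans (sym (+-identityʳ x)) (trans (h 1) (+-identityʳ y))

length-filter-upTo : ∀ {P : ℕ → Set} (P? : ∀ q → Dec (P q)) f M → length (filter P? (applyUpTo f M)) ≡ Sn (λ q → [ P? (f q) ]) M
length-filter-upTo P? f zero = refl
length-filter-upTo P? f (suc M) = trans (split (P? (f 0)) refl) (sym (Sn-head (λ q → [ P? (f q) ]) M))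
  where
  split : ∀ d → P? (f 0) ≡ d → length (filter P? (f 0 ∷ applyUpTo (f ∘ suc) M)) ≡ [ d ] + Sn (λ q → [ P? (f (suc q)) ]) M
  split (yes p) _ = trans (cong length (ListP.filter-accept P? p)) (cong suc (length-filter-upTo P? (f ∘ suc) M))
  split (no ¬p) _ = trans (cong length (ListP.filter-reject P? ¬p)) (length-filter-upTo P? (f ∘ suc) M)

Sn-extend : ∀ f {M N} → M ≤ N → (∀ q → M ≤ q → f q ≡ 0) → Sn f M ≡ Sn f N
Sn-extend f {M} le h with m≤n⇒∃[o]m+o≡n le
... | o , refl = go o
  where
  go : ∀ o → Sn f M ≡ Sn f (M + o)
  go zero = cong (Sn f) (sym (+-identityʳ M))
  go (suc o) = trans (go o) (trans (sym (trans (cong (Sn f (M + o) ℕ.+_) (h (M + o) (m≤m+n M o))) (+-identityʳ _))) (cong (Sn f) (sym (+-suc M o))))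

sum-tabulate : ∀ {m} (f : Fin m → ℕ) (g : ℤ → ℕ) p → (∀ i → f i ≡ g (p ⊕ toℕ i)) → sum (List.tabulate f) ≡ S g p m
sum-tabulate {zero} f g p h = refl
sum-tabulate {suc m} f g p h = cong₂ _+_ (h Fin.zero) (sum-tabulate (f ∘ Fin.suc) g (up p) (λ i → h (Fin.suc i)))

sum-toList : ∀ {m} (k : ℕ) (v : Vec ℕ m) (g : ℤ → ℕ) p → (∀ i → lookup v i ≡ g (p ⊕ toℕ i)) → sum (map (k ⊓_) (Vec.toList v)) ≡ S (λ x → k ⊓ g x) p m
sum-toList k [] g p h = refl
sum-toList k (x ∷ v) g p h = cong₂ _+_ (cong (k ⊓_) (h Fin.zero)) (sum-toList k v g (up p) (λ i → h (Fin.suc i)))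

-- The partition μ(w) in terms of the code of a word.

module Shape (n : ℕ) .{{nz : NonZero n}} (3≤n : 3 ≤ n) where

  open Residues n
  open Codes n
  open Moves n
  open Words n 3≤n
  open Group n 3≤n

  module _ (W : List ℕ) (i : Fin n) where
    private
      v = inv n (wordElt n W)
      y = app W

      lookup-v : ∀ r → lookup v r ≡ y (pos r)
      lookup-v r = trans (cong (λ z → lookup z r) (inv-wordElt W)) (trans (lookup-wordElt (reverse W) r) (cong (λ V → app V (pos r)) (ListP.reverse-involutive W)))

      P? : ∀ r q → Dec (pos i <ᶻ pos r +ᶻ + q *ᶻ + n × lookup v r +ᶻ + q *ᶻ + n <ᶻ lookup v i)
      P? r q = (pos i ℤ.<? pos r +ᶻ + q *ᶻ + n) ×-dec (lookup v r +ᶻ + q *ᶻ + n ℤ.<? lookup v i)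

      G : ℤ → ℕ
      G m = [ (pos i ℤ.<? m) ×-dec (y m ℤ.<? y (pos i)) ]

      G-P : ∀ r q → [ P? r q ] ≡ G (pos r +ᶻ + q *ᶻ + n)
      G-P r q = []-⇔ (P? r q) ((pos i ℤ.<? m) ×-dec (y m ℤ.<? y (pos i)))
        (λ { (a , b) → a , subst₂ _<ᶻ_ (trans (cong (_+ᶻ + q *ᶻ + n) (lookup-v r)) (sym (app-mult W (pos r) (+ q)))) (lookup-v i) b })
        (λ { (a , b) → a , subst₂ _<ᶻ_ (sym (trans (cong (_+ᶻ + q *ᶻ + n) (lookup-v r)) (sym (app-mult W (pos r) (+ q))))) (sym (lookup-v i)) b })
        where m = pos r +ᶻ + q *ᶻ + n

      M : Fin n → ℕ
      M r = ℤ.∣ lookup v i -ᶻ lookup v r ∣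

      q≤q*n : ∀ q → q ≤ q * n
      q≤q*n q = ℕP.m≤m*n q n

      beyond-M : ∀ r q → M r ≤ q → [ P? r q ] ≡ 0
      beyond-M r q le = []-no (P? r q) (λ { (_ , lt) → ℤP.<⇒≱ lt
        (subst (_≤ᶻ lookup v r +ᶻ + q *ᶻ + n) (lem (lookup v i) (lookup v r)) (ℤP.+-monoʳ-≤ (lookup v r)
          (ℤP.≤-trans (i≤+∣i∣ (lookup v i -ᶻ lookup v r)) (ℤP.≤-trans (ℤ.+≤+ (≤-trans le (q≤q*n q))) (ℤP.≤-reflexive (ℤP.pos-* q n)))))) })
        where
        lem : ∀ a b → b +ᶻ (a -ᶻ b) ≡ a
        lem = solve-∀
        i≤+∣i∣ : ∀ i → i ≤ᶻ + ℤ.∣ i ∣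
        i≤+∣i∣ (+ m) = ℤP.≤-refl
        i≤+∣i∣ -[1+ m ] = ℤ.-≤+

      -- One period more than the bound: the first one contains `i` and is cut off at `i`, and the
      -- remaining periods still cover the bound.
      Q : ℕ
      Q = suc (bound W)

      beyond-Q : ∀ r q → Q ≤ q → [ P? r q ] ≡ 0
      beyond-Q r (suc q) (s≤s le) = []-no (P? r (suc q)) (λ { (_ , lt) → ℤP.<-asym
          (subst₂ _<ᶻ_ (lookup-v' r) (lookup-v i) lt)
          (subst (λ z → y (pos i) <ᶻ y z) offset (Aff.bnd (affine W) (pos i) (suc (toℕ r) + ((n ∸ suc (toℕ i)) + q * n)) (≤-trans le (≤-trans (q≤q*n q) (≤-trans (m≤n+m (q * n) (n ∸ suc (toℕ i))) (m≤n+m _ (suc (toℕ r)))))))) })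
        where
        lookup-v' : ∀ r → lookup v r +ᶻ + suc q *ᶻ + n ≡ y (pos r +ᶻ + suc q *ᶻ + n)
        lookup-v' r = trans (cong (_+ᶻ + suc q *ᶻ + n) (lookup-v r)) (sym (app-mult W (pos r) (+ suc q)))
        lem : ∀ i r a b → i +ᶻ (r +ᶻ (a +ᶻ b)) ≡ r +ᶻ ((i +ᶻ a) +ᶻ b)
        lem = solve-∀
        offset : pos i ⊕ (suc (toℕ r) + ((n ∸ suc (toℕ i)) + q * n)) ≡ pos r +ᶻ + suc q *ᶻ + n
        offset = trans (⊕-+ (pos i) _) (trans (lem (pos i) (pos r) (+ (n ∸ suc (toℕ i))) (+ (q * n))) (cong (pos r +ᶻ_)
          (trans (cong (λ z → + z +ᶻ + (q * n)) (m+[n∸m]≡n (FinP.toℕ<n i))) (ℤP.pos-* (suc q) n))))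

      S-shift' : ∀ f s p N → S (λ x → f (x +ᶻ s)) p N ≡ S f (p +ᶻ s) N
      S-shift' f s p zero = refl
      S-shift' f s p (suc N) = cong (f (p +ᶻ s) ℕ.+_) (trans (S-shift' f s (up p) N) (cong (λ z → S f z N) (lem p s)))
        where
        lem : ∀ p s → (p +ᶻ + 1) +ᶻ s ≡ (p +ᶻ s) +ᶻ + 1
        lem = solve-∀

      blocks : ∀ K → Sn (λ q → S (λ x → G (x +ᶻ + q *ᶻ + n)) (+ 1) n) K ≡ S G (+ 1) (K * n)
      blocks zero = refl
      blocks (suc K) = trans (cong₂ _+_ (blocks K) (trans (S-shift' G (+ K *ᶻ + n) (+ 1) n) (cong (λ z → S G z n) (trans (cong (+ 1 +ᶻ_) (sym (ℤP.pos-* K n))) (sym (⊕-+ (+ 1) (K * n)))))))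
        (trans (sym (S-++ G (+ 1) (K * n) n)) (cong (S G (+ 1)) (+-comm (K * n) n)))

      countR : Fin n → ℕ
      countR r = length (filter (P? r) (upTo (M r)))

      countR-Q : ∀ r → countR r ≡ Sn (λ q → G (pos r +ᶻ + q *ᶻ + n)) Q
      countR-Q r = trans (length-filter-upTo (P? r) id (M r)) (trans (Sn-extend (λ q → [ P? r q ]) (m≤m⊔n (M r) Q) (beyond-M r))
        (trans (sym (Sn-extend (λ q → [ P? r q ]) (m≤n⊔m (M r) Q) (beyond-Q r))) (Sn-cong Q (λ q _ → G-P r q))))

      s : ℕ
      s = suc (toℕ i)

      R : ℕ
      R = (n ∸ s) + bound W * n

      Qn : Q * n ≡ s + R
      Qn = trans (cong (ℕ._+ bound W * n) (sym (m+[n∸m]≡n (FinP.toℕ<n i)))) (+-assoc s (n ∸ s) _)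

      window : S G (+ 1) (Q * n) ≡ code' R y (pos i)
      window = trans (cong (S G (+ 1)) Qn) (trans (S-++ G (+ 1) s R) (trans (cong (ℕ._+ S G (+ 1 ⊕ s) R) (S-zero G (+ 1) s early))
          (trans (cong (λ z → S G z R) (trans (⊕-+ (+ 1) s) (trans (ℤP.+-comm (+ 1) (+ s)) refl))) (S-cong< (up (pos i)) R late))))
        where
        early : ∀ t → t < s → G (+ 1 ⊕ t) ≡ 0
        early t (s≤s t≤i) = []-no ((pos i ℤ.<? (+ 1 ⊕ t)) ×-dec (y (+ 1 ⊕ t) ℤ.<? y (pos i))) (λ { (lt , _) → ℤP.<⇒≱ lt (ℤP.≤-trans (ℤP.≤-reflexive (⊕-+ (+ 1) t)) (ℤ.+≤+ (s≤s t≤i))) })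
        late : ∀ t → t < R → G (up (pos i) ⊕ t) ≡ β y (pos i) (up (pos i) ⊕ t)
        late t _ = []-⇔ ((pos i ℤ.<? (up (pos i) ⊕ t)) ×-dec (y (up (pos i) ⊕ t) ℤ.<? y (pos i))) (y (up (pos i) ⊕ t) ℤ.<? y (pos i)) proj₂ (λ lt → k<k⊕ (pos i) t , lt)

    -- The definition lists later positions as r + q n with a range for q that depends on r. Both
    -- this range and the common range `Q` discard only zero terms, the double sum over `Q` periods
    -- is one sum over consecutive positions, and the positions up to `i` contribute nothing.
    codeAt-cd : codeAt n v i ≡ cd W (pos i)
    codeAt-cd = trans (cong sum (ListP.map-cong {f = _} {g = countR} (λ r → refl) (List.allFin n)))
      (trans (cong sum (ListP.map-tabulate id countR)) (trans (sum-tabulate countR (λ x → Sn (λ q → G (x +ᶻ + q *ᶻ + n)) Q) (+ 1) (λ r → trans (countR-Q r) (cong (λ z → Sn (λ q → G (z +ᶻ + q *ᶻ + n)) Q) (pos-⊕ r))))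
        (trans (Sn-S-swap (λ x q → G (x +ᶻ + q *ᶻ + n)) (+ 1) n Q) (trans (blocks Q) (trans window (cd-N W R (≤-trans (q≤q*n (bound W)) (m≤n+m _ (n ∸ s))) (pos i)))))))

  cap-code : ∀ k W → cap k (code n (inv n (wordElt n W))) ≡ par k W
  cap-code k W = trans (sum-toList k (tabulate (codeAt n (inv n (wordElt n W)))) (cd W) (+ 1) (λ i → trans (VecP.lookup∘tabulate (codeAt n (inv n (wordElt n W))) i) (trans (codeAt-cd W i) (cong (cd W) (pos-⊕ i)))))
    (S-per (λ x → k ⊓ cd W x) (λ x → cong (k ⊓_) (cd-sh W x)) (+ 1) (+ 0))

  μ-partial : ∀ k W → sum (take k (μ n (wordElt n W))) ≡ par k W
  μ-partial k W = trans (sum-take-conj k (toPartition (code n (inv n (wordElt n W))))) (trans (cap-toPartition k (code n (inv n (wordElt n W)))) (cap-code k W))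

  par-1 : ∀ W → par 1 W ≡ cnt (supp W)
  par-1 W = trans (S-cong (λ k → trans (one (cd W k)) (cong bit (sym (mem-supp W k)))) (+ 0) n) (cnt-mem (supp W))
    where
    one : ∀ c → 1 ⊓ c ≡ bit (nonzero c)
    one zero = refl
    one (suc c) = refl

  μ-Par : ∀ W → Par n (μ n (wordElt n W))
  μ-Par W = conj-Par n (toPartition (code n (inv n (wordElt n W)))) (≤-trans (≤-reflexive (trans (cap-toPartition 1 (code n (inv n (wordElt n W)))) (trans (cap-code 1 W) (par-1 W)))) (≤-pred (≤-trans (supp-proper W) (≤-reflexive (sym (m+[n∸m]≡n (<⇒≤ 1<n)))))))

-- Single surviving terms, subsets of equal size, and monotone sequences.

sumB-nonzero : ∀ {m} (F : Vec Bool m → ℤ) → sumB F ≢ + 0 → ∃ λ A → F A ≢ + 0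
sumB-nonzero {zero} F ne = [] , ne
sumB-nonzero {suc m} F ne = by (sumB (λ A → F (true ∷ A)) ℤ.≟ + 0)
  where
  by : Dec (sumB (λ A → F (true ∷ A)) ≡ + 0) → ∃ λ A → F A ≢ + 0
  by (no ne₁) = true ∷ proj₁ r , proj₂ r
    where r = sumB-nonzero (λ A → F (true ∷ A)) ne₁
  by (yes e) = false ∷ proj₁ r , proj₂ r
    where r = sumB-nonzero (λ A → F (false ∷ A)) (λ e' → ne (cong₂ _+ᶻ_ e e'))

sumB-single : ∀ {m} (A₀ : Vec Bool m) (F : Vec Bool m → ℤ) → (∀ A → A ≢ A₀ → F A ≡ + 0) → sumB F ≡ F A₀
sumB-single {m} A₀ F h = trans (sumB-cong {m} only) (sumB-delta A₀ (λ A → VecP.≡-dec Bool._≟_ A A₀) F)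
  where
  only : ∀ A → F A ≡ guard (VecP.≡-dec Bool._≟_ A A₀) (F A)
  only A = by (VecP.≡-dec Bool._≟_ A A₀)
    where
    by : ∀ (d : Dec (A ≡ A₀)) → F A ≡ guard d (F A)
    by (yes _) = refl
    by (no ne) = h A ne

guard-nonzero : ∀ {P : Set} (d : Dec P) {x} → guard d x ≢ + 0 → P × x ≢ + 0
guard-nonzero (yes p) ne = p , ne
guard-nonzero (no _) ne = ⊥-elim (ne refl)

cnt-⊆ : ∀ {m} (A B : Vec Bool m) → (∀ i → lookup A i ≡ true → lookup B i ≡ true) → cnt B ≤ cnt A → A ≡ B
cnt-⊆ [] [] h le = refl
cnt-⊆ (true ∷ A) (b ∷ B) h le with h Fin.zero refl
cnt-⊆ (true ∷ A) (.true ∷ B) h le | refl = cong (true ∷_) (cnt-⊆ A B (λ i → h (Fin.suc i)) (≤-pred le))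
cnt-⊆ (false ∷ A) (false ∷ B) h le = cong (false ∷_) (cnt-⊆ A B (λ i → h (Fin.suc i)) le)
cnt-⊆ (false ∷ A) (true ∷ B) h le = ⊥-elim (<⇒≱ le (cnt-mono A B (λ i → h (Fin.suc i))))
  where
  cnt-mono : ∀ {m} (A B : Vec Bool m) → (∀ i → lookup A i ≡ true → lookup B i ≡ true) → cnt A ≤ cnt B
  cnt-mono [] [] h = z≤n
  cnt-mono (a ∷ A) (b ∷ B) h = +-mono-≤ (bits a b (h Fin.zero)) (cnt-mono A B (λ i → h (Fin.suc i)))
    where
    bits : ∀ a b → (a ≡ true → b ≡ true) → bit a ≤ bit b
    bits false b _ = z≤n
    bits true b h = ≤-reflexive (cong bit (sym (h refl)))

-- The truncated sum stops growing once the cap reaches the largest entry, which stands last. So the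
-- last entries agree, and removing them leaves the same situation.
increasing-unique : ∀ (f g : ℤ → ℕ) p N → (∀ t → suc t < N → f (p ⊕ t) ≤ f (p ⊕ suc t)) → (∀ t → suc t < N → g (p ⊕ t) ≤ g (p ⊕ suc t)) →
  (∀ k → S (λ x → k ⊓ f x) p N ≡ S (λ x → k ⊓ g x) p N) → ∀ t → t < N → f (p ⊕ t) ≡ g (p ⊕ t)
increasing-unique f g p zero _ _ _ t ()
increasing-unique f g p (suc N) mf mg h t t<N = by (t ≟ N)
  where
  below-last : ∀ (f : ℤ → ℕ) → (∀ t → suc t < suc N → f (p ⊕ t) ≤ f (p ⊕ suc t)) → ∀ t → t < suc N → f (p ⊕ t) ≤ f (p ⊕ N)
  below-last f mf t lt with m≤n⇒∃[o]m+o≡n (≤-pred lt)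
  ... | o , e = go o t e
    where
    go : ∀ o t → t + o ≡ N → f (p ⊕ t) ≤ f (p ⊕ N)
    go zero t e = ≤-reflexive (cong (λ z → f (p ⊕ z)) (trans (sym (+-identityʳ t)) e))
    go (suc o) t e = ≤-trans (mf t (s≤s (≤-trans (s≤s (m≤m+n t o)) (≤-reflexive (trans (sym (+-suc t o)) e))))) (go o (suc t) (trans (sym (+-suc t o)) e))
  dominated : ∀ (f g : ℤ → ℕ) → (∀ t → t < suc N → f (p ⊕ t) ≤ f (p ⊕ N)) → (∀ k → S (λ x → k ⊓ f x) p (suc N) ≡ S (λ x → k ⊓ g x) p (suc N)) → g (p ⊕ N) ≤ f (p ⊕ N)
  dominated f g top h = ≮⇒≥ (λ lt → <⇒≱ (≤-reflexive (sym (m≤n⇒m⊓n≡m lt)))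
      (≤-trans (S-tight (λ x → ℕP.⊓-monoˡ-≤ (g x) (n≤1+n F)) p (suc N) (≤-reflexive same) N (n<1+n N)) (ℕP.m⊓n≤m F _)))
    where
    F = f (p ⊕ N)
    same : S (λ x → suc F ⊓ g x) p (suc N) ≡ S (λ x → F ⊓ g x) p (suc N)
    same = trans (sym (h (suc F))) (trans (S-cong< p (suc N) (λ t lt → trans (m≥n⇒m⊓n≡n (≤-trans (top t lt) (n≤1+n F))) (sym (m≥n⇒m⊓n≡n (top t lt))))) (h F))
  last : f (p ⊕ N) ≡ g (p ⊕ N)
  last = ≤-antisym (dominated g f (below-last g mg) (λ k → sym (h k))) (dominated f g (below-last f mf) h)
  h' : ∀ k → S (λ x → k ⊓ f x) p N ≡ S (λ x → k ⊓ g x) p N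
  h' k = +-cancelʳ-≡ (k ⊓ f (p ⊕ N)) _ _ (trans (sym (S-snoc (λ x → k ⊓ f x) p N)) (trans (h k) (trans (S-snoc (λ x → k ⊓ g x) p N) (cong (λ z → S (λ x → k ⊓ g x) p N + k ⊓ z) (sym last)))))
  by : Dec (t ≡ N) → f (p ⊕ t) ≡ g (p ⊕ t)
  by (yes refl) = last
  by (no ne) = increasing-unique f g p N (λ t lt → mf t (m<n⇒m<1+n lt)) (λ t lt → mg t (m<n⇒m<1+n lt)) h' t (≤∧≢⇒< (≤-pred t<N) ne)

-- The leading monomial of F̃_w, and Grassmannian elements.

module Leading (n : ℕ) .{{nz : NonZero n}} (3≤n : 3 ≤ n) (len : Win n → ℕ) (isLen : IsCoxeterLength n len) where

  open Residues n
  open Codes n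
  open Moves n
  open Words n 3≤n
  open Group n 3≤n
  open Length len isLen
  open Mirrors n
  open Pairs n 3≤n
  open Functionals n 3≤n
  open Transfer n 3≤n
  open Coefficients n 3≤n len isLen
  open Shape n 3≤n

  wordH : List (Vec Bool n) → List ℕ
  wordH [] = []
  wordH (A ∷ As) = wordH As ++ D A

  T-nonzero : ∀ α ψ → T (H α) ψ ≢ + 0 → ∃ λ As → map cnt As ≡ α × ψ (wordH As) ≢ + 0
  T-nonzero [] ψ ne = [] , refl , ne
  T-nonzero (a ∷ α) ψ ne = one (sumB-nonzero {n} _ ne)
    where
    one : (∃ λ A → guard (cnt A ≟ a) (T (H α) (λ W → ψ (W ++ D A))) ≢ + 0) → ∃ λ As → map cnt As ≡ a ∷ α × ψ (wordH As) ≢ + 0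
    one (A , ne') = rest (T-nonzero α (λ W → ψ (W ++ D A)) (proj₂ (guard-nonzero (cnt A ≟ a) ne')))
      where
      rest : (∃ λ As → map cnt As ≡ α × ψ (wordH As ++ D A) ≢ + 0) → ∃ λ As → map cnt As ≡ a ∷ α × ψ (wordH As) ≢ + 0
      rest (As , e , ne'') = A ∷ As , cong₂ _∷_ (proj₁ (guard-nonzero (cnt A ≟ a) ne')) e , ne''

  length-wordH : ∀ As → All (_< n) (map cnt As) → length (wordH As) ≡ sum (map cnt As)
  length-wordH [] [] = refl
  length-wordH (A ∷ As) (p ∷ ps) = trans (ListP.length-++ (wordH As)) (trans (cong₂ _+_ (length-wordH As ps) (length-D A p)) (+-comm _ (cnt A)))

  -- Each factor raises any entry of the code by at most one.
  chain-bound : ∀ As → All (_< n) (map cnt As) → ∀ V → siz (wordH As ++ V) ≡ length (wordH As) + siz V →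
    ∀ k j → par j V + sum (take k (map cnt As)) ≤ par (k + j) (wordH As ++ V)
  chain-bound [] [] V _ zero j = ≤-reflexive (+-identityʳ _)
  chain-bound [] [] V _ (suc k) j = ≤-trans (≤-reflexive (+-identityʳ _)) (S-mono (λ x → ℕP.⊓-monoˡ-≤ (cd V x) (m≤n+m j (suc k))) (+ 0) n)
  chain-bound (A ∷ As) (p ∷ ps) V e k j = subst (par j V + sum (take k (cnt A ∷ map cnt As)) ≤_) (sym (par-≈ (k + j) ((wordH As ++ D A) ++ V) (wordH As ++ V') assoc)) (by k)
    where
    V' = D A ++ V
    assoc : (wordH As ++ D A) ++ V ≈ wordH As ++ V'
    assoc = ≡⇒≈ (ListP.++-assoc (wordH As) (D A) V)
    e' : siz (wordH As ++ V') ≡ length (wordH As) + (length (D A) + siz V)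
    e' = trans (sym (siz-≈ ((wordH As ++ D A) ++ V) (wordH As ++ V') assoc)) (trans e (trans (cong (ℕ._+ siz V) (ListP.length-++ (wordH As))) (+-assoc (length (wordH As)) _ _)))
    sizV' : siz V' ≡ length (D A) + siz V
    sizV' = ≤-antisym (siz-++ˡ (D A) V) (+-cancelˡ-≤ (length (wordH As)) _ _ (≤-trans (≤-reflexive (sym e')) (siz-++ˡ (wordH As) V')))
    module St = Step (moveA A p) V V' (app-++ (D A) V)
    valid : Valid (moveA A p) (app V')
    valid = St.siz-tight (≤-reflexive (trans (+-comm (siz V) _) (trans (cong (ℕ._+ siz V) (trans (cnt-mem A) (sym (length-D A p)))) (sym sizV'))))
    ih = chain-bound As ps V' (trans e' (cong (length (wordH As) ℕ.+_) (sym sizV')))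
    by : ∀ k → par j V + sum (take k (cnt A ∷ map cnt As)) ≤ par (k + j) (wordH As ++ V')
    by zero = ≤-trans (+-monoˡ-≤ 0 (St.par-mono valid j)) (ih 0 j)
    by (suc k) = ≤-trans (≤-reflexive (sym (+-assoc (par j V) (cnt A) _))) (≤-trans (+-monoˡ-≤ _ (≤-trans (≤-reflexive (cong (par j V ℕ.+_) (sym (cnt-mem A)))) (St.par-step valid j)))
      (subst (λ z → par (suc j) V' + sum (take k (map cnt As)) ≤ par z (wordH As ++ V')) (+-suc k j) (ih k (suc j))))

  module _ (W : List ℕ) where
    private
      w = wordElt n W

    φ-nonzero : ∀ V → φ w V ≢ + 0 → V ≈ W × siz V ≡ length V
    φ-nonzero V ne = wordElt⇒≈ V W (proj₁ p) , trans (sym (L≡siz V)) (trans (cong len (proj₁ p)) (proj₂ p))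
      where p = proj₁ (guard-nonzero ((wordElt n V ≟ʷ w) ×-dec (len w ≟ length V)) ne)

    support-bound : ∀ α → All (_< n) α → T (H α) (φ w) ≢ + 0 → sum α ≡ siz W × (∀ k → sum (take k α) ≤ par k W)
    support-bound α <n ne = conclude (T-nonzero α (φ w) ne)
      where
      conclude : (∃ λ As → map cnt As ≡ α × φ w (wordH As) ≢ + 0) → sum α ≡ siz W × (∀ k → sum (take k α) ≤ par k W)
      conclude (As , refl , ne') = trans (sym (length-wordH As <n)) (trans (sym red) (siz-≈ (wordH As) W ≈W)) , bounds
        where
        ≈W = proj₁ (φ-nonzero (wordH As) ne')
        red = proj₂ (φ-nonzero (wordH As) ne')
        ≈W' : wordH As ++ [] ≈ W
        ≈W' k = trans (cong (λ V → app V k) (ListP.++-identityʳ (wordH As))) (≈W k)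
        bounds : ∀ k → sum (take k (map cnt As)) ≤ par k W
        bounds k = ≤-trans (m≤n+m _ (par 0 [])) (≤-trans (chain-bound As <n [] (trans (cong siz (ListP.++-identityʳ (wordH As))) (trans red (trans (sym (+-identityʳ _)) (cong (length (wordH As) ℕ.+_) (sym siz-[]))))) k 0)
          (≤-reflexive (trans (par-≈ (k + 0) (wordH As ++ []) W ≈W') (cong (λ z → par z W) (+-identityʳ k)))))

    private
      A₀ = supp W
      V₀ = back A₀ W

    -- Removing the support takes one from every nonzero entry, and `suc j ⊓ suc v` is
    -- `suc (j ⊓ v)`.
    par-suc : ∀ j → par (suc j) W ≡ cnt A₀ + par j V₀
    par-suc j = trans (S-cong (λ k → trans (trans (entry (cd W k) (cd V₀ (app (D A₀) k)) (cd-back-supp W k)) (cong (λ b → bit b + j ⊓ cd V₀ (app (D A₀) k)) (sym (mem-supp W k)))) refl) (+ 0) n)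
      (trans (S-distrib-+ (bit ∘ mem A₀) (λ k → j ⊓ cd V₀ (app (D A₀) k)) (+ 0) n) (cong₂ _+_ (cnt-mem A₀)
        (Move.S-∘e (moveA A₀ (supp-proper W)) (λ k → j ⊓ cd V₀ k) (λ k → cong (j ⊓_) (cd-sh V₀ k)) (+ 0))))
      where
      entry : ∀ c v → c ≡ v + bit (nonzero c) → suc j ⊓ c ≡ bit (nonzero c) + j ⊓ v
      entry zero v e = sym (trans (cong (j ⊓_) (ℕP.m+n≡0⇒m≡0 v (sym e))) (⊓-zeroʳ j))
      entry (suc c) v e = cong (λ z → suc (j ⊓ z)) (suc-injective (trans e (+-comm v 1)))

    -- The two partitions have the same partial sums by `par-suc`: the support of the code accounts
    -- for the first part of μ(w).
    μ-step : ∀ m → cnt A₀ ≡ suc m → μ n w ≡ cnt A₀ ∷ μ n (wordElt n V₀)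
    μ-step m e = partial-sums-injective _ _ (All.map proj₁ (proj₂ (μ-Par W))) (subst (1 ≤_) (sym e) (s≤s z≤n) ∷ All.map proj₁ (proj₂ (μ-Par V₀))) same
      where
      same : ∀ k → sum (take k (μ n w)) ≡ sum (take k (cnt A₀ ∷ μ n (wordElt n V₀)))
      same zero = refl
      same (suc k) = trans (μ-partial (suc k) W) (trans (par-suc k) (cong (cnt A₀ ℕ.+_) (sym (μ-partial k V₀))))

    μ-zero : cnt A₀ ≡ 0 → μ n w ≡ []
    μ-zero e = partial-sums-injective _ [] (All.map proj₁ (proj₂ (μ-Par W))) [] (λ k → trans (μ-partial k W) (trans (S-zero _ (+ 0) n (λ t _ → trans (cong (k ⊓_) (cnt-supp-zero W e (+ 0 ⊕ t))) (⊓-zeroʳ k))) (sym (sum-take-[] k))))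
      where
      sum-take-[] : ∀ k → sum (take k []) ≡ 0
      sum-take-[] zero = refl
      sum-take-[] (suc k) = refl

    -- The last factor of a decomposition of type (…, |A₀|) must be A₀, the support of the code.
    peel : ∀ α → T (H (α ++ cnt A₀ ∷ [])) (φ w) ≡ T (H α) (φ (wordElt n V₀))
    peel α = trans (cong (λ x → T x (φ w)) (ListP.map-++ (dec ,_) α (cnt A₀ ∷ []))) (trans (T-snoc (H α) dec (cnt A₀) (φ w))
      (trans (sumB-single {n} A₀ _ others) (trans (guard-yes (cnt A₀ ≟ cnt A₀) _ refl) (T-cong (H α) same))))
      where
      len-eq : len w ≡ len (wordElt n V₀) + cnt A₀
      len-eq = trans (L≡siz W) (trans (siz-back-supp W) (cong (ℕ._+ cnt A₀) (sym (L≡siz V₀))))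
      length-D++ : ∀ V → length (D A₀ ++ V) ≡ length V + cnt A₀
      length-D++ V = trans (ListP.length-++ (D A₀)) (trans (cong (ℕ._+ length V) (length-D A₀ (supp-proper W))) (+-comm (cnt A₀) _))
      same : ∀ V → φ w (D A₀ ++ V) ≡ φ (wordElt n V₀) V
      same V = guard-⇔ _ _ (+ 1)
        (λ { (a , b) → ≈⇒wordElt V V₀ (λ k → trans (sym (cancel-reverse (D A₀) V k)) (back-≈ A₀ {D A₀ ++ V} {W} (wordElt⇒≈ (D A₀ ++ V) W a) k)) ,
               +-cancelʳ-≡ (cnt A₀) _ _ (trans (sym len-eq) (trans b (length-D++ V))) })
        (λ { (a , b) → ≈⇒wordElt (D A₀ ++ V) W (λ k → trans (++-≈ {D A₀} {D A₀} {V} {V₀} (λ _ → refl) (wordElt⇒≈ V V₀ a) k) (rebuild A₀ W k)) ,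
               trans len-eq (trans (cong (ℕ._+ cnt A₀) b) (sym (length-D++ V))) })
      -- If d_A can be the last factor, every member of `A` has a nonzero code entry; so `A` lies in
      -- the support, and equal sizes force equality.
      others : ∀ A → A ≢ A₀ → guard (cnt A ≟ cnt A₀) (T (H α) (λ V → φ w (D A ++ V))) ≡ + 0
      others A ne = trans (guard-cong (cnt A ≟ cnt A₀) (λ e → T-0 (H α) (λ V → vanishes e V (φ w (D A ++ V) ℤ.≟ + 0)))) (guard-0 (cnt A ≟ cnt A₀) refl)
        where
        vanishes : cnt A ≡ cnt A₀ → ∀ V → Dec (φ w (D A ++ V) ≡ + 0) → φ w (D A ++ V) ≡ + 0
        vanishes e V (yes z) = z
        vanishes e V (no nz) = ⊥-elim (ne (cnt-⊆ A A₀ subset (≤-reflexive (sym e))))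
          where
          p : cnt A < n
          p = subst (_< n) (sym e) (supp-proper W)
          ≈W = proj₁ (φ-nonzero (D A ++ V) nz)
          red = proj₂ (φ-nonzero (D A ++ V) nz)
          module St = Step (moveA A p) V (D A ++ V) (app-++ (D A) V)
          valid : Valid (moveA A p) (app (D A ++ V))
          valid = St.siz-tight (≤-trans (+-mono-≤ (siz≤length V) (≤-reflexive (trans (cnt-mem A) (sym (length-D A p))))) (≤-reflexive (trans (+-comm (length V) _) (trans (sym (ListP.length-++ (D A))) (sym red)))))
          memA⇒ : ∀ k → mem A k ≡ true → mem A₀ k ≡ true
          memA⇒ k ak = trans (mem-supp W k) (positive (cd W k) (trans (sym (cd-≈ (D A ++ V) W ≈W k)) (trans (St.cd-valid valid k) (trans (cong (λ b → cd V (app (D A) k) + bit b) ak) (+-comm _ 1)))))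
            where
            positive : ∀ c {v} → c ≡ suc v → nonzero c ≡ true
            positive (suc c) _ = refl
          subset : ∀ i → lookup A i ≡ true → lookup A₀ i ≡ true
          subset i ai = trans (sym (cong (lookup A₀) (resF-toℕ i))) (memA⇒ (+ toℕ i) (trans (cong (lookup A) (resF-toℕ i)) ai))

  -- The exponents appear reversed because `peel` removes the factor applied last, whose size is the
  -- first part of μ(w).
  leading : ∀ m W → siz W ≤ m → T (H (reverse (μ n (wordElt n W)))) (φ (wordElt n W)) ≡ + 1
  leading m W le = go m le (cnt (supp W)) refl
    where
    w = wordElt n W
    go : ∀ m → siz W ≤ m → ∀ c → cnt (supp W) ≡ c → T (H (reverse (μ n w))) (φ w) ≡ + 1
    go m le zero e = trans (cong (λ l → T (H (reverse l)) (φ w)) (μ-zero W e)) (guard-yes _ (+ 1) (≈⇒wordElt [] W (λ k → sym (zero-code⇒id W (cnt-supp-zero W e) k)) ,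
      trans (L≡siz W) (S-zero (cd W) (+ 0) n (λ t _ → cnt-supp-zero W e (+ 0 ⊕ t)))))
    go zero le (suc c) e = ⊥-elim (siz≢0 W c e le)
    go (suc m) le (suc c) e = trans (cong (λ l → T (H l) (φ w)) (trans (cong reverse (μ-step W c e)) (ListP.unfold-reverse (cnt (supp W)) (μ n (wordElt n (back (supp W) W))))))
      (trans (peel W (reverse (μ n (wordElt n (back (supp W) W))))) (leading m (back (supp W) W)
        (siz-back-≤ W m c e le)))

  -- If the entry at `i` exceeded the next one, left multiplication by s_i would shorten the
  -- element, against minimality in the coset; an ascent of the sequence gives an ascent of the code
  -- by `code-grow`.
  Grassmannian-increasing : ∀ W → Grassmannian n len (wordElt n W) → ∀ i → 1 ≤ i → i < n → cd W (+ i) ≤ cd W (up (+ i))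
  Grassmannian-increasing W gr i 1≤i i<n = by (ℤP.<-cmp (y (+ i)) (y (up (+ i))))
    where
    y = app W
    by : _ → cd W (+ i) ≤ cd W (up (+ i))
    by (tri< lt _ _) = code-grow (affine W) (+ i) 0 (λ { zero _ → lt })
    by (tri≈ _ e _) = ⊥-elim (ℤP.<-irrefl (Aff.inj (affine W) e) (k<k⊕ (+ i) 0))
    by (tri> _ _ gt) = ⊥-elim (<⇒≱ shorter (gr (i ∷ []) ((1≤i , i<n) ∷ [])))
      where
      module M = Move (letter i)
      module St = Step (letter i) (i ∷ W) W (λ k → cong y (sym (sAt-involutive i k)))
      next-out : ∀ k → at i k ≡ true → at i (up k) ≡ false
      next-out k ak with at i (up k) in eq
      ... | false = refl
      ... | true = ⊥-elim (res-up≢ k (trans (at-true i (up k) eq) (sym (at-true i k ak))))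
      ν≡ : ∀ k → at i k ≡ true → M.ν k ≡ up k
      ν≡ k ak = trans (M.ν-in k ak) (M.ν-out (up k) (next-out k ak))
      valid : Valid (letter i) y
      valid k ak = shift (res-diff {k} {+ i} (at-true i k ak))
        where
        lem : ∀ i x → (i +ᶻ x) +ᶻ + 1 ≡ (i +ᶻ + 1) +ᶻ x
        lem = solve-∀
        shift : (∃ λ q → k ≡ + i +ᶻ q *ᶻ + n) → y (M.ν k) <ᶻ y k
        shift (q , e) = subst₂ _<ᶻ_ (sym (trans (cong y (trans (ν≡ k ak) (trans (cong up e) (lem (+ i) (q *ᶻ + n))))) (app-mult W (up (+ i)) q))) (sym (trans (cong y e) (app-mult W (+ i) q))) (ℤP.+-monoˡ-< (q *ᶻ + n) gt)
      shorter : L (i ∷ W) < L W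
      shorter = ≤-reflexive (trans (cong suc (L≡siz (i ∷ W))) (sym (trans (L≡siz W) (trans (St.siz-valid valid) (trans (cong (siz (i ∷ W) ℕ.+_) (letter-card i)) (+-comm _ 1))))))

  -- On the window 1, ..., n the codes increase weakly, so the truncated sums encoded by μ determine
  -- them there and, by periodicity, everywhere; the code determines the element.
  Grassmannian-unique : ∀ V W → Grassmannian n len (wordElt n V) → Grassmannian n len (wordElt n W) → μ n (wordElt n V) ≡ μ n (wordElt n W) → wordElt n V ≡ wordElt n W
  Grassmannian-unique V W gV gW e = ≈⇒wordElt V W (code-injective (siz V) V W ≤-refl all-codes)
    where
    sums : ∀ k → S (λ x → k ⊓ cd V x) (+ 1) n ≡ S (λ x → k ⊓ cd W x) (+ 1) n
    sums k = trans (S-per _ (λ x → cong (k ⊓_) (cd-sh V x)) (+ 1) (+ 0)) (trans (trans (sym (μ-partial k V)) (trans (cong (λ l → sum (take k l)) e) (μ-partial k W))) (S-per _ (λ x → cong (k ⊓_) (cd-sh W x)) (+ 0) (+ 1)))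
    mono : ∀ U → Grassmannian n len (wordElt n U) → ∀ t → suc t < n → cd U (+ 1 ⊕ t) ≤ cd U (+ 1 ⊕ suc t)
    mono U gU t lt = subst₂ (λ a b → cd U a ≤ cd U b) (sym (⊕-+ (+ 1) t)) (trans (cong up (sym (⊕-+ (+ 1) t))) (⊕-up (+ 1) t)) (Grassmannian-increasing U gU (suc t) (s≤s z≤n) lt)
    window : ∀ t → t < n → cd V (+ 1 ⊕ t) ≡ cd W (+ 1 ⊕ t)
    window = increasing-unique (cd V) (cd W) (+ 1) n (mono V gV) (mono W gW) sums
    all-codes : ∀ k → cd V k ≡ cd W k
    all-codes k = go (reach (+ 1) k)
      where
      go : (∃ λ t → t < n × ∃ λ q → k ≡ (+ 1 ⊕ t) +ᶻ q *ᶻ + n) → cd V k ≡ cd W k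
      go (t , t<n , q , eq) = trans (cong (cd V) eq) (trans (per-mult (cd V) (cd-sh V) (+ 1 ⊕ t) q) (trans (window t t<n) (sym (trans (cong (cd W) eq) (per-mult (cd W) (cd-sh W) (+ 1 ⊕ t) q)))))

-- Lists of partitions, coefficients and dominance order.

_≟ˡ_ : (l m : List ℕ) → Dec (l ≡ m)
_≟ˡ_ = ListP.≡-dec ℕP._≟_

sumL-0 : ∀ {X : Set} {f : X → ℤ} xs → All (λ x → f x ≡ + 0) xs → sumL f xs ≡ + 0
sumL-0 [] [] = refl
sumL-0 (x ∷ xs) (e ∷ es) = cong₂ _+ᶻ_ e (sumL-0 xs es)

sumL-+ : ∀ {X : Set} (f g : X → ℤ) xs → sumL (λ x → f x +ᶻ g x) xs ≡ sumL f xs +ᶻ sumL g xs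
sumL-+ f g [] = refl
sumL-+ f g (x ∷ xs) = trans (cong (f x +ᶻ g x +ᶻ_) (sumL-+ f g xs)) (lem (f x) (g x) _ _)
  where
  lem : ∀ a b c d → (a +ᶻ b) +ᶻ (c +ᶻ d) ≡ (a +ᶻ c) +ᶻ (b +ᶻ d)
  lem = solve-∀

sumL-swap : ∀ {X Y : Set} (F : X → Y → ℤ) xs ys → sumL (λ x → sumL (F x) ys) xs ≡ sumL (λ y → sumL (λ x → F x y) xs) ys
sumL-swap F [] ys = sym (sumL-0 ys (All.universal (λ _ → refl) ys))
sumL-swap F (x ∷ xs) ys = trans (cong (sumL (F x) ys +ᶻ_) (sumL-swap F xs ys)) (sym (sumL-+ (F x) (λ y → sumL (λ x → F x y) xs) ys))

sumL-*ʳ : ∀ {X : Set} (f : X → ℤ) c xs → sumL f xs *ᶻ c ≡ sumL (λ x → f x *ᶻ c) xs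
sumL-*ʳ f c [] = refl
sumL-*ʳ f c (x ∷ xs) = trans (ℤP.*-distribʳ-+ c (f x) _) (cong (f x *ᶻ c +ᶻ_) (sumL-*ʳ f c xs))

sumL-foldr : ∀ {X : Set} (f : X → ℤ) xs → foldr _+ᶻ_ (+ 0) (map f xs) ≡ sumL f xs
sumL-foldr f [] = refl
sumL-foldr f (x ∷ xs) = cong (f x +ᶻ_) (sumL-foldr f xs)

sumL-delta∉ : ∀ (l : List ℕ) (g : List ℕ → ℤ) xs → l ∉ xs → sumL (λ m → guard (l ≟ˡ m) (g m)) xs ≡ + 0
sumL-delta∉ l g xs l∉ = sumL-0 xs (All.tabulate (λ {m} m∈ → guard-no (l ≟ˡ m) _ (λ e → l∉ (subst (_∈ xs) (sym e) m∈))))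

sumL-delta : ∀ (l : List ℕ) (g : List ℕ → ℤ) xs → Unique xs → l ∈ xs → sumL (λ m → guard (l ≟ˡ m) (g m)) xs ≡ g l
sumL-delta l g (x ∷ xs) (x∉ ∷ u) (here refl) = trans (cong₂ _+ᶻ_ (guard-yes (l ≟ˡ l) _ refl) (sumL-delta∉ l g xs (λ l∈ → All.lookup x∉ l∈ refl))) (ℤP.+-identityʳ _)
sumL-delta l g (x ∷ xs) (x∉ ∷ u) (there l∈) = trans (cong₂ _+ᶻ_ (guard-no (l ≟ˡ x) _ (λ e → All.lookup x∉ l∈ (sym e))) (sumL-delta l g xs u l∈)) (ℤP.+-identityˡ _)

sumL-only : ∀ (l : List ℕ) (g : List ℕ → ℤ) xs → Unique xs → l ∈ xs → (∀ m → m ∈ xs → m ≢ l → g m ≡ + 0) → sumL g xs ≡ g l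
sumL-only l g xs u l∈ h = trans (sumL-cong xs (All.tabulate (λ {m} m∈ → only m m∈ (l ≟ˡ m)))) (sumL-delta l g xs u l∈)
  where
  only : ∀ m → m ∈ xs → ∀ (d : Dec (l ≡ m)) → g m ≡ guard d (g m)
  only m m∈ (yes _) = refl
  only m m∈ (no ne) = h m m∈ (ne ∘ sym)

decreasing? : ∀ l → Dec (Decreasing l)
decreasing? [] = yes dnil
decreasing? (x ∷ []) = yes done
decreasing? (x ∷ y ∷ l) with y ℕ.≤? x | decreasing? (y ∷ l)
... | yes p | yes q = yes (dcons p q)
... | no ¬p | _ = no (λ { (dcons p _) → ¬p p })
... | _ | no ¬q = no (λ { (dcons _ q) → ¬q q })

Par? : ∀ n l → Dec (Par n l)
Par? n l = decreasing? l ×-dec All.all? (λ x → (1 ℕ.≤? x) ×-dec (x ℕ.≤? n ∸ 1)) l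

-- A finite list that contains every partition of N with parts below n, since such a partition has
-- at most N parts.
candidates : ℕ → ℕ → List (List ℕ)
candidates n zero = [] ∷ []
candidates n (suc N) = [] ∷ concatMap (λ x → map (x ∷_) (candidates n N)) (upTo n)

∈-candidates : ∀ n N l → length l ≤ N → All (_< n) l → l ∈ candidates n N
∈-candidates n zero [] _ _ = here refl
∈-candidates n (suc N) [] _ _ = here refl
∈-candidates n (suc N) (x ∷ l) (s≤s le) (x<n ∷ all) = there (MemP.∈-concat⁺′ (MemP.∈-map⁺ (x ∷_) (∈-candidates n N l le all)) (MemP.∈-map⁺ (λ x → map (x ∷_) (candidates n N)) (MemP.∈-upTo⁺ x<n)))

length≤sum : ∀ l → All (1 ≤_) l → length l ≤ sum l
length≤sum [] [] = z≤n
length≤sum (x ∷ l) (p ∷ ps) = +-mono-≤ p (length≤sum l ps)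

take-all : ∀ k (l : List ℕ) → length l ≤ k → take k l ≡ l
take-all k l le = ListP.take-all k l le

sum-take≤ : ∀ k l → sum (take k l) ≤ sum l
sum-take≤ zero l = z≤n
sum-take≤ (suc k) [] = z≤n
sum-take≤ (suc k) (x ∷ l) = +-monoʳ-≤ x (sum-take≤ k l)

⪯-trans : ∀ {l m o} → l ⪯ m → m ⪯ o → l ⪯ o
⪯-trans (e , h) (e' , h') = trans e e' , λ k → ≤-trans (h k) (h' k)

-- The sum of the partial sums with 0 to N terms: a number that is strictly monotone for dominance
-- among partitions of N and serves as induction measure.
height : ℕ → List ℕ → ℕ
height N l = Sn (λ k → sum (take k l)) (suc N)

height-≤ : ∀ N l → height N l ≤ suc N * sum l
height-≤ N l = go (suc N)
  where
  go : ∀ M → Sn (λ k → sum (take k l)) M ≤ M * sum l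
  go zero = z≤n
  go (suc M) = ≤-trans (+-mono-≤ (go M) (sum-take≤ M l)) (≤-reflexive (+-comm (M * sum l) (sum l)))

⪯⇒height : ∀ N {l m} → l ⪯ m → height N l ≤ height N m
⪯⇒height N (_ , h) = Sn-mono (suc N) (λ k _ → h k)

Sn-tight : ∀ {f g} M → (∀ t → f t ≤ g t) → Sn g M ≤ Sn f M → ∀ t → t < M → f t ≡ g t
Sn-tight {f} {g} (suc M) h le t t<M = by (t ≟ M)
  where
  last : g M ≤ f M
  last = +-cancelˡ-≤ (Sn f M) _ _ (≤-trans (+-monoˡ-≤ (g M) (Sn-mono M (λ t _ → h t))) le)
  init : Sn g M ≤ Sn f M
  init = +-cancelʳ-≤ (g M) _ _ (≤-trans le (+-monoʳ-≤ (Sn f M) (h M)))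
  by : Dec (t ≡ M) → f t ≡ g t
  by (yes refl) = ≤-antisym (h M) last
  by (no ne) = Sn-tight M h init t (≤∧≢⇒< (≤-pred t<M) ne)

-- All partial sums compare in the same direction, so equality of their total forces equality of
-- each. Beyond `sum l` terms both lists are exhausted.
⪯-height-antisym : ∀ {l m} → All (1 ≤_) l → All (1 ≤_) m → l ⪯ m → height (sum l) m ≤ height (sum l) l → l ≡ m
⪯-height-antisym {l} {m} pl pm (e , h) le = partial-sums-injective l m pl pm (λ k → by k (k <? suc (sum l)))
  where
  by : ∀ k → Dec (k < suc (sum l)) → sum (take k l) ≡ sum (take k m)
  by k (yes lt) = Sn-tight (suc (sum l)) h le k lt
  by k (no ≮) = trans (cong sum (take-all k l (≤-trans (length≤sum l pl) big))) (trans e (sym (cong sum (take-all k m (≤-trans (length≤sum m pm) (≤-trans (≤-reflexive (sym e)) big))))))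
    where
    big : sum l ≤ k
    big = ≤-trans (n≤1+n _) (≮⇒≥ ≮)

⪯-antisym : ∀ {l m} → All (1 ≤_) l → All (1 ≤_) m → l ⪯ m → m ⪯ l → l ≡ m
⪯-antisym {l} pl pm p q = ⪯-height-antisym pl pm p (⪯⇒height (sum l) q)

coeff-sumL : ∀ n .{{_ : NonZero n}} L l → coeffOf n L l ≡ sumL (λ p → guard (proj₁ p ≟ˡ l) (proj₂ p)) L
coeff-sumL n [] l = refl
coeff-sumL n (p ∷ L) l = by (proj₁ p ≟ˡ l)
  where
  by : ∀ (d : Dec (proj₁ p ≡ l)) → coeffOf n (p ∷ L) l ≡ guard d (proj₂ p) +ᶻ sumL (λ p → guard (proj₁ p ≟ˡ l) (proj₂ p)) L
  by (yes e) = trans (cong (foldr _+ᶻ_ (+ 0) ∘ map proj₂) (ListP.filter-accept (λ p → ListP.≡-dec ℕP._≟_ (proj₁ p) l) e)) (cong (proj₂ p +ᶻ_) (coeff-sumL n L l))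
  by (no ne) = trans (cong (foldr _+ᶻ_ (+ 0) ∘ map proj₂) (ListP.filter-reject (λ p → ListP.≡-dec ℕP._≟_ (proj₁ p) l) ne)) (trans (coeff-sumL n L l) (sym (ℤP.+-identityˡ _)))

-- Expansions in a family that is unitriangular for dominance order.

module Triangular (n : ℕ) .{{nz : NonZero n}} (1<n : 1 < n) (K : List ℕ → List ℕ → ℤ)
  (K-diag : ∀ l → Par n l → K l l ≡ + 1) (K-dom : ∀ l m → Par n l → Par n m → K l m ≢ + 0 → m ⪯ l) where

  private
    positive : ∀ {l} → Par n l → All (1 ≤_) l
    positive p = All.map proj₁ (proj₂ p)

    small : ∀ {l} → Par n l → All (_< n) l
    small p = All.map (λ q → ≤-trans (s≤s (proj₂ q)) (≤-reflexive (m+[n∸m]≡n (<⇒≤ 1<n)))) (proj₂ p)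

  combination : List (List ℕ × ℤ) → List ℕ → ℤ
  combination L m = sumL (λ p → proj₂ p *ᶻ K (proj₁ p) m) L

  -- Induction on a strict bound for the heights in the support. The multiples `f l · K l` for all
  -- `l` of the maximal height are subtracted; at an `m` of at least that height only `l ≡ m` can
  -- contribute, because `K l m` nonzero means `m ⪯ l`.
  expand : ∀ N b (f : List ℕ → ℤ) → (∀ m → Par n m → f m ≢ + 0 → sum m ≡ N × height N m < b) →
    ∃ λ L → All (λ p → Par n (proj₁ p)) L × (∀ m → Par n m → f m ≡ combination L m)
  expand N zero f h = [] , [] , λ m pm → zero-at m pm (f m ℤ.≟ + 0)
    where
    zero-at : ∀ m → Par n m → Dec (f m ≡ + 0) → f m ≡ + 0
    zero-at m pm (yes e) = e
    zero-at m pm (no ne) = ⊥-elim (ℕP.n≮0 (proj₂ (h m pm ne)))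
  expand N (suc b) f h = extend (expand N b f' h')
    where
    Top : List ℕ → Set
    Top l = Par n l × (sum l ≡ N × height N l ≡ b)
    Top? : ∀ l → Dec (Top l)
    Top? l = Par? n l ×-dec ((sum l ≟ N) ×-dec (height N l ≟ b))
    tops : List (List ℕ)
    -- Duplicates are removed, as a repeated partition would be subtracted twice.
    tops = filter Top? (deduplicate _≟ˡ_ (candidates n N))
    tops-unique : Unique tops
    tops-unique = UniqueP.filter⁺ Top? (UniqueDec.deduplicate-! _≟ˡ_ (candidates n N))
    top-of : ∀ {l} → l ∈ tops → Top l
    top-of l∈ = proj₂ (MemP.∈-filter⁻ Top? {xs = deduplicate _≟ˡ_ (candidates n N)} l∈)
    ∈-tops : ∀ {l} → Top l → l ∈ tops
    ∈-tops {l} t = MemP.∈-filter⁺ Top? (MemP.∈-deduplicate⁺ _≟ˡ_ (∈-candidates n N l (≤-trans (length≤sum l (positive (proj₁ t))) (≤-reflexive (proj₁ (proj₂ t)))) (small (proj₁ t)))) t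
    g : List ℕ → ℤ
    g m = sumL (λ l → f l *ᶻ K l m) tops
    f' : List ℕ → ℤ
    f' m = f m -ᶻ g m
    cancel : ∀ m → Par n m → b ≤ height N m → f' m ≡ + 0
    cancel m pm b≤ = by (Top? m)
      where
      equal : ∀ l → l ∈ tops → K l m ≢ + 0 → m ≡ l
      equal l l∈ ne = ⪯-height-antisym (positive pm) (positive (proj₁ (top-of l∈))) dom
          (subst (λ N → height N l ≤ height N m) (sym sum-m) (≤-trans (≤-reflexive (proj₂ (proj₂ (top-of l∈)))) b≤))
        where
        dom = K-dom l m (proj₁ (top-of l∈)) pm ne
        sum-m = trans (proj₁ dom) (proj₁ (proj₂ (top-of l∈)))
      term : ∀ l → l ∈ tops → m ≢ l → f l *ᶻ K l m ≡ + 0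
      term l l∈ ne = zero-K (K l m ℤ.≟ + 0)
        where
        zero-K : Dec (K l m ≡ + 0) → f l *ᶻ K l m ≡ + 0
        zero-K (yes e) = trans (cong (f l *ᶻ_) e) (ℤP.*-zeroʳ (f l))
        zero-K (no ne') = ⊥-elim (ne (equal l l∈ ne'))
      by : Dec (Top m) → f' m ≡ + 0
      by (yes t) = trans (cong (f m -ᶻ_) (trans (sumL-only m (λ l → f l *ᶻ K l m) tops tops-unique (∈-tops t) (λ l l∈ ne → term l l∈ (ne ∘ sym))) (trans (cong (f m *ᶻ_) (K-diag m pm)) (ℤP.*-identityʳ _)))) (ℤP.+-inverseʳ (f m))
      by (no ¬t) = cong₂ _-ᶻ_ (zero-f (f m ℤ.≟ + 0)) (sumL-0 tops (All.tabulate (λ {l} l∈ → term l l∈ (λ e → ¬t (subst Top (sym e) (top-of l∈))))))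
        where
        zero-f : Dec (f m ≡ + 0) → f m ≡ + 0
        zero-f (yes e) = e
        zero-f (no ne) = ⊥-elim (¬t (pm , proj₁ (h m pm ne) , ≤-antisym (≤-pred (proj₂ (h m pm ne))) b≤))
    h' : ∀ m → Par n m → f' m ≢ + 0 → sum m ≡ N × height N m < b
    h' m pm ne = sums (f m ℤ.≟ + 0) , ≰⇒> (λ b≤ → ne (cancel m pm b≤))
      where
      sums : Dec (f m ≡ + 0) → sum m ≡ N
      sums (no ne') = proj₁ (h m pm ne')
      sums (yes e) = from-K (Any.any? (λ l → ¬? (K l m ℤ.≟ + 0)) tops)
        where
        from-K : Dec (Any (λ l → K l m ≢ + 0) tops) → sum m ≡ N
        from-K (yes a) = trans (proj₁ (K-dom l m (proj₁ (top-of l∈)) pm nk)) (proj₁ (proj₂ (top-of l∈)))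
          where
          l = proj₁ (find a)
          l∈ = proj₁ (proj₂ (find a))
          nk = proj₂ (proj₂ (find a))
        from-K (no none) = ⊥-elim (ne (cong₂ _-ᶻ_ e (sumL-0 tops (All.tabulate (λ {l} l∈ → zero-K l l∈ (K l m ℤ.≟ + 0))))))
          where
          zero-K : ∀ l → l ∈ tops → Dec (K l m ≡ + 0) → f l *ᶻ K l m ≡ + 0
          zero-K l l∈ (yes e) = trans (cong (f l *ᶻ_) e) (ℤP.*-zeroʳ (f l))
          zero-K l l∈ (no nk) = ⊥-elim (none (lose l∈ nk))
    extend : (∃ λ L → All (λ p → Par n (proj₁ p)) L × (∀ m → Par n m → f' m ≡ combination L m)) →
      ∃ λ L → All (λ p → Par n (proj₁ p)) L × (∀ m → Par n m → f m ≡ combination L m)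
    extend (L , all , e) = map (λ l → l , f l) tops ++ L , AllP.++⁺ (AllP.map⁺ (All.tabulate (λ l∈ → proj₁ (top-of l∈)))) all ,
      λ m pm → trans (lem (f m) (g m)) (trans (cong (g m +ᶻ_) (e m pm)) (sym (trans (sumL-++ _ (map (λ l → l , f l) tops) L) (cong (_+ᶻ combination L m) (sumL-map (λ p → proj₂ p *ᶻ K (proj₁ p) m) (λ l → l , f l) tops)))))
      where
      lem : ∀ a b → a ≡ b +ᶻ (a -ᶻ b)
      lem = solve-∀

  module _ (L : List (List ℕ × ℤ)) (parL : All (λ p → Par n (proj₁ p)) L) (f : List ℕ → ℤ) (f≡ : ∀ m → Par n m → f m ≡ combination L m)
    (top : List ℕ) (par-top : Par n top) (f-top : f top ≡ + 1) (f-dom : ∀ m → Par n m → f m ≢ + 0 → m ⪯ top) where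

    private
      a : List ℕ → ℤ
      a = coeffOf n L

      module _ (l : List ℕ) (par-l : Par n l) where
        -- The index `l` is included even if it does not occur in `L`, so that the diagonal term is
        -- always among the summands.
        U : List (List ℕ)
        U = deduplicate _≟ˡ_ (l ∷ map proj₁ L)

        U-unique : Unique U
        U-unique = UniqueDec.deduplicate-! _≟ˡ_ (l ∷ map proj₁ L)

        U-par : ∀ {m} → m ∈ U → Par n m
        U-par m∈ = All.lookup (par-l ∷ AllP.map⁺ parL) (MemP.∈-deduplicate⁻ _≟ˡ_ (l ∷ map proj₁ L) m∈)

        l∈U : l ∈ U
        l∈U = MemP.∈-deduplicate⁺ _≟ˡ_ {l ∷ map proj₁ L} (here refl)

        collect : f l ≡ sumL (λ m → a m *ᶻ K m l) U
        collect = trans (f≡ l par-l) (sym (trans (sumL-cong U (All.universal (λ m → trans (cong (_*ᶻ K m l) (coeff-sumL n L m)) (sumL-*ʳ _ (K m l) L)) U))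
          (trans (sumL-swap (λ m p → guard (proj₁ p ≟ˡ m) (proj₂ p) *ᶻ K m l) U L) (sumL-cong L (All.tabulate (λ {p} p∈ → one p p∈))))))
          where
          one : ∀ p → p ∈ L → sumL (λ m → guard (proj₁ p ≟ˡ m) (proj₂ p) *ᶻ K m l) U ≡ proj₂ p *ᶻ K (proj₁ p) l
          one p p∈ = trans (sumL-cong U (All.universal (λ m → pull (proj₁ p ≟ˡ m) m) U)) (sumL-delta (proj₁ p) (λ m → proj₂ p *ᶻ K m l) U U-unique (MemP.∈-deduplicate⁺ _≟ˡ_ {l ∷ map proj₁ L} (there (MemP.∈-map⁺ proj₁ p∈))))
            where
            pull : ∀ {P : Set} (d : Dec P) m → guard d (proj₂ p) *ᶻ K m l ≡ guard d (proj₂ p *ᶻ K m l)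
            pull (yes _) m = refl
            pull (no _) m = refl

    -- Induction from large heights to small ones, `t` being the room left below the bound of
    -- `height-≤`. If some other `m` has a nonzero coefficient and `K m l` is nonzero, then `l ⪯ m`
    -- with `m` strictly higher, and induction applies to `m`. Otherwise `f l` equals the
    -- coefficient of `l`, which is nonzero.
    expansion-dominated : ∀ l → Par n l → a l ≢ + 0 → l ⪯ top
    expansion-dominated l par-l = go (suc (suc (sum l) * sum l)) l par-l (m≤n+m _ _)
      where
      go : ∀ t l → Par n l → suc (suc (sum l) * sum l) ≤ height (sum l) l + t → a l ≢ + 0 → l ⪯ top
      go zero l par-l le ne = ⊥-elim (<⇒≱ le (≤-trans (≤-reflexive (+-identityʳ _)) (height-≤ (sum l) l)))
      go (suc t) l par-l le ne = by (Any.any? (λ m → ¬? (m ≟ˡ l) ×-dec (¬? (a m ℤ.≟ + 0) ×-dec ¬? (K m l ℤ.≟ + 0))) (U l par-l))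
        where
        by : Dec (Any (λ m → m ≢ l × (a m ≢ + 0 × K m l ≢ + 0)) (U l par-l)) → l ⪯ top
        by (yes any) = ⪯-trans l⪯m (go t m (U-par l par-l m∈) le' am)
          where
          m = proj₁ (find any)
          m∈ = proj₁ (proj₂ (find any))
          m≢l = proj₁ (proj₂ (proj₂ (find any)))
          am = proj₁ (proj₂ (proj₂ (proj₂ (find any))))
          Km = proj₂ (proj₂ (proj₂ (proj₂ (find any))))
          l⪯m : l ⪯ m
          l⪯m = K-dom m l (U-par l par-l m∈) par-l Km
          higher : height (sum l) l < height (sum l) m
          higher = ≰⇒> (λ le → m≢l (sym (⪯-height-antisym (positive par-l) (positive (U-par l par-l m∈)) l⪯m le)))
          le' : suc (suc (sum m) * sum m) ≤ height (sum m) m + t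
          le' = subst (λ N → suc (suc N * N) ≤ height N m + t) (proj₁ l⪯m) (≤-trans le (≤-trans (≤-reflexive (+-suc _ t)) (+-monoˡ-≤ t higher)))
        by (no none) = f-dom l par-l (λ e → ne (trans (sym (trans (cong (a l *ᶻ_) (K-diag l par-l)) (ℤP.*-identityʳ _))) (trans (sym single) (trans (sym (collect l par-l)) e))))
          where
          single : sumL (λ m → a m *ᶻ K m l) (U l par-l) ≡ a l *ᶻ K l l
          single = sumL-only l (λ m → a m *ᶻ K m l) (U l par-l) (U-unique l par-l) (l∈U l par-l) (λ m m∈ m≢l → vanish m m∈ m≢l (a m ℤ.≟ + 0) (K m l ℤ.≟ + 0))
            where
            vanish : ∀ m → m ∈ U l par-l → m ≢ l → Dec (a m ≡ + 0) → Dec (K m l ≡ + 0) → a m *ᶻ K m l ≡ + 0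
            vanish m m∈ m≢l (yes e) _ = cong (_*ᶻ K m l) e
            vanish m m∈ m≢l (no _) (yes e) = trans (cong (a m *ᶻ_) e) (ℤP.*-zeroʳ (a m))
            vanish m m∈ m≢l (no na) (no nk) = ⊥-elim (none (lose m∈ (m≢l , na , nk)))

    -- A further index `m` contributing at `top` would satisfy `top ⪯ m` by `K-dom` and `m ⪯ top` by
    -- `expansion-dominated`.
    expansion-leading : a top ≡ + 1
    expansion-leading = trans (sym (trans (cong (a top *ᶻ_) (K-diag top par-top)) (ℤP.*-identityʳ _))) (trans (sym single) (trans (sym (collect top par-top)) f-top))
      where
      single : sumL (λ m → a m *ᶻ K m top) (U top par-top) ≡ a top *ᶻ K top top
      single = sumL-only top (λ m → a m *ᶻ K m top) (U top par-top) (U-unique top par-top) (l∈U top par-top) (λ m m∈ m≢ → vanish m m∈ m≢ (a m ℤ.≟ + 0) (K m top ℤ.≟ + 0))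
        where
        vanish : ∀ m → m ∈ U top par-top → m ≢ top → Dec (a m ≡ + 0) → Dec (K m top ≡ + 0) → a m *ᶻ K m top ≡ + 0
        vanish m m∈ m≢ (yes e) _ = cong (_*ᶻ K m top) e
        vanish m m∈ m≢ (no _) (yes e) = trans (cong (a m *ᶻ_) e) (ℤP.*-zeroʳ (a m))
        vanish m m∈ m≢ (no na) (no nk) = ⊥-elim (m≢ (⪯-antisym (positive pm) (positive par-top) (expansion-dominated m pm na) (K-dom m top pm par-top nk)))
          where pm = U-par top par-top m∈

-- Sorting exponents into partitions.

insertDesc-↭ : ∀ x l → insertDesc x l ↭ x ∷ l
insertDesc-↭ x [] = Perm.refl
insertDesc-↭ x (y ∷ l) with y ℕ.≤? x
... | yes _ = Perm.refl
... | no _ = Perm.trans (Perm.prep y (insertDesc-↭ x l)) (Perm.swap y x Perm.refl)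

sortDesc-↭ : ∀ l → sortDesc l ↭ l
sortDesc-↭ [] = Perm.refl
sortDesc-↭ (x ∷ l) = Perm.trans (insertDesc-↭ x (sortDesc l)) (Perm.prep x (sortDesc-↭ l))

Decreasing-∷ : ∀ {x l} → All (_≤ x) l → Decreasing l → Decreasing (x ∷ l)
Decreasing-∷ [] dnil = done
Decreasing-∷ (p ∷ _) d = dcons p d

Decreasing-head : ∀ {x l} → Decreasing (x ∷ l) → All (_≤ x) l
Decreasing-head done = []
Decreasing-head (dcons p d) = p ∷ All.map (λ q → ≤-trans q p) (Decreasing-head d)

Decreasing-tail : ∀ {x l} → Decreasing (x ∷ l) → Decreasing l
Decreasing-tail done = dnil
Decreasing-tail (dcons _ d) = d

insertDesc-Decreasing : ∀ x l → Decreasing l → Decreasing (insertDesc x l)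
insertDesc-Decreasing x [] _ = done
insertDesc-Decreasing x (y ∷ l) d with y ℕ.≤? x
... | yes p = dcons p d
... | no ¬p = Decreasing-∷ (PermP.All-resp-↭ (Perm.↭-sym (insertDesc-↭ x l)) (<⇒≤ (≰⇒> ¬p) ∷ Decreasing-head d)) (insertDesc-Decreasing x l (Decreasing-tail d))

sortDesc-Decreasing : ∀ l → Decreasing (sortDesc l)
sortDesc-Decreasing [] = dnil
sortDesc-Decreasing (x ∷ l) = insertDesc-Decreasing x (sortDesc l) (sortDesc-Decreasing l)

filter-Decreasing : ∀ l → Decreasing l → Decreasing (filter (λ x → 1 ℕ.≤? x) l)
filter-Decreasing [] _ = dnil
filter-Decreasing (zero ∷ l) d = filter-Decreasing l (Decreasing-tail d)
filter-Decreasing (suc x ∷ l) d = Decreasing-∷ (AllP.filter⁺ (λ x → 1 ℕ.≤? x) (Decreasing-head d)) (filter-Decreasing l (Decreasing-tail d))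

toPartition-Par : ∀ n α → 1 < n → All (_< n) α → Par n (toPartition α)
toPartition-Par n α 1<n <n = filter-Decreasing (sortDesc α) (sortDesc-Decreasing α) ,
  All.zip (AllP.all-filter (λ x → 1 ℕ.≤? x) (sortDesc α) , AllP.filter⁺ (λ x → 1 ℕ.≤? x) (PermP.All-resp-↭ (Perm.↭-sym (sortDesc-↭ α)) (All.map (λ lt → ≤-pred (≤-trans lt (≤-reflexive (sym (m+[n∸m]≡n (<⇒≤ 1<n)))))) <n)))

Par⇒< : ∀ {n l} → 1 < n → Par n l → All (_< n) l
Par⇒< 1<n p = All.map (λ q → ≤-trans (s≤s (proj₂ q)) (≤-reflexive (m+[n∸m]≡n (<⇒≤ 1<n)))) (proj₂ p)

-- Affine Stanley functions: triangularity, inverses and the star involution.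

module Stanley (n : ℕ) .{{nz : NonZero n}} (3≤n : 3 ≤ n) (len : Win n → ℕ) (isLen : IsCoxeterLength n len) where

  open Residues n
  open Codes n
  open Moves n
  open Words n 3≤n
  open Group n 3≤n
  open Length len isLen
  open Pairs n 3≤n
  open Functionals n 3≤n
  open Transfer n 3≤n
  open Coefficients n 3≤n len isLen
  open Shape n 3≤n
  open Leading n 3≤n len isLen

  F : Win n → List ℕ → ℤ
  F w α = + coefF n len w α

  F-perm : ∀ w {α β} → α ↭ β → All (_< n) α → F w α ≡ F w β
  F-perm w {α} {β} p <n = trans (coefF-T w α <n) (trans (T-perm p <n (φ-Nil w)) (sym (coefF-T w β (PermP.All-resp-↭ p <n))))

  T-filter : ∀ l ψ → T (H l) ψ ≡ T (H (filter (λ x → 1 ℕ.≤? x) l)) ψ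
  T-filter [] ψ = refl
  T-filter (zero ∷ l) ψ = trans (T-drop-0 dec (H l) ψ) (T-filter l ψ)
  T-filter (suc x ∷ l) ψ = sumB-cong {n} (λ A → cong (guard (cnt A ≟ suc x)) (T-filter l _))

  -- By symmetry the exponents may be sorted, and zeros may be dropped because h_0 = 1.
  F-toPartition : ∀ w α → All (_< n) α → F w α ≡ F w (toPartition α)
  F-toPartition w α <n = trans (F-perm w (Perm.↭-sym (sortDesc-↭ α)) <n) (trans (coefF-T w (sortDesc α) sorted<n)
    (trans (T-filter (sortDesc α) (φ w)) (sym (coefF-T w (toPartition α) (AllP.filter⁺ (λ x → 1 ℕ.≤? x) sorted<n)))))
    where
    sorted<n : All (_< n) (sortDesc α)
    sorted<n = PermP.All-resp-↭ (Perm.↭-sym (sortDesc-↭ α)) <n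

  sum-μ : ∀ W → sum (μ n (wordElt n W)) ≡ siz W
  sum-μ W = trans (cong sum (sym (take-all k (μ n (wordElt n W)) (m≤m+n _ (siz W))))) (trans (μ-partial k W) (S-cong< (+ 0) n (λ t t<n → m≥n⇒m⊓n≡n (≤-trans (S-term (cd W) (+ 0) n t t<n) (m≤n+m (siz W) _)))))
    -- Large enough both to take all parts of μ and to make every truncation of a code entry
    -- trivial.
    where k = length (μ n (wordElt n W)) + siz W

  F-dom : ∀ W α → All (_< n) α → F (wordElt n W) α ≢ + 0 → α ⪯ μ n (wordElt n W)
  F-dom W α <n ne = trans (proj₁ b) (sym (sum-μ W)) , λ k → ≤-trans (proj₂ b k) (≤-reflexive (sym (μ-partial k W)))
    where b = support-bound W α <n (λ e → ne (trans (coefF-T (wordElt n W) α <n) e))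

  F-leading : ∀ W → F (wordElt n W) (μ n (wordElt n W)) ≡ + 1
  F-leading W = trans (F-perm w (Perm.↭-sym (PermP.↭-reverse (μ n w))) <n) (trans (coefF-T w (reverse (μ n w)) (PermP.All-resp-↭ (Perm.↭-sym (PermP.↭-reverse (μ n w))) <n)) (leading (siz W) W ≤-refl))
    where
    w = wordElt n W
    <n : All (_< n) (μ n w)
    <n = Par⇒< 1<n (μ-Par W)

  siz-reverse : ∀ W → siz (reverse W) ≡ siz W
  siz-reverse W = ≤-antisym (half W) (≤-trans (≤-reflexive (cong siz (sym (ListP.reverse-involutive W)))) (half (reverse W)))
    where
    half : ∀ W → siz (reverse W) ≤ siz W
    half W = go (reduce (siz W) W ≤-refl)
      where
      go : (∃ λ V → V ≈ W × length V ≡ siz W) → siz (reverse W) ≤ siz W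
      go (V , V≈W , e) = ≤-trans (≤-reflexive (sym (siz-≈ (reverse V) (reverse W) (reverse-≈ {V} {W} V≈W)))) (≤-trans (siz≤length (reverse V)) (≤-reflexive (trans (ListP.length-reverse V) e)))

  φ-reverse : ∀ W V → φ (wordElt n (reverse W)) V ≡ φ (wordElt n W) (reverse V)
  φ-reverse W V = guard-⇔ _ _ (+ 1)
    (λ { (a , b) → ≈⇒wordElt (reverse V) W (flip V W (wordElt⇒≈ V (reverse W) a)) , trans (sym lens) (trans b (sym (ListP.length-reverse V))) })
    (λ { (a , b) → ≈⇒wordElt V (reverse W) (λ k → trans (cong (λ X → app X k) (sym (ListP.reverse-involutive V))) (reverse-≈ {reverse V} {W} (wordElt⇒≈ (reverse V) W a) k)) , trans lens (trans b (ListP.length-reverse V)) })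
    where
    lens : len (wordElt n (reverse W)) ≡ len (wordElt n W)
    lens = trans (L≡siz (reverse W)) (trans (siz-reverse W) (sym (L≡siz W)))
    flip : ∀ V W → V ≈ reverse W → reverse V ≈ W
    flip V W h k = trans (reverse-≈ {V} {reverse W} h k) (cong (λ X → app X k) (ListP.reverse-involutive W))

  -- Reversing words also reverses the order of the factors; symmetry of F̃ is used beforehand to
  -- reverse the exponents.
  F-inverse : ∀ W α → All (_< n) α → F (wordElt n (reverse W)) α ≡ T (map (inc ,_) α) (φ (wordElt n W))
  F-inverse W α <n = trans (F-perm (wordElt n (reverse W)) (Perm.↭-sym (PermP.↭-reverse α)) <n) (trans (coefF-T (wordElt n (reverse W)) (reverse α) (PermP.All-resp-↭ (Perm.↭-sym (PermP.↭-reverse α)) <n))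
    (trans (T-cong (H (reverse α)) (φ-reverse W)) (trans (T-reverse (reverse α) (φ (wordElt n W))) (cong (λ x → T x (φ (wordElt n W))) (trans (map-inc α []) (ListP.++-identityʳ _))))))

  private
    σ-all : ∀ Z → All (_< n) Z → L (map (σ n) Z) ≤ L Z
    σ-all Z all = go (proj₁ (isLen (wordElt n Z) (wordElt-affine Z)))
      where
      go : (∃ λ R → All (_< n) R × wordElt n R ≡ wordElt n Z × length R ≡ L Z) → L (map (σ n) Z) ≤ L Z
      go (R , allR , e , l) = ≤-trans (≤-reflexive (cong len (≈⇒wordElt (map (σ n) Z) (map (σ n) R) (σ-≈ Z R all allR (wordElt⇒≈ Z R (sym e))))))
        (≤-trans (proj₂ (isLen (wordElt n (map (σ n) R)) (wordElt-affine (map (σ n) R))) (map (σ n) R) (map-σ< R) refl) (≤-reflexive (trans (ListP.length-map (σ n) R) l)))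

  L-σ : ∀ Z → All (_< n) Z → L (map (σ n) Z) ≡ L Z
  L-σ Z all = ≤-antisym (σ-all Z all) (≤-trans (≤-reflexive (cong L (sym (σσ Z all)))) (σ-all (map (σ n) Z) (map-σ< Z)))

  -- The map `σ n` is compatible with equality of elements, and an involution, on words with letters
  -- below n; the words that `T` evaluates are of this kind.
  T-cong< : ∀ α → All (_< n) α → ∀ {ψ ψ'} → (∀ W → All (_< n) W → ψ W ≡ ψ' W) → T (H α) ψ ≡ T (H α) ψ'
  T-cong< [] [] h = h [] []
  T-cong< (a ∷ α) (a<n ∷ all) h = sumB-cong {n} (λ A → guard-cong (cnt A ≟ a) (λ e → T-cong< α all (λ W allW → h (W ++ D A) (AllP.++⁺ allW (D< A (subst (_< n) (sym e) a<n))))))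

  -- The right-hand side has the same form as in `F-inverse`: the star automorphism, like inversion,
  -- replaces the h's by the e's.
  F-star : ∀ U → All (_< n) U → ∀ α → All (_< n) α → F (wordElt n (map (σ n) U)) α ≡ T (map (inc ,_) α) (φ (wordElt n U))
  F-star U allU α <n = trans (coefF-T (wordElt n (map (σ n) U)) α <n) (trans (T-cong< α <n same) (T-star α <n (φ-Nil (wordElt n U))))
    where
    same : ∀ V → All (_< n) V → φ (wordElt n (map (σ n) U)) V ≡ φ (wordElt n U) (map (σ n) V)
    same V allV = guard-⇔ _ _ (+ 1)
      (λ { (a , b) → ≈⇒wordElt (map (σ n) V) U (λ k → trans (σ-≈ V (map (σ n) U) allV (map-σ< U) (wordElt⇒≈ V (map (σ n) U) a) k) (cong (λ X → app X k) (σσ U allU))) , trans (sym (L-σ U allU)) (trans b (sym (ListP.length-map (σ n) V))) })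
      (λ { (a , b) → ≈⇒wordElt V (map (σ n) U) (λ k → trans (cong (λ X → app X k) (sym (σσ V allV))) (σ-≈ (map (σ n) V) U (map-σ< V) allU (wordElt⇒≈ (map (σ n) V) U a) k)) , trans (L-σ U allU) (trans b (ListP.length-map (σ n) V)) })

  -- The automorphism preserves lengths and maps the letters 1, ..., n - 1 to themselves, hence
  -- respects minimality in cosets of S_n.
  Grassmannian-σ : ∀ U → All (_< n) U → Grassmannian n len (wordElt n U) → Grassmannian n len (wordElt n (map (σ n) U))
  Grassmannian-σ U allU gr X allX = ≤-trans (≤-reflexive (L-σ U allU)) (≤-trans (gr (map (σ n) X) (σ-letters X allX))
    (≤-reflexive (trans (cong len (wordAct-++ (map (σ n) X) U)) (trans (sym (L-σ (map (σ n) X ++ U) (AllP.++⁺ (map-σ< X) allU)))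
      (cong len (trans (cong (wordElt n) (trans (ListP.map-++ (σ n) (map (σ n) X) U) (cong (_++ map (σ n) U) (σσ X (All.map proj₂ allX))))) (sym (wordAct-++ X (map (σ n) U)))))))))
    where
    σ-letters : ∀ X → All (λ i → 1 ≤ i × i < n) X → All (λ i → 1 ≤ i × i < n) (map (σ n) X)
    σ-letters [] [] = []
    σ-letters (i ∷ X) ((1≤i , i<n) ∷ all) = (subst (1 ≤_) (sym σi) (ℕP.m<n⇒0<n∸m i<n) , σ< i) ∷ σ-letters X all
      where
      σi : σ n i ≡ n ∸ i
      σi = ℕD.m<n⇒m%n≡m (ℕP.∸-monoʳ-< 1≤i (<⇒≤ i<n))

  T-sumL : ∀ {X : Set} α (c : X → ℤ) (ψ : X → List ℕ → ℤ) L → T α (λ W → sumL (λ p → c p *ᶻ ψ p W) L) ≡ sumL (λ p → c p *ᶻ T α (ψ p)) L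
  T-sumL α c ψ [] = T-0 α (λ _ → refl)
  T-sumL α c ψ (p ∷ L) = trans (T-+ α _ _) (cong₂ _+ᶻ_ (T-*ˡ α (c p) (ψ p)) (T-sumL α c ψ L))

  module Section (star : Win n → Win n) (isStar : IsStarAut n star) (G : List ℕ → Win n) (isG : IsGrassSection n len G) where

    private
      rep : ∀ l → Par n l → ∃ λ U → All (_< n) U × wordElt n U ≡ G l
      rep l p = word-of (G l) (proj₁ (isG l p))

    K : List ℕ → List ℕ → ℤ
    K l m = F (G l) m

    K-diag : ∀ l → Par n l → K l l ≡ + 1
    K-diag l p = go (rep l p)
      where
      go : (∃ λ U → All (_< n) U × wordElt n U ≡ G l) → K l l ≡ + 1
      go (U , _ , e) = trans (cong₂ F (sym e) (trans (sym (proj₂ (proj₂ (isG l p)))) (cong (μ n) (sym e)))) (F-leading U)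

    K-dom : ∀ l m → Par n l → Par n m → K l m ≢ + 0 → m ⪯ l
    K-dom l m p pm ne = go (rep l p)
      where
      go : (∃ λ U → All (_< n) U × wordElt n U ≡ G l) → m ⪯ l
      go (U , _ , e) = subst (m ⪯_) (trans (cong (μ n) e) (proj₂ (proj₂ (isG l p)))) (F-dom U m (Par⇒< 1<n pm) (λ z → ne (trans (cong (λ w → F w m) (sym e)) z)))

    ∗ : List ℕ → List ℕ
    ∗ = parStar n star G

    record StarFacts (l : List ℕ) : Set where
      field
        ∗-Par : Par n (∗ l)
        involutive : ∗ (∗ l) ≡ l
        coefficient : ∀ α → All (_< n) α → K (∗ l) α ≡ T (map (inc ,_) α) (φ (G l))

    star-facts : ∀ l → Par n l → StarFacts l
    star-facts l p = go (rep l p)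
      where
      go : (∃ λ U → All (_< n) U × wordElt n U ≡ G l) → StarFacts l
      go (U , allU , e) = record
        { ∗-Par = par*
        ; involutive = trans (cong (μ n ∘ star) G*) (trans (cong (μ n) (trans (isStar V (map-σ< U)) (trans (cong (wordElt n) (σσ U allU)) e))) (proj₂ (proj₂ (isG l p))))
        ; coefficient = λ α <n → trans (cong (λ w → F w α) G*) (trans (F-star U allU α <n) (cong (λ w → T (map (inc ,_) α) (φ w)) e)) }
        where
        V = map (σ n) U
        star-Gl : star (G l) ≡ wordElt n V
        star-Gl = trans (cong star (sym e)) (isStar U allU)
        par* : Par n (∗ l)
        par* = subst (Par n) (cong (μ n) (sym star-Gl)) (μ-Par V)
        -- All that is known of `G (∗ l)` is that it is Grassmannian with the right μ; uniqueness
        -- identifies it with the star image of `G l`.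
        G* : G (∗ l) ≡ wordElt n V
        G* = unique (rep (∗ l) par*)
          where
          unique : (∃ λ X → All (_< n) X × wordElt n X ≡ G (∗ l)) → G (∗ l) ≡ wordElt n V
          unique (X , _ , eX) = trans (sym eX) (Grassmannian-unique X V (subst (Grassmannian n len) (sym eX) (proj₁ (proj₂ (isG (∗ l) par*))))
            (Grassmannian-σ U allU (subst (Grassmannian n len) (sym e) (proj₁ (proj₂ (isG l p)))))
            (trans (cong (μ n) eX) (trans (proj₂ (proj₂ (isG (∗ l) par*))) (cong (μ n) star-Gl))))

    module _ (W : List ℕ) where
      private
        w = wordElt n W
        module Tri = Triangular n 1<n K K-diag K-dom

      F≡combination : ∀ L → (∀ m → Par n m → F w m ≡ Tri.combination L m) → ∀ α → All (_< n) α → F w α ≡ Tri.combination L α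
      F≡combination L h α <n = trans (F-toPartition w α <n) (trans (h (toPartition α) (toPartition-Par n α 1<n <n))
        (sumL-cong L (All.universal (λ p → cong (proj₂ p *ᶻ_) (sym (F-toPartition (G (proj₁ p)) α <n))) L)))

      expansion-exists : Σ (List (List ℕ × ℤ)) (Expansion n len G w)
      -- The initial bound comes from `height-≤`: no partition of N has height above (N + 1) N.
      expansion-exists = go (Tri.expand N (suc (suc N * N)) (F w) (λ m pm ne → bounds m pm (F-dom W m (Par⇒< 1<n pm) ne)))
        where
        N = sum (μ n w)
        bounds : ∀ m → Par n m → m ⪯ μ n w → sum m ≡ N × height N m < suc (suc N * N)
        bounds m pm d = proj₁ d , s≤s (subst (λ z → height N m ≤ suc N * z) (proj₁ d) (height-≤ N m))
        go : (∃ λ L → All (λ p → Par n (proj₁ p)) L × (∀ m → Par n m → F w m ≡ Tri.combination L m)) → Σ (List (List ℕ × ℤ)) (Expansion n len G w)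
        go (L , parL , e) = L , parL , λ α <n → trans (F≡combination L e α <n) (sym (sumL-foldr _ L))

      module _ (L : List (List ℕ × ℤ)) (ex : Expansion n len G w L) where
        private
          parL = proj₁ ex

          F-L : ∀ α → All (_< n) α → F w α ≡ Tri.combination L α
          F-L α <n = trans (proj₂ ex α <n) (sumL-foldr _ L)

        dominated : ∀ l → Par n l → coeffOf n L l ≢ + 0 → l ⪯ μ n w
        dominated = Tri.expansion-dominated L parL (F w) (λ m pm → F-L m (Par⇒< 1<n pm)) (μ n w) (μ-Par W) (F-leading W) (λ m pm → F-dom W m (Par⇒< 1<n pm))

        top-coefficient : coeffOf n L (μ n w) ≡ + 1
        top-coefficient = Tri.expansion-leading L parL (F w) (λ m pm → F-L m (Par⇒< 1<n pm)) (μ n w) (μ-Par W) (F-leading W) (λ m pm → F-dom W m (Par⇒< 1<n pm))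

        -- The expansion of F̃ for w⁻¹, obtained from that for w by applying * to the indices.
        L* : List (List ℕ × ℤ)
        L* = map (λ p → ∗ (proj₁ p) , proj₂ p) L

        parL* : All (λ p → Par n (proj₁ p)) L*
        parL* = AllP.map⁺ (All.map (λ {p} q → StarFacts.∗-Par (star-facts (proj₁ p) q)) parL)

        private
          φL : List ℕ → ℤ
          φL V = sumL (λ p → proj₂ p *ᶻ φ (G (proj₁ p)) V) L

          -- The difference of the two sides of the expansion as one functional: by hypothesis it
          -- kills all products of h's, so by `vanish-inc` it kills all products of e's.
          ψ : List ℕ → ℤ
          ψ V = φ w V +ᶻ negᶻ (+ 1) *ᶻ φL V

          ψ-Nil : Nil ψ
          ψ-Nil = record
            { respects = λ V V' h e → cong₂ (λ x y → x +ᶻ negᶻ (+ 1) *ᶻ y) (Nil.respects (φ-Nil w) V V' h e)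
                (sumL-cong L (All.universal (λ p → cong (proj₂ p *ᶻ_) (Nil.respects (φ-Nil (G (proj₁ p))) V V' h e)) L))
            ; vanish = λ V ne → cong₂ (λ x y → x +ᶻ negᶻ (+ 1) *ᶻ y) (Nil.vanish (φ-Nil w) V ne)
                (sumL-0 L (All.universal (λ p → trans (cong (proj₂ p *ᶻ_) (Nil.vanish (φ-Nil (G (proj₁ p))) V ne)) (ℤP.*-zeroʳ (proj₂ p))) L)) }

          T-ψ : ∀ x → T x ψ ≡ T x (φ w) +ᶻ negᶻ (+ 1) *ᶻ sumL (λ p → proj₂ p *ᶻ T x (φ (G (proj₁ p)))) L
          T-ψ x = trans (T-+ x (φ w) (λ V → negᶻ (+ 1) *ᶻ φL V)) (cong (T x (φ w) +ᶻ_) (trans (T-*ˡ x (negᶻ (+ 1)) φL) (cong (negᶻ (+ 1) *ᶻ_) (T-sumL x proj₂ (λ p → φ (G (proj₁ p))) L))))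

          difference : ∀ a b → (a ≡ b → a +ᶻ negᶻ (+ 1) *ᶻ b ≡ + 0) × (a +ᶻ negᶻ (+ 1) *ᶻ b ≡ + 0 → a ≡ b)
          difference a b = (λ { refl → lem a }) , λ e → trans (lem₂ a b) (trans (cong (_+ᶻ b) e) (ℤP.+-identityˡ b))
            where
            lem : ∀ a → a +ᶻ negᶻ (+ 1) *ᶻ a ≡ + 0
            lem = solve-∀
            lem₂ : ∀ a b → a ≡ (a +ᶻ negᶻ (+ 1) *ᶻ b) +ᶻ b
            lem₂ = solve-∀

          T-dec : ∀ γ → All (_< n) γ → T (H γ) ψ ≡ + 0
          T-dec γ <n = trans (T-ψ (H γ)) (proj₁ (difference _ _) (trans (sym (coefF-T w γ <n)) (trans (F-L γ <n) (sumL-cong L (All.universal (λ p → cong (proj₂ p *ᶻ_) (coefF-T (G (proj₁ p)) γ <n)) L)))))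

          T-inc : ∀ α → All (_< n) α → T (map (inc ,_) α) (φ w) ≡ sumL (λ p → proj₂ p *ᶻ T (map (inc ,_) α) (φ (G (proj₁ p)))) L
          T-inc α <n = proj₂ (difference _ _) (trans (sym (T-ψ (map (inc ,_) α))) (trans (cong (λ x → T x ψ) (sym (trans (map-inc α []) (ListP.++-identityʳ _))))
            (vanish-inc ψ-Nil T-dec (reverse α) (PermP.All-resp-↭ (Perm.↭-sym (PermP.↭-reverse α)) <n) [] [])))

        F-inverse-L* : ∀ m → Par n m → F (wordElt n (reverse W)) m ≡ Tri.combination L* m
        F-inverse-L* m pm = trans (F-inverse W m <n) (trans (T-inc m <n) (trans (sumL-cong L (All.map (λ {p} q → cong (proj₂ p *ᶻ_) (sym (StarFacts.coefficient (star-facts (proj₁ p) q) m <n))) parL))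
          (sym (sumL-map (λ p → proj₂ p *ᶻ K (proj₁ p) m) (λ p → ∗ (proj₁ p) , proj₂ p) L))))
          where <n = Par⇒< 1<n pm

        coeff-L* : ∀ l → Par n l → coeffOf n L* (∗ l) ≡ coeffOf n L l
        coeff-L* l pl = trans (coeff-sumL n L* (∗ l)) (trans (sumL-map (λ p → guard (proj₁ p ≟ˡ ∗ l) (proj₂ p)) (λ p → ∗ (proj₁ p) , proj₂ p) L)
          (trans (sumL-cong L (All.map (λ {p} q → guard-⇔ (∗ (proj₁ p) ≟ˡ ∗ l) (proj₁ p ≟ˡ l) (proj₂ p) (λ e → trans (sym (StarFacts.involutive (star-facts (proj₁ p) q))) (trans (cong ∗ e) (StarFacts.involutive (star-facts l pl)))) (cong ∗)) parL))
            (sym (coeff-sumL n L l))))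

        private
          top* : List ℕ
          top* = μ n (wordElt n (reverse W))

          par-top* : Par n top*
          par-top* = μ-Par (reverse W)

          dominated* : ∀ l → Par n l → coeffOf n L* l ≢ + 0 → l ⪯ top*
          dominated* = Tri.expansion-dominated L* parL* (F (wordElt n (reverse W))) F-inverse-L* top* par-top* (F-leading (reverse W)) (λ m pm → F-dom (reverse W) m (Par⇒< 1<n pm))

          leading* : coeffOf n L* top* ≡ + 1
          leading* = Tri.expansion-leading L* parL* (F (wordElt n (reverse W))) F-inverse-L* top* par-top* (F-leading (reverse W)) (λ m pm → F-dom (reverse W) m (Par⇒< 1<n pm))

          lam≡ : lam n star G w ≡ ∗ top*
          lam≡ = cong (∗ ∘ μ n) (inv-wordElt W)

          ∗∗ : ∗ (∗ top*) ≡ top*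
          ∗∗ = StarFacts.involutive (star-facts top* par-top*)

        -- As * is an involution, λ(w)* is μ(w⁻¹). So λ(w) ⪯* λ unfolds to λ* ⪯ μ(w⁻¹), which is
        -- dominance for `L*`, and the coefficient at λ(w) is the leading one of w⁻¹.
        conclusion : ((l : List ℕ) → Par n l → coeffOf n L l ≢ + 0 → _⪯*_ n star G (lam n star G w) l × l ⪯ μ n w) ×
          (coeffOf n L (μ n w) ≡ + 1 × coeffOf n L (lam n star G w) ≡ + 1)
        conclusion = (λ l pl ne → subst (∗ l ⪯_) (sym (trans (cong ∗ lam≡) ∗∗)) (dominated* (∗ l) (StarFacts.∗-Par (star-facts l pl)) (λ e → ne (trans (sym (coeff-L* l pl)) e))) , dominated l pl ne) ,
          (top-coefficient , trans (sym (coeff-L* (lam n star G w) (subst (Par n) (sym lam≡) (StarFacts.∗-Par (star-facts top* par-top*))))) (trans (cong (coeffOf n L*) (trans (cong ∗ lam≡) ∗∗)) leading*))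

-- Passage from words to arbitrary affine permutations.

theorem10p3 : (n : ℕ) .{{_ : NonZero n}} → 3 ≤ n →
    (len : Win n → ℕ) → IsCoxeterLength n len →
    (star : Win n → Win n) → IsStarAut n star →
    (G : List ℕ → Win n) → IsGrassSection n len G →
    (w : Win n) → IsAffPerm n w →
    Σ (List (List ℕ × ℤ)) (Expansion n len G w) ×
    ((L : List (List ℕ × ℤ)) → Expansion n len G w L →
    ((l : List ℕ) → Par n l → coeffOf n L l ≢ + 0 →
    _⪯*_ n star G (lam n star G w) l × l ⪯ μ n w) ×
    (coeffOf n L (μ n w) ≡ + 1 × coeffOf n L (lam n star G w) ≡ + 1))
theorem10p3 n 3≤n len isLen star isStar G isG w affine-w = at-word (word-of w affine-w)
  where
  open Stanley n 3≤n len isLen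
  open Section star isStar G isG
  open Group n 3≤n
  open Length len isLen
  Goal : Win n → Set
  Goal w = Σ (List (List ℕ × ℤ)) (Expansion n len G w) ×
    ((L : List (List ℕ × ℤ)) → Expansion n len G w L →
    ((l : List ℕ) → Par n l → coeffOf n L l ≢ + 0 →
    _⪯*_ n star G (lam n star G w) l × l ⪯ μ n w) ×
    (coeffOf n L (μ n w) ≡ + 1 × coeffOf n L (lam n star G w) ≡ + 1))
  at-word : (∃ λ W → All (_< n) W × wordElt n W ≡ w) → Goal w
  at-word (W , _ , e) = subst Goal e (expansion-exists W , conclusion W)
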